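{- Each of the following three collections of real numbers contains at least one irrational number: $$\{\zeta(5),\zeta(7),\zeta(9),\zeta(11),\zeta(13),\zeta(15),\zeta(17),\zeta(19),\zeta(21)\},$$ $$\{\zeta(7),\zeta(9),\dots,\zeta(35),\zeta(37)\},\qquad \{\zeta(9),\zeta(11),\dots,\zeta(51),\zeta(53)\},$$ where in each collection the arguments run over all odd integers in the indicated range.
   Context: $\zeta(s)=\sum_{m\ge1}m^{ -s}$ denotes the Riemann zeta function. -}

module Defs where

open import Data.Nat as ℕ using (ℕ; zero; suc; _≤_)
open import Data.Integer using (+_)
open import Data.Rational using (ℚ; 0ℚ; 1ℚ; _+_; _*_; _-_; ∣_∣; _<_; _/_)
open import Data.Product using (Σ; ∃; _×_)
open import Relation.Nullary using (¬_)

pow : ℚ → ℕ → ℚ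
pow q zero    = 1ℚ
pow q (suc k) = q * pow q k

zetaPartial : ℕ → ℕ → ℚ
zetaPartial s zero    = 0ℚ
zetaPartial s (suc n) = zetaPartial s n + pow ((+ 1) / suc n) s

ConvergesTo : (ℕ → ℚ) → ℚ → Set
ConvergesTo a r = ∀ (ε : ℚ) → 0ℚ < ε → ∃ λ N → ∀ n → N ≤ n → ∣ a n - r ∣ < ε

ZetaRational : ℕ → Set
ZetaRational s = ∃ λ (r : ℚ) → ConvergesTo (zetaPartial s) r

-- the collection {ζ(s) : s odd, a ≤ s ≤ b} contains an irrational number,
-- read classically as: not all of its members are rational
ContainsIrrational : ℕ → ℕ → Set
ContainsIrrational a b =
  ¬ (∀ (k : ℕ) → a ≤ 2 ℕ.* k ℕ.+ 1 → 2 ℕ.* k ℕ.+ 1 ≤ b → ZetaRational (2 ℕ.* k ℕ.+ 1))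

module Submission where

-- Fix b ∈ {3, 5, 7} and put A = 7b - 1. For a prime n = 2q + 1 and m = 3q + 1 consider
--
--   R(t) = (2t+n) ∏_{j=1}^m (t-j)^b (t+n+j)^b / ∏_{κ=0}^n (t+κ)^A
--
-- and the sum F over ν ≥ 1 of the coefficients of ε^(b-1) in R(ν+ε). Expanding R in partial
-- fractions turns F into a linear form in 1 and the ζ(i+b), i < A; the symmetry t ↦ -n-t and
-- the vanishing of the sum of residues leave only the even i ≥ 2, that is
-- ζ(b+2), ζ(b+4), …, ζ(8b-3).
--
-- A common denominator M of the coefficients is determined prime by prime, and
-- M (4n)!^b / n!^(A+b) is a product of values of exp ∘ (von Mangoldt function), whose growth
-- Chebyshev's method bounds by means of explicit floor sums. The terms of F vanish for ν ≤ m,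
-- and beyond m they are small enough for M F to decay exponentially in n.
--
-- Finally F ≠ 0, because a suitable power of n times the linear form is an n-adic integer
-- whose residue modulo the prime n is a fixed nonzero integer. Were all the ζ-values rational,
-- a fixed multiple of M F would be a nonzero integer of absolute value below 1 for every large
-- prime n.

-- A pole of order i + 1 contributes ζ(i+b), so the derivative of order b - 1 is what keeps the
-- lowest ζ-values out, and b odd makes A = 7b - 1 even, which gives R(-n-t) = -R(t). The parameters
-- are tight: in each of the three cases the exponential decay of F beats the growth of M by less
-- than one percent. This is why the denominator exploits the numerator factors at every prime
-- power, and why its growth is bounded by large explicit floor sums rather than by a convenient
-- constant. The coefficients of ε^(b-1) have no evident constant sign, so positivity cannot give F
-- ≠ 0; taking n prime replaces it by one computation independent of n. Everything takes place in ℚ: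
-- F is never a number but the sequence of its partial sums, which under the hypothesis approaches a
-- rational linear form. Where the coefficient of a ζ-value vanishes, only differences of partial
-- zeta sums occur, so no limit is required there.

open import Defs
open import Data.Product using (_×_)

-- The von Mangoldt function in multiplicative form

module Mangoldt where

  open import Data.Nat
  open import Data.Nat.Properties
  open import Data.Nat.DivMod
  open import Data.Nat.Divisibility
  open import Data.Nat.Primality
  open import Data.Nat.Primality.Factorisation using (factorise)
  open import Data.Nat.Coprimality using (Coprime; coprime-divisor)
  open import Data.Nat.Induction using (<-rec)
  open import Data.Fin using (Fin; toℕ; fromℕ<)
  open import Data.Fin.Properties using (any?; toℕ-fromℕ<)
  open import Data.List using ([]; _∷_)
  open import Data.Nat.ListAction using (product)
  open import Data.List.Relation.Unary.All using ([]; _∷_)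
  open import Data.Product using (∃; _×_; _,_)
  open import Data.Sum using (_⊎_; inj₁; inj₂)
  open import Data.Empty using (⊥-elim)
  open import Function using (_∘_)
  open import Relation.Nullary
  open import Relation.Nullary.Decidable using (_×-dec_)
  open import Relation.Binary.PropositionalEquality
  open import Relation.Binary.Definitions using (tri<; tri≈; tri>)

  -- Products over w < n; throughout, the index w stands for the positive integer v = suc w.
  prod : (ℕ → ℕ) → ℕ → ℕ
  prod f zero    = 1
  prod f (suc n) = prod f n * f n

  prod-cong : ∀ {f g} n → (∀ w → w < n → f w ≡ g w) → prod f n ≡ prod g n
  prod-cong zero    h = refl
  prod-cong (suc n) h = cong₂ _*_ (prod-cong n (λ w l → h w (m<n⇒m<1+n l))) (h n ≤-refl)

  prod-≤ : ∀ {f g} n → (∀ w → w < n → f w ≤ g w) → prod f n ≤ prod g n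
  prod-≤ zero    h = ≤-refl
  prod-≤ (suc n) h = *-mono-≤ (prod-≤ n (λ w l → h w (m<n⇒m<1+n l))) (h n ≤-refl)

  prod-* : ∀ f g n → prod (λ w → f w * g w) n ≡ prod f n * prod g n
  prod-* f g zero    = refl
  prod-* f g (suc n) rewrite prod-* f g n =
    [m*n]*[o*p]≡[m*o]*[n*p] (prod f n) (prod g n) (f n) (g n)

  prod-one : ∀ {f} n → (∀ w → w < n → f w ≡ 1) → prod f n ≡ 1
  prod-one zero    h = refl
  prod-one (suc n) h rewrite prod-one n (λ w l → h w (m<n⇒m<1+n l)) | h n ≤-refl = refl

  prod-single : ∀ {f} n w₀ → w₀ < n → (∀ w → w < n → w ≢ w₀ → f w ≡ 1) → prod f n ≡ f w₀
  prod-single {f} (suc n) w₀ l h with n ≟ w₀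
  ... | yes refl = trans (cong (_* f n) (prod-one n (λ w q → h w (m<n⇒m<1+n q) (<⇒≢ q)))) (*-identityˡ _)
  ... | no n≢ = trans (cong₂ _*_ (prod-single n w₀ (≤∧≢⇒< (≤-pred l) (n≢ ∘ sym)) (λ w q → h w (m<n⇒m<1+n q))) (h n ≤-refl n≢)) (*-identityʳ _)

  ind : ∀ {a} {A : Set a} → Dec A → ℕ
  ind (yes _) = 1
  ind (no _)  = 0

  ind≤1 : ∀ {a} {A : Set a} (d : Dec A) → ind d ≤ 1
  ind≤1 (yes _) = ≤-refl
  ind≤1 (no _)  = z≤n

  ind-yes : ∀ {a} {A : Set a} (d : Dec A) → A → ind d ≡ 1
  ind-yes (yes _) a = refl
  ind-yes (no n)  a = ⊥-elim (n a)

  ind-no : ∀ {a} {A : Set a} (d : Dec A) → ¬ A → ind d ≡ 0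
  ind-no (yes y) n = ⊥-elim (n y)
  ind-no (no _)  n = refl

  ind-⇔ : ∀ {a} {A B : Set a} (d : Dec A) (d′ : Dec B) → (A → B) → (B → A) → ind d ≡ ind d′
  ind-⇔ (yes x) d′ f g = sym (ind-yes d′ (f x))
  ind-⇔ (no x)  d′ f g = sym (ind-no d′ (x ∘ g))

  dv : ℕ → ℕ → ℕ
  dv w k = ind (suc w ∣? k)

  -- Both witnesses range over finite types, so that prime powers are recognised by search. The
  -- bound on the exponent loses nothing because e + 1 < p^(e+1).
  PP : ℕ → Set
  PP v = ∃ λ (p : Fin (suc v)) → ∃ λ (e : Fin v) → Prime (toℕ p) × v ≡ toℕ p ^ suc (toℕ e)

  PP? : ∀ v → Dec (PP v)
  PP? v = any? λ p → any? λ e → prime? (toℕ p) ×-dec (v ≟ toℕ p ^ suc (toℕ e))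

  -- exp of the von Mangoldt function at suc w.
  Λ : ℕ → ℕ
  Λ w with PP? (suc w)
  ... | yes (p , _) = toℕ p
  ... | no _        = 1

  prime>1 : ∀ {p} → Prime p → 1 < p
  prime>1 pr = nonTrivial⇒n>1 _ {{prime⇒nonTrivial pr}}

  prime∣prime : ∀ {p r} → Prime p → Prime r → p ∣ r → p ≡ r
  prime∣prime pp pr d with prime⇒irreducible pr d
  ... | inj₁ refl = ⊥-elim (<-irrefl refl (prime>1 pp))
  ... | inj₂ e = e

  prime∣^ : ∀ {p} → Prime p → ∀ m e → p ∣ m ^ e → p ∣ m
  prime∣^ pp m zero d = ⊥-elim (<⇒≢ (prime>1 pp) (sym (∣1⇒≡1 d)))
  prime∣^ pp m (suc e) d with euclidsLemma m (m ^ e) pp d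
  ... | inj₁ x = x
  ... | inj₂ y = prime∣^ pp m e y

  n<p^n : ∀ {p} → 1 < p → ∀ n → n < p ^ n
  n<p^n l zero = z<s
  n<p^n {p} l (suc n) = ≤-trans (s≤s (n<p^n l n)) (≤-trans (+-monoˡ-≤ (p ^ n) (≤-trans z<s (n<p^n l n)))
     (≤-trans (≤-reflexive (cong (p ^ n +_) (sym (+-identityʳ (p ^ n))))) (*-monoˡ-≤ (p ^ n) l)))

  Λ-cases : ∀ w → Λ w ≡ 1 ⊎ (∃ λ r → ∃ λ e → Prime r × suc w ≡ r ^ suc e × Λ w ≡ r)
  Λ-cases w with PP? (suc w)
  ... | yes (p , e , pr , eq) = inj₂ (toℕ p , toℕ e , pr , eq , refl)
  ... | no _ = inj₁ refl

  -- A prime dividing a power of r equals r, so the search cannot return a different prime.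
  Λ-pp : ∀ {p} e w → Prime p → suc w ≡ p ^ suc e → Λ w ≡ p
  Λ-pp {p} e w pr eq with PP? (suc w)
  ... | yes (r , f , pr′ , eq′) = sym (prime∣prime pr pr′ (prime∣^ pr (toℕ r) (suc (toℕ f))
          (subst (p ∣_) (trans (sym eq) eq′) (m∣m*n (p ^ e)))))
  ... | no ¬pp = ⊥-elim (¬pp (fromℕ< p<v , fromℕ< e<v , subst Prime (sym (toℕ-fromℕ< p<v)) pr ,
          trans eq (cong₂ (λ x y → x ^ suc y) (sym (toℕ-fromℕ< p<v)) (sym (toℕ-fromℕ< e<v)))))
    where
    instance
      nz : NonZero (p ^ e)
      nz = m^n≢0 p e {{prime⇒nonZero pr}}
    p<v : p < suc (suc w)
    p<v = s≤s (subst (p ≤_) (sym eq) (m≤m*n p (p ^ e)))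
    e<v : e < suc w
    e<v = <-trans ≤-refl (subst (suc e <_) (sym eq) (n<p^n (prime>1 pr) (suc e)))

  Λ≥1 : ∀ w → 1 ≤ Λ w
  Λ≥1 w with Λ-cases w
  ... | inj₁ e = ≤-reflexive (sym e)
  ... | inj₂ (r , e , pr , _ , eq) = subst (1 ≤_) (sym eq) (<⇒≤ (prime>1 pr))

  -- Numbers are encoded by exponents on all positive integers instead of on primes. As `Λ` is 1 off
  -- the prime powers, statements about all primes and all their powers become pointwise statements
  -- about the exponent function.
  ⟦_⟧ : (ℕ → ℕ) → ℕ → ℕ
  ⟦ e ⟧ B = prod (λ w → Λ w ^ e w) B

  ⟦⟧-cong : ∀ {e f} B → (∀ w → w < B → e w ≡ f w) → ⟦ e ⟧ B ≡ ⟦ f ⟧ B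
  ⟦⟧-cong B h = prod-cong B (λ w l → cong (Λ w ^_) (h w l))

  ⟦⟧-+ : ∀ e f B → ⟦ (λ w → e w + f w) ⟧ B ≡ ⟦ e ⟧ B * ⟦ f ⟧ B
  ⟦⟧-+ e f B = trans (prod-cong B (λ w _ → ^-distribˡ-+-* (Λ w) (e w) (f w))) (prod-* (λ w → Λ w ^ e w) (λ w → Λ w ^ f w) B)

  ⟦⟧-zero : ∀ {e} B → (∀ w → w < B → e w ≡ 0) → ⟦ e ⟧ B ≡ 1
  ⟦⟧-zero B h = prod-one B (λ w l → cong (Λ w ^_) (h w l))

  ⟦⟧-≤ : ∀ {e f} B → (∀ w → w < B → e w ≤ f w) → ⟦ e ⟧ B ≤ ⟦ f ⟧ B
  ⟦⟧-≤ B h = prod-≤ B (λ w l → ^-monoʳ-≤ (Λ w) {{>-nonZero (Λ≥1 w)}} (h w l))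

  ⟦⟧-* : ∀ c e B → ⟦ (λ w → c * e w) ⟧ B ≡ ⟦ e ⟧ B ^ c
  ⟦⟧-* zero    e B = ⟦⟧-zero B (λ _ _ → refl)
  ⟦⟧-* (suc c) e B = trans (⟦⟧-+ e (λ w → c * e w) B) (cong (⟦ e ⟧ B *_) (⟦⟧-* c e B))

  ⟦⟧≥1 : ∀ e B → 1 ≤ ⟦ e ⟧ B
  ⟦⟧≥1 e B = subst (_≤ ⟦ e ⟧ B) (⟦⟧-zero B (λ _ _ → refl)) (⟦⟧-≤ {λ _ → 0} {e} B (λ _ _ → z≤n))

  private
    exactPower : ∀ {p} → Prime p → ∀ j → 0 < j → ∃ λ a → p ^ a ∣ j × ¬ (p ^ suc a ∣ j)
    exactPower {p} pr = <-rec _ go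
      where
      go : ∀ j → (∀ {i} → i < j → 0 < i → ∃ λ a → p ^ a ∣ i × ¬ (p ^ suc a ∣ i)) → 0 < j →
           ∃ λ a → p ^ a ∣ j × ¬ (p ^ suc a ∣ j)
      go j ih 0<j with p ∣? j
      ... | no ¬d = 0 , 1∣ j , λ d → ¬d (subst (_∣ j) (*-identityʳ p) d)
      ... | yes (divides i eq) with ih {i} i<j 0<i
        where
        0<i : 0 < i
        0<i = n≢0⇒n>0 λ i≡0 → <⇒≢ 0<j (sym (trans eq (cong (_* p) i≡0)))
        i<j : i < j
        i<j = subst (i <_) (sym eq) (m<m*n i p {{>-nonZero 0<i}} (prime>1 pr))
      ... | a , d , nd = suc a , subst (p ^ suc a ∣_) (trans (*-comm p i) (sym eq)) (*-monoʳ-∣ p d) ,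
            λ d′ → nd (*-cancelˡ-∣ p {{prime⇒nonZero pr}} (subst (p ^ suc (suc a) ∣_) (trans eq (*-comm i p)) d′))

    coprime-pow : ∀ {p r} → Prime p → Prime r → p ≢ r → ∀ e → Coprime (r ^ e) p
    coprime-pow {p} {r} pp pr ne e {d} (d∣r^e , d∣p) with prime⇒irreducible pp d∣p
    ... | inj₁ x = x
    ... | inj₂ refl = ⊥-elim (ne (prime∣prime pp pr (prime∣^ pp r e d∣r^e)))

    ^-mono-∣ : ∀ p {a b} → a ≤ b → p ^ a ∣ p ^ b
    ^-mono-∣ p {a} {b} l = subst (p ^ a ∣_) (trans (sym (^-distribˡ-+-* p a (b ∸ a))) (cong (p ^_) (m+[n∸m]≡n l))) (m∣m*n _)

    ^-inj : ∀ {p} → 1 < p → ∀ {a b} → p ^ a ≡ p ^ b → a ≡ b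
    ^-inj {p} l {a} {b} eq with <-cmp a b
    ... | tri< x _ _ = ⊥-elim (<⇒≢ (^-monoʳ-< p l x) eq)
    ... | tri≈ _ x _ = x
    ... | tri> _ _ x = ⊥-elim (<⇒≢ (^-monoʳ-< p l x) (sym eq))

    module _ {p} (pp : Prime p) {j a} (d₁ : p ^ a ∣ j) (d₂ : ¬ (p ^ suc a ∣ j)) where
      ∣⇒≤a : ∀ {e} → p ^ e ∣ j → e ≤ a
      ∣⇒≤a {e} d with e ≤? a
      ... | yes l = l
      ... | no ¬l = ⊥-elim (d₂ (∣-trans (^-mono-∣ p (≰⇒> ¬l)) d))

      w₀ : ℕ
      w₀ = pred (p ^ suc a)

      sw₀ : suc w₀ ≡ p ^ suc a
      sw₀ = suc-pred (p ^ suc a) {{m^n≢0 p (suc a) {{prime⇒nonZero pp}}}}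

      -- Multiplying j by p creates exactly one new prime-power divisor, p^(a+1), where a is the
      -- exact exponent of p in j. Positions that are not prime powers are invisible because `Λ` is
      -- 1 there.
      step : ∀ w → Λ w ^ dv w (p * j) ≡ Λ w ^ dv w j * Λ w ^ ind (w ≟ w₀)
      step w with Λ-cases w
      ... | inj₁ eq rewrite eq = trans (^-zeroˡ (dv w (p * j))) (sym (cong₂ _*_ (^-zeroˡ (dv w j)) (^-zeroˡ (ind (w ≟ w₀)))))
      ... | inj₂ (r , e , pr , vw , eq) = trans (cong (Λ w ^_) expo) (^-distribˡ-+-* (Λ w) (dv w j) (ind (w ≟ w₀)))
        where
        expo : dv w (p * j) ≡ dv w j + ind (w ≟ w₀)
        expo with p ≟ r
        ... | no p≢r = trans (ind-⇔ (suc w ∣? (p * j)) (suc w ∣? j)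
                   (λ d → subst (_∣ j) (sym vw) (coprime-divisor (coprime-pow pp pr p≢r (suc e)) (subst (_∣ p * j) vw d)))
                   (∣n⇒∣m*n p))
                 (trans (sym (+-identityʳ _)) (cong (dv w j +_) (sym (ind-no (w ≟ w₀) λ w≡ →
                    p≢r (prime∣prime pp pr (prime∣^ pp r (suc e) (subst (p ∣_) (trans (sym sw₀) (trans (cong suc (sym w≡)) vw)) (m∣m*n (p ^ a)))))))))
        ... | yes refl with <-cmp e a
        ... | tri< e<a ne _ = trans (ind-yes (suc w ∣? (p * j)) (∣n⇒∣m*n p vj))
                (sym (cong₂ _+_ (ind-yes (suc w ∣? j) vj) (ind-no (w ≟ w₀) (λ w≡ → ne (suc-injective (^-inj (prime>1 pp) (trans (sym vw) (trans (cong suc w≡) sw₀))))))))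
          where
          vj : suc w ∣ j
          vj = subst (_∣ j) (sym vw) (∣-trans (^-mono-∣ p e<a) d₁)
        ... | tri≈ _ refl _ = trans (ind-yes (suc w ∣? (p * j)) (subst (_∣ p * j) (sym vw) (*-monoʳ-∣ p d₁)))
                (sym (cong₂ _+_ (ind-no (suc w ∣? j) (λ d → d₂ (subst (_∣ j) vw d)))
                   (ind-yes (w ≟ w₀) (suc-injective (trans vw (sym sw₀))))))
        ... | tri> _ ne a<e = trans (ind-no (suc w ∣? (p * j)) (λ d → <⇒≱ a<e (∣⇒≤a (*-cancelˡ-∣ p {{prime⇒nonZero pp}} (subst (_∣ p * j) vw d)))))
                (sym (cong₂ _+_ (ind-no (suc w ∣? j) (λ d → <⇒≱ a<e (≤-trans (n≤1+n e) (∣⇒≤a (subst (_∣ j) vw d)))))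
                   (ind-no (w ≟ w₀) (λ w≡ → ne (suc-injective (^-inj (prime>1 pp) (trans (sym vw) (trans (cong suc w≡) sw₀))))))))

      stepAll : ∀ B → 0 < j → p * j ≤ B → ⟦ (λ w → dv w (p * j)) ⟧ B ≡ ⟦ (λ w → dv w j) ⟧ B * p
      stepAll B 0<j le = trans (prod-cong B (λ w _ → step w)) (trans (prod-* (λ w → Λ w ^ dv w j) (λ w → Λ w ^ ind (w ≟ w₀)) B)
         (cong (⟦ (λ w → dv w j) ⟧ B *_) (trans (prod-single B w₀ w₀<B (λ w _ ne → cong (Λ w ^_) (ind-no (w ≟ w₀) ne)))
            (trans (cong (Λ w₀ ^_) (ind-yes (w₀ ≟ w₀) refl)) (trans (*-identityʳ (Λ w₀)) (Λ-pp a w₀ pp sw₀))))))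
        where
        w₀<B : w₀ < B
        w₀<B = ≤-trans (≤-reflexive sw₀) (≤-trans (*-monoʳ-≤ p (∣⇒≤ {{>-nonZero 0<j}} d₁)) le)

  primeDivisor : ∀ k → 1 < k → ∃ λ p → Prime p × p ∣ k
  primeDivisor k 1<k with factorise k {{>-nonZero (<⇒≤ 1<k)}}
  ... | record { factors = [] ; isFactorisation = eq } = ⊥-elim (<⇒≢ 1<k (sym eq))
  ... | record { factors = p ∷ ps ; isFactorisation = eq ; factorsPrime = pp ∷ _ } = p , pp , subst (p ∣_) (sym eq) (m∣m*n (product ps))

  -- The exponential of log k = Σ Λ(v) over the divisors v of k, by splitting off one prime factor
  -- at a time.
  ⟦dv⟧ : ∀ B k → 0 < k → k ≤ B → ⟦ (λ w → dv w k) ⟧ B ≡ k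
  ⟦dv⟧ B = <-rec _ go
    where
    go : ∀ k → (∀ {i} → i < k → 0 < i → i ≤ B → ⟦ (λ w → dv w i) ⟧ B ≡ i) → 0 < k → k ≤ B → ⟦ (λ w → dv w k) ⟧ B ≡ k
    go k ih 0<k k≤B with k ≟ 1
    ... | yes refl = prod-one B one
      where
      one : ∀ w → w < B → Λ w ^ dv w 1 ≡ 1
      one w _ with Λ-cases w
      ... | inj₁ eq = trans (cong (_^ dv w 1) eq) (^-zeroˡ (dv w 1))
      ... | inj₂ (r , e , pr , vw , eq) = cong (Λ w ^_) (ind-no (suc w ∣? 1) λ d →
              <⇒≢ (prime>1 pr) (sym (∣1⇒≡1 (∣-trans (m∣m*n (r ^ e)) (subst (_∣ 1) vw d)))))
    ... | no k≢1 with primeDivisor k (≤∧≢⇒< 0<k (k≢1 ∘ sym))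
    ... | p , pp , divides j refl = trans (cong (λ z → ⟦ (λ w → dv w z) ⟧ B) (*-comm j p)) (trans
            (let (a , d₁ , d₂) = exactPower pp j 0<j in stepAll pp {j} {a} d₁ d₂ B 0<j (subst (_≤ B) (*-comm j p) k≤B))
            (cong (_* p) (ih j<k 0<j (≤-trans (<⇒≤ j<k) k≤B))))
      where
      0<j : 0 < j
      0<j = n≢0⇒n>0 λ { refl → <-irrefl refl 0<k }
      j<k : j < j * p
      j<k = m<m*n j p {{>-nonZero 0<j}} (prime>1 pp)

  fl : ℕ → ℕ → ℕ
  fl N w = N / suc w

  /-suc : ∀ N w → fl (suc N) w ≡ fl N w + dv w (suc N)
  /-suc N w with suc w ∣? suc N
  ... | yes (divides (suc q) eq) = trans (trans (cong (_/ suc w) eq) (m*n/n≡m (suc q) (suc w))) (trans (sym (+-comm q 1)) (cong (_+ 1) (sym fq)))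
    where
    Neq : N ≡ w + q * suc w
    Neq = suc-injective eq
    fq : fl N w ≡ q
    fq = trans (cong (_/ suc w) Neq) (trans (+-distrib-/-∣ʳ w (n∣m*n q)) (trans (cong (_+ q * suc w / suc w) (m<n⇒m/n≡0 {w} {suc w} ≤-refl)) (m*n/n≡m q (suc w))))
  ... | no ¬d = trans (sym lem) (sym (+-identityʳ _))
    where
    r<w : N % suc w < w
    r<w = ≤∧≢⇒< (≤-pred (m%n<n N (suc w))) λ eq → ¬d (divides (suc (N / suc w))
       (cong suc (trans (m≡m%n+[m/n]*n N (suc w)) (cong (_+ N / suc w * suc w) eq))))
    lem : fl N w ≡ fl (suc N) w
    lem = sym (trans (cong (λ z → suc z / suc w) (m≡m%n+[m/n]*n N (suc w)))
      (trans (+-distrib-/-∣ʳ (suc (N % suc w)) (n∣m*n (N / suc w)))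
         (cong₂ _+_ (m<n⇒m/n≡0 (s≤s r<w)) (m*n/n≡m (N / suc w) (suc w)))))

  -- Legendre's formula for all primes at once: ⌊N/v⌋ counts the multiples of v up to N, so it is
  -- the sum of the divisor indicators of the factors of N!.
  ⟦fl⟧ : ∀ B N → N ≤ B → ⟦ fl N ⟧ B ≡ N !
  ⟦fl⟧ B zero    l = ⟦⟧-zero B (λ w _ → 0/n≡0 (suc w))
  ⟦fl⟧ B (suc N) l = trans (⟦⟧-cong B (λ w _ → /-suc N w)) (trans (⟦⟧-+ (fl N) (λ w → dv w (suc N)) B)
     (trans (cong₂ _*_ (⟦fl⟧ B N (≤-trans (n≤1+n N) l)) (⟦dv⟧ B (suc N) z<s l)) (*-comm (N !) (suc N))))

-- Integers inside the rationals, total inversion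

module Rationals where

  open import Data.Nat as ℕ using (ℕ)
  open import Data.Integer as ℤ using (ℤ; +_)
  import Data.Integer.Properties as ℤP
  open import Data.Rational
  open import Data.Rational.Properties
  import Data.Rational.Unnormalised as ᵘ
  import Data.Rational.Unnormalised.Properties as ᵘP
  open import Data.Empty using (⊥-elim)
  open import Relation.Nullary
  open import Relation.Nullary.Decidable using (dec⇒maybe)
  open import Relation.Binary.PropositionalEquality
  open import Tactic.RingSolver.Core.AlmostCommutativeRing using (AlmostCommutativeRing; fromCommutativeRing)
  open import Tactic.RingSolver using (solve-∀)

  ℚring : AlmostCommutativeRing _ _
  ℚring = fromCommutativeRing +-*-commutativeRing (λ x → dec⇒maybe (0ℚ ≟ x))

  opaque
    ι : ℤ → ℚ
    ι z = z / 1

    toι : ∀ z → toℚᵘ (ι z) ᵘ.≃ ᵘ.mkℚᵘ z 0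
    toι z = toℚᵘ-fromℚᵘ (ᵘ.mkℚᵘ z 0)

    ι0 : ι (+ 0) ≡ 0ℚ
    ι0 = refl

    ι1 : ι (+ 1) ≡ 1ℚ
    ι1 = refl

    ι-+ : ∀ a b → ι (a ℤ.+ b) ≡ ι a + ι b
    ι-+ a b = toℚᵘ-injective (ᵘP.≃-trans (toι (a ℤ.+ b)) (ᵘP.≃-trans (ᵘ.*≡* lem)
      (ᵘP.≃-sym (ᵘP.≃-trans (toℚᵘ-homo-+ (ι a) (ι b)) (ᵘP.+-cong (toι a) (toι b))))))
      where
      lem : (a ℤ.+ b) ℤ.* (+ 1) ≡ (a ℤ.* (+ 1) ℤ.+ b ℤ.* (+ 1)) ℤ.* (+ 1)
      lem = cong (ℤ._* + 1) (cong₂ ℤ._+_ (sym (ℤP.*-identityʳ a)) (sym (ℤP.*-identityʳ b)))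

    ι-* : ∀ a b → ι (a ℤ.* b) ≡ ι a * ι b
    ι-* a b = toℚᵘ-injective (ᵘP.≃-trans (toι (a ℤ.* b)) (ᵘP.≃-trans (ᵘ.*≡* refl)
      (ᵘP.≃-sym (ᵘP.≃-trans (toℚᵘ-homo-* (ι a) (ι b)) (ᵘP.*-cong (toι a) (toι b))))))

    ι-inj : ∀ {a b} → ι a ≡ ι b → a ≡ b
    ι-inj {a} {b} eq with ᵘP.≃-trans (ᵘP.≃-sym (toι a)) (ᵘP.≃-trans (ᵘP.≃-reflexive (cong toℚᵘ eq)) (toι b))
    ... | ᵘ.*≡* e = trans (sym (ℤP.*-identityʳ a)) (trans e (ℤP.*-identityʳ b))

    ι-mono : ∀ {a b} → a ℤ.≤ b → ι a ≤ ι b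
    ι-mono {a} {b} l = toℚᵘ-cancel-≤ (ᵘP.≤-trans (ᵘP.≤-reflexive (toι a)) (ᵘP.≤-trans (ᵘ.*≤* (ℤP.*-monoʳ-≤-nonNeg (+ 1) l)) (ᵘP.≤-reflexive (ᵘP.≃-sym (toι b)))))

    ι-mono-< : ∀ {a b} → a ℤ.< b → ι a < ι b
    ι-mono-< {a} {b} l = toℚᵘ-cancel-< (ᵘP.<-respʳ-≃ (ᵘP.≃-sym (toι b)) (ᵘP.<-respˡ-≃ (ᵘP.≃-sym (toι a)) (ᵘ.*<* (ℤP.*-monoʳ-<-pos (+ 1) l))))

  ι-neg : ∀ a → ι (ℤ.- a) ≡ - ι a
  ι-neg a = begin-lem
    where
    h : ι (ℤ.- a) + ι a ≡ 0ℚ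
    h = trans (sym (ι-+ (ℤ.- a) a)) (trans (cong ι (ℤP.+-inverseˡ a)) ι0)
    alg : ∀ x y → x ≡ (x + y) + - y
    alg = solve-∀ ℚring
    begin-lem : ι (ℤ.- a) ≡ - ι a
    begin-lem = trans (alg (ι (ℤ.- a)) (ι a)) (trans (cong (_+ - ι a) h) (+-identityˡ (- ι a)))

  ιℕ : ℕ → ℚ
  ιℕ n = ι (+ n)

  ιℕ-+ : ∀ a b → ιℕ (a ℕ.+ b) ≡ ιℕ a + ιℕ b
  ιℕ-+ a b = ι-+ (+ a) (+ b)

  ιℕ-* : ∀ a b → ιℕ (a ℕ.* b) ≡ ιℕ a * ιℕ b
  ιℕ-* a b = trans (cong ι (ℤP.pos-* a b)) (ι-* (+ a) (+ b))

  ιℕ-mono : ∀ {a b} → a ℕ.≤ b → ιℕ a ≤ ιℕ b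
  ιℕ-mono l = ι-mono (ℤ.+≤+ l)

  ιℕ-mono-< : ∀ {a b} → a ℕ.< b → ιℕ a < ιℕ b
  ιℕ-mono-< l = ι-mono-< (ℤ.+<+ l)

  ιℕ≥0 : ∀ n → 0ℚ ≤ ιℕ n
  ιℕ≥0 n = subst (_≤ ιℕ n) ι0 (ιℕ-mono {0} {n} ℕ.z≤n)

  ιℕ>0 : ∀ {n} → 0 ℕ.< n → 0ℚ < ιℕ n
  ιℕ>0 {n} l = subst (_< ιℕ n) ι0 (ιℕ-mono-< l)

  ι≢0 : ∀ {z} → z ≢ + 0 → ι z ≢ 0ℚ
  ι≢0 ne eq = ne (ι-inj (trans eq (sym ι0)))

  -- Totalised by the value 0 at 0, so that the series operations carry no side condition;
  -- nonvanishing is asked for only where an inverse is cancelled.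
  inv : ℚ → ℚ
  inv q with q ≟ 0ℚ
  ... | yes _ = 0ℚ
  ... | no ne = (1/ q) {{≢-nonZero ne}}

  inv-r : ∀ {q} → q ≢ 0ℚ → q * inv q ≡ 1ℚ
  inv-r {q} ne with q ≟ 0ℚ
  ... | yes e = ⊥-elim (ne e)
  ... | no ne′ = *-inverseʳ q {{≢-nonZero ne′}}

  inv-l : ∀ {q} → q ≢ 0ℚ → inv q * q ≡ 1ℚ
  inv-l {q} ne = trans (*-comm (inv q) q) (inv-r ne)

  inv-unique : ∀ {q r} → q ≢ 0ℚ → q * r ≡ 1ℚ → r ≡ inv q
  inv-unique {q} {r} ne e = trans (sym (*-identityˡ r)) (trans (cong (_* r) (sym (inv-l ne))) (trans (*-assoc (inv q) q r) (trans (cong (inv q *_) e) (*-identityʳ (inv q)))))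

  *-cancelˡ : ∀ {q x y} → q ≢ 0ℚ → q * x ≡ q * y → x ≡ y
  *-cancelˡ {q} {x} {y} ne e = trans (lem x) (trans (cong (inv q *_) e) (sym (lem y)))
    where
    lem : ∀ z → z ≡ inv q * (q * z)
    lem z = trans (sym (*-identityˡ z)) (trans (cong (_* z) (sym (inv-l ne))) (*-assoc (inv q) q z))

  mul≢0 : ∀ {x y} → x ≢ 0ℚ → y ≢ 0ℚ → x * y ≢ 0ℚ
  mul≢0 {x} nx ny e = ny (*-cancelˡ nx (trans e (sym (*-zeroʳ x))))

  inv-* : ∀ {x y} → x ≢ 0ℚ → y ≢ 0ℚ → inv (x * y) ≡ inv x * inv y
  inv-* {x} {y} nx ny = sym (inv-unique (mul≢0 nx ny) (trans (alg x y (inv x) (inv y)) (trans (cong₂ _*_ (inv-r nx) (inv-r ny)) (*-identityˡ 1ℚ))))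
    where
    alg : ∀ x y a b → (x * y) * (a * b) ≡ (x * a) * (y * b)
    alg = solve-∀ ℚring

  inv-neg : ∀ {x} → x ≢ 0ℚ → inv (- x) ≡ - inv x
  inv-neg {x} nx = sym (inv-unique (λ e → nx (neg-injective {x} {0ℚ} e)) (trans (alg x (inv x)) (inv-r nx)))
    where
    alg : ∀ x a → (- x) * (- a) ≡ x * a
    alg = solve-∀ ℚring

  pos⇒≢0 : ∀ {q} → 0ℚ < q → q ≢ 0ℚ
  pos⇒≢0 l e = <⇒≢ l (sym e)

  inv-pos : ∀ {q} → 0ℚ < q → 0ℚ < inv q
  inv-pos {q} l with q ≟ 0ℚ
  ... | yes e = ⊥-elim (<⇒≢ l (sym e))
  ... | no ne = positive⁻¹ _ {{1/pos⇒pos q {{positive l}}}}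

  *-mono : ∀ {a b c d} → 0ℚ ≤ a → 0ℚ ≤ d → a ≤ b → c ≤ d → a * c ≤ b * d
  *-mono {a} {b} {c} {d} 0≤a 0≤d a≤b c≤d = ≤-trans (*-monoˡ-≤-nonNeg a {{nonNegative 0≤a}} c≤d) (*-monoʳ-≤-nonNeg d {{nonNegative 0≤d}} a≤b)

  *-nonneg : ∀ {a b} → 0ℚ ≤ a → 0ℚ ≤ b → 0ℚ ≤ a * b
  *-nonneg {a} {b} x y = subst (_≤ a * b) (*-zeroʳ a) (*-monoˡ-≤-nonNeg a {{nonNegative x}} y)

  *-pos : ∀ {a b} → 0ℚ < a → 0ℚ < b → 0ℚ < a * b
  *-pos {a} {b} x y = subst (_< a * b) (*-zeroʳ a) (*-monoʳ-<-pos a {{positive x}} y)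

-- Formal power series and partial fractions

module PowerSeries where

  open Rationals
  open import Data.Nat as ℕ using (ℕ; zero; suc; _∸_)
  import Data.Nat.Properties as ℕP
  open import Data.Rational
  open import Data.Rational.Properties
  open import Data.List using (List; []; _∷_; _++_; map; foldr)
  open import Data.List.Relation.Unary.All as All using (All; []; _∷_)
  open import Data.List.Relation.Unary.All.Properties as AllP using ()
  open import Data.List.Relation.Binary.Permutation.Propositional using (_↭_; refl; prep; swap; trans)
  open import Data.Product using (_×_; _,_; proj₂)
  open import Relation.Nullary
  open import Relation.Binary.PropositionalEquality as Eq using (_≡_; _≢_; refl; sym; cong; cong₂; _≗_)
  open import Tactic.RingSolver using (solve-∀)

  infixr 2 _∙_
  _∙_ : ∀ {A : Set} {x y z : A} → x ≡ y → y ≡ z → x ≡ z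
  _∙_ = Eq.trans

  Seq : Set
  Seq = ℕ → ℚ

  -- Multiplication of a formal power series by a + b ε.
  N : ℚ → ℚ → Seq → Seq
  N a b u zero    = a * u zero
  N a b u (suc s) = a * u (suc s) + b * u s

  -- Division of a formal power series by c + ε.
  den : ℚ → Seq → Seq
  den c u zero    = inv c * u zero
  den c u (suc s) = inv c * (u (suc s) - den c u s)

  mono : ℕ → Seq
  mono zero    zero    = 1ℚ
  mono zero    (suc s) = 0ℚ
  mono (suc p) zero    = 0ℚ
  mono (suc p) (suc s) = mono p s

  _∔_ : Seq → Seq → Seq
  (u ∔ v) s = u s + v s

  _⊛_ : ℚ → Seq → Seq
  (q ⊛ u) s = q * u s

  N-cong : ∀ a b {u v} → u ≗ v → N a b u ≗ N a b v
  N-cong a b h zero    = cong (a *_) (h zero)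
  N-cong a b h (suc s) = cong₂ (λ x y → a * x + b * y) (h (suc s)) (h s)

  den-cong : ∀ c {u v} → u ≗ v → den c u ≗ den c v
  den-cong c h zero    = cong (inv c *_) (h zero)
  den-cong c h (suc s) = cong₂ (λ x y → inv c * (x - y)) (h (suc s)) (den-cong c h s)

  N-comm : ∀ a b c d u → N a b (N c d u) ≗ N c d (N a b u)
  N-comm a b c d u zero = alg a c (u 0)
    where
    alg : ∀ a c x → a * (c * x) ≡ c * (a * x)
    alg = solve-∀ ℚring
  N-comm a b c d u (suc zero) = alg a b c d (u 0) (u 1)
    where
    alg : ∀ a b c d x y → a * (c * y + d * x) + b * (c * x) ≡ c * (a * y + b * x) + d * (a * x)
    alg = solve-∀ ℚring
  N-comm a b c d u (suc (suc s)) = alg a b c d (u s) (u (suc s)) (u (suc (suc s)))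
    where
    alg : ∀ a b c d x y z → a * (c * z + d * y) + b * (c * y + d * x) ≡ c * (a * z + b * y) + d * (a * y + b * x)
    alg = solve-∀ ℚring

  N-∔ : ∀ a b u v → N a b (u ∔ v) ≗ (N a b u ∔ N a b v)
  N-∔ a b u v zero    = *-distribˡ-+ a (u 0) (v 0)
  N-∔ a b u v (suc s) = alg a b (u (suc s)) (v (suc s)) (u s) (v s)
    where
    alg : ∀ a b x y z w → a * (x + y) + b * (z + w) ≡ (a * x + b * z) + (a * y + b * w)
    alg = solve-∀ ℚring

  N-⊛ : ∀ a b q u → N a b (q ⊛ u) ≗ (q ⊛ N a b u)
  N-⊛ a b q u zero    = alg a q (u 0)
    where
    alg : ∀ a c x → a * (c * x) ≡ c * (a * x)
    alg = solve-∀ ℚring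
  N-⊛ a b q u (suc s) = alg a b q (u (suc s)) (u s)
    where
    alg : ∀ a b q x y → a * (q * x) + b * (q * y) ≡ q * (a * x + b * y)
    alg = solve-∀ ℚring

  N-den : ∀ {c} → c ≢ 0ℚ → ∀ u → N c 1ℚ (den c u) ≗ u
  N-den {c} ne u zero = sym (*-assoc c (inv c) (u 0)) ∙ cong (_* u 0) (inv-r ne) ∙ *-identityˡ (u 0)
  N-den {c} ne u (suc s) = alg c (inv c) (u (suc s)) (den c u s) ∙ cong (λ z → z * (u (suc s) - den c u s) + den c u s) (inv-r ne) ∙ alg′ (u (suc s)) (den c u s)
    where
    alg : ∀ c i x y → c * (i * (x - y)) + 1ℚ * y ≡ (c * i) * (x - y) + y
    alg = solve-∀ ℚring
    alg′ : ∀ x y → 1ℚ * (x - y) + y ≡ x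
    alg′ = solve-∀ ℚring

  -- Covers c = 0 as well, where the operation is the shift by ε. Hence identities between
  -- expansions may be checked after multiplying by all denominators, even at a pole.
  N-inj : ∀ c {u v} → N c 1ℚ u ≗ N c 1ℚ v → u ≗ v
  N-inj c {u} {v} h with c ≟ 0ℚ
  ... | yes refl = λ s → alg (u (suc s)) (u s) ∙ h (suc s) ∙ sym (alg (v (suc s)) (v s))
    where
    alg : ∀ x y → y ≡ 0ℚ * x + 1ℚ * y
    alg = solve-∀ ℚring
  ... | no ne = go
    where
    canc : ∀ x y z w → x + 1ℚ * z ≡ y + 1ℚ * w → z ≡ w → x ≡ y
    canc x y z .z e refl = alg x z ∙ cong (_- z) e ∙ sym (alg y z)
      where
      alg : ∀ x z → x ≡ (x + 1ℚ * z) - z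
      alg = solve-∀ ℚring
    go : u ≗ v
    go zero    = *-cancelˡ ne (h zero)
    go (suc s) = *-cancelˡ ne (canc _ _ _ _ (h (suc s)) (go s))

  N-mono : ∀ p → N 0ℚ 1ℚ (mono p) ≗ mono (suc p)
  N-mono p zero    = *-zeroˡ (mono p 0)
  N-mono p (suc s) = cong (_+ 1ℚ * mono p s) (*-zeroˡ (mono p (suc s))) ∙ +-identityˡ (1ℚ * mono p s) ∙ *-identityˡ (mono p s)

  N-shift : ∀ a g u → N (a + g) 1ℚ u ≗ (N a 1ℚ u ∔ (g ⊛ u))
  N-shift a g u zero    = *-distribʳ-+ (u 0) a g
  N-shift a g u (suc s) = alg a g (u (suc s)) (u s)
    where
    alg : ∀ a g x y → (a + g) * x + 1ℚ * y ≡ (a * x + 1ℚ * y) + g * x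
    alg = solve-∀ ℚring

  -- (a , b) stands for the factor a + b ε.
  NN : List (ℚ × ℚ) → Seq → Seq
  NN []            u = u
  NN ((a , b) ∷ l) u = N a b (NN l u)

  NN-cong : ∀ l {u v} → u ≗ v → NN l u ≗ NN l v
  NN-cong []            h = h
  NN-cong ((a , b) ∷ l) h = N-cong a b (NN-cong l h)

  NN-N : ∀ a b l u → N a b (NN l u) ≗ NN l (N a b u)
  NN-N a b []            u s = refl
  NN-N a b ((c , d) ∷ l) u s = N-comm a b c d (NN l u) s ∙ N-cong c d (NN-N a b l u) s

  NN-++ : ∀ l l′ u → NN (l ++ l′) u ≗ NN l (NN l′ u)
  NN-++ []            l′ u s = refl
  NN-++ ((a , b) ∷ l) l′ u s = N-cong a b (NN-++ l l′ u) s

  NN-NN : ∀ l l′ u → NN l (NN l′ u) ≗ NN l′ (NN l u)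
  NN-NN []            l′ u s = refl
  NN-NN ((a , b) ∷ l) l′ u s = N-cong a b (NN-NN l l′ u) s ∙ NN-N a b l′ (NN l u) s

  NN-↭ : ∀ {l l′} → l ↭ l′ → ∀ u → NN l u ≗ NN l′ u
  NN-↭ refl u s = refl
  NN-↭ (prep (a , b) p) u s = N-cong a b (NN-↭ p u) s
  NN-↭ (swap (a , b) (c , d) p) u s = N-comm a b c d _ s ∙ N-cong c d (N-cong a b (NN-↭ p u)) s
  NN-↭ (trans p q) u s = NN-↭ p u s ∙ NN-↭ q u s

  fac : ℚ → ℚ × ℚ
  fac c = c , 1ℚ

  dd : List ℚ → Seq → Seq
  dd []      u = u
  dd (c ∷ l) u = den c (dd l u)

  dd-cong : ∀ l {u v} → u ≗ v → dd l u ≗ dd l v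
  dd-cong []      h = h
  dd-cong (c ∷ l) h = den-cong c (dd-cong l h)

  NN-dd : ∀ l → All (_≢ 0ℚ) l → ∀ u → NN (map fac l) (dd l u) ≗ u
  NN-dd [] [] u s = refl
  NN-dd (c ∷ l) (nc ∷ nl) u s = NN-N c 1ℚ (map fac l) (den c (dd l u)) s ∙ NN-cong (map fac l) (N-den nc (dd l u)) s ∙ NN-dd l nl u s

  NN-inj : ∀ l {u v} → NN (map fac l) u ≗ NN (map fac l) v → u ≗ v
  NN-inj []      h = h
  NN-inj (c ∷ l) h = NN-inj l (N-inj c h)

  -- A term (q , k , i) stands for q / (t + k)^(i+1).
  Term : Set
  Term = ℚ × ℚ × ℕ

  scale : ℚ → List Term → List Term
  scale a = map (λ { (q , k , i) → (a * q , k , i) })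

  -- Iterates 1/((t+k)(t+j)) = g (1/(t+k) - 1/(t+j)) with g = 1/(j-k). Each use leaves one term of
  -- the current order at k and lowers the order of the rest, until a simple pole at j remains.
  Dt′ : ℚ → ℚ → ℚ → ℚ → ℕ → List Term
  Dt′ g j q k zero    = (q * g , k , 0) ∷ (- (q * g) , j , 0) ∷ []
  Dt′ g j q k (suc i) = (q * g , k , suc i) ∷ Dt′ g j (- (q * g)) k i

  Dt : ℚ → Term → List Term
  Dt j (q , k , i) with k ≟ j
  ... | yes _ = (q , k , suc i) ∷ []
  ... | no _  = Dt′ (inv (j - k)) j q k i

  D : ℚ → List Term → List Term
  D j []      = []
  D j (t ∷ r) = Dt j t ++ D j r

  -- Laurent expansion of the represented function at t = - x + ε, multiplied by ε^B.
  module Expansion (x : ℚ) (B : ℕ) where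

    -- The factor ε^B turns Laurent series into power series. The truncated `B ∸ i` is the true
    -- exponent only for i ≤ B, which is why orders are bounded throughout.
    e′ : ∀ k → Dec (k ≡ x) → ℕ → Seq
    e′ k (yes _) i       = mono (B ∸ i)
    e′ k (no _)  zero    = mono B
    e′ k (no n)  (suc i) = den (k - x) (e′ k (no n) i)

    e : ℚ → ℕ → Seq
    e k = e′ k (k ≟ x)

    e0 : ∀ k → e k 0 ≗ mono B
    e0 k s with k ≟ x
    ... | yes _ = refl
    ... | no _  = refl

    Ne : ∀ k i → suc i ℕ.≤ B → N (k - x) 1ℚ (e k (suc i)) ≗ e k i
    Ne k i l = go (k ≟ x)
      where
      go : ∀ d → N (k - x) 1ℚ (e′ k d (suc i)) ≗ e′ k d i
      go (yes refl) s = cong (λ z → N z 1ℚ (mono (B ∸ suc i)) s) (+-inverseʳ k) ∙ N-mono (B ∸ suc i) s ∙ cong (λ z → mono z s) (sym (ℕP.+-∸-assoc 1 l))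
      go (no ne) = N-den (λ eq → ne (alg k x ∙ cong (_+ x) eq ∙ +-identityˡ x)) (e′ k (no ne) i)
        where
        alg : ∀ k x → k ≡ (k - x) + x
        alg = solve-∀ ℚring

    Et : Term → Seq
    Et (q , k , i) = q ⊛ e k (suc i)

    E : List Term → Seq
    E []      s = 0ℚ
    E (t ∷ r) = Et t ∔ E r

    E-++ : ∀ r r′ → E (r ++ r′) ≗ (E r ∔ E r′)
    E-++ []      r′ s = sym (+-identityˡ (E r′ s))
    E-++ (t ∷ r) r′ s = cong (Et t s +_) (E-++ r r′ s) ∙ sym (+-assoc (Et t s) (E r s) (E r′ s))

    E-scale : ∀ a r → E (scale a r) ≗ (a ⊛ E r)
    E-scale a [] s = sym (*-zeroʳ a)
    E-scale a ((q , k , i) ∷ r) s = cong₂ _+_ (*-assoc a q (e k (suc i) s)) (E-scale a r s) ∙ sym (*-distribˡ-+ a (q * e k (suc i) s) (E r s))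

    N-zero : ∀ a b → N a b (λ _ → 0ℚ) ≗ (λ _ → 0ℚ)
    N-zero a b zero    = *-zeroʳ a
    N-zero a b (suc s) = cong₂ _+_ (*-zeroʳ a) (*-zeroʳ b)

    private
      split : ∀ j k → j - x ≡ (k - x) + (j - k)
      split j k = alg j k x
        where
        alg : ∀ j k x → j - x ≡ (k - x) + (j - k)
        alg = solve-∀ ℚring

      Nj : ∀ j k i → suc i ℕ.≤ B → N (j - x) 1ℚ (e k (suc i)) ≗ (e k i ∔ ((j - k) ⊛ e k (suc i)))
      Nj j k i l s = cong (λ z → N z 1ℚ (e k (suc i)) s) (split j k) ∙ N-shift (k - x) (j - k) (e k (suc i)) s ∙ cong (_+ (j - k) * e k (suc i) s) (Ne k i l s)

    EDt′ : ∀ j q k i → k ≢ j → suc i ℕ.≤ B → N (j - x) 1ℚ (E (Dt′ (inv (j - k)) j q k i)) ≗ (q ⊛ e k (suc i))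
    EDt′ j q k i ne l = go q i l
      where
      g = inv (j - k)
      gj : (j - k) * g ≡ 1ℚ
      gj = inv-r {j - k} λ eq → ne (sym (alg j k ∙ cong (_+ k) eq ∙ +-identityˡ k))
        where
        alg : ∀ k x → k ≡ (k - x) + x
        alg = solve-∀ ℚring
      go : ∀ q i → suc i ℕ.≤ B → N (j - x) 1ℚ (E (Dt′ g j q k i)) ≗ (q ⊛ e k (suc i))
      go q zero l s =
          N-∔ (j - x) 1ℚ (Et (q * g , k , 0)) (E ((- (q * g) , j , 0) ∷ [])) s
        ∙ cong₂ _+_ (N-⊛ (j - x) 1ℚ (q * g) (e k 1) s ∙ cong ((q * g) *_) (Nj j k 0 l s ∙ cong (_+ (j - k) * e k 1 s) (e0 k s)))
            (N-∔ (j - x) 1ℚ (Et (- (q * g) , j , 0)) (λ _ → 0ℚ) s ∙ cong₂ _+_ (N-⊛ (j - x) 1ℚ (- (q * g)) (e j 1) s ∙ cong ((- (q * g)) *_) (Ne j 0 l s ∙ e0 j s)) (N-zero (j - x) 1ℚ s))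
        ∙ alg q g (mono B s) (j - k) (e k 1 s)
        ∙ cong (λ z → q * (z * e k 1 s)) gj ∙ cong (q *_) (*-identityˡ (e k 1 s))
        where
        alg : ∀ q g m d y → q * g * (m + d * y) + (- (q * g) * m + 0ℚ) ≡ q * ((d * g) * y)
        alg = solve-∀ ℚring
      go q (suc i) l s =
          N-∔ (j - x) 1ℚ (Et (q * g , k , suc i)) (E (Dt′ g j (- (q * g)) k i)) s
        ∙ cong₂ _+_ (N-⊛ (j - x) 1ℚ (q * g) (e k (suc (suc i))) s ∙ cong ((q * g) *_) (Nj j k (suc i) l s)) (go (- (q * g)) i (ℕP.≤-trans (ℕP.n≤1+n _) l) s)
        ∙ alg q g (e k (suc i) s) (j - k) (e k (suc (suc i)) s)
        ∙ cong (λ z → q * (z * e k (suc (suc i)) s)) gj ∙ cong (q *_) (*-identityˡ (e k (suc (suc i)) s))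
        where
        alg : ∀ q g m d y → q * g * (m + d * y) + (- (q * g)) * m ≡ q * ((d * g) * y)
        alg = solve-∀ ℚring

    Ord : ℕ → List Term → Set
    Ord m = All (λ t → proj₂ (proj₂ t) ℕ.< m)

    ED : ∀ j r m → Ord m r → suc m ℕ.≤ B → N (j - x) 1ℚ (E (D j r)) ≗ E r
    ED j [] m [] l s = N-zero (j - x) 1ℚ s
    ED j ((q , k , i) ∷ r) m (o ∷ os) l s =
        N-cong (j - x) 1ℚ (E-++ (Dt j (q , k , i)) (D j r)) s
      ∙ N-∔ (j - x) 1ℚ (E (Dt j (q , k , i))) (E (D j r)) s
      ∙ cong₂ _+_ (single s) (ED j r m os l s)
      where
      single : N (j - x) 1ℚ (E (Dt j (q , k , i))) ≗ (q ⊛ e k (suc i))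
      single with k ≟ j
      ... | yes refl = λ s → N-cong (k - x) 1ℚ (λ s′ → +-identityʳ (q * e k (suc (suc i)) s′)) s ∙ N-⊛ (k - x) 1ℚ q (e k (suc (suc i))) s ∙ cong (q *_) (Ne k (suc i) (ℕP.≤-trans (ℕ.s≤s o) l) s)
      ... | no ne = EDt′ j q k i ne (ℕP.≤-trans o (ℕP.≤-trans (ℕP.n≤1+n m) l))

  -- An operation (b , g , j) multiplies by (b t + g) / (t + j).
  Op : Set
  Op = ℚ × ℚ × ℚ

  -- Uses (b t + g)/(t + j) = b + (g - b j)/(t + j): one scaling plus one division.
  act : Op → List Term → List Term
  act (b , g , j) r = scale b r ++ scale (g - b * j) (D j r)

  build : ℚ → List Op → List Term
  build j₀ = foldr act ((1ℚ , j₀ , 0) ∷ [])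

  module _ where
    Ord′ : ℕ → List Term → Set
    Ord′ m = All (λ t → proj₂ (proj₂ t) ℕ.< m)

    Ord-scale : ∀ a {m} r → Ord′ m r → Ord′ m (scale a r)
    Ord-scale a [] [] = []
    Ord-scale a (_ ∷ r) (o ∷ os) = o ∷ Ord-scale a r os

    Ord-Dt′ : ∀ g j q k i {m} → i ℕ.< m → Ord′ m (Dt′ g j q k i)
    Ord-Dt′ g j q k zero l = l ∷ l ∷ []
    Ord-Dt′ g j q k (suc i) l = l ∷ Ord-Dt′ g j _ k i (ℕP.<-trans ℕP.≤-refl l)

    Ord-D : ∀ j {m} r → Ord′ m r → Ord′ (suc m) (D j r)
    Ord-D j [] [] = []
    Ord-D j ((q , k , i) ∷ r) (o ∷ os) = AllP.++⁺ one (Ord-D j r os)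
      where
      one : Ord′ _ (Dt j (q , k , i))
      one with k ≟ j
      ... | yes _ = ℕ.s≤s o ∷ []
      ... | no _  = Ord-Dt′ _ j q k i (ℕP.m<n⇒m<1+n o)

    Ord-build : ∀ j₀ ops → Ord′ (suc (Data.List.length ops)) (build j₀ ops)
    Ord-build j₀ [] = ℕ.s≤s ℕ.z≤n ∷ []
    Ord-build j₀ ((b , g , j) ∷ ops) = AllP.++⁺ (All.map ℕP.m<n⇒m<1+n (Ord-scale b _ (Ord-build j₀ ops))) (Ord-scale (g - b * j) _ (Ord-D j _ (Ord-build j₀ ops)))

  numsAt : ℚ → List Op → List (ℚ × ℚ)
  numsAt x = map (λ { (b , g , j) → (g - b * x , b) })

  densAt : ℚ → ℚ → List Op → List ℚ
  densAt x j₀ ops = map (λ { (b , g , j) → j - x }) ops ++ (j₀ - x) ∷ []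

  module _ (x : ℚ) (B : ℕ) where
    open Expansion x B

    E-act : ∀ b g j r m → Ord m r → suc m ℕ.≤ B → N (j - x) 1ℚ (E (act (b , g , j) r)) ≗ N (g - b * x) b (E r)
    E-act b g j r m o l s =
        N-cong (j - x) 1ℚ (λ s′ → E-++ (scale b r) (scale (g - b * j) (D j r)) s′ ∙ cong₂ _+_ (E-scale b r s′) (E-scale (g - b * j) (D j r) s′)) s
      ∙ N-∔ (j - x) 1ℚ (b ⊛ E r) ((g - b * j) ⊛ E (D j r)) s
      ∙ cong₂ _+_ (N-⊛ (j - x) 1ℚ b (E r) s) (N-⊛ (j - x) 1ℚ (g - b * j) (E (D j r)) s ∙ cong ((g - b * j) *_) (ED j r m o l s))
      ∙ fin s
      where
      fin : ∀ s → b * N (j - x) 1ℚ (E r) s + (g - b * j) * E r s ≡ N (g - b * x) b (E r) s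
      fin zero = alg b g j x (E r 0)
        where
        alg : ∀ b g j x y → b * ((j - x) * y) + (g - b * j) * y ≡ (g - b * x) * y
        alg = solve-∀ ℚring
      fin (suc s) = alg b g j x (E r (suc s)) (E r s)
        where
        alg : ∀ b g j x y z → b * ((j - x) * y + 1ℚ * z) + (g - b * j) * y ≡ (g - b * x) * y + b * z
        alg = solve-∀ ℚring

    E-build : ∀ j₀ ops → suc (suc (Data.List.length ops)) ℕ.≤ B → NN (map fac (densAt x j₀ ops)) (E (build j₀ ops)) ≗ NN (numsAt x ops) (mono B)
    E-build j₀ [] l s = N-cong (j₀ - x) 1ℚ (λ s′ → +-identityʳ (1ℚ * e j₀ 1 s′) ∙ *-identityˡ (e j₀ 1 s′)) s ∙ Ne j₀ 0 (ℕP.≤-trans (ℕ.s≤s ℕ.z≤n) l) s ∙ e0 j₀ s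
    E-build j₀ ((b , g , j) ∷ ops) l s =
        NN-N (j - x) 1ℚ dl (E (build j₀ ((b , g , j) ∷ ops))) s
      ∙ NN-cong dl (E-act b g j (build j₀ ops) (suc (Data.List.length ops)) (Ord-build j₀ ops) (ℕP.≤-trans (ℕP.n≤1+n _) l)) s
      ∙ sym (NN-N (g - b * x) b dl (E (build j₀ ops)) s)
      ∙ N-cong (g - b * x) b (E-build j₀ ops (ℕP.≤-trans (ℕP.n≤1+n _) l)) s
      where
      dl = map fac (densAt x j₀ ops)

    -- The bridge between the computed list of terms and explicit local factorisations: at each
    -- point a formula for the expansion may be proposed freely and only has to have the right
    -- product with the denominators.
    E-unique : ∀ j₀ ops u → suc (suc (Data.List.length ops)) ℕ.≤ B → NN (map fac (densAt x j₀ ops)) u ≗ NN (numsAt x ops) (mono B) → E (build j₀ ops) ≗ u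
    E-unique j₀ ops u l h = NN-inj (densAt x j₀ ops) (λ s → E-build j₀ ops l s ∙ sym (h s))

-- Coefficients, poles and residues of partial fractions

module PartialFractions where

  open Rationals
  open PowerSeries
  open import Defs using (pow)
  open import Data.Nat as ℕ using (ℕ; zero; suc; _∸_)
  import Data.Nat.Properties as ℕP
  open import Data.Integer as ℤ using (ℤ)
  import Data.Integer.Properties as ℤP
  open import Data.Rational
  open import Data.Rational.Properties
  open import Data.List using (List; []; _∷_; _++_; map; length)
  open import Data.List.Relation.Unary.All as All using (All; []; _∷_)
  open import Data.List.Relation.Unary.All.Properties as AllP using ()
  open import Data.Product using (∃; _×_; _,_; proj₁; proj₂)
  open import Data.Empty using (⊥-elim)
  open import Function using (_∘_)
  open import Relation.Nullary
  open import Relation.Binary.PropositionalEquality using (_≡_; _≢_; refl; sym; cong; cong₂; _≗_)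
  open import Tactic.RingSolver using (solve-∀)

  Vanish : ℕ → Seq → Set
  Vanish p u = ∀ s → s ℕ.< p → u s ≡ 0ℚ

  N-vanish : ∀ {p} a b {u} → Vanish p u → Vanish p (N a b u)
  N-vanish a b h zero    l = cong (a *_) (h zero l) ∙ *-zeroʳ a
  N-vanish a b h (suc s) l = cong₂ (λ x y → a * x + b * y) (h (suc s) l) (h s (ℕP.<-trans ℕP.≤-refl l)) ∙ cong₂ _+_ (*-zeroʳ a) (*-zeroʳ b)

  N0-vanish : ∀ {p} b {u} → Vanish p u → Vanish (suc p) (N 0ℚ b u)
  N0-vanish b {u} h zero    l = *-zeroˡ (u 0)
  N0-vanish b {u} h (suc s) l = cong₂ _+_ (*-zeroˡ (u (suc s))) (cong (b *_) (h s (ℕP.≤-pred l)) ∙ *-zeroʳ b)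

  den-vanish : ∀ {p} c {u} → Vanish p u → Vanish p (den c u)
  den-vanish c h zero    l = cong (inv c *_) (h zero l) ∙ *-zeroʳ (inv c)
  den-vanish c h (suc s) l = cong₂ (λ x y → inv c * (x - y)) (h (suc s) l) (den-vanish c h s (ℕP.<-trans ℕP.≤-refl l)) ∙ *-zeroʳ (inv c)

  mono-vanish : ∀ p → Vanish p (mono p)
  mono-vanish (suc p) zero    l = refl
  mono-vanish (suc p) (suc s) l = mono-vanish p s (ℕP.≤-pred l)

  mono-at : ∀ p → mono p p ≡ 1ℚ
  mono-at zero    = refl
  mono-at (suc p) = mono-at p

  mono-ne : ∀ p s → p ≢ s → mono p s ≡ 0ℚ
  mono-ne zero    zero    ne = ⊥-elim (ne refl)
  mono-ne zero    (suc s) ne = refl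
  mono-ne (suc p) zero    ne = refl
  mono-ne (suc p) (suc s) ne = mono-ne p s (ne ∘ cong suc)

  -- v = ε^p u
  Shift : ℕ → Seq → Seq → Set
  Shift p u v = Vanish p v × (∀ s → v (p ℕ.+ s) ≡ u s)

  Shift-mono : ∀ p → Shift p (mono 0) (mono p)
  Shift-mono p = mono-vanish p , go p
    where
    go : ∀ p s → mono p (p ℕ.+ s) ≡ mono 0 s
    go zero    s = refl
    go (suc p) s = go p s

  private
    below : ∀ p v → Vanish p v → ∀ q → p ℕ.+ 0 ≡ suc q → v q ≡ 0ℚ
    below p v h q e = h q (ℕP.≤-reflexive (sym (sym (ℕP.+-identityʳ p) ∙ e)))

  Shift-N : ∀ p a b {u v} → Shift p u v → Shift p (N a b u) (N a b v)
  Shift-N p a b {u} {v} (h₁ , h₂) = N-vanish a b h₁ , go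
    where
    z : ∀ q → p ℕ.+ 0 ≡ q → N a b v q ≡ a * u 0
    z zero    e = cong (λ w → a * v w) (sym e) ∙ cong (a *_) (h₂ 0)
    z (suc q) e = cong₂ (λ x y → a * x + b * y) (cong v (sym e) ∙ h₂ 0) (below p v h₁ q e) ∙ cong (λ w → a * u 0 + w) (*-zeroʳ b) ∙ +-identityʳ (a * u 0)
    go : ∀ s → N a b v (p ℕ.+ s) ≡ N a b u s
    go zero    = z _ refl
    go (suc s) = cong (N a b v) (ℕP.+-suc p s) ∙ cong₂ (λ x y → a * x + b * y) (cong v (sym (ℕP.+-suc p s)) ∙ h₂ (suc s)) (h₂ s)

  Shift-den : ∀ p c {u v} → Shift p u v → Shift p (den c u) (den c v)
  Shift-den p c {u} {v} (h₁ , h₂) = den-vanish c h₁ , go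
    where
    z : ∀ q → p ℕ.+ 0 ≡ q → den c v q ≡ inv c * u 0
    z zero    e = cong (λ w → inv c * v w) (sym e) ∙ cong (inv c *_) (h₂ 0)
    z (suc q) e = cong₂ (λ x y → inv c * (x - y)) (cong v (sym e) ∙ h₂ 0) (den-vanish c h₁ q (ℕP.≤-reflexive (sym (sym (ℕP.+-identityʳ p) ∙ e)))) ∙ cong (inv c *_) (+-identityʳ (u 0))
    go : ∀ s → den c v (p ℕ.+ s) ≡ den c u s
    go zero    = z _ refl
    go (suc s) = cong (den c v) (ℕP.+-suc p s) ∙ cong₂ (λ x y → inv c * (x - y)) (cong v (sym (ℕP.+-suc p s)) ∙ h₂ (suc s)) (go s)

  Shift-NN : ∀ p l {u v} → Shift p u v → Shift p (NN l u) (NN l v)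
  Shift-NN p []            h = h
  Shift-NN p ((a , b) ∷ l) h = Shift-N p a b (Shift-NN p l h)

  Shift-dd : ∀ p l {u v} → Shift p u v → Shift p (dd l u) (dd l v)
  Shift-dd p []      h = h
  Shift-dd p (c ∷ l) h = Shift-den p c (Shift-dd p l h)

  -- (y + ε)^(-i) = Σ_s bc i s y^(-i-s) ε^s
  bc : ℕ → ℕ → ℤ
  bc zero    zero    = ℤ.+ 1
  bc zero    (suc s) = ℤ.+ 0
  bc (suc i) zero    = bc i zero
  bc (suc i) (suc s) = bc i (suc s) ℤ.- bc (suc i) s

  dpow : ℚ → ℕ → Seq
  dpow y zero    = mono 0
  dpow y (suc i) = den y (dpow y i)

  dpow-bc : ∀ y i s → dpow y i s ≡ ι (bc i s) * pow (inv y) (i ℕ.+ s)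
  dpow-bc y zero    zero    = cong (_* 1ℚ) (sym ι1)
  dpow-bc y zero    (suc s) = sym (cong (_* pow (inv y) (suc s)) ι0 ∙ *-zeroˡ (pow (inv y) (suc s)))
  dpow-bc y (suc i) zero    = cong (inv y *_) (dpow-bc y i 0) ∙ alg (inv y) (ι (bc i 0)) (pow (inv y) (i ℕ.+ 0))
    where
    alg : ∀ a b c → a * (b * c) ≡ b * (a * c)
    alg = solve-∀ ℚring
  dpow-bc y (suc i) (suc s) =
      cong₂ (λ p q → inv y * (p - q)) (dpow-bc y i (suc s)) (dpow-bc y (suc i) s ∙ cong (λ z → ι (bc (suc i) s) * pow (inv y) z) (sym (ℕP.+-suc i s)))
    ∙ alg (inv y) (ι (bc i (suc s))) (ι (bc (suc i) s)) (pow (inv y) (i ℕ.+ suc s))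
    ∙ cong (_* (inv y * pow (inv y) (i ℕ.+ suc s))) (cong (ι (bc i (suc s)) +_) (sym (ι-neg (bc (suc i) s))) ∙ sym (ι-+ (bc i (suc s)) (ℤ.- bc (suc i) s)))
    where
    alg : ∀ a b c d → a * (b * d - c * d) ≡ (b - c) * (a * d)
    alg = solve-∀ ℚring

  Σ : ℕ → (ℕ → ℚ) → ℚ
  Σ zero    f = 0ℚ
  Σ (suc n) f = Σ n f + f n

  Σ-cong : ∀ n {f g} → (∀ i → i ℕ.< n → f i ≡ g i) → Σ n f ≡ Σ n g
  Σ-cong zero    h = refl
  Σ-cong (suc n) h = cong₂ _+_ (Σ-cong n (λ i l → h i (ℕP.m<n⇒m<1+n l))) (h n ℕP.≤-refl)

  Σ-zero : ∀ n {f} → (∀ i → i ℕ.< n → f i ≡ 0ℚ) → Σ n f ≡ 0ℚ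
  Σ-zero zero    h = refl
  Σ-zero (suc n) h = cong₂ _+_ (Σ-zero n (λ i l → h i (ℕP.m<n⇒m<1+n l))) (h n ℕP.≤-refl)

  Σ-+ : ∀ n f g → Σ n (λ i → f i + g i) ≡ Σ n f + Σ n g
  Σ-+ zero    f g = refl
  Σ-+ (suc n) f g = cong (_+ (f n + g n)) (Σ-+ n f g) ∙ alg (Σ n f) (Σ n g) (f n) (g n)
    where
    alg : ∀ a b c d → (a + b) + (c + d) ≡ (a + c) + (b + d)
    alg = solve-∀ ℚring

  Σ-* : ∀ n c f → Σ n (λ i → c * f i) ≡ c * Σ n f
  Σ-* zero    c f = sym (*-zeroʳ c)
  Σ-* (suc n) c f = cong (_+ c * f n) (Σ-* n c f) ∙ sym (*-distribˡ-+ c (Σ n f) (f n))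

  Σ-single : ∀ n k f → k ℕ.< n → (∀ i → i ℕ.< n → i ≢ k → f i ≡ 0ℚ) → Σ n f ≡ f k
  Σ-single (suc n) k f l h with n ℕ.≟ k
  ... | yes refl = cong (_+ f n) (Σ-zero n (λ i q → h i (ℕP.m<n⇒m<1+n q) (ℕP.<⇒≢ q))) ∙ +-identityˡ (f n)
  ... | no ne = cong₂ _+_ (Σ-single n k f (ℕP.≤∧≢⇒< (ℕP.≤-pred l) (ne ∘ sym)) (λ i q → h i (ℕP.m<n⇒m<1+n q))) (h n ℕP.≤-refl ne) ∙ +-identityʳ (f k)

  Σ-swap : ∀ n m (f : ℕ → ℕ → ℚ) → Σ n (λ i → Σ m (f i)) ≡ Σ m (λ j → Σ n (λ i → f i j))
  Σ-swap zero    m f = sym (Σ-zero m (λ _ _ → refl))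
  Σ-swap (suc n) m f = cong (_+ Σ m (f n)) (Σ-swap n m f) ∙ sym (Σ-+ m (λ j → Σ n (λ i → f i j)) (f n))

  Σ-rev : ∀ n f → Σ (suc n) f ≡ Σ (suc n) (λ i → f (n ∸ i))
  Σ-rev n f = go n ∙ Σ-cong (suc n) (λ _ _ → refl)
    where
    shiftl : ∀ n g → Σ (suc n) g ≡ g 0 + Σ n (g ∘ suc)
    shiftl zero    g = +-identityˡ (g 0) ∙ sym (+-identityʳ (g 0))
    shiftl (suc n) g = cong (_+ g (suc n)) (shiftl n g) ∙ +-assoc (g 0) (Σ n (g ∘ suc)) (g (suc n))
    go : ∀ n → Σ (suc n) f ≡ Σ (suc n) (λ i → f (n ∸ i))
    go zero    = refl
    go (suc n) = +-comm (Σ (suc n) f) (f (suc n)) ∙ cong (f (suc n) +_) (go n) ∙ sym (shiftl (suc n) (λ i → f (suc n ∸ i)))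

  δ : ∀ {A : Set} → Dec A → ℚ → ℚ
  δ (yes _) q = q
  δ (no _)  q = 0ℚ

  cf : ℚ → ℕ → List Term → ℚ
  cf k i [] = 0ℚ
  cf k i ((q , k′ , i′) ∷ r) = δ (k′ ≟ k) (δ (i′ ℕ.≟ i) q) + cf k i r

  module _ (B : ℕ) where
    -- A term with its pole elsewhere is regular here, hence divisible by ε^B and invisible below
    -- that index; a term of order j at the point itself is the single monomial ε^(B-j).
    E-polar : ∀ k i r → suc i ℕ.≤ B → Ord′ B r → Expansion.E k B r (B ∸ suc i) ≡ cf k i r
    E-polar k i [] l [] = refl
    E-polar k i ((q , k′ , i′) ∷ r) l (o ∷ os) = cong₂ _+_ one (E-polar k i r l os)
      where
      open Expansion k B
      lt : B ∸ suc i ℕ.< B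
      lt = ℕP.∸-monoʳ-< (ℕ.s≤s ℕ.z≤n) l
      vv : ∀ ne j → Vanish B (e′ k′ (no ne) j)
      vv ne zero    = mono-vanish B
      vv ne (suc j) = den-vanish (k′ - k) (vv ne j)
      one : q * e′ k′ (k′ ≟ k) (suc i′) (B ∸ suc i) ≡ δ (k′ ≟ k) (δ (i′ ℕ.≟ i) q)
      one with k′ ≟ k
      ... | no ne = cong (q *_) (vv ne (suc i′) _ lt) ∙ *-zeroʳ q
      ... | yes _ with i′ ℕ.≟ i
      ...   | yes refl = cong (q *_) (mono-at (B ∸ suc i)) ∙ *-identityʳ q
      ...   | no ne = cong (q *_) (mono-ne _ _ (λ eq → ne (ℕP.suc-injective (ℕP.∸-cancelˡ-≡ o l eq)))) ∙ *-zeroʳ q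

    tsum : (ℚ → ℕ → ℚ) → List Term → ℚ
    tsum φ [] = 0ℚ
    tsum φ ((q , k , i) ∷ r) = q * φ k i + tsum φ r

    E-regular : ∀ x s r → All (λ t → proj₁ (proj₂ t) ≢ x) r → Expansion.E x B r (B ℕ.+ s) ≡ tsum (λ k i → dpow (k - x) (suc i) s) r
    E-regular x s [] [] = refl
    E-regular x s ((q , k , i) ∷ r) (ne ∷ nes) = cong₂ _+_ (cong (q *_) one) (E-regular x s r nes)
      where
      open Expansion x B
      sh : ∀ ne j → Shift B (dpow (k - x) j) (e′ k (no ne) j)
      sh ne zero    = Shift-mono B
      sh ne (suc j) = Shift-den B (k - x) (sh ne j)
      one : e′ k (k ≟ x) (suc i) (B ℕ.+ s) ≡ dpow (k - x) (suc i) s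
      one with k ≟ x
      ... | yes eq = ⊥-elim (ne eq)
      ... | no ne′ = proj₂ (sh ne′ (suc i)) s

    PolesIn : ℕ → List Term → Set
    PolesIn M = All (λ t → ∃ λ κ → κ ℕ.< M × proj₁ (proj₂ t) ≡ ιℕ κ)

    ιℕ-inj : ∀ {a b} → ιℕ a ≡ ιℕ b → a ≡ b
    ιℕ-inj {a} {b} e = ℤP.+-injective (ι-inj {ℤ.+ a} {ℤ.+ b} e)

    regroup : ∀ φ M I r → PolesIn M r → Ord′ I r → tsum φ r ≡ Σ M (λ κ → Σ I (λ i → cf (ιℕ κ) i r * φ (ιℕ κ) i))
    regroup φ M I [] [] [] = sym (Σ-zero M (λ κ _ → Σ-zero I (λ i _ → *-zeroˡ (φ (ιℕ κ) i))))
    regroup φ M I ((q , k , i₀) ∷ r) ((κ₀ , κ₀< , refl) ∷ ps) (o ∷ os) =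
        cong₂ _+_ (sym one) (regroup φ M I r ps os)
      ∙ sym (Σ-+ M _ _)
      ∙ Σ-cong M (λ κ _ → sym (Σ-+ I _ _) ∙ Σ-cong I (λ i _ → sym (*-distribʳ-+ (φ (ιℕ κ) i) (δ (k ≟ ιℕ κ) (δ (i₀ ℕ.≟ i) q)) (cf (ιℕ κ) i r))))
      where
      g : ℕ → ℕ → ℚ
      g κ i = δ (k ≟ ιℕ κ) (δ (i₀ ℕ.≟ i) q) * φ (ιℕ κ) i
      g≢κ : ∀ κ i → κ ≢ κ₀ → g κ i ≡ 0ℚ
      g≢κ κ i ne with k ≟ ιℕ κ
      ... | yes e = ⊥-elim (ne (sym (ιℕ-inj e)))
      ... | no _  = *-zeroˡ (φ (ιℕ κ) i)
      g≢i : ∀ κ i → i ≢ i₀ → g κ i ≡ 0ℚ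
      g≢i κ i ne with k ≟ ιℕ κ
      ... | no _  = *-zeroˡ (φ (ιℕ κ) i)
      ... | yes _ with i₀ ℕ.≟ i
      ...   | yes e = ⊥-elim (ne (sym e))
      ...   | no _  = *-zeroˡ (φ (ιℕ κ) i)
      g= : g κ₀ i₀ ≡ q * φ k i₀
      g= with ιℕ κ₀ ≟ ιℕ κ₀
      ... | no ne = ⊥-elim (ne refl)
      ... | yes _ with i₀ ℕ.≟ i₀
      ...   | no ne = ⊥-elim (ne refl)
      ...   | yes _ = refl
      one : Σ M (λ κ → Σ I (g κ)) ≡ q * φ k i₀
      one = Σ-single M κ₀ _ κ₀< (λ κ _ ne → Σ-zero I (λ i _ → g≢κ κ i ne)) ∙ Σ-single I i₀ (g κ₀) o (λ i _ ne → g≢i κ₀ i ne) ∙ g=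

    -- Selects the simple poles, so `tsum ind0` is the sum of all residues.
    ind0 : ℚ → ℕ → ℚ
    ind0 k zero    = 1ℚ
    ind0 k (suc i) = 0ℚ

    tsum-++ : ∀ φ r r′ → tsum φ (r ++ r′) ≡ tsum φ r + tsum φ r′
    tsum-++ φ [] r′ = sym (+-identityˡ _)
    tsum-++ φ ((q , k , i) ∷ r) r′ = cong (q * φ k i +_) (tsum-++ φ r r′) ∙ sym (+-assoc (q * φ k i) (tsum φ r) (tsum φ r′))

    tsum-scale : ∀ φ a r → tsum φ (scale a r) ≡ a * tsum φ r
    tsum-scale φ a [] = sym (*-zeroʳ a)
    tsum-scale φ a ((q , k , i) ∷ r) = cong₂ _+_ (*-assoc a q (φ k i)) (tsum-scale φ a r) ∙ sym (*-distribˡ-+ a (q * φ k i) (tsum φ r))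

    res-Dt′ : ∀ g j q k i → tsum ind0 (Dt′ g j q k i) ≡ 0ℚ
    res-Dt′ g j q k zero = alg (q * g)
      where
      alg : ∀ a → a * 1ℚ + (- a * 1ℚ + 0ℚ) ≡ 0ℚ
      alg = solve-∀ ℚring
    res-Dt′ g j q k (suc i) = cong₂ _+_ (*-zeroʳ (q * g)) (res-Dt′ g j (- (q * g)) k i)

    -- A term divided by a further linear factor decays at least like t^(-2), so its residues
    -- cancel; in `Dt′` they are the two final entries.
    res-D : ∀ j r → tsum ind0 (D j r) ≡ 0ℚ
    res-D j [] = refl
    res-D j ((q , k , i) ∷ r) = tsum-++ ind0 (Dt j (q , k , i)) (D j r) ∙ cong₂ _+_ one (res-D j r)
      where
      one : tsum ind0 (Dt j (q , k , i)) ≡ 0ℚ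
      one with k ≟ j
      ... | yes _ = cong (_+ 0ℚ) (*-zeroʳ q)
      ... | no _  = res-Dt′ _ j q k i

    res-act : ∀ g j r → tsum ind0 (act (0ℚ , g , j) r) ≡ 0ℚ
    res-act g j r = tsum-++ ind0 (scale 0ℚ r) (scale (g - 0ℚ * j) (D j r)) ∙ cong₂ _+_ (tsum-scale ind0 0ℚ r ∙ *-zeroˡ (tsum ind0 r)) (tsum-scale ind0 (g - 0ℚ * j) (D j r) ∙ cong ((g - 0ℚ * j) *_) (res-D j r) ∙ *-zeroʳ (g - 0ℚ * j))

    Poles-scale : ∀ a {M} r → PolesIn M r → PolesIn M (scale a r)
    Poles-scale a [] [] = []
    Poles-scale a (_ ∷ r) (p ∷ ps) = p ∷ Poles-scale a r ps

    Poles-D : ∀ {M} j r → (∃ λ κ → κ ℕ.< M × j ≡ ιℕ κ) → PolesIn M r → PolesIn M (D j r)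
    Poles-D j [] pj [] = []
    Poles-D {M} j ((q , k , i) ∷ r) pj (p ∷ ps) = AllP.++⁺ one (Poles-D j r pj ps)
      where
      Pg : ∀ g q i → PolesIn M (Dt′ g j q k i)
      Pg g q zero    = p ∷ pj ∷ []
      Pg g q (suc i) = p ∷ Pg g _ i
      one : PolesIn M (Dt j (q , k , i))
      one with k ≟ j
      ... | yes _ = p ∷ []
      ... | no _  = Pg _ q i

    Poles-build : ∀ {M} j₀ ops → (∃ λ κ → κ ℕ.< M × j₀ ≡ ιℕ κ) → All (λ o → ∃ λ κ → κ ℕ.< M × proj₂ (proj₂ o) ≡ ιℕ κ) ops → PolesIn M (build j₀ ops)
    Poles-build j₀ [] p [] = p ∷ []
    Poles-build j₀ ((b , g , j) ∷ ops) p (pj ∷ ps) = AllP.++⁺ (Poles-scale b _ (Poles-build j₀ ops p ps)) (Poles-scale (g - b * j) _ (Poles-D j _ pj (Poles-build j₀ ops p ps)))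

  -- Surplus denominators are paired with the numerator 1. Surplus numerators would be lost, which
  -- the length hypotheses of the lemmas exclude.
  mkOps : List (ℚ × ℚ) → List ℚ → List Op
  mkOps ns             []       = []
  mkOps []             (j ∷ js) = (0ℚ , 1ℚ , j) ∷ mkOps [] js
  mkOps ((b , g) ∷ ns) (j ∷ js) = (b , g , j) ∷ mkOps ns js

  at : ℚ → ℚ × ℚ → ℚ × ℚ
  at x (b , g) = g - b * x , b

  N-one : ∀ x u → N (1ℚ - 0ℚ * x) 0ℚ u ≗ u
  N-one x u zero = alg x (u 0)
    where
    alg : ∀ x y → (1ℚ - 0ℚ * x) * y ≡ y
    alg = solve-∀ ℚring
  N-one x u (suc s) = alg x (u (suc s)) (u s)
    where
    alg : ∀ x y z → (1ℚ - 0ℚ * x) * y + 0ℚ * z ≡ y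
    alg = solve-∀ ℚring

  mkOps-nums : ∀ x ns js → length ns ℕ.≤ length js → ∀ u → NN (numsAt x (mkOps ns js)) u ≗ NN (map (at x) ns) u
  mkOps-nums x [] [] l u s = refl
  mkOps-nums x [] (j ∷ js) l u s = N-one x _ s ∙ mkOps-nums x [] js ℕ.z≤n u s
  mkOps-nums x ((b , g) ∷ ns) (j ∷ js) l u s = N-cong (g - b * x) b (mkOps-nums x ns js (ℕP.≤-pred l) u) s

  mkOps-dens : ∀ x j₀ ns js → densAt x j₀ (mkOps ns js) ≡ map (_- x) js ++ (j₀ - x) ∷ []
  mkOps-dens x j₀ ns [] = refl
  mkOps-dens x j₀ [] (j ∷ js) = cong ((j - x) ∷_) (mkOps-dens x j₀ [] js)
  mkOps-dens x j₀ (_ ∷ ns) (j ∷ js) = cong ((j - x) ∷_) (mkOps-dens x j₀ ns js)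

  mkOps-All : ∀ {P : ℚ → Set} ns js → All P js → All (λ o → P (proj₂ (proj₂ o))) (mkOps ns js)
  mkOps-All ns [] [] = []
  mkOps-All [] (j ∷ js) (p ∷ ps) = p ∷ mkOps-All [] js ps
  mkOps-All (_ ∷ ns) (j ∷ js) (p ∷ ps) = p ∷ mkOps-All ns js ps

  mkOps-length : ∀ ns js → length (mkOps ns js) ≡ length js
  mkOps-length ns [] = refl
  mkOps-length [] (j ∷ js) = cong suc (mkOps-length [] js)
  mkOps-length (_ ∷ ns) (j ∷ js) = cong suc (mkOps-length ns js)

-- Reordering of linear factors and the reflection of ε

module LocalExpansion where

  open Rationals
  open PowerSeries
  open import Data.Nat as ℕ using (ℕ; zero; suc)
  import Data.Nat.Properties as ℕP
  open import Data.Integer as ℤ using (ℤ)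
  import Data.Integer.Tactic.RingSolver as ℤS
  open import Data.Rational
  open import Data.Rational.Properties
  open import Data.List using (List; []; _∷_; _++_; map; length; replicate)
  import Data.List.Properties as LP
  open import Data.List.Relation.Unary.All as All using (All; []; _∷_)
  open import Data.List.Relation.Unary.All.Properties as AllP using ()
  open import Data.List.Relation.Binary.Permutation.Propositional using (_↭_; ↭-refl; ↭-sym; ↭-trans; ↭-reflexive; prep)
  open import Data.List.Relation.Binary.Permutation.Propositional.Properties as PermP using ()
  open import Data.Product using (_,_)
  open import Relation.Binary.PropositionalEquality using (_≡_; _≢_; refl; sym; cong; cong₂; _≗_)
  open import Tactic.RingSolver using (solve-∀)

  rep : ∀ {A : Set} → ℕ → List A → List A
  rep zero    l = []
  rep (suc b) l = l ++ rep b l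

  map-rep : ∀ {A B : Set} (f : A → B) b l → map f (rep b l) ≡ rep b (map f l)
  map-rep f zero    l = refl
  map-rep f (suc b) l = LP.map-++ f l (rep b l) ∙ cong (map f l ++_) (map-rep f b l)

  length-rep : ∀ {A : Set} b (l : List A) → length (rep b l) ≡ b ℕ.* length l
  length-rep zero    l = refl
  length-rep (suc b) l = LP.length-++ l ∙ cong (length l ℕ.+_) (length-rep b l)

  All-rep : ∀ {A : Set} {P : A → Set} b {l} → All P l → All P (rep b l)
  All-rep zero    h = []
  All-rep (suc b) h = AllP.++⁺ h (All-rep b h)

  rep-↭ : ∀ {A : Set} b {l l′ : List A} → l ↭ l′ → rep b l ↭ rep b l′
  rep-↭ zero    p = ↭-refl
  rep-↭ (suc b) p = PermP.++⁺ p (rep-↭ b p)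

  rep-cons : ∀ {A : Set} b (z : A) l → rep b (z ∷ l) ↭ replicate b z ++ rep b l
  rep-cons zero    z l = ↭-refl
  rep-cons (suc b) z l = prep z (↭-trans (PermP.++⁺ˡ l (rep-cons b z l))
    (↭-trans (↭-reflexive (sym (LP.++-assoc l (replicate b z) (rep b l))))
    (↭-trans (PermP.++⁺ʳ (rep b l) (PermP.++-comm l (replicate b z)))
     (↭-reflexive (LP.++-assoc (replicate b z) l (rep b l))))))

  rng : ℕ → List ℕ
  rng zero    = []
  rng (suc j) = suc j ∷ rng j

  rng-+ : ∀ k r → rng (r ℕ.+ k) ≡ map (k ℕ.+_) (rng r) ++ rng k
  rng-+ k zero    = refl
  rng-+ k (suc r) = cong₂ _∷_ (ℕP.+-comm (suc r) k) (rng-+ k r)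

  length-rng : ∀ m → length (rng m) ≡ m
  length-rng zero    = refl
  length-rng (suc m) = cong suc (length-rng m)

  up : ℕ → List ℤ
  up k = map ℤ.+_ (rng k)

  dn : ℕ → List ℤ
  dn k = map (λ j → ℤ.- (ℤ.+ j)) (rng k)

  -- The nonzero differences j - k for 0 ≤ j ≤ k + r.
  Dk : ℕ → ℕ → List ℤ
  Dk k r = dn k ++ up r

  -- The recursion for division is not visibly symmetric in the factors, whereas multiplication is;
  -- so the two sides are compared after clearing denominators.
  dd-↭ : ∀ {l l′} → All (_≢ 0ℚ) l → l ↭ l′ → ∀ u → dd l u ≗ dd l′ u
  dd-↭ {l} {l′} nl p u = NN-inj l (λ s → NN-dd l nl u s ∙ sym (NN-dd l′ (PermP.All-resp-↭ p nl) u s) ∙ NN-↭ (PermP.map⁺ fac (↭-sym p)) (dd l′ u) s)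

  sg : ℕ → ℚ
  sg zero    = 1ℚ
  sg (suc s) = - sg s

  -- The substitution of -ε for ε.
  τ : Seq → Seq
  τ u s = sg s * u s

  τ-N : ∀ a b u → τ (N a b u) ≗ ((- 1ℚ) ⊛ N (- a) b (τ u))
  τ-N a b u zero = alg a (u 0)
    where
    alg : ∀ a x → 1ℚ * (a * x) ≡ (- 1ℚ) * ((- a) * (1ℚ * x))
    alg = solve-∀ ℚring
  τ-N a b u (suc s) = alg a b (sg s) (u (suc s)) (u s)
    where
    alg : ∀ a b g x y → (- g) * (a * x + b * y) ≡ (- 1ℚ) * ((- a) * ((- g) * x) + b * (g * y))
    alg = solve-∀ ℚring

  ⊛-den : ∀ q c u → den c (q ⊛ u) ≗ (q ⊛ den c u)
  ⊛-den q c u zero = alg (inv c) q (u 0)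
    where
    alg : ∀ i q x → i * (q * x) ≡ q * (i * x)
    alg = solve-∀ ℚring
  ⊛-den q c u (suc s) = cong (λ z → inv c * (q * u (suc s) - z)) (⊛-den q c u s) ∙ alg (inv c) q (u (suc s)) (den c u s)
    where
    alg : ∀ i q x y → i * (q * x - q * y) ≡ q * (i * (x - y))
    alg = solve-∀ ℚring

  τ-den : ∀ c u → c ≢ 0ℚ → τ (den c u) ≗ ((- 1ℚ) ⊛ den (- c) (τ u))
  τ-den c u nc zero = alg (inv c) (u 0) ∙ cong (λ z → (- 1ℚ) * (z * (1ℚ * u 0))) (sym (inv-neg nc))
    where
    alg : ∀ a x → 1ℚ * (a * x) ≡ (- 1ℚ) * ((- a) * (1ℚ * x))
    alg = solve-∀ ℚring
  τ-den c u nc (suc s) = alg (sg s) (inv c) (u (suc s)) (den c u s) ∙ cong (λ z → (- inv c) * (sg s * u (suc s) + (- z))) (τ-den c u nc s) ∙ alg′ (inv c) (sg s) (u (suc s)) (den (- c) (τ u) s)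
       ∙ cong (λ z → (- 1ℚ) * (z * ((- sg s) * u (suc s) - den (- c) (τ u) s))) (sym (inv-neg nc))
    where
    alg : ∀ g i x y → (- g) * (i * (x - y)) ≡ (- i) * (g * x + (- (g * y)))
    alg = solve-∀ ℚring
    alg′ : ∀ i g x z → (- i) * (g * x + (- ((- 1ℚ) * z))) ≡ (- 1ℚ) * ((- i) * ((- g) * x - z))
    alg′ = solve-∀ ℚring

  τ-NN : ∀ l u → τ (NN l u) ≗ (sg (length l) ⊛ NN (map (λ { (a , b) → (- a , b) }) l) (τ u))
  τ-NN [] u s = sym (*-identityˡ (τ u s))
  τ-NN ((a , b) ∷ l) u s = τ-N a b (NN l u) s
    ∙ cong ((- 1ℚ) *_) (N-cong (- a) b (τ-NN l u) s ∙ N-⊛ (- a) b (sg (length l)) _ s)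
    ∙ alg (sg (length l)) (N (- a) b (NN (map (λ { (a , b) → (- a , b) }) l) (τ u)) s)
    where
    alg : ∀ g x → (- 1ℚ) * (g * x) ≡ (- g) * x
    alg = solve-∀ ℚring

  τ-dd : ∀ l u → All (_≢ 0ℚ) l → τ (dd l u) ≗ (sg (length l) ⊛ dd (map -_ l) (τ u))
  τ-dd [] u [] s = sym (*-identityˡ (τ u s))
  τ-dd (c ∷ l) u (nc ∷ nl) s = τ-den c (dd l u) nc s
    ∙ cong ((- 1ℚ) *_) (den-cong (- c) (τ-dd l u nl) s ∙ ⊛-den (sg (length l)) (- c) _ s)
    ∙ alg (sg (length l)) (den (- c) (dd (map -_ l) (τ u)) s)
    where
    alg : ∀ g x → (- 1ℚ) * (g * x) ≡ (- g) * x
    alg = solve-∀ ℚring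

  sg-+ : ∀ a b → sg (a ℕ.+ b) ≡ sg a * sg b
  sg-+ zero    b = sym (*-identityˡ (sg b))
  sg-+ (suc a) b = cong -_ (sg-+ a b) ∙ neg-distribˡ-* (sg a) (sg b)

  sg-even : ∀ a → sg (a ℕ.+ a) ≡ 1ℚ
  sg-even zero    = refl
  sg-even (suc a) = cong (λ z → - sg z) (ℕP.+-suc a a) ∙ alg (sg (a ℕ.+ a)) ∙ sg-even a
    where
    alg : ∀ x → - (- x) ≡ x
    alg = solve-∀ ℚring

  τ-mono0 : τ (mono 0) ≗ mono 0
  τ-mono0 zero    = refl
  τ-mono0 (suc s) = *-zeroʳ (sg (suc s))

  blk-↭ : ∀ k r → map (λ κ → ℤ.+ κ ℤ.- ℤ.+ k) (0 ∷ rng (r ℕ.+ k)) ↭ (ℤ.+ 0) ∷ Dk k r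
  blk-↭ k r = ↭-trans (↭-reflexive e₁) (↭-trans (PermP.++-comm (ℤ.+ 0 ℤ.- ℤ.+ k ∷ map f (map (k ℕ.+_) (rng r))) (map f (rng k)))
       (↭-trans (↭-reflexive (refl {x = map f (rng k) ++ ((ℤ.+ 0 ℤ.- ℤ.+ k) ∷ map f (map (k ℕ.+_) (rng r)))}))
       (↭-trans (PermP.shift (ℤ.+ 0 ℤ.- ℤ.+ k) (map f (rng k)) (map f (map (k ℕ.+_) (rng r))))
       (↭-trans (PermP.++⁺ʳ (map f (map (k ℕ.+_) (rng r))) (low k))
         (prep (ℤ.+ 0) (PermP.++⁺ˡ (dn k) (↭-reflexive e₂)))))))
    where
    f : ℕ → ℤ
    f κ = ℤ.+ κ ℤ.- ℤ.+ k
    e₁ : map f (0 ∷ rng (r ℕ.+ k)) ≡ ((ℤ.+ 0 ℤ.- ℤ.+ k) ∷ map f (map (k ℕ.+_) (rng r))) ++ map f (rng k)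
    e₁ = cong ((ℤ.+ 0 ℤ.- ℤ.+ k) ∷_) (cong (map f) (rng-+ k r) ∙ LP.map-++ f (map (k ℕ.+_) (rng r)) (rng k))
    e₂ : map f (map (k ℕ.+_) (rng r)) ≡ up r
    e₂ = sym (LP.map-∘ (rng r)) ∙ LP.map-cong (λ j → alg (ℤ.+ k) (ℤ.+ j)) (rng r)
      where
      alg : ∀ a b → (a ℤ.+ b) ℤ.- a ≡ b
      alg = ℤS.solve-∀
    dsc : ℕ → List ℕ
    dsc zero    = 0 ∷ []
    dsc (suc k) = suc k ∷ dsc k
    dsc-suc : ∀ k → dsc (suc k) ≡ map suc (dsc k) ++ 0 ∷ []
    dsc-suc zero    = refl
    dsc-suc (suc k) = cong (suc (suc k) ∷_) (dsc-suc k)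
    dsc-rng : ∀ k → dsc k ≡ rng k ++ 0 ∷ []
    dsc-rng zero    = refl
    dsc-rng (suc k) = cong (suc k ∷_) (dsc-rng k)
    low′ : ∀ k → map (λ κ → ℤ.+ κ ℤ.- ℤ.+ k) (dsc k) ↭ map (λ j → ℤ.- (ℤ.+ j)) (dsc k)
    low′ zero    = ↭-refl
    low′ (suc k) = ↭-trans (↭-reflexive (cong (map g) (dsc-suc k) ∙ LP.map-++ g (map suc (dsc k)) (0 ∷ []) ∙ cong (_++ g 0 ∷ []) (sym (LP.map-∘ (dsc k)) ∙ LP.map-cong (λ j → alg (ℤ.+ 1) (ℤ.+ j) (ℤ.+ k)) (dsc k))))
      (↭-trans (PermP.++-comm (map (λ κ → ℤ.+ κ ℤ.- ℤ.+ k) (dsc k)) (g 0 ∷ [])) (prep (g 0) (low′ k)))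
      where
      g : ℕ → ℤ
      g κ = ℤ.+ κ ℤ.- ℤ.+ (suc k)
      alg : ∀ o j k → (o ℤ.+ j) ℤ.- (o ℤ.+ k) ≡ j ℤ.- k
      alg = ℤS.solve-∀
    low : ∀ k → (ℤ.+ 0 ℤ.- ℤ.+ k) ∷ map (λ κ → ℤ.+ κ ℤ.- ℤ.+ k) (rng k) ↭ (ℤ.+ 0) ∷ dn k
    low k = ↭-trans (↭-sym (PermP.++-comm (map (λ κ → ℤ.+ κ ℤ.- ℤ.+ k) (rng k)) ((ℤ.+ 0 ℤ.- ℤ.+ k) ∷ [])))
      (↭-trans (↭-reflexive (sym (cong (map (λ κ → ℤ.+ κ ℤ.- ℤ.+ k)) (dsc-rng k) ∙ LP.map-++ (λ κ → ℤ.+ κ ℤ.- ℤ.+ k) (rng k) (0 ∷ []))))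
      (↭-trans (low′ k) (↭-trans (↭-reflexive (cong (map (λ j → ℤ.- (ℤ.+ j))) (dsc-rng k) ∙ LP.map-++ (λ j → ℤ.- (ℤ.+ j)) (rng k) (0 ∷ [])))
        (PermP.++-comm (dn k) ((ℤ.+ 0) ∷ [])))))

-- The rational function R and its coefficients

module RationalFunction where

  open Rationals
  open PowerSeries
  open PartialFractions
  open LocalExpansion
  open import Data.Nat as ℕ using (ℕ; zero; suc; _∸_)
  import Data.Nat.Properties as ℕP
  open import Data.Integer as ℤ using (ℤ)
  import Data.Integer.Properties as ℤP
  import Data.Integer.Tactic.RingSolver as ℤS
  open import Data.Rational
  open import Data.Rational.Properties
  open import Data.List using (List; []; _∷_; _++_; map; length; replicate)
  import Data.List.Properties as LP
  open import Data.List.Relation.Unary.All as All using (All; []; _∷_)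
  open import Data.List.Relation.Unary.All.Properties as AllP using ()
  open import Data.List.Relation.Binary.Permutation.Propositional using (_↭_; ↭-refl; ↭-sym; ↭-trans; ↭-reflexive)
  open import Data.List.Relation.Binary.Permutation.Propositional.Properties as PermP using ()
  open import Data.Product using (∃; _×_; _,_; proj₁; proj₂)
  open import Data.Empty using (⊥-elim)
  open import Relation.Nullary
  open import Relation.Binary.PropositionalEquality as Eq using (_≡_; _≢_; refl; sym; cong; cong₂; subst; _≗_)
  open import Tactic.RingSolver using (solve-∀)

  rng-All : ∀ {P : ℕ → Set} n → (∀ j → 0 ℕ.< j → j ℕ.≤ n → P j) → All P (rng n)
  rng-All zero    h = []
  rng-All (suc n) h = h (suc n) (ℕ.s≤s ℕ.z≤n) ℕP.≤-refl ∷ rng-All n (λ j p q → h j p (ℕP.m≤n⇒m≤1+n q))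

  Dk-nz : ∀ k r → All (_≢ ℤ.+ 0) (Dk k r)
  Dk-nz k r = AllP.++⁺ (AllP.map⁺ (rng-All k (λ { (suc j) _ _ () }))) (AllP.map⁺ (rng-All r (λ { (suc j) _ _ () })))

  fz : ℤ → ℚ × ℚ
  fz c = fac (ι c)

  -- R(t) = (2t+n) ∏_{j=1}^m (t-j)^b (t+n+j)^b / ∏_{κ=0}^n (t+κ)^A
  module RF (n m b a : ℕ) (enough : 2 ℕ.+ b ℕ.* (m ℕ.+ m) ℕ.≤ n ℕ.+ a ℕ.* suc n) where

    A : ℕ
    A = suc a

    left right : ℤ → List ℤ
    left  y = map (λ j → y ℤ.- ℤ.+ j) (rng m)
    right y = map (λ j → y ℤ.+ ℤ.+ (n ℕ.+ j)) (rng m)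

    nums : ℤ → List ℤ
    nums y = rep b (left y ++ right y)

    num₀ : ℤ → ℤ
    num₀ y = (y ℤ.+ y) ℤ.+ ℤ.+ n

    -- The expansion at t = y + ε, with the zero factors of the denominator left out; dens
    -- lists the remaining ones.
    loc : ℤ → List ℤ → Seq
    loc y dens = N (ι (num₀ y)) (ι (ℤ.+ 2)) (NN (map fz (nums y)) (dd (map ι dens) (mono 0)))

    -- All linear factors of the denominator except one factor t, which is the starting term 1/t of
    -- `build`.
    jsN : List ℕ
    jsN = rng n ++ rep a (0 ∷ rng n)

    -- The constant numerator 1 in front makes the outermost operation a pure division, on which the
    -- vanishing of the residue sum rests. Room for it comes from `enough`, which says that R decays
    -- at least like t^(-2).
    ns : List (ℚ × ℚ)
    ns = (0ℚ , 1ℚ) ∷ (ι (ℤ.+ 2) , ιℕ n) ∷ map (λ γ → (1ℚ , ι γ)) (nums (ℤ.+ 0))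

    ops : List Op
    ops = mkOps ns (map ιℕ jsN)

    r : List Term
    r = build (ιℕ 0) ops

    B : ℕ
    B = suc (suc (length ops))

    len-js : length (map ιℕ jsN) ≡ n ℕ.+ a ℕ.* suc n
    len-js = LP.length-map ιℕ jsN ∙ LP.length-++ (rng n) ∙ cong₂ ℕ._+_ (length-rng n) (length-rep a (0 ∷ rng n) ∙ cong (λ z → a ℕ.* suc z) (length-rng n))

    len-nums : ∀ y → length (nums y) ≡ b ℕ.* (m ℕ.+ m)
    len-nums y = length-rep b (left y ++ right y) ∙ cong (b ℕ.*_) (LP.length-++ (left y) ∙ cong₂ ℕ._+_ (LP.length-map _ (rng m) ∙ length-rng m) (LP.length-map _ (rng m) ∙ length-rng m))

    len-ok : length ns ℕ.≤ length (map ιℕ jsN)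
    len-ok = subst (length ns ℕ.≤_) (sym len-js) (subst (λ z → suc (suc z) ℕ.≤ _) (sym (LP.length-map _ (nums (ℤ.+ 0)) ∙ len-nums (ℤ.+ 0))) enough)

    A≤B : A ℕ.≤ B
    A≤B = ℕ.s≤s (ℕP.≤-trans (ℕP.m≤m*n a (suc n)) (ℕP.≤-trans (ℕP.m≤n+m (a ℕ.* suc n) n) (ℕP.≤-trans (ℕP.≤-reflexive (sym (mkOps-length ns (map ιℕ jsN) ∙ len-js))) (ℕP.n≤1+n _))))

    nums-shift : ∀ y → nums y ≡ map (ℤ._+ y) (nums (ℤ.+ 0))
    nums-shift y = sym (map-rep (ℤ._+ y) b _ ∙ cong (rep b) (LP.map-++ (ℤ._+ y) (left (ℤ.+ 0)) (right (ℤ.+ 0)) ∙ cong₂ _++_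
        (sym (LP.map-∘ (rng m)) ∙ LP.map-cong (λ j → l₁ (ℤ.+ j) y) (rng m)) (sym (LP.map-∘ (rng m)) ∙ LP.map-cong (λ j → l₂ (ℤ.+ (n ℕ.+ j)) y) (rng m))))
      where
      l₁ : ∀ j y → (ℤ.+ 0 ℤ.- j) ℤ.+ y ≡ y ℤ.- j
      l₁ = ℤS.solve-∀
      l₂ : ∀ j y → (ℤ.+ 0 ℤ.+ j) ℤ.+ y ≡ y ℤ.+ j
      l₂ = ℤS.solve-∀

    nums-at : ∀ y u → NN (map (at (ι (ℤ.- y))) ns) u ≗ N (ι (num₀ y)) (ι (ℤ.+ 2)) (NN (map fz (nums y)) u)
    nums-at y u s = N-one x _ s ∙ cong (λ z → N z (ι (ℤ.+ 2)) (NN (map (at x) (map (λ γ → (1ℚ , ι γ)) (nums (ℤ.+ 0)))) u) s) e₁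
         ∙ cong (λ l → N (ι (num₀ y)) (ι (ℤ.+ 2)) (NN l u) s) e₂
      where
      x = ι (ℤ.- y)
      e₁ : ιℕ n - ι (ℤ.+ 2) * x ≡ ι (num₀ y)
      e₁ = cong (λ z → ιℕ n - z) (sym (ι-* (ℤ.+ 2) (ℤ.- y))) ∙ cong (ιℕ n +_) (sym (ι-neg (ℤ.+ 2 ℤ.* (ℤ.- y)))) ∙ sym (ι-+ (ℤ.+ n) (ℤ.- (ℤ.+ 2 ℤ.* (ℤ.- y)))) ∙ cong ι (alg (ℤ.+ n) y)
        where
        alg : ∀ n y → n ℤ.+ (ℤ.- (ℤ.+ 2 ℤ.* (ℤ.- y))) ≡ (y ℤ.+ y) ℤ.+ n
        alg = ℤS.solve-∀
      e₂ : map (at x) (map (λ γ → (1ℚ , ι γ)) (nums (ℤ.+ 0))) ≡ map fz (nums y)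
      e₂ = sym (LP.map-∘ (nums (ℤ.+ 0))) ∙ LP.map-cong one (nums (ℤ.+ 0)) ∙ LP.map-∘ (nums (ℤ.+ 0)) ∙ cong (map fz) (sym (nums-shift y))
        where
        one : ∀ γ → at x (1ℚ , ι γ) ≡ fz (γ ℤ.+ y)
        one γ = cong (_, 1ℚ) (cong (λ z → ι γ - z) (*-identityˡ x ∙ ι-neg y) ∙ alg (ι γ) (ι y) ∙ sym (ι-+ γ y))
          where
          alg : ∀ g y → g - (- y) ≡ g + y
          alg = solve-∀ ℚring

    dens-at : ∀ y → densAt (ι (ℤ.- y)) (ιℕ 0) ops ↭ map ι (rep A (map (λ κ → ℤ.+ κ ℤ.+ y) (0 ∷ rng n)))
    dens-at y = ↭-trans (↭-reflexive (mkOps-dens x (ιℕ 0) ns (map ιℕ jsN)))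
       (↭-trans (PermP.++-comm (map (_- x) (map ιℕ jsN)) ((ιℕ 0 - x) ∷ []))
       (↭-reflexive (cong (map (_- x)) {map ιℕ (0 ∷ jsN)} refl ∙ sym (LP.map-∘ (0 ∷ jsN)) ∙ LP.map-cong one (0 ∷ jsN) ∙ LP.map-∘ (0 ∷ jsN) ∙ cong (map ι) (map-rep (λ κ → ℤ.+ κ ℤ.+ y) A (0 ∷ rng n)))))
      where
      x = ι (ℤ.- y)
      one : ∀ κ → ιℕ κ - x ≡ ι (ℤ.+ κ ℤ.+ y)
      one κ = cong (λ z → ιℕ κ - z) (ι-neg y) ∙ alg (ιℕ κ) (ι y) ∙ sym (ι-+ (ℤ.+ κ) y)
        where
        alg : ∀ g y → g - (- y) ≡ g + y
        alg = solve-∀ ℚring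

    NN-zeros : ∀ c p → NN (map fac (replicate c 0ℚ)) (mono p) ≗ mono (c ℕ.+ p)
    NN-zeros zero    p s = refl
    NN-zeros (suc c) p s = N-cong 0ℚ 1ℚ (NN-zeros c p) s ∙ N-mono (c ℕ.+ p) s

    -- c zero factors among the denominators, the remaining ones being dens
    module At (y : ℤ) (c : ℕ) (dens : List ℤ) (c≤B : c ℕ.≤ B) (nz : All (_≢ ℤ.+ 0) dens)
              (perm : map ι (rep A (map (λ κ → ℤ.+ κ ℤ.+ y) (0 ∷ rng n))) ↭ replicate c 0ℚ ++ map ι dens) where
      x : ℚ
      x = ι (ℤ.- y)
      u : Seq
      u = N (ι (num₀ y)) (ι (ℤ.+ 2)) (NN (map fz (nums y)) (dd (map ι dens) (mono (B ∸ c))))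

      nzQ : All (_≢ 0ℚ) (map ι dens)
      nzQ = AllP.map⁺ (All.map (λ ne → ι≢0 ne) nz)

      -- Clearing denominators in `u`: the c zero factors supply ε^c, the remaining ones cancel
      -- `dd`, and the numerator times ε^B is left.
      E≗u : Expansion.E x B r ≗ u
      E≗u = E-unique x B (ιℕ 0) ops u ℕP.≤-refl λ s →
          NN-↭ (PermP.map⁺ fac (↭-trans (dens-at y) perm)) u s
        ∙ cong (λ l → NN l u s) (LP.map-++ fac (replicate c 0ℚ) (map ι dens))
        ∙ NN-++ (map fac (replicate c 0ℚ)) (map fac (map ι dens)) u s
        ∙ NN-cong (map fac (replicate c 0ℚ)) (λ s′ → NN-NN (map fac (map ι dens)) all (dd (map ι dens) (mono (B ∸ c))) s′ ∙ NN-cong all (NN-dd (map ι dens) nzQ (mono (B ∸ c))) s′) s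
        ∙ NN-NN (map fac (replicate c 0ℚ)) all (mono (B ∸ c)) s
        ∙ NN-cong all (λ s′ → NN-zeros c (B ∸ c) s′ ∙ cong (λ z → mono z s′) (ℕP.m+[n∸m]≡n c≤B)) s
        ∙ sym (nums-at y (mono B) s)
        ∙ sym (mkOps-nums x ns (map ιℕ jsN) len-ok (mono B) s)
        where
        all = (ι (num₀ y) , ι (ℤ.+ 2)) ∷ map fz (nums y)

      u-shift : Shift (B ∸ c) (loc y dens) u
      u-shift = Shift-N _ _ _ (Shift-NN _ (map fz (nums y)) (Shift-dd _ (map ι dens) (Shift-mono (B ∸ c))))

    c_ : ℕ → ℕ → ℚ
    c_ k i = cf (ιℕ k) i r

    ordB : Ord′ B r
    ordB = All.map (λ l → ℕP.≤-trans l (ℕP.n≤1+n _)) (Ord-build (ιℕ 0) ops)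

    module Pole (k rr : ℕ) (n≡ : n ≡ rr ℕ.+ k) where
      perm : map ι (rep A (map (λ κ → ℤ.+ κ ℤ.+ ℤ.- (ℤ.+ k)) (0 ∷ rng n))) ↭ replicate A 0ℚ ++ map ι (rep A (Dk k rr))
      perm = ↭-trans (PermP.map⁺ ι (↭-trans (rep-↭ A (↭-trans (↭-reflexive (cong (λ z → map (λ κ → ℤ.+ κ ℤ.+ ℤ.- (ℤ.+ k)) (0 ∷ rng z)) n≡)) (blk-↭ k rr))) (rep-cons A (ℤ.+ 0) (Dk k rr))))
          (↭-reflexive (LP.map-++ ι (replicate A (ℤ.+ 0)) (rep A (Dk k rr)) ∙ cong (_++ map ι (rep A (Dk k rr))) (LP.map-replicate ι A (ℤ.+ 0) ∙ cong (replicate A) ι0)))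
      open At (ℤ.- (ℤ.+ k)) A (rep A (Dk k rr)) A≤B (All-rep A (Dk-nz k rr)) perm public

      U : Seq
      U = loc (ℤ.- (ℤ.+ k)) (rep A (Dk k rr))

      x≡ : x ≡ ιℕ k
      x≡ = cong ι (ℤP.neg-involutive (ℤ.+ k))

      E-c : ∀ i → suc i ℕ.≤ B → u (B ∸ suc i) ≡ c_ k i
      E-c i l = sym (E≗u (B ∸ suc i)) ∙ cong (λ z → Expansion.E z B r (B ∸ suc i)) x≡ ∙ E-polar B (ιℕ k) i r l ordB

      c≡U : ∀ i → i ℕ.< A → c_ k i ≡ U (A ∸ suc i)
      c≡U i l = sym (E-c i (ℕP.≤-trans l A≤B)) ∙ cong u idx ∙ proj₂ u-shift (A ∸ suc i)
        where
        idx : B ∸ suc i ≡ (B ∸ A) ℕ.+ (A ∸ suc i)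
        idx = cong (_∸ suc i) (sym (ℕP.m∸n+n≡m A≤B)) ∙ ℕP.+-∸-assoc (B ∸ A) l

      c≡0 : ∀ i → A ℕ.≤ i → i ℕ.< B → c_ k i ≡ 0ℚ
      c≡0 i l l′ = sym (E-c i l′) ∙ proj₁ u-shift _ (ℕP.∸-monoʳ-< (ℕ.s≤s l) l′)

    poles : PolesIn B (suc n) r
    poles = Poles-build B (ιℕ 0) ops (0 , ℕ.s≤s ℕ.z≤n , refl) (mkOps-All ns (map ιℕ jsN) (AllP.map⁺ (AllP.++⁺ rr (All-rep a ((0 , ℕ.s≤s ℕ.z≤n , refl) ∷ rr)))))
      where
      rr : All (λ κ → ∃ λ κ′ → κ′ ℕ.< suc n × ιℕ κ ≡ ιℕ κ′) (rng n)
      rr = rng-All n (λ j _ l → j , ℕ.s≤s l , refl)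

    -- The list of terms is only known to have orders up to B. Beyond A the coefficients vanish,
    -- since the local factorisation shows a pole of order at most A.
    trunc : ∀ φ → tsum B φ r ≡ Σ (suc n) (λ κ → Σ A (λ i → c_ κ i * φ (ιℕ κ) i))
    trunc φ = regroup B φ (suc n) B r poles ordB ∙ Σ-cong (suc n) (λ κ l → cut κ (ℕP.≤-pred l) B A≤B ℕP.≤-refl)
      where
      cut : ∀ κ → κ ℕ.≤ n → ∀ I → A ℕ.≤ I → I ℕ.≤ B → Σ I (λ i → c_ κ i * φ (ιℕ κ) i) ≡ Σ A (λ i → c_ κ i * φ (ιℕ κ) i)
      cut κ l I A≤I I≤B with A ℕ.≟ I
      ... | yes refl = refl
      cut κ l zero    () I≤B | no ne
      cut κ l (suc I) A≤I I≤B | no ne =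
          cong₂ _+_ (cut κ l I A≤I′ (ℕP.≤-trans (ℕP.n≤1+n I) I≤B)) (cong (_* φ (ιℕ κ) I) (Pole.c≡0 κ (n ∸ κ) (sym (ℕP.m∸n+n≡m l)) I A≤I′ I≤B) ∙ *-zeroˡ (φ (ιℕ κ) I)) ∙ +-identityʳ _
        where
        A≤I′ : A ℕ.≤ I
        A≤I′ = ℕP.≤-pred (ℕP.≤∧≢⇒< A≤I ne)

    -- the expansion at the regular point t = ν
    V : ℕ → Seq
    V ν = loc (ℤ.+ ν) (rep A (map (λ κ → ℤ.+ κ ℤ.+ ℤ.+ ν) (0 ∷ rng n)))

    regular : ∀ ν s → 0 ℕ.< ν → V ν s ≡ Σ (suc n) (λ κ → Σ A (λ i → c_ κ i * dpow (ιℕ (κ ℕ.+ ν)) (suc i) s))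
    regular ν@(suc ν′) s l = sym (proj₂ u-shift s) ∙ sym (E≗u (B ℕ.+ s)) ∙ E-regular B x s r (All.map (λ {t} → ne {t}) poles) ∙ trunc (λ k i → dpow (k - x) (suc i) s)
        ∙ Σ-cong (suc n) (λ κ _ → Σ-cong A (λ i _ → cong (λ z → c_ κ i * dpow z (suc i) s) (sub κ)))
      where
      nzd : All (_≢ ℤ.+ 0) (rep A (map (λ κ → ℤ.+ κ ℤ.+ ℤ.+ ν) (0 ∷ rng n)))
      nzd = All-rep A ((λ ()) ∷ AllP.map⁺ (rng-All n (λ j _ _ e → ℕP.1+n≢0 (ℤP.+-injective (Eq.trans (cong ℤ.+_ (sym (ℕP.+-suc j ν′))) e)))))
      open At (ℤ.+ ν) 0 (rep A (map (λ κ → ℤ.+ κ ℤ.+ ℤ.+ ν) (0 ∷ rng n))) ℕ.z≤n nzd ↭-refl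
      ne : ∀ {t : Term} → (∃ λ κ → κ ℕ.< suc n × proj₁ (proj₂ t) ≡ ιℕ κ) → proj₁ (proj₂ t) ≢ x
      ne (κ , _ , e) e′ with ι-inj {ℤ.+ κ} {ℤ.- (ℤ.+ ν)} (sym e ∙ e′)
      ... | ()
      sub : ∀ κ → ιℕ κ - x ≡ ιℕ (κ ℕ.+ ν)
      sub κ = cong (λ z → ιℕ κ - z) (ι-neg (ℤ.+ ν)) ∙ alg (ιℕ κ) (ιℕ ν) ∙ sym (ιℕ-+ κ ν)
        where
        alg : ∀ g y → g - (- y) ≡ g + y
        alg = solve-∀ ℚring

    -- Removes ζ(b), the value that belongs to the simple poles.
    res≡0 : jsN ≢ [] → Σ (suc n) (λ κ → c_ κ 0) ≡ 0ℚ
    res≡0 ne = Σ-cong (suc n) (λ κ _ → sym (Σ-single A 0 _ (ℕ.s≤s ℕ.z≤n) (λ { zero _ h → ⊥-elim (h refl) ; (suc i) _ _ → *-zeroʳ (c_ κ (suc i)) }) ∙ *-identityʳ (c_ κ 0)))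
       ∙ sym (trunc (ind0 B)) ∙ go jsN ne
      where
      go : ∀ js → js ≢ [] → tsum B (ind0 B) (build (ιℕ 0) (mkOps ns (map ιℕ js))) ≡ 0ℚ
      go []       ne = ⊥-elim (ne refl)
      go (j ∷ js) ne = res-act B 1ℚ (ιℕ j) (build (ιℕ 0) (mkOps ((ι (ℤ.+ 2) , ιℕ n) ∷ map (λ γ → (1ℚ , ι γ)) (nums (ℤ.+ 0))) (map ιℕ js)))

    module Symmetric (h : ℕ) (A-even : A ≡ h ℕ.+ h) where
      -- The local form of R(-n-t) = -R(t). The factor 2t + n changes sign, the factors t - j and t
      -- + n + j are exchanged with an even number of signs, and A even makes the denominator
      -- contribute none.
      U-sym : ∀ k rr (e : n ≡ rr ℕ.+ k) (e′ : n ≡ k ℕ.+ rr) s → Pole.U rr k e′ s ≡ - (sg s * Pole.U k rr e s)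
      U-sym k rr e e′ s = sym (cong (-_) (τ-N (ι (num₀ y)) (ι (ℤ.+ 2)) W s)
          ∙ cong (λ z → - ((- 1ℚ) * z)) (cong (λ z → N z (ι (ℤ.+ 2)) (τ W) s) e₀ ∙ N-cong (ι (num₀ y′)) (ι (ℤ.+ 2)) τW s)
          ∙ alg (Pole.U rr k e′ s))
        where
        y y′ : ℤ
        y = ℤ.- (ℤ.+ k)
        y′ = ℤ.- (ℤ.+ rr)
        W : Seq
        W = NN (map fz (nums y)) (dd (map ι (rep A (Dk k rr))) (mono 0))
        alg : ∀ z → - ((- 1ℚ) * z) ≡ z
        alg = solve-∀ ℚring
        e₀ : - ι (num₀ y) ≡ ι (num₀ y′)
        e₀ = sym (ι-neg (num₀ y)) ∙ cong ι (cong (λ z → ℤ.- ((y ℤ.+ y) ℤ.+ ℤ.+ z)) e ∙ a₁ (ℤ.+ rr) (ℤ.+ k) ∙ cong (λ z → (y′ ℤ.+ y′) ℤ.+ ℤ.+ z) (sym e))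
          where
          a₁ : ∀ r k → ℤ.- ((ℤ.- k ℤ.+ ℤ.- k) ℤ.+ (r ℤ.+ k)) ≡ (ℤ.- r ℤ.+ ℤ.- r) ℤ.+ (r ℤ.+ k)
          a₁ = ℤS.solve-∀
        negpair : ℚ × ℚ → ℚ × ℚ
        negpair = λ { (a , b) → (- a , b) }
        neg-nums : map negpair (map fz (nums y)) ↭ map fz (nums y′)
        neg-nums = ↭-trans (↭-reflexive (sym (LP.map-∘ (nums y)) ∙ LP.map-cong (λ c → cong (_, 1ℚ) (sym (ι-neg c))) (nums y) ∙ LP.map-∘ (nums y)))
          (PermP.map⁺ fz (↭-trans (↭-reflexive (map-rep ℤ.-_ b (left y ++ right y))) (rep-↭ b
            (↭-trans (↭-reflexive (LP.map-++ ℤ.-_ (left y) (right y) ∙ cong₂ _++_ le re)) (PermP.++-comm (right y′) (left y′))))))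
          where
          le : map ℤ.-_ (left y) ≡ right y′
          le = sym (LP.map-∘ (rng m)) ∙ LP.map-cong (λ j → a₁ (ℤ.+ k) (ℤ.+ j) (ℤ.+ rr) ∙ cong (λ z → y′ ℤ.+ ℤ.+ (z ℕ.+ j)) (sym e)) (rng m)
            where
            a₁ : ∀ k j r → ℤ.- (ℤ.- k ℤ.- j) ≡ ℤ.- r ℤ.+ ((r ℤ.+ k) ℤ.+ j)
            a₁ = ℤS.solve-∀
          re : map ℤ.-_ (right y) ≡ left y′
          re = sym (LP.map-∘ (rng m)) ∙ LP.map-cong (λ j → cong (λ z → ℤ.- (y ℤ.+ ℤ.+ (z ℕ.+ j))) e ∙ a₁ (ℤ.+ k) (ℤ.+ j) (ℤ.+ rr)) (rng m)
            where
            a₁ : ∀ k j r → ℤ.- (ℤ.- k ℤ.+ ((r ℤ.+ k) ℤ.+ j)) ≡ ℤ.- r ℤ.- j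
            a₁ = ℤS.solve-∀
        neg-dens : map -_ (map ι (rep A (Dk k rr))) ↭ map ι (rep A (Dk rr k))
        neg-dens = ↭-trans (↭-reflexive (sym (LP.map-∘ (rep A (Dk k rr))) ∙ LP.map-cong (λ c → sym (ι-neg c)) (rep A (Dk k rr)) ∙ LP.map-∘ (rep A (Dk k rr))))
          (PermP.map⁺ ι (↭-trans (↭-reflexive (map-rep ℤ.-_ A (Dk k rr))) (rep-↭ A
            (↭-trans (↭-reflexive (LP.map-++ ℤ.-_ (dn k) (up rr) ∙ cong₂ _++_ (sym (LP.map-∘ (rng k)) ∙ LP.map-cong (λ j → ℤP.neg-involutive (ℤ.+ j)) (rng k)) (sym (LP.map-∘ (rng rr))))) (PermP.++-comm (up k) (dn rr))))))
        nzA : ∀ p q → All (_≢ 0ℚ) (map ι (rep A (Dk p q)))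
        nzA p q = AllP.map⁺ (All.map (λ ne → ι≢0 ne) (All-rep A (Dk-nz p q)))
        sgn : sg (length (map fz (nums y))) ≡ 1ℚ
        sgn = cong sg (LP.length-map fz (nums y) ∙ len-nums y ∙ ℕP.*-distribˡ-+ b m m) ∙ sg-even (b ℕ.* m)
        sgd : sg (length (map ι (rep A (Dk k rr)))) ≡ 1ℚ
        sgd = cong sg (LP.length-map ι (rep A (Dk k rr)) ∙ length-rep A (Dk k rr) ∙ cong (ℕ._* length (Dk k rr)) A-even ∙ ℕP.*-distribʳ-+ (length (Dk k rr)) h h) ∙ sg-even (h ℕ.* length (Dk k rr))
        W′ : Seq
        W′ = dd (map ι (rep A (Dk k rr))) (mono 0)
        τW′ : τ W′ ≗ dd (map ι (rep A (Dk rr k))) (mono 0)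
        τW′ s = τ-dd (map ι (rep A (Dk k rr))) (mono 0) (nzA k rr) s ∙ cong (_* dd (map -_ (map ι (rep A (Dk k rr)))) (τ (mono 0)) s) sgd ∙ *-identityˡ _
          ∙ dd-cong (map -_ (map ι (rep A (Dk k rr)))) τ-mono0 s ∙ dd-↭ (PermP.All-resp-↭ (↭-sym neg-dens) (nzA rr k)) neg-dens (mono 0) s
        τW : τ W ≗ NN (map fz (nums y′)) (dd (map ι (rep A (Dk rr k))) (mono 0))
        τW s = τ-NN (map fz (nums y)) W′ s ∙ cong (_* NN (map negpair (map fz (nums y))) (τ W′) s) sgn ∙ *-identityˡ _
          ∙ NN-↭ neg-nums (τ W′) s ∙ NN-cong (map fz (nums y′)) τW′ s

      private
        sgA : ∀ i j → A ≡ suc i ℕ.+ j → - sg j ≡ sg i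
        sgA i j e = alg₂ (sg i) (sg j) (sg-sq j) (sym (alg (sg i) (sg j)) ∙ cong -_ (sym (sg-+ i j)) ∙ cong sg (sym e ∙ A-even) ∙ sg-even h)
          where
          sg-sq : ∀ j → sg j * sg j ≡ 1ℚ
          sg-sq j = sym (sg-+ j j) ∙ sg-even j
          alg : ∀ a b → - (a * b) ≡ a * (- b)
          alg = solve-∀ ℚring
          alg₂ : ∀ a b → b * b ≡ 1ℚ → a * (- b) ≡ 1ℚ → - b ≡ a
          alg₂ a b e₁ e₂ = sym (sym (h₂ a b ∙ cong (a *_) e₁ ∙ *-identityʳ a) ∙ cong₂ _*_ e₂ refl ∙ *-identityˡ (- b))
            where
            h₂ : ∀ a b → (a * (- b)) * (- b) ≡ a * (b * b)
            h₂ = solve-∀ ℚring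

      c-sym : ∀ k i → k ℕ.≤ n → i ℕ.< A → c_ (n ∸ k) i ≡ sg i * c_ k i
      c-sym k i l i<A = Pole.c≡U (n ∸ k) k e′ i i<A ∙ U-sym k (n ∸ k) e e′ (A ∸ suc i)
           ∙ alg (sg (A ∸ suc i)) (Pole.U k (n ∸ k) e (A ∸ suc i)) ∙ cong₂ _*_ (sgA i (A ∸ suc i) (sym (ℕP.m+[n∸m]≡n i<A))) (sym (Pole.c≡U k (n ∸ k) e i i<A))
        where
        e : n ≡ n ∸ k ℕ.+ k
        e = sym (ℕP.m∸n+n≡m l)
        e′ : n ≡ k ℕ.+ (n ∸ k)
        e′ = sym (ℕP.m+[n∸m]≡n l)
        alg : ∀ a b → - (a * b) ≡ (- a) * b
        alg = solve-∀ ℚring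

      -- The reflection of κ into n - κ turns the sum into its negative. For odd b, odd i belongs to
      -- the even arguments i + b.
      ρ≡0 : ∀ i → i ℕ.< A → sg i ≡ - 1ℚ → Σ (suc n) (λ κ → c_ κ i) ≡ 0ℚ
      ρ≡0 i i<A e = half (Σ (suc n) (λ κ → c_ κ i)) (Σ-rev n (λ κ → c_ κ i) ∙ Σ-cong (suc n) (λ κ l → c-sym κ i (ℕP.≤-pred l) i<A ∙ cong (_* c_ κ i) e) ∙ Σ-* (suc n) (- 1ℚ) (λ κ → c_ κ i))
        where
        half : ∀ x → x ≡ (- 1ℚ) * x → x ≡ 0ℚ
        half x e = *-cancelˡ {ι (ℤ.+ 2)} {x} {0ℚ} (ι≢0 {ℤ.+ 2} λ ()) (alg x ∙ cong (x +_) e ∙ alg′ x ∙ sym (*-zeroʳ (ι (ℤ.+ 2))))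
          where
          alg : ∀ x → ι (ℤ.+ 2) * x ≡ x + x
          alg x = cong (_* x) (ι-+ (ℤ.+ 1) (ℤ.+ 1) ∙ cong₂ _+_ ι1 ι1) ∙ *-distribʳ-+ x 1ℚ 1ℚ ∙ cong₂ _+_ (*-identityˡ x) (*-identityˡ x)
          alg′ : ∀ x → x + (- 1ℚ) * x ≡ 0ℚ
          alg′ = solve-∀ ℚring

-- Integrality from pointwise exponent counts

module IntegerValues where

  open Mangoldt
  open Rationals
  open PowerSeries
  open PartialFractions
  open LocalExpansion
  open RationalFunction using (fz)
  open import Data.Nat as ℕ using (ℕ; zero; suc; _∸_)
  import Data.Nat.Properties as ℕP
  open import Data.Nat.DivMod using (m<n⇒m/n≡0; m/n*n≤m; m≡m%n+[m/n]*n; m%n<n; m<n*o⇒m/o<n; /-monoˡ-≤; m*n/n≡m)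
  open import Data.Nat.Divisibility using (_∣?_; >⇒∤)
  import Data.Nat.Tactic.RingSolver as ℕS
  open import Data.Integer as ℤ using (ℤ; -[1+_])
  import Data.Integer.Properties as ℤP
  open import Data.Rational hiding (_/_; _⊔_)
  open import Data.Rational.Properties
  open import Data.List using (List; []; _∷_; _++_; map)
  open import Data.List.Relation.Unary.All as All using (All; []; _∷_)
  open import Data.Product using (∃; _×_; _,_; proj₁; proj₂)
  open import Data.Empty using (⊥-elim)
  open import Relation.Nullary
  open import Relation.Binary.PropositionalEquality using (_≡_; _≢_; refl; sym; cong; cong₂; subst)
  open import Tactic.RingSolver using (solve-∀)

  IsInt : ℚ → Set
  IsInt q = ∃ λ z → q ≡ ι z

  int-+ : ∀ {x y} → IsInt x → IsInt y → IsInt (x + y)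
  int-+ (a , refl) (b , refl) = a ℤ.+ b , sym (ι-+ a b)

  int-* : ∀ {x y} → IsInt x → IsInt y → IsInt (x * y)
  int-* (a , refl) (b , refl) = a ℤ.* b , sym (ι-* a b)

  int-neg : ∀ {x} → IsInt x → IsInt (- x)
  int-neg (a , refl) = ℤ.- a , sym (ι-neg a)

  int-ι : ∀ z → IsInt (ι z)
  int-ι z = z , refl

  int-≡ : ∀ {x y} → x ≡ y → IsInt x → IsInt y
  int-≡ refl h = h

  int-0 : IsInt 0ℚ
  int-0 = ℤ.+ 0 , sym ι0

  int-1 : IsInt 1ℚ
  int-1 = ℤ.+ 1 , sym ι1

  int-Σ : ∀ n {f} → (∀ i → i ℕ.< n → IsInt (f i)) → IsInt (Σ n f)
  int-Σ zero    h = int-0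
  int-Σ (suc n) h = int-+ (int-Σ n (λ i l → h i (ℕP.m<n⇒m<1+n l))) (h n ℕP.≤-refl)

  le∸ : ∀ m {n o} → m ℕ.+ n ℕ.≤ o → n ℕ.≤ o ∸ m
  le∸ m {n} {o} l = ℕP.m+n≤o⇒m≤o∸n n (subst (ℕ._≤ o) (ℕP.+-comm m n) l)

  cnt : ℕ → List ℤ → ℕ
  cnt w []      = 0
  cnt w (c ∷ l) = dv w ℤ.∣ c ∣ ℕ.+ cnt w l

  cnt-++ : ∀ w l l′ → cnt w (l ++ l′) ≡ cnt w l ℕ.+ cnt w l′
  cnt-++ w []      l′ = refl
  cnt-++ w (c ∷ l) l′ = cong (dv w ℤ.∣ c ∣ ℕ.+_) (cnt-++ w l l′) ∙ sym (ℕP.+-assoc (dv w ℤ.∣ c ∣) (cnt w l) (cnt w l′))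

  cnt-rep : ∀ w b l → cnt w (rep b l) ≡ b ℕ.* cnt w l
  cnt-rep w zero    l = refl
  cnt-rep w (suc b) l = cnt-++ w l (rep b l) ∙ cong (cnt w l ℕ.+_) (cnt-rep w b l)

  -- Additional inverses, later the powers j^(-i-b) occurring in partial zeta sums.
  hinv : List ℤ → ℚ
  hinv []      = 1ℚ
  hinv (h ∷ l) = inv (ι h) * hinv l

  unit-sign : ∀ c → c ≢ ℤ.+ 0 → IsInt (ιℕ ℤ.∣ c ∣ * inv (ι c))
  unit-sign (ℤ.+ zero)  ne = ⊥-elim (ne refl)
  unit-sign (ℤ.+ suc c) ne = int-≡ (sym (inv-r (ι≢0 {ℤ.+ suc c} λ ()))) int-1
  unit-sign -[1+ c ]    ne = int-≡ (sym (alg (ιℕ (suc c)) ∙ cong (λ z → - (z * inv z′)) (sym (ι-neg (ℤ.+ suc c))) ∙ cong -_ (inv-r (ι≢0 { -[1+ c ]} λ ())))) (int-neg int-1)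
    where
    z′ = ι -[1+ c ]
    alg : ∀ x → x * inv z′ ≡ - ((- x) * inv z′)
    alg x = h x (inv z′)
      where
      h : ∀ x y → x * y ≡ - ((- x) * y)
      h = solve-∀ ℚring

  unit-sign′ : ∀ c → ∃ λ z → ι c ≡ ιℕ ℤ.∣ c ∣ * ι z
  unit-sign′ (ℤ.+ c)  = ℤ.+ 1 , sym (cong (ιℕ c *_) ι1 ∙ *-identityʳ (ιℕ c))
  unit-sign′ -[1+ c ] = -[1+ 0 ] , sym (sym (ι-* (ℤ.+ suc c) -[1+ 0 ]) ∙ cong ι (ℤP.*-comm (ℤ.+ suc c) -[1+ 0 ] ∙ ℤP.-1*i≡-i (ℤ.+ suc c)))

  dv-big : ∀ w c → 0 ℕ.< c → c ℕ.≤ w → dv w c ≡ 0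
  dv-big w (suc c) l le = ind-no (suc w ∣? suc c) (>⇒∤ (ℕ.s≤s le))

  module Integrality (n B : ℕ) where

    -- Denominators will be `Small` and numerators `Fits`: the stronger bound confines the exponent
    -- conditions to positions below n, while numerator factors may be larger.
    Small : ℤ → Set
    Small c = c ≢ ℤ.+ 0 × ℤ.∣ c ∣ ℕ.≤ n

    Fits : ℤ → Set
    Fits c = c ≢ ℤ.+ 0 × ℤ.∣ c ∣ ℕ.≤ B

    abs>0 : ∀ {c} → c ≢ ℤ.+ 0 → 0 ℕ.< ℤ.∣ c ∣
    abs>0 {ℤ.+ zero}  ne = ⊥-elim (ne refl)
    abs>0 {ℤ.+ suc c} ne = ℕ.s≤s ℕ.z≤n
    abs>0 { -[1+ c ]} ne = ℕ.s≤s ℕ.z≤n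

    -- Positions from n on are automatic, because a nonzero integer of absolute value at most n has
    -- no divisor beyond n.
    extract : n ℕ.≤ B → ∀ e c → Small c → (∀ w → w ℕ.< n → dv w ℤ.∣ c ∣ ℕ.≤ e w) → ⟦ e ⟧ B ≡ ⟦ (λ w → e w ∸ dv w ℤ.∣ c ∣) ⟧ B ℕ.* ℤ.∣ c ∣
    extract nB e c (nc , sc) h = ⟦⟧-cong B (λ w _ → sym (ℕP.m∸n+n≡m (le w))) ∙ ⟦⟧-+ (λ w → e w ∸ dv w ℤ.∣ c ∣) (λ w → dv w ℤ.∣ c ∣) B ∙ cong (⟦ (λ w → e w ∸ dv w ℤ.∣ c ∣) ⟧ B ℕ.*_) (⟦dv⟧ B ℤ.∣ c ∣ (abs>0 nc) (ℕP.≤-trans sc nB))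
      where
      le : ∀ w → dv w ℤ.∣ c ∣ ℕ.≤ e w
      le w with w ℕ.<? n
      ... | yes l = h w l
      ... | no ¬l = subst (ℕ._≤ e w) (sym (dv-big w ℤ.∣ c ∣ (abs>0 nc) (ℕP.≤-trans sc (ℕP.≮⇒≥ ¬l)))) ℕ.z≤n

    module _ (nB : n ℕ.≤ B) where
      int-inv : ∀ e c X → Small c → (∀ w → w ℕ.< n → dv w ℤ.∣ c ∣ ℕ.≤ e w) → IsInt (ιℕ (⟦ (λ w → e w ∸ dv w ℤ.∣ c ∣) ⟧ B) * X) → IsInt (ιℕ (⟦ e ⟧ B) * (inv (ι c) * X))
      int-inv e c X sc h hX = int-≡ (sym (cong (_* (inv (ι c) * X)) (cong ιℕ (extract nB e c sc h) ∙ ιℕ-* M′ ℤ.∣ c ∣) ∙ alg (ιℕ M′) (ιℕ ℤ.∣ c ∣) (inv (ι c)) X)) (int-* (unit-sign c (proj₁ sc)) hX)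
        where
        M′ = ⟦ (λ w → e w ∸ dv w ℤ.∣ c ∣) ⟧ B
        alg : ∀ M a i X → (M * a) * (i * X) ≡ (a * i) * (M * X)
        alg = solve-∀ ℚring

      int-hinv : ∀ H e → All Small H → (∀ w → w ℕ.< n → cnt w H ℕ.≤ e w) → IsInt (ιℕ (⟦ e ⟧ B) * hinv H)
      int-hinv [] e [] h = int-≡ (sym (*-identityʳ (ιℕ (⟦ e ⟧ B)))) (int-ι (ℤ.+ (⟦ e ⟧ B)))
      int-hinv (c ∷ H) e (sc ∷ sH) h = int-inv e c (hinv H) sc (λ w l → ℕP.≤-trans (ℕP.m≤m+n _ _) (h w l))
         (int-hinv H (λ w → e w ∸ dv w ℤ.∣ c ∣) sH (λ w l → le∸ (dv w ℤ.∣ c ∣) (h w l)))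

      -- The coefficient of ε^s in a product of 1/(c+ε) is a sum of terms with s repeated inverses
      -- besides one inverse of each c. An inverse consumes at most one unit of exponent at each
      -- position, whence the summand s.
      int-dd : ∀ D H → All Small D → All Small H → ∀ e s → (∀ w → w ℕ.< n → (cnt w D ℕ.+ cnt w H) ℕ.+ s ℕ.≤ e w) → IsInt (ιℕ (⟦ e ⟧ B) * (dd (map ι D) (mono 0) s * hinv H))
      int-dd [] H [] sH e zero h = int-≡ (cong (ιℕ (⟦ e ⟧ B) *_) (sym (*-identityˡ (hinv H)))) (int-hinv H e sH (λ w l → ℕP.≤-trans (ℕP.m≤m+n _ 0) (h w l)))
      int-dd [] H [] sH e (suc s) h = int-≡ (sym (cong (ιℕ (⟦ e ⟧ B) *_) (*-zeroˡ (hinv H)) ∙ *-zeroʳ (ιℕ (⟦ e ⟧ B)))) int-0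
      int-dd (c ∷ D) H (sc ∷ sD) sH e zero h =
        int-≡ (cong (ιℕ (⟦ e ⟧ B) *_) (sym (*-assoc (inv (ι c)) (dd (map ι D) (mono 0) 0) (hinv H))))
          (int-inv e c _ sc (λ w l → ℕP.≤-trans (ℕP.≤-trans (ℕP.m≤m+n _ _) (ℕP.≤-trans (ℕP.m≤m+n _ _) (ℕP.m≤m+n _ 0))) (h w l))
            (int-dd D H sD sH _ 0 (λ w l → le∸ (dv w ℤ.∣ c ∣) (ℕP.≤-trans (ℕP.≤-reflexive (alg (dv w ℤ.∣ c ∣) (cnt w D) (cnt w H) 0)) (h w l)))))
        where
        alg : ∀ a b c d → a ℕ.+ ((b ℕ.+ c) ℕ.+ d) ≡ ((a ℕ.+ b) ℕ.+ c) ℕ.+ d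
        alg = ℕS.solve-∀
      int-dd (c ∷ D) H (sc ∷ sD) sH e (suc s) h =
        int-≡ (cong (ιℕ (⟦ e ⟧ B) *_) (sym (*-assoc (inv (ι c)) (X - Y) (hinv H))))
          (int-inv e c _ sc (λ w l → ℕP.≤-trans (ℕP.≤-trans (ℕP.m≤m+n _ _) (ℕP.≤-trans (ℕP.m≤m+n _ _) (ℕP.m≤m+n _ (suc s)))) (h w l))
            (int-≡ (alg₀ (ιℕ (⟦ e′ ⟧ B)) X Y (hinv H)) (int-+
              (int-dd D H sD sH e′ (suc s) (λ w l → le∸ (dv w ℤ.∣ c ∣) (ℕP.≤-trans (ℕP.≤-reflexive (alg (dv w ℤ.∣ c ∣) (cnt w D) (cnt w H) (suc s))) (h w l))))
              (int-neg (int-dd (c ∷ D) H (sc ∷ sD) sH e′ s (λ w l → le∸ (dv w ℤ.∣ c ∣)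
                 (ℕP.≤-trans (ℕP.+-monoˡ-≤ ((cnt w (c ∷ D) ℕ.+ cnt w H) ℕ.+ s) (ind≤1 (suc w ∣? ℤ.∣ c ∣))) (ℕP.≤-trans (ℕP.≤-reflexive (sym (ℕP.+-suc _ s))) (h w l)))))))))
        where
        X = dd (map ι D) (mono 0) (suc s)
        Y = dd (map ι (c ∷ D)) (mono 0) s
        e′ : ℕ → ℕ
        e′ w = e w ∸ dv w ℤ.∣ c ∣
        alg : ∀ a b c d → a ℕ.+ ((b ℕ.+ c) ℕ.+ d) ≡ ((a ℕ.+ b) ℕ.+ c) ℕ.+ d
        alg = ℕS.solve-∀
        alg₀ : ∀ M x y h → M * (x * h) + (- (M * (y * h))) ≡ M * ((x - y) * h)
        alg₀ = solve-∀ ℚring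

      -- A numerator factor adds its divisors to the exponents available. Choosing ε from it instead
      -- forfeits at most one unit at each position, and the drop of s by one repays that.
      int-NN : ∀ L D H → All Fits L → All Small D → All Small H → ∀ e s → (∀ w → w ℕ.< n → (cnt w D ℕ.+ cnt w H) ℕ.+ s ℕ.≤ e w ℕ.+ cnt w L) →
               IsInt (ιℕ (⟦ e ⟧ B) * (NN (map fz L) (dd (map ι D) (mono 0)) s * hinv H))
      int-NN [] D H [] sD sH e s h = int-dd D H sD sH e s (λ w l → ℕP.≤-trans (h w l) (ℕP.≤-reflexive (ℕP.+-identityʳ (e w))))
      int-NN (c ∷ L) D H ((nc , fc) ∷ fL) sD sH e s h = go s h
        where
        u = NN (map fz L) (dd (map ι D) (mono 0))
        first : ∀ s → (∀ w → w ℕ.< n → (cnt w D ℕ.+ cnt w H) ℕ.+ s ℕ.≤ e w ℕ.+ (dv w ℤ.∣ c ∣ ℕ.+ cnt w L)) → IsInt (ιℕ (⟦ e ⟧ B) * ((ι c * u s) * hinv H))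
        first s h = int-≡ (sym (cong (λ z → ιℕ (⟦ e ⟧ B) * ((z * u s) * hinv H)) cz ∙ alg (ιℕ (⟦ e ⟧ B)) (ιℕ ℤ.∣ c ∣) (ι (proj₁ σ)) (u s) (hinv H)
             ∙ cong (λ z → ι (proj₁ σ) * (z * (u s * hinv H))) (sym (ιℕ-* (⟦ e ⟧ B) ℤ.∣ c ∣) ∙ cong ιℕ (sym (⟦⟧-+ e (λ w → dv w ℤ.∣ c ∣) B ∙ cong (⟦ e ⟧ B ℕ.*_) (⟦dv⟧ B ℤ.∣ c ∣ (abs>0 nc) fc))))))
           (int-* (int-ι (proj₁ σ)) (int-NN L D H fL sD sH (λ w → e w ℕ.+ dv w ℤ.∣ c ∣) s (λ w l → ℕP.≤-trans (h w l) (ℕP.≤-reflexive (sym (ℕP.+-assoc (e w) _ _))))))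
          where
          σ = unit-sign′ c
          cz = proj₂ σ
          alg : ∀ M a z u h → M * (((a * z) * u) * h) ≡ z * ((M * a) * (u * h))
          alg = solve-∀ ℚring
        go : ∀ s → (∀ w → w ℕ.< n → (cnt w D ℕ.+ cnt w H) ℕ.+ s ℕ.≤ e w ℕ.+ (dv w ℤ.∣ c ∣ ℕ.+ cnt w L)) → IsInt (ιℕ (⟦ e ⟧ B) * (N (ι c) 1ℚ u s * hinv H))
        go zero h = first 0 h
        go (suc s) h = int-≡ (alg (ιℕ (⟦ e ⟧ B)) (ι c * u (suc s)) (u s) (hinv H)) (int-+ (first (suc s) h)
          (int-NN L D H fL sD sH e s (λ w l → ℕP.≤-pred (ℕP.≤-trans (ℕP.≤-reflexive (sym (ℕP.+-suc _ s))) (ℕP.≤-trans (h w l) (ℕP.≤-trans (ℕP.+-monoʳ-≤ (e w) (ℕP.+-monoˡ-≤ (cnt w L) (ind≤1 (suc w ∣? ℤ.∣ c ∣)))) (ℕP.≤-reflexive (ℕP.+-suc (e w) (cnt w L)))))))))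
          where
          alg : ∀ M x y h → M * (x * h) + M * (y * h) ≡ M * ((x + 1ℚ * y) * h)
          alg = solve-∀ ℚring

  cnt-up : ∀ w k → cnt w (up k) ≡ fl k w
  cnt-up w zero    = sym (m<n⇒m/n≡0 {0} {suc w} (ℕ.s≤s ℕ.z≤n))
  cnt-up w (suc k) = cong (dv w (suc k) ℕ.+_) (cnt-up w k) ∙ ℕP.+-comm (dv w (suc k)) (fl k w) ∙ sym (/-suc k w)

  cnt-abs : ∀ w (f g : ℕ → ℤ) l → (∀ j → ℤ.∣ f j ∣ ≡ ℤ.∣ g j ∣) → cnt w (map f l) ≡ cnt w (map g l)
  cnt-abs w f g []      h = refl
  cnt-abs w f g (j ∷ l) h = cong₂ ℕ._+_ (cong (dv w) (h j)) (cnt-abs w f g l h)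

  cnt-dn : ∀ w k → cnt w (dn k) ≡ fl k w
  cnt-dn w k = cnt-abs w _ _ (rng k) (λ j → ℤP.∣-i∣≡∣i∣ (ℤ.+ j)) ∙ cnt-up w k

  cnt-shift : ∀ w m k → cnt w (map (λ j → ℤ.+ (k ℕ.+ j)) (rng m)) ℕ.+ fl k w ≡ fl (k ℕ.+ m) w
  cnt-shift w zero    k = cong (λ z → fl z w) (sym (ℕP.+-identityʳ k))
  cnt-shift w (suc m) k = ℕP.+-assoc (dv w (k ℕ.+ suc m)) _ (fl k w) ∙ cong (dv w (k ℕ.+ suc m) ℕ.+_) (cnt-shift w m k)
     ∙ ℕP.+-comm (dv w (k ℕ.+ suc m)) (fl (k ℕ.+ m) w) ∙ sym (cong (λ z → fl z w) (ℕP.+-suc k m) ∙ /-suc (k ℕ.+ m) w ∙ cong (λ z → fl (k ℕ.+ m) w ℕ.+ dv w z) (sym (ℕP.+-suc k m)))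

  fl-+≥ : ∀ x y w → fl x w ℕ.+ fl y w ℕ.≤ fl (x ℕ.+ y) w
  fl-+≥ x y w = ℕP.≤-trans (ℕP.≤-reflexive (sym (m*n/n≡m (fl x w ℕ.+ fl y w) (suc w)))) (/-monoˡ-≤ (suc w)
     (ℕP.≤-trans (ℕP.≤-reflexive (ℕP.*-distribʳ-+ (suc w) (fl x w) (fl y w))) (ℕP.+-mono-≤ (m/n*n≤m x (suc w)) (m/n*n≤m y (suc w)))))

  fl-upper : ∀ x w → suc x ℕ.≤ suc (fl x w) ℕ.* suc w
  fl-upper x w = ℕP.≤-trans (ℕP.≤-reflexive (cong suc (m≡m%n+[m/n]*n x (suc w)))) (ℕP.+-monoˡ-≤ (fl x w ℕ.* suc w) (m%n<n x (suc w)))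

  fl-+≤ : ∀ x y w → fl (suc (x ℕ.+ y)) w ℕ.≤ suc (fl x w ℕ.+ fl y w)
  fl-+≤ x y w = ℕP.≤-pred (m<n*o⇒m/o<n {suc (x ℕ.+ y)} {suc (suc (fl x w ℕ.+ fl y w))} {suc w}
     (ℕP.≤-trans (ℕP.≤-reflexive (cong suc (sym (ℕP.+-suc x y)))) (ℕP.≤-trans (ℕP.+-mono-≤ (fl-upper x w) (fl-upper y w)) (ℕP.≤-reflexive (alg (fl x w) (fl y w) (suc w))))))
    where
    alg : ∀ a b c → suc a ℕ.* c ℕ.+ suc b ℕ.* c ≡ suc (suc (a ℕ.+ b)) ℕ.* c
    alg = ℕS.solve-∀

  fl-mono : ∀ {x y} w → x ℕ.≤ y → fl x w ℕ.≤ fl y w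
  fl-mono w l = /-monoˡ-≤ (suc w) l

-- The common denominator of the linear form

module Arithmetic where

  open Mangoldt
  open Rationals
  open PowerSeries
  open LocalExpansion
  open RationalFunction
  open IntegerValues
  open import Data.Nat as ℕ using (ℕ; zero; suc; _∸_; _!; _⊔_)
  import Data.Nat.Properties as ℕP
  open import Data.Nat.DivMod using (m<n⇒m/n≡0; m<n*o⇒m/o<n)
  open import Data.Nat.Divisibility using (_∣?_)
  import Data.Nat.Tactic.RingSolver as ℕS
  open import Data.Integer as ℤ using (ℤ)
  import Data.Integer.Properties as ℤP
  import Data.Integer.Tactic.RingSolver as ℤS
  open import Data.Rational hiding (_/_; _⊔_)
  open import Data.Rational.Properties
  open import Data.List using ([]; _∷_; _++_; map; length)
  open import Data.List.Relation.Unary.All as All using (All; []; _∷_)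
  open import Data.List.Relation.Unary.All.Properties as AllP using ()
  open import Data.Product using (_,_)
  open import Data.Empty using (⊥-elim)
  open import Relation.Nullary
  open import Relation.Binary.PropositionalEquality using (_≡_; refl; sym; cong; cong₂; subst)
  open import Tactic.RingSolver using (solve-∀)

  module Denominators (n m b a : ℕ) (enough : 2 ℕ.+ b ℕ.* (m ℕ.+ m) ℕ.≤ n ℕ.+ a ℕ.* suc n)
               (hm : suc (m ℕ.+ m) ≡ n ℕ.+ n ℕ.+ n) (ha : suc (suc a) ≡ 7 ℕ.* b) (hb : 1 ℕ.≤ b) where
    open RF n m b a enough

    Q4 : ℕ
    Q4 = suc (n ℕ.+ (m ℕ.+ m))

    Q4≡ : Q4 ≡ 4 ℕ.* n
    Q4≡ = sym (ℕP.+-suc n (m ℕ.+ m)) ∙ cong (n ℕ.+_) hm ∙ alg n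
      where
      alg : ∀ n → n ℕ.+ (n ℕ.+ n ℕ.+ n) ≡ 4 ℕ.* n
      alg = ℕS.solve-∀

    -- A lower bound, uniform in k, for the multiplicity of suc w in (m+k)!(n+m-k)! when suc w
    -- does not occur in the binomial coefficient n over k.
    g : ℕ → ℕ
    g w = (fl Q4 w ∸ 1) ⊔ (fl m w ℕ.+ fl m w ℕ.+ fl n w)

    -- What the denominators can consume, (A+b)⌊n/v⌋ + (a+b), less the multiplicity b g that the
    -- numerators are sure to supply. Beyond n no denominator has a divisor.
    eM : ℕ → ℕ
    eM w with w ℕ.<? n
    ... | yes _ = ((A ℕ.+ b) ℕ.* fl n w ℕ.+ (a ℕ.+ b)) ∸ b ℕ.* g w
    ... | no _  = 0

    -- Determined by `M-Y`: it is `eM` plus b⌊4n/v⌋ minus (A+b)⌊n/v⌋, with the subtractions carried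
    -- out.
    Y : ℕ → ℕ
    Y w with w ℕ.<? n
    ... | yes _ = (a ℕ.+ b) ℕ.+ b ℕ.* (fl Q4 w ∸ g w)
    ... | no _  = b ℕ.* fl Q4 w

    Y-below : ∀ w → w ℕ.< n → Y w ≡ (a ℕ.+ b) ℕ.+ b ℕ.* (fl Q4 w ∸ g w)
    Y-below w l with w ℕ.<? n
    ... | yes _ = refl
    ... | no ¬l = ⊥-elim (¬l l)

    Y-above : ∀ w → ¬ (w ℕ.< n) → Y w ≡ b ℕ.* fl Q4 w
    Y-above w ¬l with w ℕ.<? n
    ... | yes l = ⊥-elim (¬l l)
    ... | no _  = refl

    M : ℕ
    M = ⟦ eM ⟧ Q4

    n≤Q4 : n ℕ.≤ Q4
    n≤Q4 = ℕP.≤-trans (ℕP.m≤m+n n _) (ℕP.n≤1+n _)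

    mmn≤ : ∀ w → fl m w ℕ.+ fl m w ℕ.+ fl n w ℕ.≤ fl Q4 w
    mmn≤ w = ℕP.≤-trans (ℕP.+-monoˡ-≤ (fl n w) (fl-+≥ m m w)) (ℕP.≤-trans (fl-+≥ (m ℕ.+ m) n w) (fl-mono w (ℕP.≤-trans (ℕP.≤-reflexive (ℕP.+-comm (m ℕ.+ m) n)) (ℕP.n≤1+n _))))

    g≤Q4 : ∀ w → g w ℕ.≤ fl Q4 w
    g≤Q4 w = ℕP.⊔-lub (ℕP.m∸n≤m (fl Q4 w) 1) (mmn≤ w)

    -- Makes the truncated subtraction in `eM` exact: g is at most ⌊4n/v⌋ ≤ 4⌊n/v⌋ + 3, and A + b ≥
    -- 4b, a + b ≥ 3b.
    g≤ : ∀ w → b ℕ.* g w ℕ.≤ (A ℕ.+ b) ℕ.* fl n w ℕ.+ (a ℕ.+ b)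
    g≤ w = ℕP.≤-trans (ℕP.*-monoʳ-≤ b (ℕP.≤-trans (g≤Q4 w) q4)) (ℕP.≤-trans (ℕP.≤-reflexive (alg b f)) (ℕP.+-mono-≤ (ℕP.*-monoˡ-≤ f b4) b3))
      where
      f = fl n w
      q4 : fl Q4 w ℕ.≤ 4 ℕ.* f ℕ.+ 3
      q4 = ℕP.≤-pred (m<n*o⇒m/o<n {Q4} {suc (4 ℕ.* f ℕ.+ 3)} {suc w} (ℕP.≤-trans (ℕP.≤-reflexive (cong suc Q4≡)) (ℕP.≤-trans (ℕP.+-monoʳ-≤ 1 (ℕP.≤-trans (ℕP.m≤n+m (4 ℕ.* n) 3) ℕP.≤-refl)) (ℕP.≤-trans (ℕP.≤-reflexive (a₁ n)) (ℕP.≤-trans (ℕP.*-monoʳ-≤ 4 (fl-upper n w)) (ℕP.≤-reflexive (a₂ f (suc w))))))))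
        where
        a₁ : ∀ n → 1 ℕ.+ (3 ℕ.+ 4 ℕ.* n) ≡ 4 ℕ.* suc n
        a₁ = ℕS.solve-∀
        a₂ : ∀ f v → 4 ℕ.* (suc f ℕ.* v) ≡ suc (4 ℕ.* f ℕ.+ 3) ℕ.* v
        a₂ = ℕS.solve-∀
      alg : ∀ b f → b ℕ.* (4 ℕ.* f ℕ.+ 3) ≡ (4 ℕ.* b) ℕ.* f ℕ.+ 3 ℕ.* b
      alg = ℕS.solve-∀
      a5 : 5 ℕ.* b ℕ.≤ a
      a5 = ℕP.≤-pred (ℕP.≤-pred (ℕP.≤-trans (ℕP.≤-trans (ℕP.≤-reflexive (a₁ b)) (ℕP.+-monoʳ-≤ (5 ℕ.* b) (ℕP.*-monoʳ-≤ 2 hb))) (ℕP.≤-reflexive (a₂ b ∙ sym ha))))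
        where
        a₁ : ∀ b → 2 ℕ.+ 5 ℕ.* b ≡ 5 ℕ.* b ℕ.+ 2 ℕ.* 1
        a₁ = ℕS.solve-∀
        a₂ : ∀ b → 5 ℕ.* b ℕ.+ 2 ℕ.* b ≡ 7 ℕ.* b
        a₂ = ℕS.solve-∀
      b4 : 4 ℕ.* b ℕ.≤ A ℕ.+ b
      b4 = ℕP.≤-trans (ℕP.*-monoˡ-≤ b {4} {5} (ℕ.s≤s (ℕ.s≤s (ℕ.s≤s (ℕ.s≤s ℕ.z≤n))))) (ℕP.≤-trans a5 (ℕP.≤-trans (ℕP.n≤1+n a) (ℕP.m≤m+n A b)))
      b3 : 3 ℕ.* b ℕ.≤ a ℕ.+ b
      b3 = ℕP.≤-trans (ℕP.*-monoˡ-≤ b {3} {5} (ℕ.s≤s (ℕ.s≤s (ℕ.s≤s ℕ.z≤n)))) (ℕP.≤-trans a5 (ℕP.m≤m+n a b))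

    eM-eq : ∀ w → w ℕ.< n → eM w ℕ.+ b ℕ.* g w ≡ (A ℕ.+ b) ℕ.* fl n w ℕ.+ (a ℕ.+ b)
    eM-eq w l with w ℕ.<? n
    ... | yes _ = ℕP.m∸n+n≡m (g≤ w)
    ... | no ¬l = ⊥-elim (¬l l)

    M-Y : M ℕ.* (Q4 !) ℕ.^ b ≡ (n !) ℕ.^ (A ℕ.+ b) ℕ.* ⟦ Y ⟧ Q4
    M-Y = cong (M ℕ.*_) (cong (ℕ._^ b) (sym (⟦fl⟧ Q4 Q4 ℕP.≤-refl)) ∙ sym (⟦⟧-* b (fl Q4) Q4)) ∙ sym (⟦⟧-+ eM (λ w → b ℕ.* fl Q4 w) Q4)
       ∙ ⟦⟧-cong Q4 (λ w _ → pt w) ∙ ⟦⟧-+ (λ w → (A ℕ.+ b) ℕ.* fl n w) Y Q4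
       ∙ cong (ℕ._* ⟦ Y ⟧ Q4) (⟦⟧-* (A ℕ.+ b) (fl n) Q4 ∙ cong (ℕ._^ (A ℕ.+ b)) (⟦fl⟧ Q4 n n≤Q4))
      where
      pt : ∀ w → eM w ℕ.+ b ℕ.* fl Q4 w ≡ (A ℕ.+ b) ℕ.* fl n w ℕ.+ Y w
      pt w with w ℕ.<? n
      ... | yes _ = cong (λ z → e ℕ.+ b ℕ.* z) (sym (ℕP.m+[n∸m]≡n (g≤Q4 w))) ∙ alg e b (g w) (fl Q4 w ∸ g w) ∙ cong (ℕ._+ b ℕ.* (fl Q4 w ∸ g w)) (ℕP.m∸n+n≡m (g≤ w)) ∙ ℕP.+-assoc ((A ℕ.+ b) ℕ.* fl n w) (a ℕ.+ b) _
        where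
        e = ((A ℕ.+ b) ℕ.* fl n w ℕ.+ (a ℕ.+ b)) ∸ b ℕ.* g w
        alg : ∀ e b g d → e ℕ.+ b ℕ.* (g ℕ.+ d) ≡ (e ℕ.+ b ℕ.* g) ℕ.+ b ℕ.* d
        alg = ℕS.solve-∀
      ... | no ¬l = cong (ℕ._+ b ℕ.* fl Q4 w) (sym (cong ((A ℕ.+ b) ℕ.*_) (m<n⇒m/n≡0 (ℕ.s≤s (ℕP.≮⇒≥ ¬l))) ∙ ℕP.*-zeroʳ (A ℕ.+ b)))

    open Integrality n Q4

    cnt≤length : ∀ w H → cnt w H ℕ.≤ length H
    cnt≤length w []      = ℕ.z≤n
    cnt≤length w (h ∷ H) = ℕP.+-mono-≤ (ind≤1 (suc w ∣? ℤ.∣ h ∣)) (cnt≤length w H)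

    module AtPole (k rr : ℕ) (e : n ≡ rr ℕ.+ k) where
      y = ℤ.- (ℤ.+ k)

      left-abs : ∀ j → ℤ.∣ y ℤ.- ℤ.+ j ∣ ≡ k ℕ.+ j
      left-abs j = cong ℤ.∣_∣ (alg (ℤ.+ k) (ℤ.+ j)) ∙ ℤP.∣-i∣≡∣i∣ (ℤ.+ (k ℕ.+ j))
        where
        alg : ∀ k j → ℤ.- k ℤ.- j ≡ ℤ.- (k ℤ.+ j)
        alg = ℤS.solve-∀

      right-val : ∀ j → y ℤ.+ ℤ.+ (n ℕ.+ j) ≡ ℤ.+ (rr ℕ.+ j)
      right-val j = cong (λ z → y ℤ.+ ℤ.+ (z ℕ.+ j)) e ∙ alg (ℤ.+ k) (ℤ.+ rr) (ℤ.+ j)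
        where
        alg : ∀ k r j → ℤ.- k ℤ.+ ((r ℤ.+ k) ℤ.+ j) ≡ r ℤ.+ j
        alg = ℤS.solve-∀

      cl cr : ℕ → ℕ
      cl w = cnt w (map (λ j → ℤ.+ (k ℕ.+ j)) (rng m))
      cr w = cnt w (map (λ j → ℤ.+ (rr ℕ.+ j)) (rng m))

      cnt-nums : ∀ w → cnt w (nums y) ≡ b ℕ.* (cl w ℕ.+ cr w)
      cnt-nums w = cnt-rep w b (left y ++ right y) ∙ cong (b ℕ.*_) (cnt-++ w (left y) (right y) ∙ cong₂ ℕ._+_ (cnt-abs w _ _ (rng m) left-abs) (cnt-abs w _ _ (rng m) (λ j → cong ℤ.∣_∣ (right-val j))))

      cnt-dens : ∀ w → cnt w (rep A (Dk k rr)) ≡ A ℕ.* (fl k w ℕ.+ fl rr w)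
      cnt-dens w = cnt-rep w A (Dk k rr) ∙ cong (A ℕ.*_) (cnt-++ w (dn k) (up rr) ∙ cong₂ ℕ._+_ (cnt-dn w k) (cnt-up w rr))

      -- Let d = ⌊n/v⌋ - ⌊k/v⌋ - ⌊(n-k)/v⌋, the share of v in the binomial coefficient n over k. The
      -- numerator may miss the multiplicity g by d, but the denominator then falls short of its
      -- maximum by d with weight A + b ≥ b, which covers the loss b d.
      key : ∀ w → w ℕ.< n → A ℕ.* (fl k w ℕ.+ fl rr w) ℕ.+ (a ℕ.+ b) ℕ.≤ eM w ℕ.+ b ℕ.* (cl w ℕ.+ cr w)
      key w l = ℕP.+-cancelʳ-≤ (b ℕ.* K ℕ.+ b ℕ.* g w) _ _ (ℕP.≤-trans (ℕP.≤-reflexive (a₁ A K (a ℕ.+ b) b (g w)))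
          (ℕP.≤-trans (ℕP.+-monoˡ-≤ (a ℕ.+ b) main) (ℕP.≤-reflexive (a₂ (A ℕ.+ b) f (a ℕ.+ b) ∙ cong (λ z → (b ℕ.* Wd) ℕ.+ z) (sym (eM-eq w l)) ∙ cong (λ z → b ℕ.* z ℕ.+ (eM w ℕ.+ b ℕ.* g w)) Wd≡ ∙ a₃ b (eM w) (g w) (cl w) (cr w) K))))
        where
        K = fl k w ℕ.+ fl rr w
        f = fl n w
        Wd = fl (k ℕ.+ m) w ℕ.+ fl (rr ℕ.+ m) w
        Wd≡ : Wd ≡ (cl w ℕ.+ cr w) ℕ.+ K
        Wd≡ = sym (cong₂ ℕ._+_ (cnt-shift w m k) (cnt-shift w m rr)) ∙ alg (cl w) (fl k w) (cr w) (fl rr w)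
          where
          alg : ∀ a b c d → (a ℕ.+ b) ℕ.+ (c ℕ.+ d) ≡ (a ℕ.+ c) ℕ.+ (b ℕ.+ d)
          alg = ℕS.solve-∀
        K≤f : K ℕ.≤ f
        K≤f = ℕP.≤-trans (fl-+≥ k rr w) (ℕP.≤-reflexive (cong (λ z → fl z w) (ℕP.+-comm k rr ∙ sym e)))
        d = f ∸ K
        Kd : K ℕ.+ d ≡ f
        Kd = ℕP.m+[n∸m]≡n K≤f
        -- The first bound uses 4n = (k+m) + (n-k+m) + 1, where splitting the floor loses at most
        -- one; the second is superadditivity of the floor.
        gW : g w ℕ.≤ Wd ℕ.+ d
        gW = ℕP.⊔-lub (ℕP.≤-trans (ℕP.m≤n+o⇒m∸n≤o (fl Q4 w) 1 (ℕP.≤-trans (ℕP.≤-reflexive (cong (λ z → fl (suc z) w) q4)) (fl-+≤ (k ℕ.+ m) (rr ℕ.+ m) w))) (ℕP.m≤m+n Wd d))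
              (ℕP.≤-trans (ℕP.≤-reflexive (cong (fl m w ℕ.+ fl m w ℕ.+_) (sym Kd) ∙ alg (fl m w) (fl k w) (fl rr w) d)) (ℕP.+-monoˡ-≤ d (ℕP.+-mono-≤ (fl-+≥ k m w) (fl-+≥ rr m w))))
          where
          q4 : n ℕ.+ (m ℕ.+ m) ≡ (k ℕ.+ m) ℕ.+ (rr ℕ.+ m)
          q4 = cong (ℕ._+ (m ℕ.+ m)) e ∙ alg k rr m
            where
            alg : ∀ k r m → (r ℕ.+ k) ℕ.+ (m ℕ.+ m) ≡ (k ℕ.+ m) ℕ.+ (r ℕ.+ m)
            alg = ℕS.solve-∀
          alg : ∀ m k r d → (m ℕ.+ m) ℕ.+ ((k ℕ.+ r) ℕ.+ d) ≡ ((k ℕ.+ m) ℕ.+ (r ℕ.+ m)) ℕ.+ d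
          alg = ℕS.solve-∀
        main : (A ℕ.+ b) ℕ.* K ℕ.+ b ℕ.* g w ℕ.≤ b ℕ.* Wd ℕ.+ (A ℕ.+ b) ℕ.* f
        main = ℕP.≤-trans (ℕP.+-monoʳ-≤ ((A ℕ.+ b) ℕ.* K) (ℕP.≤-trans (ℕP.*-monoʳ-≤ b gW) (ℕP.≤-reflexive (ℕP.*-distribˡ-+ b Wd d))))
          (ℕP.≤-trans (ℕP.+-monoʳ-≤ ((A ℕ.+ b) ℕ.* K) (ℕP.+-monoʳ-≤ (b ℕ.* Wd) (ℕP.*-monoˡ-≤ d (ℕP.m≤n+m b A)))) (ℕP.≤-reflexive (alg (A ℕ.+ b) K (b ℕ.* Wd) d ∙ cong (λ z → b ℕ.* Wd ℕ.+ (A ℕ.+ b) ℕ.* z) Kd)))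
          where
          alg : ∀ T K w d → T ℕ.* K ℕ.+ (w ℕ.+ T ℕ.* d) ≡ w ℕ.+ T ℕ.* (K ℕ.+ d)
          alg = ℕS.solve-∀
        a₁ : ∀ A K s b g → (A ℕ.* K ℕ.+ s) ℕ.+ (b ℕ.* K ℕ.+ b ℕ.* g) ≡ ((A ℕ.+ b) ℕ.* K ℕ.+ b ℕ.* g) ℕ.+ s
        a₁ = ℕS.solve-∀
        a₂ : ∀ T f s → (b ℕ.* Wd ℕ.+ T ℕ.* f) ℕ.+ s ≡ b ℕ.* Wd ℕ.+ (T ℕ.* f ℕ.+ s)
        a₂ T f s = ℕP.+-assoc (b ℕ.* Wd) (T ℕ.* f) s
        a₃ : ∀ b e g l r K → b ℕ.* ((l ℕ.+ r) ℕ.+ K) ℕ.+ (e ℕ.+ b ℕ.* g) ≡ (e ℕ.+ b ℕ.* (l ℕ.+ r)) ℕ.+ (b ℕ.* K ℕ.+ b ℕ.* g)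
        a₃ = ℕS.solve-∀

      k≤n : k ℕ.≤ n
      k≤n = subst (k ℕ.≤_) (sym e) (ℕP.m≤n+m k rr)
      rr≤n : rr ℕ.≤ n
      rr≤n = subst (rr ℕ.≤_) (sym e) (ℕP.m≤m+n rr k)

      smallD : All Small (rep A (Dk k rr))
      smallD = All-rep A (AllP.++⁺ (AllP.map⁺ (rng-All k (λ { (suc j) _ l → (λ ()) , ℕP.≤-trans l k≤n }))) (AllP.map⁺ (rng-All rr (λ { (suc j) _ l → (λ ()) , ℕP.≤-trans l rr≤n }))))

      fitsN : All Fits (nums y)
      fitsN = All-rep b (AllP.++⁺ (AllP.map⁺ (rng-All m (λ j p l → fit (left-abs j) p l k≤n))) (AllP.map⁺ (rng-All m (λ j p l → fit (cong ℤ.∣_∣ (right-val j)) p l rr≤n))))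
        where
        fit : ∀ {c j x} → ℤ.∣ c ∣ ≡ x ℕ.+ j → 0 ℕ.< j → j ℕ.≤ m → x ℕ.≤ n → Fits c
        fit {c} {j} {x} eq p l xn = (λ { refl → ℕP.<⇒≢ (ℕP.≤-trans p (ℕP.m≤n+m j x)) eq }) , ℕP.≤-trans (ℕP.≤-reflexive eq) (ℕP.≤-trans (ℕP.+-mono-≤ xn l) (ℕP.≤-trans (ℕP.+-monoʳ-≤ n (ℕP.m≤m+n m m)) (ℕP.n≤1+n _)))

      int-U : ∀ s H → All Small H → s ℕ.+ length H ℕ.≤ a ℕ.+ b → IsInt (ιℕ M * (Pole.U k rr e s * hinv H))
      int-U s H sH l = go s l
        where
        X = NN (map fz (nums y)) (dd (map ι (rep A (Dk k rr))) (mono 0))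
        iX : ∀ s → s ℕ.+ length H ℕ.≤ a ℕ.+ b → IsInt (ιℕ M * (X s * hinv H))
        iX s l = int-NN n≤Q4 (nums y) (rep A (Dk k rr)) H fitsN smallD sH eM s (λ w lw →
           ℕP.≤-trans (ℕP.≤-reflexive (ℕP.+-assoc (cnt w (rep A (Dk k rr))) (cnt w H) s)) (ℕP.≤-trans (ℕP.+-mono-≤ (ℕP.≤-reflexive (cnt-dens w)) (ℕP.≤-trans (ℕP.≤-reflexive (ℕP.+-comm (cnt w H) s)) (ℕP.≤-trans (ℕP.+-monoʳ-≤ s (cnt≤length w H)) l)))
            (ℕP.≤-trans (key w lw) (ℕP.≤-reflexive (cong (eM w ℕ.+_) (sym (cnt-nums w)))))))
        go : ∀ s → s ℕ.+ length H ℕ.≤ a ℕ.+ b → IsInt (ιℕ M * (N (ι (num₀ y)) (ι (ℤ.+ 2)) X s * hinv H))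
        go zero l = int-≡ (alg (ιℕ M) (ι (num₀ y)) (X 0) (hinv H)) (int-* (int-ι (num₀ y)) (iX 0 l))
          where
          alg : ∀ M a x h → a * (M * (x * h)) ≡ M * ((a * x) * h)
          alg = solve-∀ ℚring
        go (suc s) l = int-≡ (alg (ιℕ M) (ι (num₀ y)) (ι (ℤ.+ 2)) (X (suc s)) (X s) (hinv H)) (int-+ (int-* (int-ι (num₀ y)) (iX (suc s) l)) (int-* (int-ι (ℤ.+ 2)) (iX s (ℕP.≤-trans (ℕP.n≤1+n _) l))))
          where
          alg : ∀ M a t x y h → a * (M * (x * h)) + t * (M * (y * h)) ≡ M * ((a * x + t * y) * h)
          alg = solve-∀ ℚring

    -- The coefficient of (t+k)^(-i-1) is an expansion coefficient of order a - i. Of the a + b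
    -- units available this leaves i + b, exactly enough for one power j^(-i-b).
    int-c : ∀ k i → k ℕ.≤ n → i ℕ.< A → ∀ H → All Small H → length H ℕ.≤ i ℕ.+ b → IsInt (ιℕ M * (c_ k i * hinv H))
    int-c k i kn iA H sH l = int-≡ (cong (λ z → ιℕ M * (z * hinv H)) (sym (Pole.c≡U k (n ∸ k) e i iA))) (AtPole.int-U k (n ∸ k) e (A ∸ suc i) H sH
         (ℕP.≤-trans (ℕP.+-monoʳ-≤ (a ∸ i) l) (ℕP.≤-reflexive (sym (ℕP.+-assoc (a ∸ i) i b) ∙ cong (ℕ._+ b) (ℕP.m∸n+n≡m (ℕP.≤-pred iA))))))
      where
      e : n ≡ n ∸ k ℕ.+ k
      e = sym (ℕP.m∸n+n≡m kn)

-- Congruences in the localisation at a prime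

module LocalRing where

  open import Defs using (pow)
  open Mangoldt using (prime>1)
  open Rationals
  open PowerSeries
  open PartialFractions
  open RationalFunction using (fz)
  open IntegerValues
  open import Data.Nat as ℕ using (ℕ; zero; suc)
  import Data.Nat.Properties as ℕP
  open import Data.Nat.Divisibility as ℕD using (divides; _∣_)
  open import Data.Nat.Primality using (Prime; euclidsLemma; prime⇒nonZero)
  open import Data.Integer as ℤ using (ℤ)
  import Data.Integer.Properties as ℤP
  open import Data.Rational
  open import Data.Rational.Properties
  import Data.Rational.Unnormalised as ᵘ
  import Data.Rational.Unnormalised.Properties as ᵘP
  open import Data.List using ([]; _∷_; map)
  open import Data.List.Relation.Unary.All as All using (All; []; _∷_)
  open import Data.Product using (∃; _×_; _,_; proj₁; proj₂)
  open import Data.Sum using (inj₁; inj₂; [_,_]′)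
  open import Data.Empty using (⊥-elim)
  open import Relation.Nullary
  open import Relation.Binary.PropositionalEquality using (_≡_; _≢_; refl; sym; cong; cong₂; _≗_)
  open import Tactic.RingSolver using (solve-∀)

  inv-1/ : ∀ h → (ℤ.+ 1) / suc h ≡ inv (ιℕ (suc h))
  inv-1/ h = inv-unique (ι≢0 {ℤ.+ suc h} λ ()) (toℚᵘ-injective (ᵘP.≃-trans (toℚᵘ-homo-* (ιℕ (suc h)) ((ℤ.+ 1) / suc h))
     (ᵘP.≃-trans (ᵘP.*-cong (toι (ℤ.+ suc h)) (toℚᵘ-fromℚᵘ (ᵘ.mkℚᵘ (ℤ.+ 1) h))) (ᵘ.*≡* (cong (ℤ._* ℤ.+ 1) (ℤP.*-identityʳ (ℤ.+ suc h)) ∙ ℤP.*-identityʳ (ℤ.+ suc h) ∙ sym (ℤP.*-identityˡ _ ∙ cong (λ z → ℤ.+ suc z) (ℕP.+-identityʳ h)))))))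

  pow-+ : ∀ x a b → pow x (a ℕ.+ b) ≡ pow x a * pow x b
  pow-+ x zero    b = sym (*-identityˡ (pow x b))
  pow-+ x (suc a) b = cong (x *_) (pow-+ x a b) ∙ sym (*-assoc x (pow x a) (pow x b))

  pow-inv : ∀ x a → x ≢ 0ℚ → pow x a * pow (inv x) a ≡ 1ℚ
  pow-inv x zero    nx = refl
  pow-inv x (suc a) nx = alg x (inv x) (pow x a) (pow (inv x) a) ∙ cong₂ _*_ (inv-r nx) (pow-inv x a nx)
    where
    alg : ∀ x i a b → (x * a) * (i * b) ≡ (x * i) * (a * b)
    alg = solve-∀ ℚring

  pow≢0 : ∀ x a → x ≢ 0ℚ → pow x a ≢ 0ℚ
  pow≢0 x zero    nx ()
  pow≢0 x (suc a) nx = mul≢0 nx (pow≢0 x a nx)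

  module Local-ring (P : ℕ) (pr : Prime P) where

    π : ℚ
    π = ιℕ P

    P≢0 : P ≢ 0
    P≢0 = ℕ.≢-nonZero⁻¹ P {{prime⇒nonZero pr}}

    π≢0 : π ≢ 0ℚ
    π≢0 e = P≢0 (ℤP.+-injective (ι-inj {ℤ.+ P} {ℤ.+ 0} (e ∙ sym ι0)))

    ∤-* : ∀ {d e} → ¬ P ∣ d → ¬ P ∣ e → ¬ P ∣ d ℕ.* e
    ∤-* nd ne h with euclidsLemma _ _ pr h
    ... | inj₁ x = nd x
    ... | inj₂ y = ne y

    -- The rationals with denominator prime to P; `PLoc` below is the maximal ideal of this local
    -- ring.
    Loc : ℚ → Set
    Loc x = ∃ λ d → ¬ P ∣ d × IsInt (ιℕ d * x)

    P∤1 : ¬ P ∣ 1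
    P∤1 h = ℕP.<⇒≢ (prime>1 pr) (sym (ℕD.∣1⇒≡1 h))

    loc-int : ∀ {x} → IsInt x → Loc x
    loc-int {x} h = 1 , P∤1 , int-≡ (sym (cong (_* x) ι1 ∙ *-identityˡ x)) h

    loc-+ : ∀ {x y} → Loc x → Loc y → Loc (x + y)
    loc-+ {x} {y} (d , nd , hx) (e , ne , hy) = d ℕ.* e , ∤-* nd ne , int-≡ (sym (cong (_* (x + y)) (ιℕ-* d e) ∙ alg (ιℕ d) (ιℕ e) x y)) (int-+ (int-* (int-ι (ℤ.+ e)) hx) (int-* (int-ι (ℤ.+ d)) hy))
      where
      alg : ∀ d e x y → (d * e) * (x + y) ≡ e * (d * x) + d * (e * y)
      alg = solve-∀ ℚring

    loc-* : ∀ {x y} → Loc x → Loc y → Loc (x * y)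
    loc-* {x} {y} (d , nd , hx) (e , ne , hy) = d ℕ.* e , ∤-* nd ne , int-≡ (sym (cong (_* (x * y)) (ιℕ-* d e) ∙ alg (ιℕ d) (ιℕ e) x y)) (int-* hx hy)
      where
      alg : ∀ d e x y → (d * e) * (x * y) ≡ (d * x) * (e * y)
      alg = solve-∀ ℚring

    loc-≡ : ∀ {x y} → x ≡ y → Loc x → Loc y
    loc-≡ refl h = h

    loc-neg : ∀ {x} → Loc x → Loc (- x)
    loc-neg {x} (d , nd , h) = d , nd , int-≡ (alg (ιℕ d) x) (int-neg h)
      where
      alg : ∀ d x → - (d * x) ≡ d * (- x)
      alg = solve-∀ ℚring

    loc-inv : ∀ c → ¬ P ∣ ℤ.∣ c ∣ → Loc (inv (ι c))
    loc-inv c nd = ℤ.∣ c ∣ , nd , unit-sign c (λ { refl → nd (divides 0 refl) })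

    PLoc : ℚ → Set
    PLoc x = ∃ λ y → Loc y × x ≡ π * y

    ploc-≡ : ∀ {x y} → x ≡ y → PLoc x → PLoc y
    ploc-≡ refl h = h

    ploc-0 : PLoc 0ℚ
    ploc-0 = 0ℚ , loc-int int-0 , sym (*-zeroʳ π)

    ploc-+ : ∀ {x y} → PLoc x → PLoc y → PLoc (x + y)
    ploc-+ (x , lx , refl) (y , ly , refl) = x + y , loc-+ lx ly , sym (*-distribˡ-+ π x y)

    ploc-neg : ∀ {x} → PLoc x → PLoc (- x)
    ploc-neg (x , lx , refl) = - x , loc-neg lx , alg π x
      where
      alg : ∀ p x → - (p * x) ≡ p * (- x)
      alg = solve-∀ ℚring

    ploc-* : ∀ {x y} → Loc x → PLoc y → PLoc (x * y)
    ploc-* {x} lx (y , ly , refl) = x * y , loc-* lx ly , alg π x y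
      where
      alg : ∀ p x y → x * (p * y) ≡ p * (x * y)
      alg = solve-∀ ℚring

    ploc-π : ∀ {x} → Loc x → PLoc (π * x)
    ploc-π {x} l = x , l , refl

    loc-pow : ∀ {x} k → Loc x → Loc (pow x k)
    loc-pow zero    l = loc-int int-1
    loc-pow (suc k) l = loc-* l (loc-pow k l)

    loc-π : Loc π
    loc-π = loc-int (int-ι (ℤ.+ P))

    ploc-Σ : ∀ n {f} → (∀ i → i ℕ.< n → PLoc (f i)) → PLoc (Σ n f)
    ploc-Σ zero    h = ploc-0
    ploc-Σ (suc n) h = ploc-+ (ploc-Σ n (λ i l → h i (ℕP.m<n⇒m<1+n l))) (h n ℕP.≤-refl)

    ploc-int : ∀ z → PLoc (ι z) → P ∣ ℤ.∣ z ∣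
    ploc-int z (y , (d , nd , (t , eq)) , e) = [ (λ x → ⊥-elim (nd x)) , (λ x → x) ]′ (euclidsLemma d ℤ.∣ z ∣ pr div)
      where
      e₂ : (ℤ.+ d) ℤ.* z ≡ (ℤ.+ P) ℤ.* t
      e₂ = ι-inj (ι-* (ℤ.+ d) z ∙ cong (ιℕ d *_) e ∙ alg (ιℕ d) π y ∙ cong (π *_) eq ∙ sym (ι-* (ℤ.+ P) t))
        where
        alg : ∀ d p y → d * (p * y) ≡ p * (d * y)
        alg = solve-∀ ℚring
      div : P ∣ d ℕ.* ℤ.∣ z ∣
      div = divides ℤ.∣ t ∣ (sym (ℤP.abs-* (ℤ.+ d) z) ∙ cong ℤ.∣_∣ e₂ ∙ ℤP.abs-* (ℤ.+ P) t ∙ ℕP.*-comm P ℤ.∣ t ∣)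

    Unit : ℚ → Set
    Unit μ = Loc μ × ∃ λ x → Loc x × x * μ ≡ 1ℚ

    -- κ rescales u by powers of P, and modulo P it is the unit μ times γ.
    record State (t j : ℕ) (u γ : Seq) : Set where
      field
        κ    : Seq
        μ    : ℚ
        rel  : ∀ s → pow π (t ℕ.+ s) * u s ≡ pow π j * κ s
        locκ : ∀ s → Loc (κ s)
        cong-κ : ∀ s → PLoc (κ s - μ * γ s)
        unit : Unit μ
    open State

    start : State 0 0 (mono 0) (mono 0)
    start = record { κ = mono 0 ; μ = 1ℚ ; rel = r ; locκ = λ s → loc-int (im s) ; cong-κ = λ s → ploc-≡ (alg (mono 0 s)) ploc-0
                   ; unit = loc-int int-1 , 1ℚ , loc-int int-1 , refl }
      where
      im : ∀ s → IsInt (mono 0 s)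
      im zero    = int-1
      im (suc s) = int-0
      r : ∀ s → pow π s * mono 0 s ≡ 1ℚ * mono 0 s
      r zero    = refl
      r (suc s) = *-zeroʳ (pow π (suc s))
      alg : ∀ x → 0ℚ ≡ x - 1ℚ * x
      alg = solve-∀ ℚring

    -- The rescaling in `State` is the substitution ε = P z. A factor c + ε with c prime to P
    -- becomes c + P z, congruent to c, so it only changes the unit.
    step-num-unit : ∀ c {t j u γ} → ¬ P ∣ ℤ.∣ c ∣ → State t j u γ → State t j (N (ι c) 1ℚ u) γ
    step-num-unit c {t} {j} {u} {γ} nd S = record { κ = N (ι c) π (κ S) ; μ = ι c * μ S ; rel = r ; locκ = lk ; cong-κ = ck
         ; unit = loc-* (loc-int (int-ι c)) (proj₁ (unit S)) , inv (ι c) * x , loc-* (loc-inv c nd) lx , (alg₁ (inv (ι c)) x (ι c) (μ S) ∙ cong₂ _*_ (inv-l nz) xe) }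
      where
      x = proj₁ (proj₂ (unit S))
      lx = proj₁ (proj₂ (proj₂ (unit S)))
      xe = proj₂ (proj₂ (proj₂ (unit S)))
      nz : ι c ≢ 0ℚ
      nz = ι≢0 {c} (λ { refl → nd (divides 0 refl) })
      alg₁ : ∀ i x c m → (i * x) * (c * m) ≡ (i * c) * (x * m)
      alg₁ = solve-∀ ℚring
      r : ∀ s → pow π (t ℕ.+ s) * N (ι c) 1ℚ u s ≡ pow π j * N (ι c) π (κ S) s
      r zero = a₁ (pow π (t ℕ.+ 0)) (ι c) (u 0) ∙ cong (ι c *_) (rel S 0) ∙ sym (a₁ (pow π j) (ι c) (κ S 0))
        where
        a₁ : ∀ p c x → p * (c * x) ≡ c * (p * x)
        a₁ = solve-∀ ℚring
      r (suc s) = a₁ (pow π (t ℕ.+ suc s)) (ι c) (u (suc s)) (u s) ∙ cong₂ (λ p q → ι c * p + q) (rel S (suc s)) (cong (λ z → pow π z * u s) (ℕP.+-suc t s) ∙ *-assoc π (pow π (t ℕ.+ s)) (u s) ∙ cong (π *_) (rel S s))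
           ∙ a₂ (pow π j) (ι c) (κ S (suc s)) π (κ S s)
        where
        a₁ : ∀ p c x y → p * (c * x + 1ℚ * y) ≡ c * (p * x) + p * y
        a₁ = solve-∀ ℚring
        a₂ : ∀ p c x q y → c * (p * x) + q * (p * y) ≡ p * (c * x + q * y)
        a₂ = solve-∀ ℚring
      lk : ∀ s → Loc (N (ι c) π (κ S) s)
      lk zero    = loc-* (loc-int (int-ι c)) (locκ S 0)
      lk (suc s) = loc-+ (loc-* (loc-int (int-ι c)) (locκ S (suc s))) (loc-* loc-π (locκ S s))
      ck : ∀ s → PLoc (N (ι c) π (κ S) s - (ι c * μ S) * γ s)
      ck zero    = ploc-≡ (a₁ (ι c) (κ S 0) (μ S) (γ 0)) (ploc-* (loc-int (int-ι c)) (cong-κ S 0))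
        where
        a₁ : ∀ c k m g → c * (k - m * g) ≡ c * k - (c * m) * g
        a₁ = solve-∀ ℚring
      ck (suc s) = ploc-≡ (a₁ (ι c) (κ S (suc s)) (μ S) (γ (suc s)) (π * κ S s)) (ploc-+ (ploc-* (loc-int (int-ι c)) (cong-κ S (suc s))) (ploc-π (locκ S s)))
        where
        a₁ : ∀ c k m g p → c * (k - m * g) + p ≡ (c * k + p) - (c * m) * g
        a₁ = solve-∀ ℚring

    -- Under ε = P z the factor P c + β ε equals P (c + β z): a power of P splits off and the factor
    -- survives modulo P.
    step-num-mult : ∀ c β {t j u γ} → State t j u γ → State t (suc j) (N (π * ι c) (ι β) u) (N (ι c) (ι β) γ)
    step-num-mult c β {t} {j} {u} {γ} S = record { κ = N (ι c) (ι β) (κ S) ; μ = μ S ; rel = r ; locκ = lk ; cong-κ = ck ; unit = unit S }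
      where
      r : ∀ s → pow π (t ℕ.+ s) * N (π * ι c) (ι β) u s ≡ (π * pow π j) * N (ι c) (ι β) (κ S) s
      r zero = a₁ (pow π (t ℕ.+ 0)) π (ι c) (u 0) ∙ cong ((π * ι c) *_) (rel S 0) ∙ a₂ π (ι c) (pow π j) (κ S 0)
        where
        a₁ : ∀ p q c x → p * ((q * c) * x) ≡ (q * c) * (p * x)
        a₁ = solve-∀ ℚring
        a₂ : ∀ q c p x → (q * c) * (p * x) ≡ (q * p) * (c * x)
        a₂ = solve-∀ ℚring
      r (suc s) = a₁ (pow π (t ℕ.+ suc s)) π (ι c) (ι β) (u (suc s)) (u s) ∙ cong₂ (λ p q → (π * ι c) * p + ι β * q) (rel S (suc s)) (cong (λ z → pow π z * u s) (ℕP.+-suc t s) ∙ *-assoc π (pow π (t ℕ.+ s)) (u s) ∙ cong (π *_) (rel S s))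
           ∙ a₂ π (ι c) (ι β) (pow π j) (κ S (suc s)) (κ S s)
        where
        a₁ : ∀ p q c b x y → p * ((q * c) * x + b * y) ≡ (q * c) * (p * x) + b * (p * y)
        a₁ = solve-∀ ℚring
        a₂ : ∀ q c b p x y → (q * c) * (p * x) + b * (q * (p * y)) ≡ (q * p) * (c * x + b * y)
        a₂ = solve-∀ ℚring
      lk : ∀ s → Loc (N (ι c) (ι β) (κ S) s)
      lk zero    = loc-* (loc-int (int-ι c)) (locκ S 0)
      lk (suc s) = loc-+ (loc-* (loc-int (int-ι c)) (locκ S (suc s))) (loc-* (loc-int (int-ι β)) (locκ S s))
      ck : ∀ s → PLoc (N (ι c) (ι β) (κ S) s - μ S * N (ι c) (ι β) γ s)
      ck zero    = ploc-≡ (a₁ (ι c) (κ S 0) (μ S) (γ 0)) (ploc-* (loc-int (int-ι c)) (cong-κ S 0))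
        where
        a₁ : ∀ c k m g → c * (k - m * g) ≡ c * k - m * (c * g)
        a₁ = solve-∀ ℚring
      ck (suc s) = ploc-≡ (a₁ (ι c) (κ S (suc s)) (μ S) (γ (suc s)) (ι β) (κ S s) (γ s)) (ploc-+ (ploc-* (loc-int (int-ι c)) (cong-κ S (suc s))) (ploc-* (loc-int (int-ι β)) (cong-κ S s)))
        where
        a₁ : ∀ c k m g b l h → c * (k - m * g) + b * (l - m * h) ≡ (c * k + b * l) - m * (c * g + b * h)
        a₁ = solve-∀ ℚring

    denπ : ℚ → Seq → Seq
    denπ i κ zero    = i * κ zero
    denπ i κ (suc s) = i * (κ (suc s) - π * denπ i κ s)

    step-den-unit : ∀ c {t j u γ} → ¬ P ∣ ℤ.∣ c ∣ → State t j u γ → State t j (den (ι c) u) γ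
    step-den-unit c {t} {j} {u} {γ} nd S = record { κ = κ′ ; μ = i * μ S ; rel = r ; locκ = lk ; cong-κ = ck
         ; unit = loc-* li (proj₁ (unit S)) , ι c * x , loc-* (loc-int (int-ι c)) lx , (alg₁ (ι c) x i (μ S) ∙ cong₂ _*_ (inv-r nz) xe) }
      where
      x = proj₁ (proj₂ (unit S))
      lx = proj₁ (proj₂ (proj₂ (unit S)))
      xe = proj₂ (proj₂ (proj₂ (unit S)))
      i = inv (ι c)
      li = loc-inv c nd
      κ′ = denπ i (κ S)
      nz : ι c ≢ 0ℚ
      nz = ι≢0 {c} (λ { refl → nd (divides 0 refl) })
      alg₁ : ∀ i x c m → (i * x) * (c * m) ≡ (i * c) * (x * m)
      alg₁ = solve-∀ ℚring
      r : ∀ s → pow π (t ℕ.+ s) * den (ι c) u s ≡ pow π j * κ′ s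
      r zero = a₁ (pow π (t ℕ.+ 0)) i (u 0) ∙ cong (i *_) (rel S 0) ∙ sym (a₁ (pow π j) i (κ S 0))
        where
        a₁ : ∀ p c x → p * (c * x) ≡ c * (p * x)
        a₁ = solve-∀ ℚring
      r (suc s) = a₁ (pow π (t ℕ.+ suc s)) i (u (suc s)) (den (ι c) u s) ∙ cong₂ (λ p q → i * (p - q)) (rel S (suc s)) (cong (λ z → pow π z * den (ι c) u s) (ℕP.+-suc t s) ∙ *-assoc π (pow π (t ℕ.+ s)) (den (ι c) u s) ∙ cong (π *_) (r s))
           ∙ a₂ (pow π j) i (κ S (suc s)) π (κ′ s)
        where
        a₁ : ∀ p c x y → p * (c * (x - y)) ≡ c * (p * x - p * y)
        a₁ = solve-∀ ℚring
        a₂ : ∀ p c x q y → c * (p * x - q * (p * y)) ≡ p * (c * (x - q * y))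
        a₂ = solve-∀ ℚring
      lk : ∀ s → Loc (κ′ s)
      lk zero    = loc-* li (locκ S 0)
      lk (suc s) = loc-* li (loc-+ (locκ S (suc s)) (loc-neg (loc-* loc-π (lk s))))
      ck : ∀ s → PLoc (κ′ s - (i * μ S) * γ s)
      ck zero    = ploc-≡ (a₁ i (κ S 0) (μ S) (γ 0)) (ploc-* li (cong-κ S 0))
        where
        a₁ : ∀ c k m g → c * (k - m * g) ≡ c * k - (c * m) * g
        a₁ = solve-∀ ℚring
      ck (suc s) = ploc-≡ (a₁ i (κ S (suc s)) (μ S) (γ (suc s)) (π * κ′ s)) (ploc-* li (ploc-+ (cong-κ S (suc s)) (ploc-neg (ploc-π (lk s)))))
        where
        a₁ : ∀ c k m g p → c * ((k - m * g) + (- p)) ≡ c * (k - p) - (c * m) * g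
        a₁ = solve-∀ ℚring

    -- division by the factor -P + ε
    step-den-P : ∀ {t j u γ} → State t j u γ → State (suc t) j (den (- π) u) (den (- 1ℚ) γ)
    step-den-P {t} {j} {u} {γ} S = record { κ = κ′ ; μ = μ S ; rel = r ; locκ = lk ; cong-κ = ck ; unit = unit S }
      where
      i = inv (- 1ℚ)
      κ′ = den (- 1ℚ) (κ S)
      li : Loc i
      li = loc-int (int-neg int-1)
      πi : π * inv (- π) ≡ i
      πi = cong (π *_) (inv-neg π≢0) ∙ sym (neg-distribʳ-* π (inv π)) ∙ cong -_ (inv-r π≢0)
      r : ∀ s → (π * pow π (t ℕ.+ s)) * den (- π) u s ≡ pow π j * κ′ s
      r zero = a₁ π (pow π (t ℕ.+ 0)) (inv (- π)) (u 0) ∙ cong₂ _*_ πi (rel S 0) ∙ a₂ i (pow π j) (κ S 0)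
        where
        a₁ : ∀ q p c x → (q * p) * (c * x) ≡ (q * c) * (p * x)
        a₁ = solve-∀ ℚring
        a₂ : ∀ i p x → i * (p * x) ≡ p * (i * x)
        a₂ = solve-∀ ℚring
      r (suc s) = a₁ π (pow π (t ℕ.+ suc s)) (inv (- π)) (u (suc s)) (den (- π) u s) ∙ cong₂ (λ z w → z * (w - pow π (t ℕ.+ suc s) * den (- π) u s)) πi (rel S (suc s))
          ∙ cong (λ z → i * (pow π j * κ S (suc s) - z)) (cong (λ z → pow π z * den (- π) u s) (ℕP.+-suc t s) ∙ r s) ∙ a₂ i (pow π j) (κ S (suc s)) (κ′ s)
        where
        a₁ : ∀ q p c x y → (q * p) * (c * (x - y)) ≡ (q * c) * (p * x - p * y)
        a₁ = solve-∀ ℚring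
        a₂ : ∀ i p x y → i * (p * x - p * y) ≡ p * (i * (x - y))
        a₂ = solve-∀ ℚring
      lk : ∀ s → Loc (κ′ s)
      lk zero    = loc-* li (locκ S 0)
      lk (suc s) = loc-* li (loc-+ (locκ S (suc s)) (loc-neg (lk s)))
      ck : ∀ s → PLoc (κ′ s - μ S * den (- 1ℚ) γ s)
      ck zero    = ploc-≡ (a₁ i (κ S 0) (μ S) (γ 0)) (ploc-* li (cong-κ S 0))
        where
        a₁ : ∀ c k m g → c * (k - m * g) ≡ c * k - m * (c * g)
        a₁ = solve-∀ ℚring
      ck (suc s) = ploc-≡ (a₁ i (κ S (suc s)) (μ S) (γ (suc s)) (κ′ s) (den (- 1ℚ) γ s)) (ploc-* li (ploc-+ (cong-κ S (suc s)) (ploc-neg (ck s))))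
        where
        a₁ : ∀ c k m g l h → c * ((k - m * g) + (- (l - m * h))) ≡ c * (k - l) - m * (c * (g - h))
        a₁ = solve-∀ ℚring

    units-num : ∀ l {t j u γ} → All (λ c → ¬ P ∣ ℤ.∣ c ∣) l → State t j u γ → State t j (NN (map fz l) u) γ
    units-num []      []        S = S
    units-num (c ∷ l) (nd ∷ nl) S = step-num-unit c nd (units-num l nl S)

    units-den : ∀ l {t j u γ} → All (λ c → ¬ P ∣ ℤ.∣ c ∣) l → State t j u γ → State t j (dd (map ι l) u) γ
    units-den []      []        S = S
    units-den (c ∷ l) (nd ∷ nl) S = step-den-unit c nd (units-den l nl S)

    state-≗ : ∀ {t j u u′ γ} → u ≗ u′ → State t j u γ → State t j u′ γ
    state-≗ {t} h S = record { κ = κ S ; μ = μ S ; rel = λ s → cong (pow π (t ℕ.+ s) *_) (sym (h s)) ∙ rel S s ; locκ = locκ S ; cong-κ = cong-κ S ; unit = unit S }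

    NN-loc : ∀ l {u} → (∀ s → Loc (u s)) → ∀ s → Loc (NN (map fz l) u s)
    NN-loc []      h s = h s
    NN-loc (c ∷ l) h zero    = loc-* (loc-int (int-ι c)) (NN-loc l h 0)
    NN-loc (c ∷ l) h (suc s) = loc-+ (loc-* (loc-int (int-ι c)) (NN-loc l h (suc s))) (loc-* (loc-int int-1) (NN-loc l h s))

    dd-loc : ∀ l {u} → All (λ c → ¬ P ∣ ℤ.∣ c ∣) l → (∀ s → Loc (u s)) → ∀ s → Loc (dd (map ι l) u s)
    dd-loc []      []        h s = h s
    dd-loc (c ∷ l) (nd ∷ nl) h zero    = loc-* (loc-inv c nd) (dd-loc l nl h 0)
    dd-loc (c ∷ l) (nd ∷ nl) h (suc s) = loc-* (loc-inv c nd) (loc-+ (dd-loc l nl h (suc s)) (loc-neg (dd-loc (c ∷ l) (nd ∷ nl) h s)))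

-- Nonvanishing of the linear form modulo the prime n

module Nonvanishing where

  open import Defs using (pow; zetaPartial)
  open Rationals
  open PowerSeries
  open PartialFractions
  open LocalExpansion
  open RationalFunction
  open IntegerValues
  open LocalRing
  open import Data.Nat as ℕ using (ℕ; zero; suc; _∸_)
  import Data.Nat.Properties as ℕP
  open import Data.Nat.Divisibility as ℕD using (_∣_; >⇒∤)
  open import Data.Nat.Primality using (Prime; euclidsLemma)
  import Data.Nat.Tactic.RingSolver as ℕS
  open import Data.Integer as ℤ using (ℤ)
  import Data.Integer.Properties as ℤP
  import Data.Integer.Tactic.RingSolver as ℤS
  open import Data.Rational
  open import Data.Rational.Properties
  open import Data.List using (List; []; _∷_; _++_; map; length; replicate)
  import Data.List.Properties as LP
  open import Data.List.Relation.Unary.All as All using ([]; _∷_)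
  open import Data.List.Relation.Unary.All.Properties as AllP using ()
  open import Data.Product using (_,_; proj₁; proj₂)
  open import Data.Sum using ([_,_]′)
  open import Relation.Nullary
  open import Relation.Binary.PropositionalEquality using (_≡_; _≢_; refl; sym; cong; cong₂; subst; _≗_)
  open import Tactic.RingSolver using (solve-∀)

  iter : ∀ {A : Set} → ℕ → (A → A) → A → A
  iter zero    f x = x
  iter (suc k) f x = f (iter k f x)

  -- Integer versions of the series operations on truncated series, for evaluation.
  nth : List ℤ → ℕ → ℤ
  nth []      s       = ℤ.+ 0
  nth (x ∷ l) zero    = x
  nth (x ∷ l) (suc s) = nth l s

  -- The argument `p` is the preceding coefficient of the input; in `denL` it is the preceding
  -- coefficient of the output.
  mulL : ℤ → ℤ → ℤ → List ℤ → List ℤ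
  mulL a b p []      = []
  mulL a b p (x ∷ l) = (a ℤ.* x ℤ.+ b ℤ.* p) ∷ mulL a b x l

  -- division by σ + ε with σ = ±1
  denL : ℤ → ℤ → List ℤ → List ℤ
  denL σ p []      = []
  denL σ p (x ∷ l) = σ ℤ.* (x ℤ.- p) ∷ denL σ (σ ℤ.* (x ℤ.- p)) l

  length-mulL : ∀ a b p l → length (mulL a b p l) ≡ length l
  length-mulL a b p []      = refl
  length-mulL a b p (x ∷ l) = cong suc (length-mulL a b x l)

  length-denL : ∀ σ p l → length (denL σ p l) ≡ length l
  length-denL σ p []      = refl
  length-denL σ p (x ∷ l) = cong suc (length-denL σ _ l)

  Rep : List ℤ → Seq → Set
  Rep l u = ∀ s → s ℕ.< length l → ι (nth l s) ≡ u s

  rep-mul : ∀ a b l u → Rep l u → Rep (mulL a b (ℤ.+ 0) l) (N (ι a) (ι b) u)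
  rep-mul a b l u h s lt = go l s (subst (s ℕ.<_) (length-mulL a b (ℤ.+ 0) l) lt) h
    where
    mid : ∀ p l s → suc s ℕ.< length l → nth (mulL a b p l) (suc s) ≡ a ℤ.* nth l (suc s) ℤ.+ b ℤ.* nth l s
    mid p (x ∷ [])    zero    (ℕ.s≤s ())
    mid p (x ∷ [])    (suc s) (ℕ.s≤s ())
    mid p (x ∷ y ∷ l) zero    lt = refl
    mid p (x ∷ y ∷ l) (suc s) lt = mid x (y ∷ l) s (ℕP.≤-pred lt)
    go : ∀ l s → s ℕ.< length l → Rep l u → ι (nth (mulL a b (ℤ.+ 0) l) s) ≡ N (ι a) (ι b) u s
    go l@(x ∷ l′) zero lt h = ι-+ (a ℤ.* x) (b ℤ.* ℤ.+ 0) ∙ cong₂ _+_ (ι-* a x) (cong ι (ℤP.*-zeroʳ b) ∙ ι0) ∙ +-identityʳ _ ∙ cong (ι a *_) (h 0 lt)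
    go l (suc s) lt h = cong ι (mid (ℤ.+ 0) l s lt) ∙ ι-+ _ _ ∙ cong₂ _+_ (ι-* a _ ∙ cong (ι a *_) (h (suc s) lt)) (ι-* b _ ∙ cong (ι b *_) (h s (ℕP.<-trans ℕP.≤-refl lt)))

  rep-den : ∀ σ l u → σ ℤ.* σ ≡ ℤ.+ 1 → Rep l u → Rep (denL σ (ℤ.+ 0) l) (den (ι σ) u)
  rep-den σ l u hσ h s lt = go l s (subst (s ℕ.<_) (length-denL σ (ℤ.+ 0) l) lt) h
    where
    ισ : inv (ι σ) ≡ ι σ
    ισ = sym (inv-unique (λ e → 1≢0 (sym ι1 ∙ cong ι (sym hσ) ∙ ι-* σ σ ∙ cong (λ z → z * ι σ) {ι σ} {0ℚ} e ∙ *-zeroˡ (ι σ))) (sym (ι-* σ σ) ∙ cong ι hσ ∙ ι1))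
    mid : ∀ p l s → suc s ℕ.< length l → nth (denL σ p l) (suc s) ≡ σ ℤ.* (nth l (suc s) ℤ.- nth (denL σ p l) s)
    mid p (x ∷ [])    zero    (ℕ.s≤s ())
    mid p (x ∷ [])    (suc s) (ℕ.s≤s ())
    mid p (x ∷ y ∷ l) zero    lt = refl
    mid p (x ∷ y ∷ l) (suc s) lt = mid _ (y ∷ l) s (ℕP.≤-pred lt)
    go : ∀ l s → s ℕ.< length l → Rep l u → ι (nth (denL σ (ℤ.+ 0) l) s) ≡ den (ι σ) u s
    go l@(x ∷ l′) zero lt h = ι-* σ _ ∙ cong₂ _*_ (sym ισ) (cong ι (ℤP.+-identityʳ x) ∙ h 0 lt)
    go l (suc s) lt h = cong ι (mid (ℤ.+ 0) l s lt) ∙ ι-* σ _ ∙ cong₂ _*_ (sym ισ) (ι-+ _ _ ∙ cong₂ _+_ (h (suc s) lt) (ι-neg _ ∙ cong -_ (go l s (ℕP.<-trans ℕP.≤-refl lt) h)))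

  oneL : ℕ → List ℤ
  oneL k = ℤ.+ 1 ∷ replicate k (ℤ.+ 0)

  rep-one : ∀ k → Rep (oneL k) (mono 0)
  rep-one k zero    lt = ι1
  rep-one k (suc s) lt = cong ι (z k s) ∙ ι0
    where
    z : ∀ k s → nth (replicate k (ℤ.+ 0)) s ≡ ℤ.+ 0
    z zero    s       = refl
    z (suc k) zero    = refl
    z (suc k) (suc s) = z k s

  ΣZ : ℕ → (ℕ → ℤ) → ℤ
  ΣZ zero    f = ℤ.+ 0
  ΣZ (suc n) f = ΣZ n f ℤ.+ f n

  ι-Σ : ∀ n f → ι (ΣZ n f) ≡ Σ n (λ i → ι (f i))
  ι-Σ zero    f = ι0
  ι-Σ (suc n) f = ι-+ (ΣZ n f) (f n) ∙ cong (_+ ι (f n)) (ι-Σ n f)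

  -- Coefficients of (-1+2z) ((z+1)(z-2))^b / (z-1)^A.
  module Gamma (b A k : ℕ) where
    FL : List ℤ → List ℤ
    FL l = mulL (ℤ.- ℤ.+ 2) (ℤ.+ 1) (ℤ.+ 0) (mulL (ℤ.+ 1) (ℤ.+ 1) (ℤ.+ 0) l)
    FS : Seq → Seq
    FS u = N (ι (ℤ.- ℤ.+ 2)) (ι (ℤ.+ 1)) (N (ι (ℤ.+ 1)) (ι (ℤ.+ 1)) u)
    dL : List ℤ → List ℤ
    dL = denL (ℤ.- ℤ.+ 1) (ℤ.+ 0)
    dS : Seq → Seq
    dS = den (ι (ℤ.- ℤ.+ 1))

    γL : List ℤ
    γL = mulL (ℤ.- ℤ.+ 1) (ℤ.+ 2) (ℤ.+ 0) (iter b FL (iter A dL (oneL k)))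

    γ : Seq
    γ = N (ι (ℤ.- ℤ.+ 1)) (ι (ℤ.+ 2)) (iter b FS (iter A dS (mono 0)))

    rep-iter : ∀ (F : List ℤ → List ℤ) (f : Seq → Seq) → (∀ l u → Rep l u → Rep (F l) (f u)) → ∀ j l u → Rep l u → Rep (iter j F l) (iter j f u)
    rep-iter F f H zero    l u h = h
    rep-iter F f H (suc j) l u h = H (iter j F l) (iter j f u) (rep-iter F f H j l u h)

    repγ : Rep γL γ
    repγ = rep-mul (ℤ.- ℤ.+ 1) (ℤ.+ 2) (iter b FL (iter A dL (oneL k))) (iter b FS (iter A dS (mono 0)))
      (rep-iter FL FS (λ l u h → rep-mul (ℤ.- ℤ.+ 2) (ℤ.+ 1) (mulL (ℤ.+ 1) (ℤ.+ 1) (ℤ.+ 0) l) (N (ι (ℤ.+ 1)) (ι (ℤ.+ 1)) u) (rep-mul (ℤ.+ 1) (ℤ.+ 1) l u h)) b (iter A dL (oneL k)) (iter A dS (mono 0))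
        (rep-iter dL dS (λ l u h → rep-den (ℤ.- ℤ.+ 1) l u refl h) A (oneL k) (mono 0) (rep-one k)))

    length-iter : ∀ (F : List ℤ → List ℤ) → (∀ l → length (F l) ≡ length l) → ∀ j l → length (iter j F l) ≡ length l
    length-iter F H zero    l = refl
    length-iter F H (suc j) l = H (iter j F l) ∙ length-iter F H j l

    lengthγ : length γL ≡ suc k
    lengthγ = length-mulL (ℤ.- ℤ.+ 1) (ℤ.+ 2) (ℤ.+ 0) (iter b FL (iter A dL (oneL k)))
      ∙ length-iter FL (λ l → length-mulL (ℤ.- ℤ.+ 2) (ℤ.+ 1) (ℤ.+ 0) (mulL (ℤ.+ 1) (ℤ.+ 1) (ℤ.+ 0) l) ∙ length-mulL (ℤ.+ 1) (ℤ.+ 1) (ℤ.+ 0) l) b (iter A dL (oneL k))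
      ∙ length-iter dL (length-denL (ℤ.- ℤ.+ 1) (ℤ.+ 0)) A (oneL k) ∙ cong suc (LP.length-replicate k {ℤ.+ 0})

    γ-at : ∀ s → s ℕ.≤ k → ι (nth γL s) ≡ γ s
    γ-at s l = repγ s (subst (s ℕ.<_) (sym lengthγ) (ℕ.s≤s l))

  rowL : ℕ → ℕ → List ℤ
  rowL k i = iter i (denL (ℤ.+ 1) (ℤ.+ 0)) (oneL k)

  rowL-bc : ∀ k i s → s ℕ.≤ k → nth (rowL k i) s ≡ bc i s
  rowL-bc k i s l = ι-inj (row i s (subst (s ℕ.<_) (sym (len i)) (ℕ.s≤s l)) ∙ dpow-bc (ι (ℤ.+ 1)) i s ∙ cong (ι (bc i s) *_) (pow1 (i ℕ.+ s)) ∙ *-identityʳ (ι (bc i s)))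
    where
    len : ∀ i → length (rowL k i) ≡ suc k
    len zero    = cong suc (LP.length-replicate k)
    len (suc i) = length-denL _ _ (rowL k i) ∙ len i
    row : ∀ i → Rep (rowL k i) (dpow (ι (ℤ.+ 1)) i)
    row zero    = rep-one k
    row (suc i) = rep-den (ℤ.+ 1) (rowL k i) (dpow (ι (ℤ.+ 1)) i) refl (row i)
    i1 : inv (ι (ℤ.+ 1)) ≡ 1ℚ
    i1 = cong inv ι1
    pow1 : ∀ j → pow (inv (ι (ℤ.+ 1))) j ≡ 1ℚ
    pow1 zero    = refl
    pow1 (suc j) = cong₂ _*_ i1 (pow1 j)

  -- The residue of the linear form up to a unit. It depends on b and A but not on the prime, so one
  -- evaluation settles all large n.
  Nb : ℕ → ℕ → ℤ
  Nb β a = ΣZ (suc a) (λ i → nth (rowL β (suc i)) β ℤ.* nth (Gamma.γL (suc β) (suc a) a) (a ∸ i))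

  module NonVanishing (p m β a h : ℕ) (pr : Prime (suc p)) (enough : 2 ℕ.+ suc β ℕ.* (m ℕ.+ m) ℕ.≤ suc p ℕ.+ a ℕ.* suc (suc p))
               (hm : suc (m ℕ.+ m) ≡ suc p ℕ.+ suc p ℕ.+ suc p) (ha : suc (suc a) ≡ 7 ℕ.* suc β) (A-even : suc a ≡ h ℕ.+ h) (rm : ℕ) (m≡ : m ≡ rm ℕ.+ suc p) (rm< : rm ℕ.≤ p) where

    P b : ℕ
    P = suc p
    b = suc β
    open RF P m b a enough
    open Symmetric h A-even
    open Local-ring P pr
    open State
    open Gamma b (suc a) a

    small : ∀ j → 0 ℕ.< j → j ℕ.≤ p → ¬ P ∣ j
    small (suc j) _ l = >⇒∤ (ℕ.s≤s l)

    small+ : ∀ j x → 0 ℕ.< j → j ℕ.≤ p → P ∣ x → ¬ P ∣ x ℕ.+ j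
    small+ j x q l d d′ = small j q l (ℕD.∣m+n∣m⇒∣n d′ d)

    y : ℤ
    y = ℤ.- (ℤ.+ P)

    left-abs : ∀ j → ℤ.∣ y ℤ.- ℤ.+ j ∣ ≡ P ℕ.+ j
    left-abs j = cong ℤ.∣_∣ (alg (ℤ.+ P) (ℤ.+ j)) ∙ ℤP.∣-i∣≡∣i∣ (ℤ.+ (P ℕ.+ j))
      where
      alg : ∀ k j → ℤ.- k ℤ.- j ≡ ℤ.- (k ℤ.+ j)
      alg = ℤS.solve-∀

    right-val : ∀ j → y ℤ.+ ℤ.+ (P ℕ.+ j) ≡ ℤ.+ j
    right-val j = alg (ℤ.+ P) (ℤ.+ j)
      where
      alg : ∀ k j → ℤ.- k ℤ.+ (k ℤ.+ j) ≡ j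
      alg = ℤS.solve-∀

    -- among j = 1..m exactly j = P is a multiple of P
    block : ∀ (f : ℕ → ℤ) (c : ℤ) → (∀ j → ¬ P ∣ j → ¬ P ∣ ℤ.∣ f j ∣) → f P ≡ ℤ.+ P ℤ.* c →
            ∀ {t j u γ} → State t j u γ → State t (suc j) (NN (map fz (map f (rng m))) u) (N (ι c) (ι (ℤ.+ 1)) γ)
    block f c hf fP {t} {j} {u} {γ} S = state-≗ (λ s → sym (cong (λ l → NN (map fz (map f l)) u s) (cong rng m≡ ∙ rng-+ P rm) ∙ cong (λ l → NN l u s) (cong (map fz) (LP.map-++ f hi (rng P)) ∙ LP.map-++ fz (map f hi) (map f (rng P))) ∙ NN-++ (map fz (map f hi)) (map fz (map f (rng P))) u s))
        (units-num (map f hi) (AllP.map⁺ (AllP.map⁺ (rng-All rm (λ j q l → hf (P ℕ.+ j) (small+ j P q (ℕP.≤-trans l rm<) ℕD.∣-refl)))))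
          (state-≗ (λ s → cong₂ (λ x₁ x₂ → N x₁ x₂ (NN (map fz (map f (rng p))) u) s) (sym (ι-* (ℤ.+ P) c) ∙ cong ι (sym fP)) ι1)
            (step-num-mult c (ℤ.+ 1) (units-num (map f (rng p)) (AllP.map⁺ (rng-All p (λ j q l → hf j (small j q l)))) S))))
      where
      hi = map (P ℕ.+_) (rng rm)

    blocks : ∀ k {t j u γ} → State t j u γ → State t (k ℕ.+ k ℕ.+ j) (NN (map fz (rep k (left y ++ right y))) u) (iter k FS γ)
    blocks zero S = S
    blocks (suc k) {t} {j} {u} {γ′} S = state-≗ (λ s → sym (cong (λ l → NN l u s) (LP.map-++ fz (left y ++ right y) (rep k (left y ++ right y)) ∙ cong (_++ map fz (rep k (left y ++ right y))) (LP.map-++ fz (left y) (right y))) ∙ NN-++ (map fz (left y) ++ map fz (right y)) _ u s ∙ NN-++ (map fz (left y)) (map fz (right y)) _ s))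
       (subst (λ z → State t z (NN (map fz (left y)) (NN (map fz (right y)) (NN (map fz (rep k (left y ++ right y))) u))) (FS (iter k FS γ′))) (idx k j) (block (λ j → y ℤ.- ℤ.+ j) (ℤ.- ℤ.+ 2) (λ j nd d → nd (ℕD.∣m+n∣m⇒∣n (subst (P ∣_) (left-abs j) d) ℕD.∣-refl)) (lP (ℤ.+ P))
         (block (λ j → y ℤ.+ ℤ.+ (P ℕ.+ j)) (ℤ.+ 1) (λ j nd d → nd (subst (λ z → P ∣ ℤ.∣ z ∣) (right-val j) d)) (right-val P ∙ sym (ℤP.*-identityʳ (ℤ.+ P))) (blocks k S))))
      where
      idx : ∀ k j → suc (suc (k ℕ.+ k ℕ.+ j)) ≡ suc k ℕ.+ suc k ℕ.+ j
      idx k j = cong (λ z → suc (z ℕ.+ j)) (sym (ℕP.+-suc k k))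
      lP : ∀ P → ℤ.- P ℤ.- P ≡ P ℤ.* (ℤ.- ℤ.+ 2)
      lP = ℤS.solve-∀

    dens : ∀ k {t j u γ} → State t j u γ → State (k ℕ.+ t) j (dd (map ι (rep k (Dk P 0))) u) (iter k (den (ι (ℤ.- ℤ.+ 1))) γ)
    dens zero S = S
    dens (suc k) {t} {j} {u} {γ} S = subst (λ z → State (suc k ℕ.+ t) j (dd (map ι (rep (suc k) (Dk P 0))) u) (den z (iter k (den (ι (ℤ.- ℤ.+ 1))) γ))) (cong -_ (sym ι1) ∙ sym (ι-neg (ℤ.+ 1)))
       (state-≗ (λ s → cong (λ z → den z (dd (map ι (dn p)) (dd (map ι (rep k (Dk P 0))) u)) s) (sym (ι-neg (ℤ.+ P))) ∙ sym (cong (λ l → dd l u s) (cong (map ι) (cong (_++ rep k (Dk P 0)) (LP.++-identityʳ (dn P))) ∙ LP.map-++ ι (dn P) (rep k (Dk P 0))) ∙ dd-++ (map ι (dn P)) _ s))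
         (step-den-P (units-den (dn p) (AllP.map⁺ (rng-All p (λ j q l → subst (λ z → ¬ P ∣ z) (sym (ℤP.∣-i∣≡∣i∣ (ℤ.+ j))) (small j q l)))) (dens k S))))
      where
      dd-++ : ∀ l l′ → dd (l ++ l′) u ≗ dd l (dd l′ u)
      dd-++ []      l′ s = refl
      dd-++ (c ∷ l) l′ s = den-cong c (dd-++ l l′) s

    J : ℕ
    J = suc (b ℕ.+ b ℕ.+ 0)

    -- At t = -P + P z the factors divisible by P are 2t + P = P(2z-1), t - P = P(z-2), t + 2P =
    -- P(z+1) and t = P(z-1), besides the pole t + P itself, which is left out. All other factors
    -- are units at P, so only these enter `γ`.
    final : State (suc a ℕ.+ 0) J (Pole.U P 0 refl) γ
    final = state-≗ (λ s → cong (λ z → N z (ι (ℤ.+ 2)) (NN (map fz (nums y)) (dd (map ι (rep (suc a) (Dk P 0))) (mono 0))) s) (sym (ι-* (ℤ.+ P) (ℤ.- ℤ.+ 1)) ∙ cong ι (nP (ℤ.+ P)))) (step-num-mult (ℤ.- ℤ.+ 1) (ℤ.+ 2) (blocks b (dens (suc a) start)))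
      where
      nP : ∀ P → P ℤ.* (ℤ.- ℤ.+ 1) ≡ (ℤ.- P ℤ.+ ℤ.- P) ℤ.+ P
      nP = ℤS.solve-∀

    C : ℕ → ℤ
    C i = bc (suc i) β

    ρ : ℕ → ℚ
    ρ i = Σ (suc P) (λ κ → c_ κ i)

    Zp : ℕ → ℕ → ℚ
    Zp i κ = zetaPartial (i ℕ.+ b) κ

    Lform : (ℕ → ℚ) → ℚ
    Lform z = Σ A (λ i → ι (C i) * (ρ i * z i)) - Σ A (λ i → ι (C i) * Σ (suc P) (λ κ → c_ κ i * Zp i κ))

    -- One power of P serves all i: the order a - i of the coefficient and the exponent i + b of the
    -- matching zeta term have a constant sum.
    W : ℕ
    W = (suc a ℕ.+ a ℕ.+ b) ∸ J

    W+J : W ℕ.+ J ≡ suc a ℕ.+ a ℕ.+ b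
    W+J = ℕP.m∸n+n≡m J≤

      where
      b≤a : b ℕ.≤ a
      b≤a = ℕP.≤-pred (ℕP.≤-pred (ℕP.≤-trans (ℕP.≤-trans (ℕP.+-monoˡ-≤ b (ℕP.*-monoʳ-≤ 2 {1} {b} (ℕ.s≤s ℕ.z≤n))) (ℕP.≤-trans (ℕP.m≤m+n (2 ℕ.* b ℕ.+ b) (4 ℕ.* b)) (ℕP.≤-reflexive (alg b)))) (ℕP.≤-reflexive (sym ha))))
        where
        alg : ∀ b → 2 ℕ.* b ℕ.+ b ℕ.+ 4 ℕ.* b ≡ 7 ℕ.* b
        alg = ℕS.solve-∀
      J≤ : J ℕ.≤ suc a ℕ.+ a ℕ.+ b
      J≤ = ℕ.s≤s (ℕP.≤-trans (ℕP.≤-reflexive (ℕP.+-identityʳ (b ℕ.+ b))) (ℕP.+-monoˡ-≤ b (ℕP.≤-trans b≤a (ℕP.m≤m+n a a))))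

    W≥1 : 1 ℕ.≤ W
    W≥1 = ℕP.m+n≤o⇒m≤o∸n 1 (ℕP.≤-trans (ℕP.≤-reflexive (cong suc (cong suc (ℕP.+-identityʳ (b ℕ.+ b))))) (ℕP.≤-trans (ℕ.s≤s (ℕP.+-monoˡ-≤ b sb)) (ℕP.≤-reflexive refl)))
      where
      sb : suc b ℕ.≤ a ℕ.+ a
      sb = ℕP.≤-trans (ℕP.≤-pred (ℕP.≤-pred (ℕP.≤-trans (ℕP.≤-trans (ℕP.≤-reflexive (ℕP.+-comm 3 b)) (ℕP.≤-trans (ℕP.+-monoʳ-≤ b (ℕP.≤-trans (ℕP.*-monoʳ-≤ 3 {1} {b} (ℕ.s≤s ℕ.z≤n)) (ℕP.m≤m+n (3 ℕ.* b) (3 ℕ.* b)))) (ℕP.≤-reflexive (alg b)))) (ℕP.≤-reflexive (sym ha))))) (ℕP.m≤m+n a a)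
        where
        alg : ∀ b → b ℕ.+ (3 ℕ.* b ℕ.+ 3 ℕ.* b) ≡ 7 ℕ.* b
        alg = ℕS.solve-∀

    κF = κ final
    μF = μ final

    c-top : ∀ i → i ℕ.< A → pow π W * c_ P i ≡ pow π (i ℕ.+ b) * κF (a ∸ i)
    c-top i iA = *-cancelˡ (pow≢0 π J π≢0) (sym (*-assoc (pow π J) (pow π W) (c_ P i)) ∙ cong₂ _*_ (sym (pow-+ π J W) ∙ cong (pow π) idx) (Pole.c≡U P 0 refl i iA)
        ∙ cong (_* Pole.U P 0 refl (a ∸ i)) (pow-+ π (i ℕ.+ b) (suc a ℕ.+ 0 ℕ.+ (a ∸ i))) ∙ *-assoc (pow π (i ℕ.+ b)) _ _ ∙ cong (pow π (i ℕ.+ b) *_) (rel final (a ∸ i)) ∙ alg (pow π (i ℕ.+ b)) (pow π J) (κF (a ∸ i)))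
      where
      alg : ∀ x y z → x * (y * z) ≡ y * (x * z)
      alg = solve-∀ ℚring
      idx : J ℕ.+ W ≡ (i ℕ.+ b) ℕ.+ (suc a ℕ.+ 0 ℕ.+ (a ∸ i))
      idx = ℕP.+-comm J W ∙ W+J ∙ cong (λ z → suc a ℕ.+ z ℕ.+ b) (sym (ℕP.m+[n∸m]≡n (ℕP.≤-pred iA))) ∙ a₁ (suc a) i (a ∸ i) b
        where
        a₁ : ∀ A i r b → A ℕ.+ (i ℕ.+ r) ℕ.+ b ≡ (i ℕ.+ b) ℕ.+ (A ℕ.+ 0 ℕ.+ r)
        a₁ = ℕS.solve-∀

    top-ploc : ∀ i → i ℕ.< A → PLoc (pow π W * c_ P i)
    top-ploc i iA = ploc-≡ (sym (c-top i iA ∙ cong (λ z → pow π z * κF (a ∸ i)) (ℕP.+-suc i β) ∙ *-assoc π (pow π (i ℕ.+ β)) (κF (a ∸ i)))) (ploc-π (loc-* (loc-pow (i ℕ.+ β) loc-π) (locκ final (a ∸ i))))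

    sg-int : ∀ i → IsInt (sg i)
    sg-int zero    = int-1
    sg-int (suc i) = int-neg (sg-int i)

    -- The pole k = P has been computed and k = 0 is its mirror image. For 0 < k < P the coefficient
    -- is already integral at P, and W ≥ 1 supplies a factor P.
    c-ploc : ∀ k i → k ℕ.≤ P → i ℕ.< A → PLoc (pow π W * c_ k i)
    c-ploc zero i kP iA = ploc-≡ (alg (sg i) (pow π W) (c_ P i) ∙ cong (pow π W *_) (sym (c-sym P i ℕP.≤-refl iA) ∙ cong (λ z → c_ z i) (ℕP.n∸n≡0 P))) (ploc-* (loc-int (sg-int i)) (top-ploc i iA))
      where
      alg : ∀ s p c → s * (p * c) ≡ p * (s * c)
      alg = solve-∀ ℚring
    c-ploc k@(suc k′) i kP iA with k ℕ.≟ P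
    ... | yes refl = top-ploc i iA
    ... | no ne = ploc-≡ (sym (*-assoc π (pow π (W ∸ 1)) (c_ k i)) ∙ cong (λ z → pow π z * c_ k i) (ℕP.m+[n∸m]≡n W≥1)) (ploc-π (loc-* (loc-pow (W ∸ 1) loc-π) (loc-≡ (sym (Pole.c≡U k (P ∸ k) e i iA)) (Uloc (A ∸ suc i)))))
      where
      e : P ≡ P ∸ k ℕ.+ k
      e = sym (ℕP.m∸n+n≡m kP)
      k≤p : k ℕ.≤ p
      k≤p = ℕP.≤-pred (ℕP.≤∧≢⇒< kP ne)
      mono-loc : ∀ s → Loc (mono 0 s)
      mono-loc zero    = loc-int int-1
      mono-loc (suc s) = loc-int int-0
      X = NN (map fz (nums (ℤ.- (ℤ.+ k)))) (dd (map ι (rep A (Dk k (P ∸ k)))) (mono 0))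
      Xloc : ∀ s → Loc (X s)
      Xloc = NN-loc (nums (ℤ.- (ℤ.+ k))) (dd-loc (rep A (Dk k (P ∸ k))) (All-rep A (AllP.++⁺ (AllP.map⁺ (rng-All k (λ j q l → subst (λ z → ¬ P ∣ z) (sym (ℤP.∣-i∣≡∣i∣ (ℤ.+ j))) (small j q (ℕP.≤-trans l k≤p)))))
           (AllP.map⁺ (rng-All (P ∸ k) (λ j q l → small j q (ℕP.≤-trans l (ℕP.m∸n≤m p k′))))))) mono-loc)
      Uloc : ∀ s → Loc (Pole.U k (P ∸ k) e s)
      Uloc zero    = loc-* (loc-int (int-ι _)) (Xloc 0)
      Uloc (suc s) = loc-+ (loc-* (loc-int (int-ι _)) (Xloc (suc s))) (loc-* (loc-int (int-ι _)) (Xloc s))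

    Zp-loc : ∀ i κ → κ ℕ.≤ p → Loc (Zp i κ)
    Zp-loc i zero    l = loc-int int-0
    Zp-loc i (suc κ) l = loc-+ (Zp-loc i κ (ℕP.≤-trans (ℕP.n≤1+n κ) l)) (loc-pow (i ℕ.+ b) (loc-≡ (sym (inv-1/ κ)) (loc-inv (ℤ.+ suc κ) (small (suc κ) (ℕ.s≤s ℕ.z≤n) l))))

    -- Of all partial zeta sums up to κ ≤ P, only the last summand P^(-i-b) at κ = P has P in its
    -- denominator; it alone survives modulo P.
    inner : ∀ i → i ℕ.< A → PLoc (Σ (suc P) (λ κ → (pow π W * c_ κ i) * Zp i κ) - κF (a ∸ i))
    inner i iA = ploc-≡ (sym (cong (λ z → (Σ P f + z) - κF (a ∸ i)) lastT ∙ alg (Σ P f) ((pow π W * c_ P i) * Zp i p) (κF (a ∸ i)))) (ploc-+ (ploc-Σ P (λ κ l → ploc-≡ (*-comm (Zp i κ) (pow π W * c_ κ i)) (ploc-* (Zp-loc i κ (ℕP.≤-pred l)) (c-ploc κ i (ℕP.<⇒≤ l) iA)))) (ploc-≡ (*-comm (Zp i p) (pow π W * c_ P i)) (ploc-* (Zp-loc i p ℕP.≤-refl) (top-ploc i iA))))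
      where
      f : ℕ → ℚ
      f κ = (pow π W * c_ κ i) * Zp i κ
      alg : ∀ s x k → (s + (x + k)) - k ≡ s + x
      alg = solve-∀ ℚring
      lastT : f P ≡ (pow π W * c_ P i) * Zp i p + κF (a ∸ i)
      lastT = *-distribˡ-+ (pow π W * c_ P i) (Zp i p) (pow ((ℤ.+ 1) / suc p) (i ℕ.+ b)) ∙ cong ((pow π W * c_ P i) * Zp i p +_) (cong₂ _*_ (c-top i iA) (cong (λ z → pow z (i ℕ.+ b)) (inv-1/ p)) ∙ a₁ (pow π (i ℕ.+ b)) (κF (a ∸ i)) (pow (inv π) (i ℕ.+ b)) ∙ cong (_* κF (a ∸ i)) (pow-inv π (i ℕ.+ b) π≢0) ∙ *-identityˡ _)
        where
        a₁ : ∀ x k y → (x * k) * y ≡ (x * y) * k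
        a₁ = solve-∀ ℚring

    -- Multiply a vanishing form by Q P^W. The part with the values z i is divisible by P, since Q
    -- clears their denominators, and the rest is congruent to a unit times Q `Nb`; so P would
    -- divide Q or `Nb`.
    nonvanishing : ∀ z Q → (∀ i → i ℕ.< A → IsInt (ιℕ Q * z i)) → ¬ P ∣ Q → ¬ P ∣ ℤ.∣ Nb β a ∣ → Lform z ≢ 0ℚ
    nonvanishing z Q hz nQ nN L≡0 = [ nQ , nN ]′ (euclidsLemma Q ℤ.∣ Nb β a ∣ pr (subst (P ∣_) (ℤP.abs-* (ℤ.+ Q) (Nb β a)) (ploc-int ((ℤ.+ Q) ℤ.* Nb β a) s₅)))
      where
      q = ιℕ Q
      pw = pow π W
      S₁ S₂ S₃ : ℚ
      S₁ = Σ A (λ i → ι (C i) * (ρ i * z i))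
      S₂ = Σ A (λ i → ι (C i) * Σ (suc P) (λ κ → c_ κ i * Zp i κ))
      S₃ = Σ A (λ i → ι (C i) * κF (a ∸ i))
      S₄ : ℚ
      S₄ = Σ A (λ i → ι (C i) * γ (a ∸ i))
      lC : ∀ i → Loc (ι (C i))
      lC i = loc-int (int-ι (C i))
      p₁ : PLoc (pw * (q * S₁))
      p₁ = ploc-≡ (Σ-* A pw _ ∙ cong (pw *_) (Σ-* A q _)) (ploc-Σ A (λ i l → ploc-≡ (a₁ (ι (C i)) (q * z i) pw (ρ i) q (z i) refl) (ploc-* (loc-* (lC i) (loc-int (hz i l))) (ploc-≡ (Σ-* (suc P) pw _) (ploc-Σ (suc P) (λ κ k< → c-ploc κ i (ℕP.≤-pred k<) l))))))
        where
        a₁ : ∀ c qz p r q z → qz ≡ q * z → (c * qz) * (p * r) ≡ p * (q * (c * (r * z)))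
        a₁ c _ p r q z refl = a₂ c q z p r
          where
          a₂ : ∀ c q z p r → (c * (q * z)) * (p * r) ≡ p * (q * (c * (r * z)))
          a₂ = solve-∀ ℚring
      p₂ : PLoc (pw * S₂ - S₃)
      p₂ = ploc-≡ (Σ-+ A _ _ ∙ cong₂ _+_ (Σ-* A pw _) (Σ-* A (- 1ℚ) _ ∙ alg S₃)) (ploc-Σ A (λ i l → ploc-≡ (a₁ (ι (C i)) pw (Σ (suc P) (λ κ → c_ κ i * Zp i κ)) (κF (a ∸ i)) ) (ploc-* (lC i) (ploc-≡ (cong (_- κF (a ∸ i)) (Σ-cong (suc P) (λ κ _ → *-assoc pw (c_ κ i) (Zp i κ)) ∙ Σ-* (suc P) pw _)) (inner i l)))))
        where
        alg : ∀ x → (- 1ℚ) * x ≡ - x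
        alg = solve-∀ ℚring
        a₁ : ∀ c p s k → c * (p * s - k) ≡ p * (c * s) + (- 1ℚ) * (c * k)
        a₁ = solve-∀ ℚring
      s₃ : PLoc (q * S₃)
      s₃ = ploc-≡ (a₁ pw q S₁ S₂ S₃ ∙ cong (λ z → (q * S₃) + pw * (q * z)) L≡0 ∙ a₂ (q * S₃) pw q) (ploc-+ p₁ (ploc-neg (ploc-* (loc-int (int-ι (ℤ.+ Q))) p₂)))
        where
        a₁ : ∀ p q x y w → p * (q * x) + (- (q * (p * y - w))) ≡ (q * w) + p * (q * (x - y))
        a₁ = solve-∀ ℚring
        a₂ : ∀ w p q → w + p * (q * 0ℚ) ≡ w
        a₂ = solve-∀ ℚring
      p₃ : PLoc (S₃ - μF * S₄)
      p₃ = ploc-≡ (Σ-+ A _ _ ∙ cong (S₃ +_) (Σ-* A (- μF) (λ i → ι (C i) * γ (a ∸ i)) ∙ alg μF S₄)) (ploc-Σ A (λ i l → ploc-≡ (a₁ (ι (C i)) (κF (a ∸ i)) μF (γ (a ∸ i))) (ploc-* (lC i) (cong-κ final (a ∸ i)))))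
        where
        alg : ∀ m x → (- m) * x ≡ - (m * x)
        alg = solve-∀ ℚring
        a₁ : ∀ c k m g → c * (k - m * g) ≡ c * k + (- m) * (c * g)
        a₁ = solve-∀ ℚring
      x = proj₁ (proj₂ (unit final))
      lx = proj₁ (proj₂ (proj₂ (unit final)))
      xe : x * μF ≡ 1ℚ
      xe = proj₂ (proj₂ (proj₂ (unit final)))
      s₄ : PLoc (q * S₄)
      s₄ = ploc-≡ (a₁ x q S₃ μF S₄ ∙ cong (λ z → z * (q * S₄)) xe ∙ *-identityˡ (q * S₄)) (ploc-* lx (ploc-+ s₃ (ploc-neg (ploc-* (loc-int (int-ι (ℤ.+ Q))) p₃))))
        where
        a₁ : ∀ x q s m t → x * (q * s + (- (q * (s - m * t)))) ≡ (x * m) * (q * t)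
        a₁ = solve-∀ ℚring
      s₅ : PLoc (ι ((ℤ.+ Q) ℤ.* Nb β a))
      s₅ = ploc-≡ (cong (q *_) (Σ-cong A (λ i l → cong₂ _*_ (cong ι (sym (rowL-bc β (suc i) β ℕP.≤-refl))) (sym (γ-at (a ∸ i) (ℕP.m∸n≤m a i))) ∙ sym (ι-* _ _)) ∙ sym (ι-Σ A _)) ∙ sym (ι-* (ℤ.+ Q) (Nb β a))) s₄

-- Chebyshev's method through floor inequalities

module Chebyshev where

  open Mangoldt
  open PowerSeries using (_∙_) public
  open import Data.Nat
  open import Data.Nat.Properties
  open import Data.Nat.DivMod
  open import Data.Nat.Tactic.RingSolver using (solve-∀)
  open import Data.Bool using (Bool; true; false; _∧_; T)
  open import Data.List using (List; []; _∷_)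
  open import Data.Product using (_×_; _,_; proj₁; proj₂)
  open import Data.Empty using (⊥-elim)
  open import Data.Unit using (tt)
  open import Relation.Nullary
  open import Relation.Binary.PropositionalEquality


  -- An entry (c , m) has weight c and modulus suc m.
  Ent : Set
  Ent = ℕ × ℕ

  S : List Ent → ℕ → ℕ
  S []            X = 0
  S ((c , m) ∷ l) X = c * (X / suc m) + S l X

  b2n : Bool → ℕ
  b2n true  = 1
  b2n false = 0

  step : ℕ → ℕ → ℕ
  step K X = b2n (K ≤ᵇ X)

  -- A penalty (g , K) has weight g from suc K on.
  Pen : List Ent → ℕ → ℕ
  Pen []            X = 0
  Pen ((g , K) ∷ l) X = g * step (suc K) X + Pen l X

  fact : List Ent → ℕ → ℕ
  fact []            B = 1
  fact ((c , m) ∷ l) B = ((B / suc m) !) ^ c * fact l B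

  -- the least common multiple of 1, …, n
  d : ℕ → ℕ
  d n = prod Λ n

  dpen : List Ent → ℕ → ℕ
  dpen []            B = 1
  dpen ((g , K) ∷ l) B = d (B / suc K) ^ g * dpen l B

  -- Nested floors make every ⌊⌊B/M⌋/v⌋ a function of X = ⌊B/v⌋, so that inequalities at all
  -- positions v reduce to a single one in X.
  fl-fl : ∀ B m w → fl (B / suc m) w ≡ fl B w / suc m
  fl-fl B m w = m/n/o≡m/[n*o] B (suc m) (suc w) ∙ /-congʳ {m = B} (*-comm (suc m) (suc w)) ∙ sym (m/n/o≡m/[n*o] B (suc w) (suc m))

  ⟦S⟧ : ∀ l B → ⟦ (λ w → S l (fl B w)) ⟧ B ≡ fact l B
  ⟦S⟧ []            B = ⟦⟧-zero B (λ _ _ → refl)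
  ⟦S⟧ ((c , m) ∷ l) B = ⟦⟧-+ (λ w → c * (fl B w / suc m)) (λ w → S l (fl B w)) B
    ∙ cong₂ _*_ (⟦⟧-* c (λ w → fl B w / suc m) B ∙ cong (_^ c) (⟦⟧-cong B (λ w _ → sym (fl-fl B m w)) ∙ ⟦fl⟧ B (B / suc m) (m/n≤m B (suc m)))) (⟦S⟧ l B)

  step-yes : ∀ K X → K ≤ X → step K X ≡ 1
  step-yes K X l with K ≤ᵇ X | ≤⇒≤ᵇ l
  ... | true | _ = refl

  step-no : ∀ K X → X < K → step K X ≡ 0
  step-no K X l with K ≤ᵇ X in eq
  ... | true  = ⊥-elim (<⇒≱ l (≤ᵇ⇒≤ K X (subst T (sym eq) tt)))
  ... | false = refl

  -- X > K means v ≤ B/(K+1), so a penalty collects exactly the values of `Λ` that make up an lcm.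
  ⟦step⟧ : ∀ K B → ⟦ (λ w → step (suc K) (fl B w)) ⟧ B ≡ d (B / suc K)
  ⟦step⟧ K B = go B (m/n≤m B (suc K)) (λ w l → step-yes (suc K) (fl B w) (big w l)) (λ w l → step-no (suc K) (fl B w) (small w l))
    where
    N = B / suc K
    big : ∀ w → w < N → suc K ≤ fl B w
    big w l = subst (_≤ fl B w) (m*n/n≡m (suc K) (suc w)) (/-monoˡ-≤ (suc w) (≤-trans (≤-reflexive (*-comm (suc K) (suc w))) (≤-trans (*-monoˡ-≤ (suc K) l) (m/n*n≤m B (suc K)))))
    small : ∀ w → N ≤ w → fl B w < suc K
    small w l = m<n*o⇒m/o<n (≤-trans (≤-trans (≤-reflexive (cong suc (m≡m%n+[m/n]*n B (suc K)))) (+-monoˡ-≤ (N * suc K) (m%n<n B (suc K)))) (≤-trans (*-monoˡ-≤ (suc K) (s≤s l)) (≤-reflexive (*-comm (suc w) (suc K)))))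
    go : ∀ C → N ≤ C → (∀ w → w < N → step (suc K) (fl B w) ≡ 1) → (∀ w → N ≤ w → step (suc K) (fl B w) ≡ 0) → prod (λ w → Λ w ^ step (suc K) (fl B w)) C ≡ prod Λ N
    go C l h₁ h₀ with m≤n⇒∃[o]m+o≡n l
    ... | o , refl = extend o
      where
      extend : ∀ o → prod (λ w → Λ w ^ step (suc K) (fl B w)) (N + o) ≡ prod Λ N
      extend zero    = cong (prod _) (+-identityʳ N) ∙ prod-cong N (λ w l → cong (Λ w ^_) (h₁ w l) ∙ *-identityʳ (Λ w))
      extend (suc o) = cong (prod _) (+-suc N o) ∙ cong₂ _*_ (extend o) (cong (Λ (N + o) ^_) (h₀ (N + o) (m≤m+n N o))) ∙ *-identityʳ _

  ⟦Pen⟧ : ∀ l B → ⟦ (λ w → Pen l (fl B w)) ⟧ B ≡ dpen l B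
  ⟦Pen⟧ []            B = ⟦⟧-zero B (λ _ _ → refl)
  ⟦Pen⟧ ((g , K) ∷ l) B = ⟦⟧-+ (λ w → g * step (suc K) (fl B w)) (λ w → Pen l (fl B w)) B
    ∙ cong₂ _*_ (⟦⟧-* g (λ w → step (suc K) (fl B w)) B ∙ cong (_^ g) (⟦step⟧ K B)) (⟦Pen⟧ l B)

  -- Chebyshev's method: an inequality between floor sums bounds a product of values of Λ.
  chebyshev : ∀ pos neg pen (s : ℕ) (Y : ℕ → ℕ) B →
    (∀ X → s * Y X + S neg X ≤ S pos X + Pen pen X) →
    ⟦ (λ w → Y (fl B w)) ⟧ B ^ s * fact neg B ≤ fact pos B * dpen pen B
  chebyshev pos neg pen s Y B h = subst₂ _≤_
    (⟦⟧-+ (λ w → s * Y (fl B w)) (λ w → S neg (fl B w)) B ∙ cong₂ _*_ (⟦⟧-* s (λ w → Y (fl B w)) B) (⟦S⟧ neg B))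
    (⟦⟧-+ (λ w → S pos (fl B w)) (λ w → Pen pen (fl B w)) B ∙ cong₂ _*_ (⟦S⟧ pos B) (⟦Pen⟧ pen B))
    (⟦⟧-≤ B (λ w _ → h (fl B w)))

  -- Verification of the floor inequality: by evaluation for X < XM, and by dropping the
  -- fractional parts beyond XM.
  bal : ℕ → List Ent → ℕ
  bal L []            = 0
  bal L ((c , m) ∷ l) = c * (L / suc m) + bal L l

  wt : List Ent → ℕ
  wt []            = 0
  wt ((c , m) ∷ l) = c + wt l

  allDiv : ℕ → List Ent → Bool
  allDiv L []            = true
  allDiv L ((c , m) ∷ l) = ((L / suc m) * suc m ≡ᵇ L) ∧ allDiv L l

  ∧-split : ∀ {a b} → (a ∧ b) ≡ true → a ≡ true × b ≡ true
  ∧-split {true} {true} refl = refl , refl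

  ≡ᵇ-true : ∀ {a b} → (a ≡ᵇ b) ≡ true → a ≡ b
  ≡ᵇ-true {a} {b} e = ≡ᵇ⇒≡ a b (subst T (sym e) tt)

  ≤ᵇ-true : ∀ {a b} → (a ≤ᵇ b) ≡ true → a ≤ b
  ≤ᵇ-true {a} {b} e = ≤ᵇ⇒≤ a b (subst T (sym e) tt)

  S-upper : ∀ L l X → allDiv L l ≡ true → L * S l X ≤ bal L l * X
  S-upper L []            X h = ≤-reflexive (*-zeroʳ L)
  S-upper L ((c , m) ∷ l) X h = ≤-trans (≤-reflexive (*-distribˡ-+ L (c * (X / suc m)) (S l X) ∙ cong (_+ L * S l X) (cong (_* (c * (X / suc m))) (sym (≡ᵇ-true {(L / suc m) * suc m} {L} (proj₁ (∧-split {(L / suc m) * suc m ≡ᵇ L} {allDiv L l} h)))) ∙ alg (L / suc m) (suc m) c (X / suc m))))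
     (≤-trans (+-mono-≤ (*-monoʳ-≤ (c * (L / suc m)) (m/n*n≤m X (suc m))) (S-upper L l X (proj₂ (∧-split {(L / suc m) * suc m ≡ᵇ L} {allDiv L l} h)))) (≤-reflexive (sym (*-distribʳ-+ X (c * (L / suc m)) (bal L l)))))
    where
    alg : ∀ q m c x → (q * m) * (c * x) ≡ (c * q) * (x * m)
    alg = solve-∀

  S-lower : ∀ L l X → allDiv L l ≡ true → bal L l * X ≤ L * S l X + L * wt l
  S-lower L []            X h = z≤n
  S-lower L ((c , m) ∷ l) X h = ≤-trans (≤-reflexive (*-distribʳ-+ X (c * (L / suc m)) (bal L l)))
     (≤-trans (+-mono-≤ (≤-trans (*-monoʳ-≤ (c * (L / suc m)) le) (≤-reflexive (alg (L / suc m) (suc m) c (X / suc m) ∙ cong (_* (c * suc (X / suc m))) (≡ᵇ-true {(L / suc m) * suc m} {L} (proj₁ (∧-split {(L / suc m) * suc m ≡ᵇ L} {allDiv L l} h)))))) (S-lower L l X (proj₂ (∧-split {(L / suc m) * suc m ≡ᵇ L} {allDiv L l} h)))) (≤-reflexive (alg₂ L c (X / suc m) (S l X) (wt l))))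
    where
    le : X ≤ suc (X / suc m) * suc m
    le = <⇒≤ (≤-trans (≤-reflexive (cong suc (m≡m%n+[m/n]*n X (suc m)))) (+-monoˡ-≤ (X / suc m * suc m) (m%n<n X (suc m))))
    alg : ∀ q m c x → (c * q) * (suc x * m) ≡ (q * m) * (c * suc x)
    alg = solve-∀
    alg₂ : ∀ L c x s w → L * (c * suc x) + (L * s + L * w) ≡ L * (c * x + s) + L * (c + w)
    alg₂ = solve-∀

  Pen-mono : ∀ l {X X′} → X ≤ X′ → Pen l X ≤ Pen l X′
  Pen-mono []            h = ≤-refl
  Pen-mono ((g , K) ∷ l) {X} {X′} h = +-mono-≤ (*-monoʳ-≤ g st) (Pen-mono l h)
    where
    st : step (suc K) X ≤ step (suc K) X′
    st with suc K ≤? X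
    ... | yes y = ≤-reflexive (step-yes (suc K) X y ∙ sym (step-yes (suc K) X′ (≤-trans y h)))
    ... | no ¬y = ≤-trans (≤-reflexive (step-no (suc K) X (≰⇒> ¬y))) z≤n

  check : (ℕ → ℕ) → List Ent → List Ent → List Ent → ℕ → ℕ → ℕ → Bool
  check Y pos neg pen s zero    X = true
  check Y pos neg pen s (suc k) X = (s * Y X + S neg X ≤ᵇ S pos X + Pen pen X) ∧ check Y pos neg pen s k (suc X)

  check-sound : ∀ Y pos neg pen s k X₀ → check Y pos neg pen s k X₀ ≡ true → ∀ X → X₀ ≤ X → X < X₀ + k → s * Y X + S neg X ≤ S pos X + Pen pen X
  check-sound Y pos neg pen s zero    X₀ h X l l′ = ⊥-elim (<⇒≱ l′ (≤-trans (≤-reflexive (+-identityʳ X₀)) l))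
  check-sound Y pos neg pen s (suc k) X₀ h X l l′ with X₀ ≟ X
  ... | yes refl = ≤ᵇ-true (proj₁ (∧-split h))
  ... | no ne = check-sound Y pos neg pen s k (suc X₀) (proj₂ (∧-split h)) X (≤∧≢⇒< l ne) (≤-trans l′ (≤-reflexive (+-suc X₀ k)))

  -- In chunks, to keep the evaluation stack short.
  checks : (ℕ → ℕ) → List Ent → List Ent → List Ent → ℕ → ℕ → ℕ → ℕ → Bool
  checks Y pos neg pen s len zero    X = true
  checks Y pos neg pen s len (suc j) X = check Y pos neg pen s len X ∧ checks Y pos neg pen s len j (len + X)

  checks-sound : ∀ Y pos neg pen s len j X₀ → checks Y pos neg pen s len j X₀ ≡ true → ∀ X → X₀ ≤ X → X < X₀ + j * len → s * Y X + S neg X ≤ S pos X + Pen pen X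
  checks-sound Y pos neg pen s len zero    X₀ h X l l′ = ⊥-elim (<⇒≱ l′ (≤-trans (≤-reflexive (+-identityʳ X₀)) l))
  checks-sound Y pos neg pen s len (suc j) X₀ h X l l′ with X <? X₀ + len
  ... | yes x = check-sound Y pos neg pen s len X₀ (proj₁ (∧-split h)) X l x
  ... | no ¬x = checks-sound Y pos neg pen s len j (len + X₀) (proj₂ (∧-split {check Y pos neg pen s len X₀} h)) X (≤-trans (≤-reflexive (+-comm len X₀)) (≮⇒≥ ¬x))
     (≤-trans l′ (≤-reflexive (sym (+-assoc X₀ len (j * len)) ∙ cong (_+ j * len) (+-comm X₀ len))))

  -- In the tail, equal linear growth (`bal`) and dropped fractional parts give S neg ≤ S pos + wt
  -- pos; the penalties have to pay for this loss and for s ymax.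
  certificate : ∀ Y pos neg pen s L ymax len j .{{_ : NonZero L}} → (∀ X → Y X ≤ ymax) →
    checks Y pos neg pen s len j 0 ≡ true → allDiv L pos ≡ true → allDiv L neg ≡ true → (bal L pos ≡ᵇ bal L neg) ≡ true →
    (s * ymax + wt pos ≤ᵇ Pen pen (j * len)) ≡ true → ∀ X → s * Y X + S neg X ≤ S pos X + Pen pen X
  certificate Y pos neg pen s L ymax len j hY hc hp hn hb ht X with X <? j * len
  ... | yes l = checks-sound Y pos neg pen s len j 0 hc X z≤n l
  ... | no ¬l = *-cancelˡ-≤ L (≤-trans (≤-reflexive (*-distribˡ-+ L (s * Y X) (S neg X)))
      (≤-trans (+-monoʳ-≤ (L * (s * Y X)) (≤-trans (S-upper L neg X hn) (≤-trans (≤-reflexive (cong (_* X) (sym (≡ᵇ-true {bal L pos} {bal L neg} hb)))) (S-lower L pos X hp))))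
      (≤-trans (≤-reflexive (alg L (s * Y X) (S pos X) (wt pos))) (*-monoʳ-≤ L (+-monoʳ-≤ (S pos X) (≤-trans (+-monoˡ-≤ (wt pos) (*-monoʳ-≤ s (hY X))) (≤-trans (≤ᵇ-true ht) (Pen-mono pen (≮⇒≥ ¬l)))))))))
    where
    alg : ∀ L y p w → L * y + (L * p + L * w) ≡ L * (p + (y + w))
    alg = solve-∀

-- Exponential rates of factorial quotients

module Certificates where

  open Mangoldt
  open Chebyshev
  open import Data.Nat
  open import Data.Nat.Properties
  open import Data.Nat.DivMod
  open import Data.Nat.Induction using (<-rec)
  open import Data.Nat.Tactic.RingSolver using (solve-∀)
  open import Data.Bool using (Bool; true; false; _∧_; T)
  open import Data.List using (List; []; _∷_)
  open import Data.Product using (_,_; proj₁; proj₂)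
  open import Data.Empty using (⊥-elim)
  open import Relation.Nullary
  open import Relation.Binary.PropositionalEquality
  open ≤-Reasoning

  ^-distribʳ-* : ∀ a b n → (a * b) ^ n ≡ a ^ n * b ^ n
  ^-distribʳ-* a b zero    = refl
  ^-distribʳ-* a b (suc n) = cong (a * b *_) (^-distribʳ-* a b n) ∙ alg a b (a ^ n) (b ^ n)
    where
    alg : ∀ a b c d → a * b * (c * d) ≡ a * c * (b * d)
    alg = solve-∀

  pow-cancel : ∀ {a b} n → a ^ suc n ≤ b ^ suc n → a ≤ b
  pow-cancel {a} {b} n h with a ≤? b
  ... | yes l = l
  ... | no ¬l = ⊥-elim (<⇒≱ (^-monoˡ-< (suc n) (≰⇒> ¬l)) h)

  ≥1-^ : ∀ {a} n → 1 ≤ a → 1 ≤ a ^ n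
  ≥1-^ n l = ≤-trans (≤-reflexive (sym (^-zeroˡ n))) (^-monoˡ-≤ n l)

  -- The Pochhammer symbol (x+1)_M.
  rise : ℕ → ℕ → ℕ
  rise x zero    = 1
  rise x (suc M) = rise x M * (x + suc M)

  rise-! : ∀ x M → (x + M) ! ≡ x ! * rise x M
  rise-! x zero    = cong _! (+-identityʳ x) ∙ sym (*-identityʳ (x !))
  rise-! x (suc M) = cong _! (+-suc x M) ∙ cong (suc (x + M) *_) (rise-! x M) ∙ cong (_* (x ! * rise x M)) (sym (+-suc x M)) ∙ alg (x + suc M) (x !) (rise x M)
    where
    alg : ∀ a b c → a * (b * c) ≡ b * (c * a)
    alg = solve-∀

  rise-≥ : ∀ x M → suc x ^ M ≤ rise x M
  rise-≥ x zero    = ≤-refl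
  rise-≥ x (suc M) = begin
    suc x * suc x ^ M  ≡⟨ *-comm (suc x) (suc x ^ M) ⟩
    suc x ^ M * suc x  ≤⟨ *-mono-≤ (rise-≥ x M) (≤-trans (s≤s (m≤m+n x M)) (≤-reflexive (sym (+-suc x M)))) ⟩
    rise x M * (x + suc M) ∎

  rise-≤ : ∀ x M T → x + M ≤ T → rise x M ≤ T ^ M
  rise-≤ x zero    T l = ≤-refl
  rise-≤ x (suc M) T l = begin
    rise x M * (x + suc M) ≤⟨ *-mono-≤ (rise-≤ x M T (≤-trans (+-monoʳ-≤ x (n≤1+n M)) l)) l ⟩
    T ^ M * T              ≡⟨ *-comm (T ^ M) T ⟩
    T ^ suc M ∎

  -- Stands in for Stirling's formula: the factors of (My)! are cut into y blocks of length M, and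
  -- each is bounded by the multiple of M at the end of its block. `fact-upper` is the converse up
  -- to a polynomial factor.
  fact-lower : ∀ M y → (M * y) ! ≤ (y !) ^ M * M ^ (M * y)
  fact-lower M zero = begin
    (M * 0) !  ≡⟨ cong _! (*-zeroʳ M) ⟩
    1          ≡⟨ sym (cong₂ _*_ (^-zeroˡ M) (cong (M ^_) (*-zeroʳ M))) ⟩
    1 ^ M * M ^ (M * 0) ∎
  fact-lower M (suc y) = begin
    (M * suc y) !                            ≡⟨ cong _! (*-suc M y ∙ +-comm M (M * y)) ⟩
    (M * y + M) !                            ≡⟨ rise-! (M * y) M ⟩
    (M * y) ! * rise (M * y) M               ≤⟨ *-mono-≤ (fact-lower M y) (rise-≤ (M * y) M (M * suc y) (≤-reflexive (+-comm (M * y) M ∙ sym (*-suc M y)))) ⟩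
    (y !) ^ M * M ^ (M * y) * (M * suc y) ^ M  ≡⟨ cong ((y !) ^ M * M ^ (M * y) *_) (^-distribʳ-* M (suc y) M) ⟩
    (y !) ^ M * M ^ (M * y) * (M ^ M * suc y ^ M) ≡⟨ alg ((y !) ^ M) (M ^ (M * y)) (M ^ M) (suc y ^ M) ⟩
    (suc y ^ M * (y !) ^ M) * (M ^ M * M ^ (M * y)) ≡⟨ cong₂ _*_ (sym (^-distribʳ-* (suc y) (y !) M)) (sym (^-distribˡ-+-* M M (M * y)) ∙ cong (M ^_) (sym (*-suc M y))) ⟩
    (suc y !) ^ M * M ^ (M * suc y) ∎
    where
    alg : ∀ a b c d → a * b * (c * d) ≡ (d * a) * (c * b)
    alg = solve-∀

  fact-upper : ∀ M y → (y !) ^ M * M ^ (M * y) ≤ (M * y) ! * suc (M * y) ^ M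
  fact-upper M zero = begin
    1 ^ M * M ^ (M * 0) ≡⟨ cong₂ _*_ (^-zeroˡ M) (cong (M ^_) (*-zeroʳ M)) ⟩
    1                   ≡⟨ sym (cong₂ _*_ (cong _! (*-zeroʳ M)) (cong (λ z → suc z ^ M) (*-zeroʳ M) ∙ ^-zeroˡ M)) ⟩
    (M * 0) ! * suc (M * 0) ^ M ∎
  fact-upper M (suc y) = begin
    (suc y !) ^ M * M ^ (M * suc y)                 ≡⟨ cong₂ _*_ (^-distribʳ-* (suc y) (y !) M) (cong (M ^_) (*-suc M y) ∙ ^-distribˡ-+-* M M (M * y)) ⟩
    (suc y ^ M * (y !) ^ M) * (M ^ M * M ^ (M * y)) ≡⟨ alg (suc y ^ M) ((y !) ^ M) (M ^ M) (M ^ (M * y)) ⟩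
    ((y !) ^ M * M ^ (M * y)) * (M ^ M * suc y ^ M) ≡⟨ cong ((y !) ^ M * M ^ (M * y) *_) (sym (^-distribʳ-* M (suc y) M)) ⟩
    ((y !) ^ M * M ^ (M * y)) * (M * suc y) ^ M     ≤⟨ *-mono-≤ (fact-upper M y) (^-monoˡ-≤ M (n≤1+n (M * suc y))) ⟩
    (M * y) ! * suc (M * y) ^ M * suc (M * suc y) ^ M ≤⟨ *-monoˡ-≤ (suc (M * suc y) ^ M) (*-monoʳ-≤ ((M * y) !) (rise-≥ (M * y) M)) ⟩
    (M * y) ! * rise (M * y) M * suc (M * suc y) ^ M ≡⟨ cong (_* suc (M * suc y) ^ M) (sym (cong _! (*-suc M y ∙ +-comm M (M * y)) ∙ rise-! (M * y) M)) ⟩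
    (M * suc y) ! * suc (M * suc y) ^ M ∎
    where
    alg : ∀ a b c d → (a * b) * (c * d) ≡ (b * d) * (c * a)
    alg = solve-∀

  module _ (B m : ℕ) where
    private
      M = suc m
      y = B / M
      My≤B : M * y ≤ B
      My≤B = ≤-trans (≤-reflexive (*-comm M y)) (m/n*n≤m B M)
      B≤ : B ≤ M * y + M
      B≤ = ≤-trans (≤-reflexive (m≡m%n+[m/n]*n B M)) (≤-trans (+-monoˡ-≤ (y * M) (<⇒≤ (m%n<n B M))) (≤-reflexive (+-comm M (y * M) ∙ cong (_+ M) (*-comm y M))))

    term-upper : (y !) ^ M * M ^ B ≤ B ! * (suc B * M) ^ M
    term-upper = begin
      (y !) ^ M * M ^ B                ≤⟨ *-monoʳ-≤ ((y !) ^ M) (≤-trans (^-monoʳ-≤ M B≤) (≤-reflexive (^-distribˡ-+-* M (M * y) M))) ⟩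
      (y !) ^ M * (M ^ (M * y) * M ^ M) ≡⟨ sym (*-assoc ((y !) ^ M) (M ^ (M * y)) (M ^ M)) ⟩
      (y !) ^ M * M ^ (M * y) * M ^ M  ≤⟨ *-monoˡ-≤ (M ^ M) (fact-upper M y) ⟩
      (M * y) ! * suc (M * y) ^ M * M ^ M ≤⟨ *-monoˡ-≤ (M ^ M) (*-mono-≤ (m≤n⇒m!≤n! My≤B) (^-monoˡ-≤ M (s≤s My≤B))) ⟩
      B ! * suc B ^ M * M ^ M          ≡⟨ *-assoc (B !) (suc B ^ M) (M ^ M) ∙ cong (B ! *_) (sym (^-distribʳ-* (suc B) M M)) ⟩
      B ! * (suc B * M) ^ M ∎
      where
      m≤n⇒m!≤n! : ∀ {a b} → a ≤ b → a ! ≤ b !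
      m≤n⇒m!≤n! {a} {b} l with m≤n⇒∃[o]m+o≡n l
      ... | o , refl = ≤-trans (m≤m*n (a !) (rise a o) {{>-nonZero (≤-trans (≥1-^ o (s≤s z≤n)) (rise-≥ a o))}}) (≤-reflexive (sym (rise-! a o)))

    term-lower : B ! ≤ ((y !) ^ M * M ^ B) * (suc B * M) ^ M
    term-lower = begin
      B !                              ≡⟨ cong _! (sym (m+[n∸m]≡n My≤B)) ∙ rise-! (M * y) (B ∸ M * y) ⟩
      (M * y) ! * rise (M * y) (B ∸ M * y) ≤⟨ *-mono-≤ (fact-lower M y) (≤-trans (rise-≤ (M * y) (B ∸ M * y) (suc B) (≤-trans (≤-reflexive (m+[n∸m]≡n My≤B)) (n≤1+n B))) (^-monoʳ-≤ (suc B) (m≤n+o⇒m∸n≤o B (M * y) B≤))) ⟩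
      (y !) ^ M * M ^ (M * y) * suc B ^ M ≤⟨ *-mono-≤ (*-monoʳ-≤ ((y !) ^ M) (^-monoʳ-≤ M My≤B)) (^-monoˡ-≤ M (m≤m*n (suc B) M)) ⟩
      (y !) ^ M * M ^ B * (suc B * M) ^ M ∎

  -- With M = m + 1 this is the exponential of L Σ c (log M)/M, the rate at which (⌊B/M⌋!)^c falls
  -- behind (B!)^(c/M).
  mm : ℕ → List Ent → ℕ
  mm L []            = 1
  mm L ((c , m) ∷ l) = (suc m) ^ (c * (L / suc m)) * mm L l

  bounded : ℕ → List Ent → Bool
  bounded Mx []            = true
  bounded Mx ((c , m) ∷ l) = (suc m ≤ᵇ Mx) ∧ bounded Mx l

  module Product (L B Mx : ℕ) where
    R = suc B * Mx

    private
      expo : ∀ {m} → (L / suc m) * suc m ≡ L → ∀ c → suc m * (c * (L / suc m)) ≡ c * L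
      expo {m} e c = alg (suc m) c (L / suc m) ∙ cong (c *_) e
        where
        alg : ∀ a c q → a * (c * q) ≡ c * (q * a)
        alg = solve-∀

    -- Raising to the power L turns the exponents c/M into integers; all rounding errors go into
    -- powers of `R`, which is linear in B.
    upper : ∀ l → allDiv L l ≡ true → bounded Mx l ≡ true → fact l B ^ L * mm L l ^ B ≤ (B !) ^ bal L l * R ^ (wt l * L)
    upper [] hd hb = ≤-reflexive (cong₂ _*_ (^-zeroˡ L) (^-zeroˡ B))
    upper ((c , m) ∷ l) hd hb = begin
      (F ^ c * fact l B) ^ L * (M ^ e * mm L l) ^ B ≡⟨ cong₂ _*_ (^-distribʳ-* (F ^ c) (fact l B) L) (^-distribʳ-* (M ^ e) (mm L l) B) ⟩
      ((F ^ c) ^ L * fact l B ^ L) * ((M ^ e) ^ B * mm L l ^ B) ≡⟨ cong₂ (λ p q → (p * fact l B ^ L) * (q * mm L l ^ B)) (^-*-assoc F c L ∙ cong (F ^_) (sym (expo eq c)) ∙ sym (^-*-assoc F M e)) (^-*-assoc M e B ∙ cong (M ^_) (*-comm e B) ∙ sym (^-*-assoc M B e)) ⟩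
      ((F ^ M) ^ e * fact l B ^ L) * ((M ^ B) ^ e * mm L l ^ B) ≡⟨ alg ((F ^ M) ^ e) (fact l B ^ L) ((M ^ B) ^ e) (mm L l ^ B) ∙ cong (_* (fact l B ^ L * mm L l ^ B)) (sym (^-distribʳ-* (F ^ M) (M ^ B) e)) ⟩
      (F ^ M * M ^ B) ^ e * (fact l B ^ L * mm L l ^ B) ≤⟨ *-mono-≤ (^-monoˡ-≤ e (≤-trans (term-upper B m) (*-monoʳ-≤ (B !) (^-monoˡ-≤ M (*-monoʳ-≤ (suc B) le))))) (upper l (proj₂ hd′) (proj₂ hb′)) ⟩
      (B ! * R ^ M) ^ e * ((B !) ^ bal L l * R ^ (wt l * L)) ≡⟨ cong (_* ((B !) ^ bal L l * R ^ (wt l * L))) (^-distribʳ-* (B !) (R ^ M) e ∙ cong ((B !) ^ e *_) (^-*-assoc R M e ∙ cong (R ^_) (expo eq c))) ⟩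
      ((B !) ^ e * R ^ (c * L)) * ((B !) ^ bal L l * R ^ (wt l * L)) ≡⟨ alg ((B !) ^ e) (R ^ (c * L)) ((B !) ^ bal L l) (R ^ (wt l * L)) ⟩
      ((B !) ^ e * (B !) ^ bal L l) * (R ^ (c * L) * R ^ (wt l * L)) ≡⟨ cong₂ _*_ (sym (^-distribˡ-+-* (B !) e (bal L l))) (sym (^-distribˡ-+-* R (c * L) (wt l * L)) ∙ cong (R ^_) (sym (*-distribʳ-+ L c (wt l)))) ⟩
      (B !) ^ (e + bal L l) * R ^ ((c + wt l) * L) ∎
      where
      M = suc m
      F = (B / M) !
      e = c * (L / M)
      hd′ = ∧-split {(L / suc m) * suc m ≡ᵇ L} {allDiv L l} hd
      hb′ = ∧-split {suc m ≤ᵇ Mx} {bounded Mx l} hb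
      eq : (L / suc m) * suc m ≡ L
      eq = ≡ᵇ-true {(L / suc m) * suc m} {L} (proj₁ hd′)
      le : M ≤ Mx
      le = ≤ᵇ-true {suc m} {Mx} (proj₁ hb′)
      alg : ∀ a b c d → (a * b) * (c * d) ≡ (a * c) * (b * d)
      alg = solve-∀

    lower : ∀ l → allDiv L l ≡ true → bounded Mx l ≡ true → (B !) ^ bal L l ≤ (fact l B ^ L * mm L l ^ B) * R ^ (wt l * L)
    lower [] hd hb = ≤-reflexive (sym (cong₂ (λ p q → p * q * 1) (^-zeroˡ L) (^-zeroˡ B)))
    lower ((c , m) ∷ l) hd hb = begin
      (B !) ^ (e + bal L l)           ≡⟨ ^-distribˡ-+-* (B !) e (bal L l) ⟩
      (B !) ^ e * (B !) ^ bal L l     ≤⟨ *-mono-≤ (^-monoˡ-≤ e (≤-trans (term-lower B m) (*-monoʳ-≤ (F ^ M * M ^ B) (^-monoˡ-≤ M (*-monoʳ-≤ (suc B) le))))) (lower l (proj₂ hd′) (proj₂ hb′)) ⟩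
      (F ^ M * M ^ B * R ^ M) ^ e * ((fact l B ^ L * mm L l ^ B) * R ^ (wt l * L)) ≡⟨ cong (_* ((fact l B ^ L * mm L l ^ B) * R ^ (wt l * L))) (^-distribʳ-* (F ^ M * M ^ B) (R ^ M) e ∙ cong₂ _*_ (^-distribʳ-* (F ^ M) (M ^ B) e) (^-*-assoc R M e ∙ cong (R ^_) (expo eq c))) ⟩
      ((F ^ M) ^ e * (M ^ B) ^ e * R ^ (c * L)) * ((fact l B ^ L * mm L l ^ B) * R ^ (wt l * L)) ≡⟨ alg ((F ^ M) ^ e) ((M ^ B) ^ e) (R ^ (c * L)) (fact l B ^ L) (mm L l ^ B) (R ^ (wt l * L)) ⟩
      (((F ^ M) ^ e * fact l B ^ L) * ((M ^ B) ^ e * mm L l ^ B)) * (R ^ (c * L) * R ^ (wt l * L)) ≡⟨ cong₂ _*_ (cong₂ (λ p q → (p * fact l B ^ L) * (q * mm L l ^ B)) (^-*-assoc F M e ∙ cong (F ^_) (expo eq c) ∙ sym (^-*-assoc F c L)) (^-*-assoc M B e ∙ cong (M ^_) (*-comm B e) ∙ sym (^-*-assoc M e B))) (sym (^-distribˡ-+-* R (c * L) (wt l * L)) ∙ cong (R ^_) (sym (*-distribʳ-+ L c (wt l)))) ⟩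
      (((F ^ c) ^ L * fact l B ^ L) * ((M ^ e) ^ B * mm L l ^ B)) * R ^ ((c + wt l) * L) ≡⟨ cong (_* R ^ ((c + wt l) * L)) (sym (cong₂ _*_ (^-distribʳ-* (F ^ c) (fact l B) L) (^-distribʳ-* (M ^ e) (mm L l) B))) ⟩
      ((F ^ c * fact l B) ^ L * (M ^ e * mm L l) ^ B) * R ^ ((c + wt l) * L) ∎
      where
      M = suc m
      F = (B / M) !
      e = c * (L / M)
      hd′ = ∧-split {(L / suc m) * suc m ≡ᵇ L} {allDiv L l} hd
      hb′ = ∧-split {suc m ≤ᵇ Mx} {bounded Mx l} hb
      eq : (L / suc m) * suc m ≡ L
      eq = ≡ᵇ-true {(L / suc m) * suc m} {L} (proj₁ hd′)
      le : M ≤ Mx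
      le = ≤ᵇ-true {suc m} {Mx} (proj₁ hb′)
      alg : ∀ a b r f g s → (a * b * r) * ((f * g) * s) ≡ ((a * f) * (b * g)) * (r * s)
      alg = solve-∀

  -- The lists of logarithms give for every entry (c , m) an integer bound for K log₂ (suc m).
  lsum : ℕ → List Ent → List ℕ → ℕ
  lsum L ((c , m) ∷ l) (x ∷ xs) = c * (L / suc m) * x + lsum L l xs
  lsum L _             _        = 0

  loOK hiOK : ℕ → List Ent → List ℕ → Bool
  loOK K []            []       = true
  loOK K ((c , m) ∷ l) (x ∷ xs) = (2 ^ x ≤ᵇ (suc m) ^ K) ∧ loOK K l xs
  loOK K _             _        = false
  hiOK K []            []       = true
  hiOK K ((c , m) ∷ l) (x ∷ xs) = ((suc m) ^ K ≤ᵇ 2 ^ x) ∧ hiOK K l xs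
  hiOK K _             _        = false

  mm-lo : ∀ K L l xs → loOK K l xs ≡ true → 2 ^ lsum L l xs ≤ mm L l ^ K
  mm-lo K L []            []       h = ≤-reflexive (sym (^-zeroˡ K))
  mm-lo K L ((c , m) ∷ l) (x ∷ xs) h = begin
    2 ^ (e * x + lsum L l xs)        ≡⟨ ^-distribˡ-+-* 2 (e * x) (lsum L l xs) ⟩
    2 ^ (e * x) * 2 ^ lsum L l xs    ≡⟨ cong (_* 2 ^ lsum L l xs) (cong (2 ^_) (*-comm e x) ∙ sym (^-*-assoc 2 x e)) ⟩
    (2 ^ x) ^ e * 2 ^ lsum L l xs    ≤⟨ *-mono-≤ (^-monoˡ-≤ e (≤ᵇ-true {2 ^ x} {suc m ^ K} (proj₁ h′))) (mm-lo K L l xs (proj₂ h′)) ⟩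
    ((suc m) ^ K) ^ e * mm L l ^ K   ≡⟨ cong (_* mm L l ^ K) (^-*-assoc (suc m) K e ∙ cong (suc m ^_) (*-comm K e) ∙ sym (^-*-assoc (suc m) e K)) ⟩
    ((suc m) ^ e) ^ K * mm L l ^ K   ≡⟨ sym (^-distribʳ-* (suc m ^ e) (mm L l) K) ⟩
    ((suc m) ^ e * mm L l) ^ K ∎
    where
    e = c * (L / suc m)
    h′ = ∧-split {2 ^ x ≤ᵇ (suc m) ^ K} {loOK K l xs} h

  mm-hi : ∀ K L l xs → hiOK K l xs ≡ true → mm L l ^ K ≤ 2 ^ lsum L l xs
  mm-hi K L []            []       h = ≤-reflexive (^-zeroˡ K)
  mm-hi K L ((c , m) ∷ l) (x ∷ xs) h = begin
    ((suc m) ^ e * mm L l) ^ K       ≡⟨ ^-distribʳ-* (suc m ^ e) (mm L l) K ⟩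
    ((suc m) ^ e) ^ K * mm L l ^ K   ≡⟨ cong (_* mm L l ^ K) (^-*-assoc (suc m) e K ∙ cong (suc m ^_) (*-comm e K) ∙ sym (^-*-assoc (suc m) K e)) ⟩
    ((suc m) ^ K) ^ e * mm L l ^ K   ≤⟨ *-mono-≤ (^-monoˡ-≤ e (≤ᵇ-true {suc m ^ K} {2 ^ x} (proj₁ h′))) (mm-hi K L l xs (proj₂ h′)) ⟩
    (2 ^ x) ^ e * 2 ^ lsum L l xs    ≡⟨ cong (_* 2 ^ lsum L l xs) (^-*-assoc 2 x e ∙ cong (2 ^_) (*-comm x e)) ⟩
    2 ^ (e * x) * 2 ^ lsum L l xs    ≡⟨ sym (^-distribˡ-+-* 2 (e * x) (lsum L l xs)) ⟩
    2 ^ (e * x + lsum L l xs) ∎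
    where
    e = c * (L / suc m)
    h′ = ∧-split {(suc m) ^ K ≤ᵇ 2 ^ x} {hiOK K l xs} h

  record Certificate (Y : ℕ → ℕ) : Set where
    field
      pos neg pen : List Ent
      plog nlog : List ℕ
      s L′ K′ ymax len chunks Mx E : ℕ
    L = suc L′
    K = suc K′
    field
      hY : ∀ X → Y X ≤ ymax
      h-check : checks Y pos neg pen s len chunks 0 ≡ true
      h-divp : allDiv L pos ≡ true
      h-divn : allDiv L neg ≡ true
      h-bal : (bal L pos ≡ᵇ bal L neg) ≡ true
      h-tail : (s * ymax + wt pos ≤ᵇ Pen pen (chunks * len)) ≡ true
      h-bp : bounded Mx pos ≡ true
      h-bn : bounded Mx neg ≡ true
      h-lo : loOK K pos plog ≡ true
      h-hi : hiOK K neg nlog ≡ true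
      h-E : (lsum L neg nlog ≤ᵇ lsum L pos plog + L * E) ≡ true

    r : ℕ → ℕ
    r B = (suc B * Mx) ^ (wt pos + wt neg)

    -- Balance cancels the powers of B!, and what is left is the quotient of the two `mm`, compared
    -- through the integer logarithms. The L-th root is extracted only at the end.
    fact-bound : ∀ B → fact pos B ^ K ≤ (fact neg B ^ K * 2 ^ (B * E)) * r B ^ K
    fact-bound B = pow-cancel {fact pos B ^ K} L′ (*-cancelʳ-≤ _ _ (2 ^ (a * B)) {{>-nonZero (≥1-^ (a * B) (s≤s z≤n))}} (begin
      (fp ^ K) ^ L * 2 ^ (a * B)            ≤⟨ *-monoʳ-≤ ((fp ^ K) ^ L) (≤-trans (≤-reflexive (sym (^-*-assoc 2 a B))) (^-monoˡ-≤ B (mm-lo K L pos plog h-lo))) ⟩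
      (fp ^ K) ^ L * (mp ^ K) ^ B           ≡⟨ cong₂ _*_ (swp fp K L) (swp mp K B) ∙ sym (^-distribʳ-* (fp ^ L) (mp ^ B) K) ⟩
      (fp ^ L * mp ^ B) ^ K                 ≤⟨ ^-monoˡ-≤ K (≤-trans (upper pos h-divp h-bp) (≤-trans (*-monoˡ-≤ (R ^ (wt pos * L)) (≤-trans (≤-reflexive (cong ((B !) ^_) (≡ᵇ-true {bal L pos} {bal L neg} h-bal))) (lower neg h-divn h-bn))) (≤-reflexive (*-assoc (fn ^ L * mn ^ B) _ _ ∙ cong ((fn ^ L * mn ^ B) *_) (sym (^-distribˡ-+-* R (wt neg * L) (wt pos * L)) ∙ cong (R ^_) (sym (*-distribʳ-+ L (wt neg) (wt pos)) ∙ cong (_* L) (+-comm (wt neg) (wt pos))) ∙ sym (^-*-assoc R (wt pos + wt neg) L)))))) ⟩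
      ((fn ^ L * mn ^ B) * r B ^ L) ^ K     ≡⟨ ^-distribʳ-* (fn ^ L * mn ^ B) (r B ^ L) K ∙ cong₂ _*_ (^-distribʳ-* (fn ^ L) (mn ^ B) K ∙ cong₂ _*_ (swp fn L K) (swp mn B K)) (swp (r B) L K) ⟩
      ((fn ^ K) ^ L * (mn ^ K) ^ B) * (r B ^ K) ^ L ≤⟨ *-monoˡ-≤ ((r B ^ K) ^ L) (*-monoʳ-≤ ((fn ^ K) ^ L) (^-monoˡ-≤ B (≤-trans (mm-hi K L neg nlog h-hi) (^-monoʳ-≤ 2 (≤ᵇ-true {lsum L neg nlog} {a + L * E} h-E))))) ⟩
      ((fn ^ K) ^ L * (2 ^ (a + L * E)) ^ B) * (r B ^ K) ^ L ≡⟨ cong (λ z → ((fn ^ K) ^ L * z) * (r B ^ K) ^ L) (^-*-assoc 2 (a + L * E) B ∙ cong (2 ^_) (alg a L E B) ∙ ^-distribˡ-+-* 2 (a * B) ((B * E) * L) ∙ cong (2 ^ (a * B) *_) (sym (^-*-assoc 2 (B * E) L))) ⟩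
      ((fn ^ K) ^ L * (2 ^ (a * B) * (2 ^ (B * E)) ^ L)) * (r B ^ K) ^ L ≡⟨ alg₂ ((fn ^ K) ^ L) (2 ^ (a * B)) ((2 ^ (B * E)) ^ L) ((r B ^ K) ^ L) ⟩
      (((fn ^ K) ^ L * (2 ^ (B * E)) ^ L) * (r B ^ K) ^ L) * 2 ^ (a * B) ≡⟨ cong (_* 2 ^ (a * B)) (sym (^-distribʳ-* (fn ^ K * 2 ^ (B * E)) (r B ^ K) L ∙ cong (_* (r B ^ K) ^ L) (^-distribʳ-* (fn ^ K) (2 ^ (B * E)) L))) ⟩
      ((fn ^ K * 2 ^ (B * E)) * r B ^ K) ^ L * 2 ^ (a * B) ∎))
      where
      open Product L B Mx
      fp = fact pos B
      fn = fact neg B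
      mp = mm L pos
      mn = mm L neg
      a = lsum L pos plog
      swp : ∀ x p q → (x ^ p) ^ q ≡ (x ^ q) ^ p
      swp x p q = ^-*-assoc x p q ∙ cong (x ^_) (*-comm p q) ∙ sym (^-*-assoc x q p)
      alg : ∀ a L E B → (a + L * E) * B ≡ a * B + (B * E) * L
      alg = solve-∀
      alg₂ : ∀ f x y z → (f * (x * y)) * z ≡ ((f * y) * z) * x
      alg₂ = solve-∀

    bound : ∀ B → (⟦ (λ w → Y (fl B w)) ⟧ B ^ s) ^ K ≤ 2 ^ (B * E) * (r B ^ K * dpen pen B ^ K)
    bound B = *-cancelˡ-≤ (fact neg B ^ K) {{>-nonZero (≥1-^ K (fact≥1 neg))}} (begin
      fact neg B ^ K * (D ^ s) ^ K          ≡⟨ sym (^-distribʳ-* (fact neg B) (D ^ s) K) ∙ cong (_^ K) (*-comm (fact neg B) (D ^ s)) ⟩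
      (D ^ s * fact neg B) ^ K              ≤⟨ ^-monoˡ-≤ K (chebyshev pos neg pen s Y B (certificate Y pos neg pen s L ymax len chunks hY h-check h-divp h-divn h-bal h-tail)) ⟩
      (fact pos B * dpen pen B) ^ K         ≡⟨ ^-distribʳ-* (fact pos B) (dpen pen B) K ⟩
      fact pos B ^ K * dpen pen B ^ K       ≤⟨ *-monoˡ-≤ (dpen pen B ^ K) (fact-bound B) ⟩
      (fact neg B ^ K * 2 ^ (B * E)) * r B ^ K * dpen pen B ^ K ≡⟨ alg (fact neg B ^ K) (2 ^ (B * E)) (r B ^ K) (dpen pen B ^ K) ⟩
      fact neg B ^ K * (2 ^ (B * E) * (r B ^ K * dpen pen B ^ K)) ∎)
      where
      D = ⟦ (λ w → Y (fl B w)) ⟧ B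
      fact≥1 : ∀ l → 1 ≤ fact l B
      fact≥1 []            = ≤-refl
      fact≥1 ((c , m) ∷ l) = *-mono-≤ (≥1-^ c (1≤n! (B / suc m))) (fact≥1 l)
      alg : ∀ a b c e → (a * b) * c * e ≡ a * (b * (c * e))
      alg = solve-∀

  -- A crude start for a bootstrap: X - 2⌊X/2⌋, plus 1 from X = 2 on, dominates the indicator of X ≥
  -- 1, so d n is at most n!/(⌊n/2⌋!)² times d ⌊n/2⌋. It only has to estimate the small penalty of
  -- Hanson's floor sum.
  d≤16^ : ∀ n → d n ≤ 16 ^ n
  d≤16^ = <-rec _ go
    where
    Y : ℕ → ℕ
    Y zero    = 0
    Y (suc _) = 1
    ineq : ∀ X → 1 * Y X + S ((2 , 1) ∷ []) X ≤ S ((1 , 0) ∷ []) X + Pen ((1 , 1) ∷ []) X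
    ineq zero = z≤n
    ineq (suc zero) = ≤-refl
    ineq X@(suc (suc x)) = ≤-trans (≤-reflexive (alg (X / 2))) (≤-trans (s≤s (m/n*n≤m X 2)) (≤-reflexive (cong suc (sym (n/1≡n X)) ∙ alg′ (X / 1))))
      where
      alg : ∀ y → 1 * 1 + (2 * y + 0) ≡ suc (y * 2)
      alg = solve-∀
      alg′ : ∀ y → suc y ≡ 1 * y + 0 + (1 * 1 + 0)
      alg′ = solve-∀
    dY : ∀ n → ⟦ (λ w → Y (fl n w)) ⟧ n ≡ d n
    dY n = prod-cong n (λ w l → cong (Λ w ^_) (one (fl n w) (m≥n⇒m/n>0 l)) ∙ *-identityʳ (Λ w))
      where
      one : ∀ x → 0 < x → Y x ≡ 1
      one (suc x) _ = refl
    n<2^ : ∀ n → suc n ≤ 2 ^ n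
    n<2^ zero = ≤-refl
    n<2^ (suc n) = ≤-trans (+-mono-≤ (≥1-^ {2} n (s≤s z≤n)) (n<2^ n)) (≤-reflexive (cong (2 ^ n +_) (sym (+-identityʳ (2 ^ n)))))
    go : ∀ n → (∀ {i} → i < n → d i ≤ 16 ^ i) → d n ≤ 16 ^ n
    go zero ih = ≤-refl
    go n@(suc n′) ih = *-cancelʳ-≤ (d n) (16 ^ n) ((y !) ^ 2) {{>-nonZero (≥1-^ 2 (1≤n! y))}} (begin
      d n * (y !) ^ 2                       ≡⟨ cong₂ _*_ (sym (dY n ) ∙ sym (^-identityʳ′ _)) (sym (*-identityʳ ((y !) ^ 2))) ⟩
      ⟦ (λ w → Y (fl n w)) ⟧ n ^ 1 * fact ((2 , 1) ∷ []) n ≤⟨ chebyshev ((1 , 0) ∷ []) ((2 , 1) ∷ []) ((1 , 1) ∷ []) 1 Y n ineq ⟩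
      fact ((1 , 0) ∷ []) n * dpen ((1 , 1) ∷ []) n ≡⟨ cong₂ _*_ (*-identityʳ _ ∙ *-identityʳ _ ∙ cong _! (n/1≡n n)) (*-identityʳ _ ∙ *-identityʳ _) ⟩
      n ! * d y                             ≤⟨ *-mono-≤ nb (ih (m/n<m n 2 (s≤s (s≤s z≤n)))) ⟩
      (Bd) * 16 ^ y                 ≤⟨ fin ⟩
      16 ^ n * (y !) ^ 2 ∎)
      where
      y = n / 2
      Bd = ((y !) ^ 2 * 2 ^ n) * suc n
      ^-identityʳ′ : ∀ x → x ^ 1 ≡ x
      ^-identityʳ′ x = *-identityʳ x
      2y≤ : 2 * y ≤ n
      2y≤ = ≤-trans (≤-reflexive (*-comm 2 y)) (m/n*n≤m n 2)
      n∸ : n ∸ 2 * y ≤ 1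
      n∸ = m≤n+o⇒m∸n≤o n (2 * y) (≤-pred (≤-trans (≤-trans (≤-reflexive (cong suc (m≡m%n+[m/n]*n n 2))) (+-monoˡ-≤ (y * 2) (m%n<n n 2))) (≤-reflexive (+-comm 2 (y * 2) ∙ cong (_+ 2) (*-comm y 2) ∙ +-suc (2 * y) 1))))
      nb : n ! ≤ ((y !) ^ 2 * 2 ^ n) * suc n
      nb = begin
        n !                                  ≡⟨ cong _! (sym (m+[n∸m]≡n 2y≤)) ∙ rise-! (2 * y) (n ∸ 2 * y) ⟩
        (2 * y) ! * rise (2 * y) (n ∸ 2 * y) ≤⟨ *-mono-≤ (fact-lower 2 y) (≤-trans (rise-≤ (2 * y) (n ∸ 2 * y) (suc n) (≤-trans (≤-reflexive (m+[n∸m]≡n 2y≤)) (n≤1+n n))) (≤-trans (^-monoʳ-≤ (suc n) n∸) (≤-reflexive (^-identityʳ′ (suc n))))) ⟩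
        ((y !) ^ 2 * 2 ^ (2 * y)) * suc n    ≤⟨ *-monoˡ-≤ (suc n) (*-monoʳ-≤ ((y !) ^ 2) (^-monoʳ-≤ 2 2y≤)) ⟩
        ((y !) ^ 2 * 2 ^ n) * suc n ∎
      fin : ((y !) ^ 2 * 2 ^ n) * suc n * 16 ^ y ≤ 16 ^ n * (y !) ^ 2
      fin = begin
        ((y !) ^ 2 * 2 ^ n) * suc n * 16 ^ y ≤⟨ *-mono-≤ (*-monoʳ-≤ ((y !) ^ 2 * 2 ^ n) (n<2^ n)) (≤-trans (≤-reflexive (^-*-assoc 4 2 y)) (^-monoʳ-≤ 4 2y≤)) ⟩
        ((y !) ^ 2 * 2 ^ n) * 2 ^ n * 4 ^ n  ≡⟨ alg ((y !) ^ 2) (2 ^ n) (4 ^ n) ∙ cong (_* (y !) ^ 2) (cong (_* 4 ^ n) (sym (^-distribʳ-* 2 2 n)) ∙ sym (^-distribʳ-* 4 4 n)) ⟩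
        16 ^ n * (y !) ^ 2 ∎
        where
        alg : ∀ f a b → f * a * a * b ≡ ((a * a) * b) * f
        alg = solve-∀

-- Decay of the terms of the series

module Estimates where

  open Chebyshev using (_∙_; ≤ᵇ-true; ∧-split)
  open Certificates using (rise; rise-!; ^-distribʳ-*; ≥1-^)
  open import Data.Nat
  open import Data.Nat.Properties
  open import Data.Nat.Tactic.RingSolver using (solve-∀)
  open import Data.Bool using (Bool; true; _∧_)
  open import Data.List using (List; []; _∷_)
  open import Data.Product using (proj₁; proj₂)
  open import Relation.Nullary
  open import Relation.Binary.PropositionalEquality
  open ≤-Reasoning

  evU : List ℕ → ℕ → ℕ
  evU []      x = 0
  evU (c ∷ p) x = c + x * evU p x

  addU : List ℕ → List ℕ → List ℕ
  addU []      q       = q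
  addU (c ∷ p) []      = c ∷ p
  addU (c ∷ p) (e ∷ q) = c + e ∷ addU p q

  scU : ℕ → List ℕ → List ℕ
  scU c []      = []
  scU c (e ∷ q) = c * e ∷ scU c q

  mulU : List ℕ → List ℕ → List ℕ
  mulU []      q = []
  mulU (c ∷ p) q = addU (scU c q) (0 ∷ mulU p q)

  evU-add : ∀ p q x → evU (addU p q) x ≡ evU p x + evU q x
  evU-add []      q       x = refl
  evU-add (c ∷ p) []      x = sym (+-identityʳ _)
  evU-add (c ∷ p) (e ∷ q) x = cong (λ z → c + e + x * z) (evU-add p q x) ∙ alg c e x (evU p x) (evU q x)
    where
    alg : ∀ c e x p q → c + e + x * (p + q) ≡ (c + x * p) + (e + x * q)
    alg = solve-∀

  evU-sc : ∀ c q x → evU (scU c q) x ≡ c * evU q x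
  evU-sc c []      x = sym (*-zeroʳ c)
  evU-sc c (e ∷ q) x = cong (λ z → c * e + x * z) (evU-sc c q x) ∙ alg c e x (evU q x)
    where
    alg : ∀ c e x q → c * e + x * (c * q) ≡ c * (e + x * q)
    alg = solve-∀

  evU-mul : ∀ p q x → evU (mulU p q) x ≡ evU p x * evU q x
  evU-mul []      q x = refl
  evU-mul (c ∷ p) q x = evU-add (scU c q) (0 ∷ mulU p q) x ∙ cong₂ (λ y z → y + (0 + x * z)) (evU-sc c q x) (evU-mul p q x) ∙ alg c x (evU p x) (evU q x)
    where
    alg : ∀ c x p q → c * q + (0 + x * (p * q)) ≡ (c + x * p) * q
    alg = solve-∀

  leU : List ℕ → List ℕ → Bool
  leU []      q       = true
  leU (c ∷ p) []      = (c ≤ᵇ 0) ∧ leU p []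
  leU (c ∷ p) (e ∷ q) = (c ≤ᵇ e) ∧ leU p q

  leU-sound : ∀ p q x → leU p q ≡ true → evU p x ≤ evU q x
  leU-sound []      q       x h = z≤n
  leU-sound (c ∷ p) []      x h = +-mono-≤ (≤ᵇ-true {c} {0} (proj₁ h′)) (≤-trans (*-monoʳ-≤ x (leU-sound p [] x (proj₂ h′))) (≤-reflexive (*-zeroʳ x)))
    where h′ = ∧-split {c ≤ᵇ 0} {leU p []} h
  leU-sound (c ∷ p) (e ∷ q) x h = +-mono-≤ (≤ᵇ-true {c} {e} (proj₁ h′)) (*-monoʳ-≤ x (leU-sound p q x (proj₂ h′)))
    where h′ = ∧-split {c ≤ᵇ e} {leU p q} h

  -- Polynomials in y over ℕ[x]. Without negative coefficients, coefficientwise comparison gives an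
  -- inequality at all natural arguments.
  Poly : Set
  Poly = List (List ℕ)

  ev : Poly → ℕ → ℕ → ℕ
  ev []      x y = 0
  ev (p ∷ P) x y = evU p x + y * ev P x y

  addP : Poly → Poly → Poly
  addP []      Q       = Q
  addP (p ∷ P) []      = p ∷ P
  addP (p ∷ P) (q ∷ Q) = addU p q ∷ addP P Q

  scP : List ℕ → Poly → Poly
  scP p []      = []
  scP p (q ∷ Q) = mulU p q ∷ scP p Q

  mulP : Poly → Poly → Poly
  mulP []      Q = []
  mulP (p ∷ P) Q = addP (scP p Q) ([] ∷ mulP P Q)

  ev-add : ∀ P Q x y → ev (addP P Q) x y ≡ ev P x y + ev Q x y
  ev-add []      Q       x y = refl
  ev-add (p ∷ P) []      x y = sym (+-identityʳ _)
  ev-add (p ∷ P) (q ∷ Q) x y = cong₂ (λ a b → a + y * b) (evU-add p q x) (ev-add P Q x y) ∙ alg (evU p x) (evU q x) y (ev P x y) (ev Q x y)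
    where
    alg : ∀ c e x p q → c + e + x * (p + q) ≡ (c + x * p) + (e + x * q)
    alg = solve-∀

  ev-sc : ∀ p Q x y → ev (scP p Q) x y ≡ evU p x * ev Q x y
  ev-sc p []      x y = sym (*-zeroʳ (evU p x))
  ev-sc p (q ∷ Q) x y = cong₂ (λ a b → a + y * b) (evU-mul p q x) (ev-sc p Q x y) ∙ alg (evU p x) (evU q x) y (ev Q x y)
    where
    alg : ∀ c e x q → c * e + x * (c * q) ≡ c * (e + x * q)
    alg = solve-∀

  ev-mul : ∀ P Q x y → ev (mulP P Q) x y ≡ ev P x y * ev Q x y
  ev-mul []      Q x y = refl
  ev-mul (p ∷ P) Q x y = ev-add (scP p Q) ([] ∷ mulP P Q) x y ∙ cong₂ (λ a b → a + (0 + y * b)) (ev-sc p Q x y) (ev-mul P Q x y) ∙ alg (evU p x) y (ev P x y) (ev Q x y)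
    where
    alg : ∀ c x p q → c * q + (0 + x * (p * q)) ≡ (c + x * p) * q
    alg = solve-∀

  powP : Poly → ℕ → Poly
  powP P zero    = (1 ∷ []) ∷ []
  powP P (suc n) = mulP P (powP P n)

  ev-pow : ∀ P n x y → ev (powP P n) x y ≡ ev P x y ^ n
  ev-pow P zero    x y = cong suc (cong₂ _+_ (*-zeroʳ x) (*-zeroʳ y))
  ev-pow P (suc n) x y = ev-mul P (powP P n) x y ∙ cong (ev P x y *_) (ev-pow P n x y)

  leP : Poly → Poly → Bool
  leP []      Q       = true
  leP (p ∷ P) []      = leU p [] ∧ leP P []
  leP (p ∷ P) (q ∷ Q) = leU p q ∧ leP P Q

  leP-sound : ∀ P Q x y → leP P Q ≡ true → ev P x y ≤ ev Q x y
  leP-sound []      Q       x y h = z≤n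
  leP-sound (p ∷ P) []      x y h = +-mono-≤ (leU-sound p [] x (proj₁ h′)) (≤-trans (*-monoʳ-≤ y (leP-sound P [] x y (proj₂ h′))) (≤-reflexive (*-zeroʳ y)))
    where h′ = ∧-split {leU p []} {leP P []} h
  leP-sound (p ∷ P) (q ∷ Q) x y h = +-mono-≤ (leU-sound p q x (proj₁ h′)) (*-monoʳ-≤ y (leP-sound P Q x y (proj₂ h′)))
    where h′ = ∧-split {leU p q} {leP P Q} h

  -- c + a q + d with q = 50 + x
  lin : ℕ → ℕ → Poly
  lin c a = (c + a * 50 ∷ a ∷ []) ∷ (1 ∷ []) ∷ []

  ev-lin : ∀ c a x y → ev (lin c a) x y ≡ c + a * (50 + x) + y
  ev-lin c a x y = alg c (a * 50) a x y ∙ cong (λ z → c + z + y) (sym (*-distribˡ-+ a 50 x))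
    where
    alg : ∀ c b a x y → (c + b + x * (a + x * 0)) + y * ((1 + x * 0) + y * 0) ≡ c + (b + a * x) + y
    alg = solve-∀

  ev-lin′ : ∀ c a q x y → 50 + x ≡ q → ev (lin c a) x y ≡ c + a * q + y
  ev-lin′ c a q x y refl = ev-lin c a x y

  coefficientwise : ∀ l₁ l₂ l₃ r₁ r₂ r₃ e₂ e₃ e₁′ e₃′ → leP (mulP l₁ (mulP (powP l₂ e₂) (powP l₃ e₃))) (mulP (powP r₁ e₁′) (mulP r₂ (powP r₃ e₃′))) ≡ true →
    ∀ x y {x₁ x₂ x₃ y₁ y₂ y₃} → ev l₁ x y ≡ x₁ → ev l₂ x y ≡ x₂ → ev l₃ x y ≡ x₃ → ev r₁ x y ≡ y₁ → ev r₂ x y ≡ y₂ → ev r₃ x y ≡ y₃ →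
    x₁ * (x₂ ^ e₂ * x₃ ^ e₃) ≤ y₁ ^ e₁′ * (y₂ * y₃ ^ e₃′)
  coefficientwise l₁ l₂ l₃ r₁ r₂ r₃ e₂ e₃ e₁′ e₃′ h x y refl refl refl refl refl refl = subst₂ _≤_
    (ev-mul l₁ L x y ∙ cong (ev l₁ x y *_) (ev-mul (powP l₂ e₂) (powP l₃ e₃) x y ∙ cong₂ _*_ (ev-pow l₂ e₂ x y) (ev-pow l₃ e₃ x y)))
    (ev-mul (powP r₁ e₁′) R x y ∙ cong₂ _*_ (ev-pow r₁ e₁′ x y) (ev-mul r₂ (powP r₃ e₃′) x y ∙ cong (ev r₂ x y *_) (ev-pow r₃ e₃′ x y)))
    (leP-sound (mulP l₁ L) (mulP (powP r₁ e₁′) R) x y h)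
    where
    L = mulP (powP l₂ e₂) (powP l₃ e₃)
    R = mulP r₂ (powP r₃ e₃′)

  homogeneous : ∀ a e₂ e₃ e₄ e₆ .{{_ : NonZero a}} {x₁ x₂ x₃ x₄ x₅ x₆ y₁ y₂ y₃ y₄ y₅ y₆} → 1 + (e₂ + e₃) ≡ e₄ + (1 + e₆) →
    a * x₁ ≡ y₁ → a * x₂ ≡ y₂ → a * x₃ ≡ y₃ → a * x₄ ≡ y₄ → a * x₅ ≡ y₅ → a * x₆ ≡ y₆ →
    y₁ * (y₂ ^ e₂ * y₃ ^ e₃) ≤ y₄ ^ e₄ * (y₅ * y₆ ^ e₆) → x₁ * (x₂ ^ e₂ * x₃ ^ e₃) ≤ x₄ ^ e₄ * (x₅ * x₆ ^ e₆)
  homogeneous a e₂ e₃ e₄ e₆ {x₁} {x₂} {x₃} {x₄} {x₅} {x₆} deg refl refl refl refl refl refl h =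
    *-cancelˡ-≤ (a ^ (1 + (e₂ + e₃))) {{m^n≢0 a (1 + (e₂ + e₃))}} (subst₂ _≤_
      (sym (scale3 x₁ (x₂ ^ e₂) (x₃ ^ e₃) 1 e₂ e₃ ∙ cong₂ _*_ (cong (_* x₁) (*-identityʳ a)) (cong₂ _*_ (sym (^-distribʳ-* a x₂ e₂)) (sym (^-distribʳ-* a x₃ e₃)))))
      (sym (cong (λ z → a ^ z * (x₄ ^ e₄ * (x₅ * x₆ ^ e₆))) deg ∙ scale3 (x₄ ^ e₄) x₅ (x₆ ^ e₆) e₄ 1 e₆ ∙ cong₂ _*_ (sym (^-distribʳ-* a x₄ e₄)) (cong₂ _*_ (cong (_* x₅) (*-identityʳ a)) (sym (^-distribʳ-* a x₆ e₆)))))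
      h)
    where
    scale3 : ∀ x y z i j k → a ^ (i + (j + k)) * (x * (y * z)) ≡ (a ^ i * x) * ((a ^ j * y) * (a ^ k * z))
    scale3 x y z i j k = cong (_* (x * (y * z))) (^-distribˡ-+-* a i (j + k) ∙ cong (a ^ i *_) (^-distribˡ-+-* a j k)) ∙ alg (a ^ i) (a ^ j) (a ^ k) x y z
      where
      alg : ∀ p q r x y z → (p * (q * r)) * (x * (y * z)) ≡ (p * x) * ((q * y) * (r * z))
      alg = solve-∀

  opaque
    coefficients-dominate : leP (mulP (lin 26 33) (mulP (powP (lin 14 13) 8) (powP (lin 14 1) 3))) (mulP (powP (lin 14 21) 7) (mulP (lin 14 17) (powP (lin 10 1) 4))) ≡ true
    coefficients-dominate = refl

  core-abstract : ∀ e₂ e₃ e₄ e₆ → 1 + (e₂ + e₃) ≡ e₄ + (1 + e₆) →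
    ∀ l₁ l₂ l₃ r₁ r₂ r₃ → leP (mulP l₁ (mulP (powP l₂ e₂) (powP l₃ e₃))) (mulP (powP r₁ e₄) (mulP r₂ (powP r₃ e₆))) ≡ true →
    ∀ a .{{_ : NonZero a}} x y {x₁ x₂ x₃ x₄ x₅ x₆} →
    a * x₁ ≡ ev l₁ x y → a * x₂ ≡ ev l₂ x y → a * x₃ ≡ ev l₃ x y → a * x₄ ≡ ev r₁ x y → a * x₅ ≡ ev r₂ x y → a * x₆ ≡ ev r₃ x y →
    x₁ * (x₂ ^ e₂ * x₃ ^ e₃) ≤ x₄ ^ e₄ * (x₅ * x₆ ^ e₆)
  core-abstract e₂ e₃ e₄ e₆ deg l₁ l₂ l₃ r₁ r₂ r₃ h a x y g₁ g₂ g₃ g₄ g₅ g₆ = homogeneous a e₂ e₃ e₄ e₆ deg g₁ g₂ g₃ g₄ g₅ g₆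
    (coefficientwise l₁ l₂ l₃ r₁ r₂ r₃ e₂ e₃ e₄ e₆ h x y refl refl refl refl refl refl)

  -- The substitution 4 v = q + 10 + d, q = 50 + x makes all coefficients nonnegative.
  core : ∀ q v → 50 ≤ q → q + 10 ≤ 4 * v → (8 * q + 4 + v) * ((3 * q + 1 + v) ^ 8 * (suc v) ^ 3) ≤ (5 * q + 1 + v) ^ 7 * ((4 * q + 1 + v) * v ^ 4)
  core q v l l′ = core-abstract 8 3 7 4 refl (lin 26 33) (lin 14 13) (lin 14 1) (lin 14 21) (lin 14 17) (lin 10 1) coefficients-dominate 4 x d
      {8 * q + 4 + v} {3 * q + 1 + v} {suc v} {5 * q + 1 + v} {4 * q + 1 + v} {v}
      (f₁ ∙ sym (ev-lin′ 26 33 q x d eq)) (f₂ ∙ sym (ev-lin′ 14 13 q x d eq)) (f₃ ∙ sym (ev-lin′ 14 1 q x d eq)) (f₄ ∙ sym (ev-lin′ 14 21 q x d eq)) (f₅ ∙ sym (ev-lin′ 14 17 q x d eq)) (f₆ ∙ sym (ev-lin′ 10 1 q x d eq))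
    where
    x = q ∸ 50
    eq : 50 + x ≡ q
    eq = m+[n∸m]≡n l
    d = 4 * v ∸ (q + 10)
    4v : 4 * v ≡ (q + 10) + d
    4v = sym (m+[n∸m]≡n l′)
    f₁ : 4 * (8 * q + 4 + v) ≡ 26 + 33 * q + d
    f₁ = alg q v ∙ cong (32 * q + 16 +_) 4v ∙ alg′ q d
      where
      alg : ∀ q v → 4 * (8 * q + 4 + v) ≡ 32 * q + 16 + 4 * v
      alg = solve-∀
      alg′ : ∀ q d → 32 * q + 16 + ((q + 10) + d) ≡ 26 + 33 * q + d
      alg′ = solve-∀
    f₂ : 4 * (3 * q + 1 + v) ≡ 14 + 13 * q + d
    f₂ = alg q v ∙ cong (12 * q + 4 +_) 4v ∙ alg′ q d
      where
      alg : ∀ q v → 4 * (3 * q + 1 + v) ≡ 12 * q + 4 + 4 * v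
      alg = solve-∀
      alg′ : ∀ q d → 12 * q + 4 + ((q + 10) + d) ≡ 14 + 13 * q + d
      alg′ = solve-∀
    f₃ : 4 * suc v ≡ 14 + 1 * q + d
    f₃ = alg v ∙ cong (4 +_) 4v ∙ alg′ q d
      where
      alg : ∀ v → 4 * suc v ≡ 4 + 4 * v
      alg = solve-∀
      alg′ : ∀ q d → 4 + ((q + 10) + d) ≡ 14 + 1 * q + d
      alg′ = solve-∀
    f₄ : 4 * (5 * q + 1 + v) ≡ 14 + 21 * q + d
    f₄ = alg q v ∙ cong (20 * q + 4 +_) 4v ∙ alg′ q d
      where
      alg : ∀ q v → 4 * (5 * q + 1 + v) ≡ 20 * q + 4 + 4 * v
      alg = solve-∀
      alg′ : ∀ q d → 20 * q + 4 + ((q + 10) + d) ≡ 14 + 21 * q + d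
      alg′ = solve-∀
    f₅ : 4 * (4 * q + 1 + v) ≡ 14 + 17 * q + d
    f₅ = alg q v ∙ cong (16 * q + 4 +_) 4v ∙ alg′ q d
      where
      alg : ∀ q v → 4 * (4 * q + 1 + v) ≡ 16 * q + 4 + 4 * v
      alg = solve-∀
      alg′ : ∀ q d → 16 * q + 4 + ((q + 10) + d) ≡ 14 + 17 * q + d
      alg′ = solve-∀
    f₆ : 4 * v ≡ 10 + 1 * q + d
    f₆ = 4v ∙ alg q d
      where
      alg : ∀ q d → (q + 10) + d ≡ 10 + 1 * q + d
      alg = solve-∀

  -- The binomial coefficient N + w over N.
  pascal : ℕ → ℕ → ℕ
  pascal zero    w       = 1
  pascal (suc N) zero    = 1
  pascal (suc N) (suc w) = pascal N (suc w) + pascal (suc N) w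

  rise-front : ∀ w N → rise w (suc N) ≡ suc w * rise (suc w) N
  rise-front w zero    = alg w
    where
    alg : ∀ w → 1 * (w + 1) ≡ suc w * 1
    alg = solve-∀
  rise-front w (suc N) = cong (_* (w + suc (suc N))) (rise-front w N) ∙ *-assoc (suc w) (rise (suc w) N) (w + suc (suc N)) ∙ cong (λ z → suc w * (rise (suc w) N * z)) (+-suc w (suc N))

  rise-0 : ∀ N → rise 0 N ≡ N !
  rise-0 N = sym (rise-! 0 N ∙ *-identityˡ (rise 0 N))

  pascal-rise : ∀ N w → N ! * pascal N w ≡ rise w N
  pascal-rise zero    w       = refl
  pascal-rise (suc N) zero    = *-identityʳ (suc N !) ∙ sym (rise-0 (suc N))
  pascal-rise (suc N) (suc w) =
      alg (suc N) (N !) (pascal N (suc w)) (pascal (suc N) w)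
    ∙ cong₂ (λ x y → suc N * x + y) (pascal-rise N (suc w)) (pascal-rise (suc N) w ∙ rise-front w N)
    ∙ alg₂ N w (rise (suc w) N)
    where
    alg : ∀ n f a b → (n * f) * (a + b) ≡ n * (f * a) + (n * f) * b
    alg = solve-∀
    alg₂ : ∀ N w r → suc N * r + suc w * r ≡ r * (suc w + suc N)
    alg₂ = solve-∀

  -- one term of the binomial expansion of (d + 1)^(N+w)
  pascal-≤ : ∀ d N w → pascal N w * d ^ N ≤ suc d ^ (N + w)
  pascal-≤ d zero    w    = ≥1-^ w (s≤s z≤n)
  pascal-≤ d (suc N) zero = ≤-trans (≤-reflexive (*-identityˡ (d ^ suc N))) (≤-trans (^-monoˡ-≤ (suc N) (n≤1+n d)) (≤-reflexive (cong (suc d ^_) (sym (+-identityʳ (suc N))))))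
  pascal-≤ d (suc N) (suc w) = begin
    (pascal N (suc w) + pascal (suc N) w) * (d * d ^ N) ≡⟨ alg (pascal N (suc w)) (pascal (suc N) w) d (d ^ N) ⟩
    d * (pascal N (suc w) * d ^ N) + pascal (suc N) w * (d * d ^ N) ≤⟨ +-mono-≤ (*-monoʳ-≤ d (pascal-≤ d N (suc w))) (pascal-≤ d (suc N) w) ⟩
    d * suc d ^ (N + suc w) + suc d ^ (suc N + w) ≡⟨ cong (λ z → d * suc d ^ (N + suc w) + suc d ^ z) (sym (+-suc N w)) ⟩
    d * suc d ^ (N + suc w) + suc d ^ (N + suc w) ≡⟨ +-comm (d * suc d ^ (N + suc w)) _ ⟩
    suc d ^ (suc N + suc w) ∎
    where
    alg : ∀ a b d e → (a + b) * (d * e) ≡ d * (a * e) + b * (d * e)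
    alg = solve-∀

  rise-binomial : ∀ d N w → rise w N * d ^ N ≤ N ! * suc d ^ (N + w)
  rise-binomial d N w = ≤-trans (≤-reflexive (cong (_* d ^ N) (sym (pascal-rise N w)) ∙ *-assoc (N !) (pascal N w) (d ^ N))) (*-monoʳ-≤ (N !) (pascal-≤ d N w))

  rise-shift : ∀ w N → rise (suc w) N * suc w ≡ rise w N * (w + suc N)
  rise-shift w N = *-comm (rise (suc w) N) (suc w) ∙ sym (rise-front w N)

  -- Rests on (U+q)^3 ≤ U (U+2q)^2. Trading factors at the midpoint U + q for factors at U and
  -- beyond U + 2q lets the polynomial inequality `core` be free of b.
  power-mean : ∀ b′ {x U W q} → x ≡ U + q → q ≤ U → U + 2 * q ≤ W → x ≤ W → x ^ (3 + b′) ≤ U * W ^ (2 + b′)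
  power-mean zero {x} {U} {W} {q} refl q≤U UW xW = begin
    (U + q) ^ 3                               ≡⟨ r₂ U q ⟩
    U * (U * U + 3 * U * q + 3 * q * q) + q * (q * q) ≤⟨ +-monoʳ-≤ (U * (U * U + 3 * U * q + 3 * q * q)) (*-monoˡ-≤ (q * q) q≤U) ⟩
    U * (U * U + 3 * U * q + 3 * q * q) + U * (q * q) ≤⟨ m≤m+n _ (U * (U * q)) ⟩
    U * (U * U + 3 * U * q + 3 * q * q) + U * (q * q) + U * (U * q) ≡⟨ r₃ U q ⟩
    U * (U + 2 * q) ^ 2                       ≤⟨ *-monoʳ-≤ U (^-monoˡ-≤ 2 UW) ⟩
    U * W ^ 2 ∎
    where
    r₂ : ∀ U q → (U + q) * ((U + q) * ((U + q) * 1)) ≡ U * (U * U + 3 * U * q + 3 * q * q) + q * (q * q)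
    r₂ = solve-∀
    r₃ : ∀ U q → U * (U * U + 3 * U * q + 3 * q * q) + U * (q * q) + U * (U * q) ≡ U * ((U + 2 * q) * ((U + 2 * q) * 1))
    r₃ = solve-∀
  power-mean (suc b′) {x} {U} {W} e q≤U UW xW = ≤-trans (*-mono-≤ xW (power-mean b′ e q≤U UW xW)) (≤-reflexive (alg₃ W U (W ^ (2 + b′))))
    where
    alg₃ : ∀ w u x → w * (u * x) ≡ u * (w * x)
    alg₃ = solve-∀

  -- n = 2q+1, m = 3q+1, N = 4n; d+1 is the base of the binomial bound.
  module Growth (b T N b′ q d : ℕ) (b≡ : b ≡ 3 + b′) (T≡ : suc T ≡ 8 * b) (N≡ : N ≡ 8 * q + 4) (q≥50 : 50 ≤ q) (hd : suc d ^ b * 13 ^ T ≤ 21 ^ T) where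

    -- At ν = m + 1 + w, `g` is the product of the ν + κ for 0 ≤ κ ≤ n, and `a` is the product of
    -- the 4n consecutive integers w + 1, ..., w + 4n. Up to polynomial factors the term of the
    -- series has size a^b / g^T with T = A + b.
    a g : ℕ → ℕ
    a w = rise w N
    g w = rise (3 * q + 1 + w) (2 * q + 2)

    u : ℕ → ℕ
    u w = 3 * q + 2 + w

    g-step : ∀ w → g (suc w) * u w ≡ g w * (u w + (2 * q + 2))
    g-step w = cong₂ _*_ (cong (λ z → rise z (2 * q + 2)) (+-suc (3 * q + 1) w)) (e₁ q w) ∙ rise-shift (3 * q + 1 + w) (2 * q + 2) ∙ cong (g w *_) (e₂ q w)
      where
      e₁ : ∀ q w → 3 * q + 2 + w ≡ suc (3 * q + 1 + w)
      e₁ = solve-∀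
      e₂ : ∀ q w → 3 * q + 1 + w + suc (2 * q + 2) ≡ 3 * q + 2 + w + (2 * q + 2)
      e₂ = solve-∀

    a-step : ∀ w → a (suc w) * suc w ≡ a w * (8 * q + 4 + suc w)
    a-step w = rise-shift w N ∙ cong (a w *_) (cong (λ z → w + suc z) N≡ ∙ e q w)
      where
      e : ∀ q w → w + suc (8 * q + 4) ≡ 8 * q + 4 + suc w
      e = solve-∀

    -- while 4w ≤ q + 5, passing from w to w+1 multiplies g by at least 21/13
    region₁ : ∀ w → 4 * w ≤ q + 9 → suc d ^ (b * w) * g 0 ^ T ≤ g w ^ T
    region₁ zero    l = ≤-reflexive (cong (λ z → suc d ^ z * g 0 ^ T) (*-zeroʳ b) ∙ *-identityˡ (g 0 ^ T))
    region₁ (suc w) l = *-cancelʳ-≤ _ _ (13 ^ T * u w ^ T) {{>-nonZero (*-mono-≤ (≥1-^ {13} T (s≤s z≤n)) (≥1-^ T u≥1))}} (begin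
      (suc d ^ (b * suc w) * g 0 ^ T) * (13 ^ T * u w ^ T) ≡⟨ cong (λ z → (z * g 0 ^ T) * (13 ^ T * u w ^ T)) (cong (suc d ^_) (*-suc b w) ∙ ^-distribˡ-+-* (suc d) b (b * w)) ∙ alg (suc d ^ b) (suc d ^ (b * w)) (g 0 ^ T) (13 ^ T) (u w ^ T) ⟩
      (suc d ^ b * 13 ^ T) * u w ^ T * (suc d ^ (b * w) * g 0 ^ T) ≤⟨ *-mono-≤ (*-monoˡ-≤ (u w ^ T) hd) (region₁ w (≤-trans (*-monoʳ-≤ 4 (n≤1+n w)) l)) ⟩
      21 ^ T * u w ^ T * g w ^ T ≡⟨ cong (_* g w ^ T) (sym (^-distribʳ-* 21 (u w) T)) ⟩
      (21 * u w) ^ T * g w ^ T ≤⟨ *-monoˡ-≤ (g w ^ T) (^-monoˡ-≤ T ratio) ⟩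
      (13 * (u w + (2 * q + 2))) ^ T * g w ^ T ≡⟨ sym (^-distribʳ-* (13 * (u w + (2 * q + 2))) (g w) T) ∙ cong (_^ T) (alg₂ (u w + (2 * q + 2)) (g w) ∙ cong (13 *_) (sym (g-step w)) ∙ alg₃ (g (suc w)) (u w)) ⟩
      (g (suc w) * (13 * u w)) ^ T ≡⟨ ^-distribʳ-* (g (suc w)) (13 * u w) T ∙ cong (g (suc w) ^ T *_) (^-distribʳ-* 13 (u w) T) ⟩
      g (suc w) ^ T * (13 ^ T * u w ^ T) ∎)
      where
      u≥1 : 1 ≤ u w
      u≥1 = ≤-trans (s≤s z≤n) (≤-trans (m≤n+m 2 (3 * q)) (m≤m+n (3 * q + 2) w))
      ratio : 21 * u w ≤ 13 * (u w + (2 * q + 2))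
      ratio = ≤-trans (≤-reflexive (r₁ q w)) (≤-trans (+-monoʳ-≤ (63 * q + 34 + 13 * w) (*-monoʳ-≤ 2 l)) (≤-reflexive (r₂ q w)))
        where
        r₁ : ∀ q w → 21 * (3 * q + 2 + w) ≡ (63 * q + 34 + 13 * w) + 2 * (4 * suc w)
        r₁ = solve-∀
        r₂ : ∀ q w → (63 * q + 34 + 13 * w) + 2 * (q + 9) ≡ 13 * (3 * q + 2 + w + (2 * q + 2))
        r₂ = solve-∀
      alg : ∀ x y z p v → (x * y * z) * (p * v) ≡ (x * p) * v * (y * z)
      alg = solve-∀
      alg₂ : ∀ x g → (13 * x) * g ≡ 13 * (g * x)
      alg₂ = solve-∀
      alg₃ : ∀ g u → 13 * (g * u) ≡ g * (13 * u)
      alg₃ = solve-∀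

    -- the factor (w+1)^(3b) provides the decay in w
    Good : ℕ → Set
    Good w = (a w ^ b * d ^ (N * b)) * (g 0 ^ T * suc w ^ (3 * b)) ≤ ((N !) ^ b * suc d ^ (N * b)) * (g w ^ T * (q + 10) ^ (3 * b))

    -- The binomial bound lets a^b grow by the factor (d+1)^b per step, and by `hd` g^T grows at
    -- least as fast while its ratio is at least 21/13, the value near w = q/4. So w = 0 is the
    -- worst case.
    good₁ : ∀ w → 4 * w ≤ q + 9 → Good w
    good₁ w l = begin
      (a w ^ b * d ^ (N * b)) * (g 0 ^ T * suc w ^ (3 * b)) ≡⟨ cong (λ z → z * (g 0 ^ T * suc w ^ (3 * b))) (cong (a w ^ b *_) (sym (^-*-assoc d N b)) ∙ sym (^-distribʳ-* (a w) (d ^ N) b)) ⟩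
      (a w * d ^ N) ^ b * (g 0 ^ T * suc w ^ (3 * b)) ≤⟨ *-mono-≤ (^-monoˡ-≤ b (rise-binomial d N w)) (*-monoʳ-≤ (g 0 ^ T) (^-monoˡ-≤ (3 * b) w≤)) ⟩
      (N ! * suc d ^ (N + w)) ^ b * (g 0 ^ T * (q + 10) ^ (3 * b)) ≡⟨ cong (_* (g 0 ^ T * (q + 10) ^ (3 * b))) (^-distribʳ-* (N !) (suc d ^ (N + w)) b ∙ cong ((N !) ^ b *_) (^-*-assoc (suc d) (N + w) b ∙ cong (suc d ^_) (*-distribʳ-+ b N w) ∙ ^-distribˡ-+-* (suc d) (N * b) (w * b))) ∙ alg ((N !) ^ b) (suc d ^ (N * b)) (suc d ^ (w * b)) (g 0 ^ T) ((q + 10) ^ (3 * b)) ⟩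
      ((N !) ^ b * suc d ^ (N * b)) * ((suc d ^ (w * b) * g 0 ^ T) * (q + 10) ^ (3 * b)) ≤⟨ *-monoʳ-≤ ((N !) ^ b * suc d ^ (N * b)) (*-monoˡ-≤ ((q + 10) ^ (3 * b)) (≤-trans (≤-reflexive (cong (λ z → suc d ^ z * g 0 ^ T) (*-comm w b))) (region₁ w l))) ⟩
      ((N !) ^ b * suc d ^ (N * b)) * (g w ^ T * (q + 10) ^ (3 * b)) ∎
      where
      w≤ : suc w ≤ q + 10
      w≤ = ≤-trans (s≤s (≤-trans (m≤n*m w 4) l)) (≤-reflexive (sym (+-suc q 9)))
      alg : ∀ f x y g z → (f * (x * y)) * (g * z) ≡ (f * x) * ((y * g) * z)
      alg = solve-∀

    -- beyond that, the ratio of consecutive terms is small enough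
    ratio₂ : ∀ v → q + 10 ≤ 4 * v → (8 * q + 4 + v) ^ b * ((3 * q + 1 + v) ^ T * suc v ^ (3 * b)) ≤ (3 * q + 1 + v + (2 * q + 2)) ^ T * (v ^ b * v ^ (3 * b))
    -- One more factor U completes U^T to U^(8b), so that `core` can be raised to the power b;
    -- `power-mean` gives the factor U back.
    ratio₂ v l = *-cancelʳ-≤ _ _ U {{>-nonZero U≥1}} (begin
      (X ^ b * (U ^ T * suc v ^ (3 * b))) * U ≡⟨ alg (X ^ b) (U ^ T) (suc v ^ (3 * b)) U ∙ cong (λ z → X ^ b * (z * suc v ^ (3 * b))) (cong (U ^_) T≡ ∙ sym (^-*-assoc U 8 b)) ⟩
      X ^ b * ((U ^ 8) ^ b * suc v ^ (3 * b)) ≡⟨ cong (λ z → X ^ b * ((U ^ 8) ^ b * z)) (sym (^-*-assoc (suc v) 3 b)) ∙ cong (X ^ b *_) (sym (^-distribʳ-* (U ^ 8) (suc v ^ 3) b)) ∙ sym (^-distribʳ-* X (U ^ 8 * suc v ^ 3) b) ⟩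
      (X * (U ^ 8 * suc v ^ 3)) ^ b ≤⟨ ^-monoˡ-≤ b (core q v q≥50 l) ⟩
      ((5 * q + 1 + v) ^ 7 * ((4 * q + 1 + v) * v ^ 4)) ^ b ≡⟨ ^-distribʳ-* ((5 * q + 1 + v) ^ 7) ((4 * q + 1 + v) * v ^ 4) b ∙ cong₂ _*_ (^-*-assoc (5 * q + 1 + v) 7 b) (^-distribʳ-* (4 * q + 1 + v) (v ^ 4) b) ⟩
      (5 * q + 1 + v) ^ (7 * b) * ((4 * q + 1 + v) ^ b * (v ^ 4) ^ b) ≤⟨ *-mono-≤ (^-monoˡ-≤ (7 * b) w₁) (*-monoˡ-≤ ((v ^ 4) ^ b) mean) ⟩
      W ^ (7 * b) * ((U * W ^ (2 + b′)) * (v ^ 4) ^ b) ≡⟨ alg₂ (W ^ (7 * b)) U (W ^ (2 + b′)) ((v ^ 4) ^ b) ∙ cong₂ (λ x y → (x * y) * U) (sym (^-distribˡ-+-* W (7 * b) (2 + b′)) ∙ cong (W ^_) e₇) (^-*-assoc v 4 b ∙ cong (v ^_) (e₄ b) ∙ ^-distribˡ-+-* v b (3 * b)) ⟩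
      (W ^ T * (v ^ b * v ^ (3 * b))) * U ∎)
      where
      X = 8 * q + 4 + v
      U = 3 * q + 1 + v
      W = 3 * q + 1 + v + (2 * q + 2)
      U≥1 : 1 ≤ U
      U≥1 = ≤-trans (m≤n+m 1 (3 * q)) (m≤m+n (3 * q + 1) v)
      e₇ : 7 * b + (2 + b′) ≡ T
      e₇ = suc-injective (r b b′ b≡ ∙ sym T≡)
        where
        r : ∀ b b′ → b ≡ 3 + b′ → suc (7 * b + (2 + b′)) ≡ 8 * b
        r b b′ refl = r′ b′
          where
          r′ : ∀ b′ → suc (7 * (3 + b′) + (2 + b′)) ≡ 8 * (3 + b′)
          r′ = solve-∀
      e₄ : ∀ b → 4 * b ≡ b + 3 * b
      e₄ = solve-∀
      w₁ : 5 * q + 1 + v ≤ W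
      w₁ = ≤-trans (m≤m+n (5 * q + 1 + v) 2) (≤-reflexive (e q v))
        where
        e : ∀ q v → 5 * q + 1 + v + 2 ≡ 3 * q + 1 + v + (2 * q + 2)
        e = solve-∀
      w₂ : 4 * q + 1 + v ≤ W
      w₂ = ≤-trans (+-monoˡ-≤ v (+-monoˡ-≤ 1 (*-monoˡ-≤ q {4} {5} (s≤s (s≤s (s≤s (s≤s z≤n))))))) w₁
      mean : (4 * q + 1 + v) ^ b ≤ U * W ^ (2 + b′)
      mean = subst (λ z → (4 * q + 1 + v) ^ z ≤ U * W ^ (2 + b′)) (sym b≡) (power-mean b′ (r₁ q v) q≤U (+-monoʳ-≤ U (m≤m+n (2 * q) 2)) w₂)
        where
        q≤U : q ≤ U
        q≤U = ≤-trans (m≤n*m q 3) (≤-trans (m≤m+n (3 * q) 1) (m≤m+n (3 * q + 1) v))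
        r₁ : ∀ q v → 4 * q + 1 + v ≡ 3 * q + 1 + v + q
        r₁ = solve-∀
      alg : ∀ x u s U → (x * (u * s)) * U ≡ x * ((U * u) * s)
      alg = solve-∀
      alg₂ : ∀ x u y z → x * ((u * y) * z) ≡ ((x * y) * z) * u
      alg₂ = solve-∀

    good-step : ∀ w → q + 10 ≤ 4 * suc w → Good w → Good (suc w)
    good-step w l h = *-cancelʳ-≤ _ _ (suc w ^ b * (u w ^ T * suc w ^ (3 * b))) {{>-nonZero (*-mono-≤ (≥1-^ b (s≤s z≤n)) (*-mono-≤ (≥1-^ T (≤-trans (m≤n+m 1 (3 * q + 1)) (≤-trans (≤-reflexive (e₁ q)) (m≤m+n (3 * q + 2) w)))) (≥1-^ (3 * b) (s≤s z≤n))))}} (begin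
      ((a (suc w) ^ b * D) * (g 0 ^ T * suc (suc w) ^ (3 * b))) * (suc w ^ b * (u w ^ T * suc w ^ (3 * b)))
        ≡⟨ alg₁ (a (suc w) ^ b) D (g 0 ^ T) (suc (suc w) ^ (3 * b)) (suc w ^ b) (u w ^ T) (suc w ^ (3 * b)) ∙ cong (λ z → (z * D) * ((g 0 ^ T * suc w ^ (3 * b)) * (u w ^ T * suc (suc w) ^ (3 * b)))) (sym (^-distribʳ-* (a (suc w)) (suc w) b) ∙ cong (_^ b) (a-step w) ∙ ^-distribʳ-* (a w) X b) ⟩
      ((a w ^ b * X ^ b) * D) * ((g 0 ^ T * suc w ^ (3 * b)) * (u w ^ T * suc (suc w) ^ (3 * b)))
        ≡⟨ alg₂ (a w ^ b) (X ^ b) D (g 0 ^ T * suc w ^ (3 * b)) (u w ^ T * suc (suc w) ^ (3 * b)) ⟩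
      ((a w ^ b * D) * (g 0 ^ T * suc w ^ (3 * b))) * (X ^ b * (u w ^ T * suc (suc w) ^ (3 * b)))
        ≤⟨ *-mono-≤ h (subst (λ z → X ^ b * (z ^ T * suc (suc w) ^ (3 * b)) ≤ (z + (2 * q + 2)) ^ T * (suc w ^ b * suc w ^ (3 * b))) (e₂ q w) (ratio₂ (suc w) l)) ⟩
      (D′ * (g w ^ T * Q)) * ((u w + (2 * q + 2)) ^ T * (suc w ^ b * suc w ^ (3 * b)))
        ≡⟨ alg₃ D′ (g w ^ T) Q ((u w + (2 * q + 2)) ^ T) (suc w ^ b) (suc w ^ (3 * b)) ∙ cong (λ z → (D′ * (z * Q)) * (suc w ^ b * suc w ^ (3 * b))) (sym (^-distribʳ-* (g w) (u w + (2 * q + 2)) T) ∙ cong (_^ T) (sym (g-step w)) ∙ ^-distribʳ-* (g (suc w)) (u w) T) ⟩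
      (D′ * ((g (suc w) ^ T * u w ^ T) * Q)) * (suc w ^ b * suc w ^ (3 * b))
        ≡⟨ alg₄ D′ (g (suc w) ^ T) (u w ^ T) Q (suc w ^ b) (suc w ^ (3 * b)) ⟩
      (D′ * (g (suc w) ^ T * Q)) * (suc w ^ b * (u w ^ T * suc w ^ (3 * b))) ∎)
      where
      D = d ^ (N * b)
      D′ = (N !) ^ b * suc d ^ (N * b)
      X = 8 * q + 4 + suc w
      Q = (q + 10) ^ (3 * b)
      e₁ : ∀ q → 3 * q + 1 + 1 ≡ 3 * q + 2
      e₁ = solve-∀
      e₂ : ∀ q w → 3 * q + 1 + suc w ≡ 3 * q + 2 + w
      e₂ = solve-∀
      alg₁ : ∀ a D g s v u t → ((a * D) * (g * s)) * (v * (u * t)) ≡ ((a * v) * D) * ((g * t) * (u * s))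
      alg₁ = solve-∀
      alg₂ : ∀ a x D g r → ((a * x) * D) * (g * r) ≡ ((a * D) * g) * (x * r)
      alg₂ = solve-∀
      alg₃ : ∀ D g Q w v t → (D * (g * Q)) * (w * (v * t)) ≡ (D * ((g * w) * Q)) * (v * t)
      alg₃ = solve-∀
      alg₄ : ∀ D g u Q v t → (D * ((g * u) * Q)) * (v * t) ≡ (D * (g * Q)) * (v * (u * t))
      alg₄ = solve-∀

    good : ∀ w → Good w
    good zero    = good₁ 0 z≤n
    good (suc w) with 4 * suc w ≤? q + 9
    ... | yes l = good₁ (suc w) l
    ... | no ¬l = good-step w (≤-trans (≤-reflexive (+-suc q 9)) (≰⇒> ¬l)) (good w)

-- Size of the expansion coefficients

module Coefficients where

  open Rationals
  open PowerSeries
  open PartialFractions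
  open LocalExpansion
  open RationalFunction
  open Certificates using (rise; ^-distribʳ-*)
  open Estimates using (rise-front)
  open import Data.Nat as ℕ using (ℕ; zero; suc)
  import Data.Nat.Properties as ℕP
  import Data.Nat.Tactic.RingSolver as ℕS
  open import Data.Integer as ℤ using (ℤ)
  import Data.Integer.Properties as ℤP
  import Data.Integer.Tactic.RingSolver as ℤS
  open import Data.Rational
  open import Data.Rational.Properties
  open import Data.List using (List; []; _∷_; _++_; map; length)
  import Data.List.Properties as LP
  open import Data.List.Relation.Unary.Any using (here; there)
  open import Data.List.Membership.Propositional using (_∈_)
  open import Data.List.Membership.Propositional.Properties using (∈-++⁺ˡ; ∈-map⁺)
  open import Data.List.Relation.Unary.All as All using (All; []; _∷_)
  open import Data.List.Relation.Unary.All.Properties as AllP using ()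
  open import Data.Product using (_,_)
  open import Relation.Nullary
  open import Relation.Binary.PropositionalEquality as Eq using (_≡_; refl; sym; cong; cong₂; subst)
  open import Tactic.RingSolver using (solve-∀)

  -- A geometric majorant. Multiplication or division by a linear factor acts on x through its value
  -- at ε = 0 and raises K by one, so a coefficient of fixed order costs only a power of the number
  -- of factors.
  Bounded : Seq → ℚ → ℕ → Set
  Bounded u x K = ∀ s → ∣ u s ∣ ≤ x * ιℕ (K ℕ.^ s)

  abs-* : ∀ c y → 0ℚ ≤ c → ∣ c * y ∣ ≡ c * ∣ y ∣
  abs-* c y l = ∣p*q∣≡∣p∣*∣q∣ c y ∙ cong (_* ∣ y ∣) (0≤p⇒∣p∣≡p l)

  *-monoˡ : ∀ {c x y} → 0ℚ ≤ c → x ≤ y → c * x ≤ c * y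
  *-monoˡ {c} l h = *-monoˡ-≤-nonNeg c {{nonNegative l}} h

  *-monoʳ : ∀ {c x y} → 0ℚ ≤ c → x ≤ y → x * c ≤ y * c
  *-monoʳ {c} l h = *-monoʳ-≤-nonNeg c {{nonNegative l}} h

  power-step : ∀ K s → K ℕ.^ suc s ℕ.+ suc K ℕ.^ s ℕ.≤ suc K ℕ.^ suc s
  power-step K s = ℕP.≤-trans (ℕP.≤-reflexive (ℕP.+-comm _ (suc K ℕ.^ s))) (ℕP.+-monoʳ-≤ (suc K ℕ.^ s) (ℕP.*-monoʳ-≤ K (ℕP.^-monoˡ-≤ s (ℕP.n≤1+n K))))

  inv≤1 : ∀ c → 1 ℕ.≤ c → inv (ιℕ c) ≤ 1ℚ
  inv≤1 c l = subst₂≤ (*-monoˡ (<⇒≤ (inv-pos (ιℕ>0 l))) (ιℕ-mono l))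
    where
    subst₂≤ : inv (ιℕ c) * ιℕ 1 ≤ inv (ιℕ c) * ιℕ c → inv (ιℕ c) ≤ 1ℚ
    subst₂≤ = Eq.subst₂ _≤_ (cong (inv (ιℕ c) *_) ι1 ∙ *-identityʳ _) (inv-l (pos⇒≢0 (ιℕ>0 l)))

  bounded-N : ∀ {u x K} c e → 0ℚ ≤ x → e ℕ.≤ c → Bounded u x K → Bounded (N (ιℕ c) (ιℕ e) u) (ιℕ c * x) (suc K)
  bounded-N {u} {x} {K} c e x≥0 l h zero    = ≤-trans (≤-reflexive (abs-* (ιℕ c) (u 0) (ιℕ≥0 c))) (≤-trans (*-monoˡ (ιℕ≥0 c) (h 0)) (≤-reflexive (sym (*-assoc (ιℕ c) x (ιℕ 1)))))
  bounded-N {u} {x} {K} c e x≥0 l h (suc s) = begin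
    ∣ ιℕ c * u (suc s) + ιℕ e * u s ∣      ≤⟨ ∣p+q∣≤∣p∣+∣q∣ (ιℕ c * u (suc s)) (ιℕ e * u s) ⟩
    ∣ ιℕ c * u (suc s) ∣ + ∣ ιℕ e * u s ∣  ≡⟨ cong₂ _+_ (abs-* (ιℕ c) (u (suc s)) (ιℕ≥0 c)) (abs-* (ιℕ e) (u s) (ιℕ≥0 e)) ⟩
    ιℕ c * ∣ u (suc s) ∣ + ιℕ e * ∣ u s ∣  ≤⟨ +-mono-≤ (*-monoˡ (ιℕ≥0 c) (h (suc s))) (≤-trans (*-monoʳ (0≤∣p∣ (u s)) (ιℕ-mono l)) (*-monoˡ (ιℕ≥0 c) (h s))) ⟩
    ιℕ c * (x * ιℕ (K ℕ.^ suc s)) + ιℕ c * (x * ιℕ (K ℕ.^ s)) ≡⟨ alg (ιℕ c) x (ιℕ (K ℕ.^ suc s)) (ιℕ (K ℕ.^ s)) ∙ cong ((ιℕ c * x) *_) (sym (ιℕ-+ (K ℕ.^ suc s) (K ℕ.^ s))) ⟩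
    (ιℕ c * x) * ιℕ (K ℕ.^ suc s ℕ.+ K ℕ.^ s) ≤⟨ *-monoˡ (*-nonneg (ιℕ≥0 c) x≥0) (ιℕ-mono (ℕP.≤-trans (ℕP.+-monoʳ-≤ (K ℕ.^ suc s) (ℕP.^-monoˡ-≤ s (ℕP.n≤1+n K))) (power-step K s))) ⟩
    (ιℕ c * x) * ιℕ (suc K ℕ.^ suc s) ∎
    where
    open ≤-Reasoning
    alg : ∀ c x p q → c * (x * p) + c * (x * q) ≡ (c * x) * (p + q)
    alg = solve-∀ ℚring

  bounded-den : ∀ {u x K} c → 0ℚ ≤ x → 1 ℕ.≤ c → Bounded u x K → Bounded (den (ιℕ c) u) (inv (ιℕ c) * x) (suc K)
  bounded-den {u} {x} {K} c x≥0 l h = go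
    where
    open ≤-Reasoning
    i = inv (ιℕ c)
    i≥0 : 0ℚ ≤ i
    i≥0 = <⇒≤ (inv-pos (ιℕ>0 l))
    alg : ∀ c x p q → c * (x * p + x * q) ≡ (c * x) * (p + q)
    alg = solve-∀ ℚring
    go : Bounded (den (ιℕ c) u) (i * x) (suc K)
    go zero    = ≤-trans (≤-reflexive (abs-* i (u 0) i≥0)) (≤-trans (*-monoˡ i≥0 (h 0)) (≤-reflexive (sym (*-assoc i x (ιℕ 1)))))
    go (suc s) = begin
      ∣ i * (u (suc s) - den (ιℕ c) u s) ∣    ≡⟨ abs-* i _ i≥0 ⟩
      i * ∣ u (suc s) - den (ιℕ c) u s ∣      ≤⟨ *-monoˡ i≥0 (≤-trans (∣p+q∣≤∣p∣+∣q∣ (u (suc s)) (- den (ιℕ c) u s)) (≤-reflexive (cong (∣ u (suc s) ∣ +_) (∣-p∣≡∣p∣ (den (ιℕ c) u s))))) ⟩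
      i * (∣ u (suc s) ∣ + ∣ den (ιℕ c) u s ∣) ≤⟨ *-monoˡ i≥0 (+-mono-≤ (h (suc s)) (≤-trans (go s) (*-monoʳ (ιℕ≥0 (suc K ℕ.^ s)) (≤-trans (*-monoʳ x≥0 (inv≤1 c l)) (≤-reflexive (*-identityˡ x)))))) ⟩
      i * (x * ιℕ (K ℕ.^ suc s) + x * ιℕ (suc K ℕ.^ s)) ≡⟨ alg i x (ιℕ (K ℕ.^ suc s)) (ιℕ (suc K ℕ.^ s)) ∙ cong ((i * x) *_) (sym (ιℕ-+ (K ℕ.^ suc s) (suc K ℕ.^ s))) ⟩
      (i * x) * ιℕ (K ℕ.^ suc s ℕ.+ suc K ℕ.^ s) ≤⟨ *-monoˡ (*-nonneg i≥0 x≥0) (ιℕ-mono (power-step K s)) ⟩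
      (i * x) * ιℕ (suc K ℕ.^ suc s) ∎

  ∏ : List ℕ → ℕ
  ∏ []      = 1
  ∏ (c ∷ l) = c ℕ.* ∏ l

  ∏-++ : ∀ l l′ → ∏ (l ++ l′) ≡ ∏ l ℕ.* ∏ l′
  ∏-++ []      l′ = sym (ℕP.*-identityˡ (∏ l′))
  ∏-++ (c ∷ l) l′ = cong (c ℕ.*_) (∏-++ l l′) ∙ sym (ℕP.*-assoc c (∏ l) (∏ l′))

  ∏-rep : ∀ b l → ∏ (rep b l) ≡ ∏ l ℕ.^ b
  ∏-rep zero    l = refl
  ∏-rep (suc b) l = ∏-++ l (rep b l) ∙ cong (∏ l ℕ.*_) (∏-rep b l)

  ∏≥1 : ∀ {l} → All (1 ℕ.≤_) l → 1 ℕ.≤ ∏ l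
  ∏≥1 []      = ℕP.≤-refl
  ∏≥1 (p ∷ h) = ℕP.*-mono-≤ p (∏≥1 h)

  bounded-dd : ∀ l → All (1 ℕ.≤_) l → Bounded (dd (map ι (map ℤ.+_ l)) (mono 0)) (inv (ιℕ (∏ l))) (length l)
  bounded-dd [] [] zero    = ≤-reflexive (sym (cong₂ (λ x y → inv x * y) ι1 ι1))
  bounded-dd [] [] (suc s) = ≤-reflexive (sym (cong (inv (ιℕ 1) *_) ι0 ∙ *-zeroʳ (inv (ιℕ 1))))
  bounded-dd (c ∷ l) (p ∷ h) s = subst (λ z → ∣ den (ιℕ c) (dd (map ι (map ℤ.+_ l)) (mono 0)) s ∣ ≤ z * ιℕ (suc (length l) ℕ.^ s))
    (sym (cong inv (ιℕ-* c (∏ l)) ∙ inv-* (pos⇒≢0 (ιℕ>0 p)) (pos⇒≢0 (ιℕ>0 (∏≥1 h)))))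
    (bounded-den c (<⇒≤ (inv-pos (ιℕ>0 (∏≥1 h)))) p (bounded-dd l h) s)

  bounded-NN : ∀ {u x K} l → All (1 ℕ.≤_) l → 0ℚ ≤ x → Bounded u x K → Bounded (NN (map fz (map ℤ.+_ l)) u) (ιℕ (∏ l) * x) (length l ℕ.+ K)
  bounded-NN {u} {x} {K} [] [] x≥0 h s = ≤-trans (h s) (≤-reflexive (cong (_* ιℕ (K ℕ.^ s)) (sym (cong (_* x) ι1 ∙ *-identityˡ x))))
  bounded-NN {u} {x} {K} (c ∷ l) (p ∷ hl) x≥0 h s = Eq.subst₂ (λ y z → ∣ N (ιℕ c) y (NN (map fz (map ℤ.+_ l)) u) s ∣ ≤ z * ιℕ (suc (length l ℕ.+ K) ℕ.^ s))
    ι1 (sym (cong (_* x) (ιℕ-* c (∏ l)) ∙ *-assoc (ιℕ c) (ιℕ (∏ l)) x))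
    (bounded-N c 1 (*-nonneg (ιℕ≥0 (∏ l)) x≥0) p (bounded-NN l hl x≥0 h) s)

  NN-vanish : ∀ l {p u} → Vanish p u → Vanish p (NN l u)
  NN-vanish []            h = h
  NN-vanish ((a , b) ∷ l) h = N-vanish a b (NN-vanish l h)

  zero-vanish : ∀ L {p u} → ℤ.+ 0 ∈ L → Vanish p u → Vanish (suc p) (NN (map fz L) u)
  zero-vanish (c ∷ L) {p} {u} (here refl) h = subst (λ z → Vanish (suc p) (N z 1ℚ (NN (map fz L) u))) (sym ι0) (N0-vanish 1ℚ (NN-vanish (map fz L) h))
  zero-vanish (c ∷ L) (there i) h = N-vanish (ι c) 1ℚ (zero-vanish L i h)

  rep-vanish : ∀ b L {u} → ℤ.+ 0 ∈ L → Vanish b (NN (map fz (rep b L)) u)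
  rep-vanish zero    L i s ()
  rep-vanish (suc b) L {u} i s l = cong (λ z → NN z u s) (LP.map-++ fz L (rep b L)) ∙ NN-++ (map fz L) (map fz (rep b L)) u s ∙ zero-vanish L i (rep-vanish b L i) s l

  rng-∈ : ∀ m {j} → 0 ℕ.< j → j ℕ.≤ m → j ∈ rng m
  rng-∈ zero    {suc j} _ ()
  rng-∈ (suc m) {j} p l with j ℕ.≟ suc m
  ... | yes refl = here refl
  ... | no ne    = there (rng-∈ m p (ℕP.≤-pred (ℕP.≤∧≢⇒< l ne)))

  rise-+ : ∀ x i j → rise x (i ℕ.+ j) ≡ rise x i ℕ.* rise (x ℕ.+ i) j
  rise-+ x i zero    = cong (rise x) (ℕP.+-identityʳ i) ∙ sym (ℕP.*-identityʳ (rise x i))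
  rise-+ x i (suc j) = cong (rise x) (ℕP.+-suc i j) ∙ cong₂ ℕ._*_ (rise-+ x i j) (cong (x ℕ.+_) (sym (ℕP.+-suc i j)) ∙ sym (ℕP.+-assoc x i (suc j))) ∙ ℕP.*-assoc (rise x i) _ _

  module Values (n m b a : ℕ) (enough : 2 ℕ.+ b ℕ.* (m ℕ.+ m) ℕ.≤ n ℕ.+ a ℕ.* suc n) where
    open RF n m b a enough

    -- One of the factors t - j is equal to ε here, and it occurs b times.
    V-vanish : ∀ ν → 0 ℕ.< ν → ν ℕ.≤ m → Vanish b (V ν)
    V-vanish ν p l = N-vanish _ _ (rep-vanish b (left (ℤ.+ ν) ++ right (ℤ.+ ν)) (∈-++⁺ˡ (subst (_∈ left (ℤ.+ ν)) (ℤP.+-inverseʳ (ℤ.+ ν)) (∈-map⁺ (λ j → ℤ.+ ν ℤ.- ℤ.+ j) (rng-∈ m p l)))))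

    leftN : ℕ → ℕ → List ℕ
    leftN zero    w = []
    leftN (suc k) w = suc w ∷ leftN k (suc w)

    left≡ : ∀ k w ν → ν ≡ suc (k ℕ.+ w) → map (λ j → ℤ.+ ν ℤ.- ℤ.+ j) (rng k) ≡ map ℤ.+_ (leftN k w)
    left≡ zero    w ν e = refl
    left≡ (suc k) w ν e = cong₂ _∷_ (cong (λ z → ℤ.+ z ℤ.- ℤ.+ suc k) (e ∙ sym (ℕP.+-suc (suc k) w)) ∙ alg (ℤ.+ suc k) (ℤ.+ suc w)) (left≡ k (suc w) ν (e ∙ cong suc (sym (ℕP.+-suc k w))))
      where
      alg : ∀ x y → (x ℤ.+ y) ℤ.- x ≡ y
      alg = ℤS.solve-∀

    ∏-left : ∀ k w → ∏ (leftN k w) ≡ rise w k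
    ∏-left zero    w = refl
    ∏-left (suc k) w = cong (suc w ℕ.*_) (∏-left k (suc w)) ∙ sym (rise-front w k)

    left≥1 : ∀ k w → All (1 ℕ.≤_) (leftN k w)
    left≥1 zero    w = []
    left≥1 (suc k) w = ℕ.s≤s ℕ.z≤n ∷ left≥1 k (suc w)

    left-length : ∀ k w → length (leftN k w) ≡ k
    left-length zero    w = refl
    left-length (suc k) w = cong suc (left-length k (suc w))

    ∏-rng : ∀ x k → ∏ (map (x ℕ.+_) (rng k)) ≡ rise x k
    ∏-rng x zero    = refl
    ∏-rng x (suc k) = cong ((x ℕ.+ suc k) ℕ.*_) (∏-rng x k) ∙ ℕP.*-comm (x ℕ.+ suc k) (rise x k)

    -- The number of linear factors in R, numerator and denominator together.
    ℓ : ℕ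
    ℓ = suc (b ℕ.* (m ℕ.+ m) ℕ.+ A ℕ.* suc n)

    module At-point (w : ℕ) where
      ν : ℕ
      ν = suc (m ℕ.+ w)
      block dens : List ℕ
      block = leftN m w ++ map ((ν ℕ.+ n) ℕ.+_) (rng m)
      dens = map (ℕ._+ ν) (0 ∷ rng n)

      nums≡ : nums (ℤ.+ ν) ≡ map ℤ.+_ (rep b block)
      nums≡ = cong (rep b) (cong₂ _++_ (left≡ m w ν refl) (LP.map-cong (λ j → cong ℤ.+_ (sym (ℕP.+-assoc ν n j))) (rng m) ∙ LP.map-∘ (rng m)) ∙ sym (LP.map-++ ℤ.+_ (leftN m w) (map ((ν ℕ.+ n) ℕ.+_) (rng m)))) ∙ sym (map-rep ℤ.+_ b block)

      dens≡ : rep A (map (λ κ → ℤ.+ κ ℤ.+ ℤ.+ ν) (0 ∷ rng n)) ≡ map ℤ.+_ (rep A dens)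
      dens≡ = cong (rep A) (LP.map-∘ (0 ∷ rng n)) ∙ sym (map-rep ℤ.+_ A dens)

      G₁ G₂ G₃ : ℕ
      G₁ = rise w m
      G₂ = rise (ν ℕ.+ n) m
      G₃ = rise (m ℕ.+ w) (suc n)

      ∏-block : ∏ (rep b block) ≡ (G₁ ℕ.* G₂) ℕ.^ b
      ∏-block = ∏-rep b block ∙ cong (ℕ._^ b) (∏-++ (leftN m w) _ ∙ cong₂ ℕ._*_ (∏-left m w) (∏-rng (ν ℕ.+ n) m))

      ∏-dens : ∏ (rep A dens) ≡ G₃ ℕ.^ A
      ∏-dens = ∏-rep A dens ∙ cong (ℕ._^ A) (cong (ν ℕ.*_) (cong ∏ (LP.map-cong (λ κ → ℕP.+-comm κ ν) (rng n)) ∙ ∏-rng ν n) ∙ sym (rise-front (m ℕ.+ w) n))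

      block≥1 : All (1 ℕ.≤_) (rep b block)
      block≥1 = All-rep b (AllP.++⁺ (left≥1 m w) (AllP.map⁺ (rng-All m (λ j _ _ → ℕ.s≤s ℕ.z≤n))))
      dens≥1 : All (1 ℕ.≤_) (rep A dens)
      dens≥1 = All-rep A (ℕ.s≤s ℕ.z≤n ∷ AllP.map⁺ (rng-All n (λ j _ _ → ℕP.≤-trans (ℕ.s≤s ℕ.z≤n) (ℕP.m≤n+m ν j))))

      G₃≥1 : 1 ℕ.≤ G₃ ℕ.^ A
      G₃≥1 = subst (1 ℕ.≤_) ∏-dens (∏≥1 dens≥1)

      len : suc (length (rep b block) ℕ.+ length (rep A dens)) ≡ ℓ
      len = cong suc (cong₂ ℕ._+_ (length-rep b block ∙ cong (b ℕ.*_) (LP.length-++ (leftN m w) ∙ cong₂ ℕ._+_ (left-length m w) (LP.length-map _ (rng m) ∙ length-rng m)))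
        (length-rep A dens ∙ cong (A ℕ.*_) (LP.length-map _ (0 ∷ rng n) ∙ cong suc (length-rng n))))

      raw : Bounded (V ν) (ιℕ (ν ℕ.+ ν ℕ.+ n) * (ιℕ ((G₁ ℕ.* G₂) ℕ.^ b) * inv (ιℕ (G₃ ℕ.^ A)))) ℓ
      raw = λ s → Eq.subst₂ (λ x y → ∣ V ν s ∣ ≤ ιℕ (ν ℕ.+ ν ℕ.+ n) * (ιℕ x * inv (ιℕ y)) * ιℕ (ℓ ℕ.^ s)) ∏-block ∏-dens
         (Eq.subst₂ (λ x y → ∣ N (ιℕ (ν ℕ.+ ν ℕ.+ n)) (ιℕ 2) (NN (map fz x) (dd (map ι y) (mono 0))) s ∣ ≤ ιℕ (ν ℕ.+ ν ℕ.+ n) * (ιℕ (∏ (rep b block)) * inv (ιℕ (∏ (rep A dens)))) * ιℕ (ℓ ℕ.^ s)) (sym nums≡) (sym dens≡)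
           (subst (λ z → ∣ N (ιℕ (ν ℕ.+ ν ℕ.+ n)) (ιℕ 2) (NN (map fz (map ℤ.+_ (rep b block))) (dd (map ι (map ℤ.+_ (rep A dens))) (mono 0))) s ∣ ≤ ιℕ (ν ℕ.+ ν ℕ.+ n) * (ιℕ (∏ (rep b block)) * inv (ιℕ (∏ (rep A dens)))) * ιℕ (z ℕ.^ s)) len
             (bounded-N (ν ℕ.+ ν ℕ.+ n) 2 (*-nonneg (ιℕ≥0 (∏ (rep b block))) i≥0) 2≤ (bounded-NN (rep b block) block≥1 i≥0 (bounded-dd (rep A dens) dens≥1)) s)))
        where
        i≥0 : 0ℚ ≤ inv (ιℕ (∏ (rep A dens)))
        i≥0 = <⇒≤ (inv-pos (ιℕ>0 (∏≥1 dens≥1)))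
        2≤ : 2 ℕ.≤ ν ℕ.+ ν ℕ.+ n
        2≤ = ℕP.≤-trans (ℕP.+-mono-≤ {1} {ν} {1} {ν} (ℕ.s≤s ℕ.z≤n) (ℕ.s≤s ℕ.z≤n)) (ℕP.m≤m+n (ν ℕ.+ ν) n)

      -- Left factors, denominators and right factors are adjacent runs of integers. This allows (G₁
      -- G₂)^b / G₃^A to be rewritten as the b-th power of one long run over G₃^(A+b).
      split : G₁ ℕ.* G₂ ℕ.* G₃ ≡ rise w (suc (n ℕ.+ (m ℕ.+ m)))
      split = alg G₁ G₂ G₃ ∙ cong (G₁ ℕ.*_) (cong₂ ℕ._*_ (cong (λ z → rise z (suc n)) (ℕP.+-comm m w)) (cong (λ z → rise z m) (alg₂ w m n)) ∙ sym (rise-+ (w ℕ.+ m) (suc n) m)) ∙ sym (rise-+ w m (suc n ℕ.+ m)) ∙ cong (rise w) (alg₃ n m)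
        where
        alg : ∀ x y z → x ℕ.* y ℕ.* z ≡ x ℕ.* (z ℕ.* y)
        alg = ℕS.solve-∀
        alg₂ : ∀ w m n → suc (m ℕ.+ w) ℕ.+ n ≡ w ℕ.+ m ℕ.+ suc n
        alg₂ = ℕS.solve-∀
        alg₃ : ∀ n m → m ℕ.+ (suc n ℕ.+ m) ≡ suc (n ℕ.+ (m ℕ.+ m))
        alg₃ = ℕS.solve-∀

      V-bound : ∀ s → ∣ V ν s ∣ * ιℕ (G₃ ℕ.^ (A ℕ.+ b)) ≤ ιℕ ((ν ℕ.+ ν ℕ.+ n) ℕ.* rise w (suc (n ℕ.+ (m ℕ.+ m))) ℕ.^ b ℕ.* ℓ ℕ.^ s)
      V-bound s = ≤-trans (*-monoʳ (ιℕ≥0 (G₃ ℕ.^ (A ℕ.+ b))) (raw s)) (≤-reflexive (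
          cong (c * (x * i) * k *_) (cong ιℕ (ℕP.^-distribˡ-+-* G₃ A b) ∙ ιℕ-* (G₃ ℕ.^ A) (G₃ ℕ.^ b))
        ∙ alg c x i k (ιℕ (G₃ ℕ.^ A)) (ιℕ (G₃ ℕ.^ b)) ∙ cong (λ z → c * (x * ιℕ (G₃ ℕ.^ b)) * k * z) (inv-l (pos⇒≢0 (ιℕ>0 G₃≥1))) ∙ *-identityʳ _
        ∙ cong (λ z → c * z * k) (sym (ιℕ-* ((G₁ ℕ.* G₂) ℕ.^ b) (G₃ ℕ.^ b)) ∙ cong ιℕ (sym (^-distribʳ-* (G₁ ℕ.* G₂) G₃ b) ∙ cong (ℕ._^ b) split))
        ∙ sym (ιℕ-* ((ν ℕ.+ ν ℕ.+ n) ℕ.* rise w (suc (n ℕ.+ (m ℕ.+ m))) ℕ.^ b) (ℓ ℕ.^ s) ∙ cong (_* k) (ιℕ-* (ν ℕ.+ ν ℕ.+ n) _))))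
        where
        c = ιℕ (ν ℕ.+ ν ℕ.+ n)
        x = ιℕ ((G₁ ℕ.* G₂) ℕ.^ b)
        i = inv (ιℕ (G₃ ℕ.^ A))
        k = ιℕ (ℓ ℕ.^ s)
        alg : ∀ c x i k g h → c * (x * i) * k * (g * h) ≡ c * (x * h) * k * (i * g)
        alg = solve-∀ ℚring

-- Null sequences and partial zeta sums

module Limits where

  open import Defs using (pow; zetaPartial)
  open Rationals
  open PowerSeries using (_∙_)
  open PartialFractions
  open Coefficients using (abs-*; *-monoˡ; *-monoʳ)
  open LocalRing using (inv-1/)
  open import Data.Nat as ℕ using (ℕ; zero; suc)
  import Data.Nat.Properties as ℕP
  open import Data.Integer as ℤ using (ℤ)
  import Data.Integer.Properties as ℤP
  import Data.Integer.Tactic.RingSolver as ℤS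
  open import Data.Rational
  open import Data.Rational.Properties
  import Data.Rational.Unnormalised as ᵘ
  import Data.Rational.Unnormalised.Properties as ᵘP
  open import Data.Product using (∃; _×_; _,_; proj₁; proj₂)
  open import Relation.Binary.PropositionalEquality as Eq using (_≡_; _≢_; sym; cong; cong₂; subst)
  open import Tactic.RingSolver using (solve-∀)

  clear-denominator : ∀ q → ιℕ (↧ₙ q) * q ≡ ι (↥ q)
  clear-denominator q@(mkℚ n d _) = toℚᵘ-injective (ᵘP.≃-trans (toℚᵘ-homo-* (ιℕ (suc d)) q) (ᵘP.≃-trans (ᵘP.*-cong (toι (ℤ.+ suc d)) (ᵘP.≃-refl {ᵘ.mkℚᵘ n d}))
      (ᵘP.≃-trans (ᵘ.*≡* lem) (ᵘP.≃-sym (toι n)))))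
    where
    lem : (ℤ.+ suc d ℤ.* n) ℤ.* ℤ.+ 1 ≡ n ℤ.* ℤ.+ (suc (d ℕ.+ 0))
    lem = Eq.trans (alg (ℤ.+ suc d) n) (cong (λ z → n ℤ.* ℤ.+ suc z) (sym (ℕP.+-identityʳ d)))
      where
      alg : ∀ d n → (d ℤ.* n) ℤ.* ℤ.+ 1 ≡ n ℤ.* d
      alg = ℤS.solve-∀

  archimedean : ∀ q → ∃ λ N → ∣ q ∣ ≤ ιℕ N
  archimedean q = ℤ.∣ ↥ ∣ q ∣ ∣ , ≤-trans (≤-reflexive (sym (*-identityˡ ∣ q ∣)))
      (≤-trans (*-monoʳ (0≤∣p∣ q) (≤-trans (≤-reflexive (sym ι1)) (ιℕ-mono {1} {↧ₙ ∣ q ∣} (ℕ.s≤s ℕ.z≤n)))) (≤-trans (≤-reflexive (clear-denominator ∣ q ∣)) (ι-mono (i≤∣i∣ (↥ ∣ q ∣)))))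
    where
    i≤∣i∣ : ∀ z → z ℤ.≤ ℤ.+ ℤ.∣ z ∣
    i≤∣i∣ (ℤ.+ n)      = ℤP.≤-refl
    i≤∣i∣ (ℤ.-[1+ n ]) = ℤ.-≤+

  Null : (ℕ → ℚ) → Set
  Null f = ∀ ε → 0ℚ < ε → ∃ λ N → ∀ n → N ℕ.≤ n → ∣ f n ∣ < ε

  null-cong : ∀ {f g} → (∀ n → f n ≡ g n) → Null f → Null g
  null-cong e h ε p with h ε p
  ... | N , k = N , λ n l → subst (λ z → ∣ z ∣ < ε) (e n) (k n l)

  null-0 : Null (λ _ → 0ℚ)
  null-0 ε p = 0 , λ _ _ → p

  null-+ : ∀ {f g} → Null f → Null g → Null (λ n → f n + g n)
  null-+ {f} {g} hf hg ε p with hf (½ * ε) (*-pos {½} {ε} (positive⁻¹ ½) p) | hg (½ * ε) (*-pos {½} {ε} (positive⁻¹ ½) p)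
  ... | N , k | N′ , k′ = N ℕ.⊔ N′ , λ n l → <-respʳ-≡ (halves ε)
      (≤-<-trans (∣p+q∣≤∣p∣+∣q∣ (f n) (g n)) (+-mono-< (k n (ℕP.≤-trans (ℕP.m≤m⊔n N N′) l)) (k′ n (ℕP.≤-trans (ℕP.m≤n⊔m N N′) l))))
    where
    halves : ∀ ε → ½ * ε + ½ * ε ≡ ε
    halves ε = sym (*-distribʳ-+ ε ½ ½) ∙ *-identityˡ ε

  null-* : ∀ c {f} → Null f → Null (λ n → c * f n)
  null-* c {f} hf ε p with archimedean c
  ... | B , cB with hf (inv (ιℕ (suc B)) * ε) (*-pos (inv-pos (ιℕ>0 (ℕ.s≤s ℕ.z≤n))) p)
  ...   | N , k = N , λ n l → ≤-<-trans (≤-reflexive (∣p*q∣≡∣p∣*∣q∣ c (f n)))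
            (≤-<-trans (*-monoʳ (0≤∣p∣ (f n)) (≤-trans cB (ιℕ-mono (ℕP.n≤1+n B))))
              (subst (ιℕ (suc B) * ∣ f n ∣ <_) e (*-monoʳ-<-pos (ιℕ (suc B)) {{positive (ιℕ>0 {suc B} (ℕ.s≤s ℕ.z≤n))}} (k n l))))
    where
    e : ιℕ (suc B) * (inv (ιℕ (suc B)) * ε) ≡ ε
    e = sym (*-assoc (ιℕ (suc B)) (inv (ιℕ (suc B))) ε) ∙ cong (_* ε) (inv-r (pos⇒≢0 (ιℕ>0 {suc B} (ℕ.s≤s ℕ.z≤n)))) ∙ *-identityˡ ε

  null-Σ : ∀ k {f : ℕ → ℕ → ℚ} → (∀ i → i ℕ.< k → Null (f i)) → Null (λ n → Σ k (λ i → f i n))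
  null-Σ zero    h = null-0
  null-Σ (suc k) h = null-+ (null-Σ k (λ i l → h i (ℕP.m≤n⇒m≤1+n l))) (h k ℕP.≤-refl)

  null-shift : ∀ κ {f} → Null f → Null (λ n → f (n ℕ.+ κ))
  null-shift κ h ε p with h ε p
  ... | N , k = N , λ n l → k (n ℕ.+ κ) (ℕP.≤-trans l (ℕP.m≤m+n n κ))

  null-≤ : ∀ {f g} → (∀ n → ∣ f n ∣ ≤ ∣ g n ∣) → Null g → Null f
  null-≤ e h ε p with h ε p
  ... | N , k = N , λ n l → ≤-<-trans (e n) (k n l)

  inv-suc : ℕ → ℚ
  inv-suc n = inv (ιℕ (suc n))

  inv-suc>0 : ∀ n → 0ℚ < inv-suc n
  inv-suc>0 n = inv-pos (ιℕ>0 (ℕ.s≤s ℕ.z≤n))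

  null-inv : Null inv-suc
  null-inv ε p with archimedean (inv ε)
  ... | N , h = N , λ n l → subst₂′ n (*-monoˡ-<-pos ε {{positive p}} (*-monoʳ-<-pos (inv-suc n) {{positive (inv-suc>0 n)}}
        (≤-<-trans (≤-trans (≤-reflexive (sym (0≤p⇒∣p∣≡p (<⇒≤ (inv-pos p))))) h) (ιℕ-mono-< {N} {suc n} (ℕ.s≤s l)))))
    where
    subst₂′ : ∀ n → (inv-suc n * inv ε) * ε < (inv-suc n * ιℕ (suc n)) * ε → ∣ inv-suc n ∣ < ε
    subst₂′ n = Eq.subst₂ _<_ (*-assoc (inv-suc n) (inv ε) ε ∙ cong (inv-suc n *_) (inv-l (pos⇒≢0 p)) ∙ *-identityʳ _ ∙ sym (0≤p⇒∣p∣≡p (<⇒≤ (inv-suc>0 n))))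
      (cong (_* ε) (inv-l (pos⇒≢0 (ιℕ>0 {suc n} (ℕ.s≤s ℕ.z≤n)))) ∙ *-identityˡ ε)

  pow-≤ : ∀ x s → 0ℚ ≤ x → x ≤ 1ℚ → (0ℚ ≤ pow x s) × (pow x s ≤ 1ℚ)
  pow-≤ x zero    p l = <⇒≤ (positive⁻¹ 1ℚ) , ≤-refl
  pow-≤ x (suc s) p l = *-nonneg p (proj₁ ih) , ≤-trans (*-mono p (<⇒≤ (positive⁻¹ 1ℚ)) l (proj₂ ih)) (≤-reflexive (*-identityˡ 1ℚ))
    where ih = pow-≤ x s p l

  null-pow : ∀ s → Null (λ n → pow (inv-suc n) (suc s))
  null-pow s = null-≤ (λ n → ≤-trans (≤-reflexive (abs-* (inv-suc n) _ (<⇒≤ (inv-suc>0 n)))) (≤-trans (*-monoˡ (<⇒≤ (inv-suc>0 n)) (≤1 n)) (≤-reflexive (*-identityʳ _ ∙ sym (0≤p⇒∣p∣≡p (<⇒≤ (inv-suc>0 n))))))) null-inv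
    where
    open Coefficients using (inv≤1)
    ≤1 : ∀ n → ∣ pow (inv-suc n) s ∣ ≤ 1ℚ
    ≤1 n = ≤-trans (≤-reflexive (0≤p⇒∣p∣≡p (proj₁ h))) (proj₂ h)
      where h = pow-≤ (inv-suc n) s (<⇒≤ (inv-suc>0 n)) (inv≤1 (suc n) (ℕ.s≤s ℕ.z≤n))

  zeta-step : ∀ s n → zetaPartial s (suc n) ≡ zetaPartial s n + pow (inv-suc n) s
  zeta-step s n = cong (λ z → zetaPartial s n + pow z s) (inv-1/ n)

  zeta-window : ∀ s κ K → Σ K (λ k → pow (inv (ιℕ (κ ℕ.+ suc k))) s) ≡ zetaPartial s (K ℕ.+ κ) - zetaPartial s κ
  zeta-window s κ zero    = sym (+-inverseʳ (zetaPartial s κ))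
  zeta-window s κ (suc K) = cong₂ _+_ (zeta-window s κ K) (cong (λ z → pow (inv (ιℕ z)) s) (ℕP.+-suc κ K ∙ cong suc (ℕP.+-comm κ K)))
     ∙ alg (zetaPartial s (K ℕ.+ κ)) (zetaPartial s κ) (pow (inv-suc (K ℕ.+ κ)) s) ∙ cong (_- zetaPartial s κ) (sym (zeta-step s (K ℕ.+ κ)))
    where
    alg : ∀ x y z → (x - y) + z ≡ (x + z) - y
    alg = solve-∀ ℚring

  -- Only finitely many single terms are involved, each tending to 0, so no limit of the series is
  -- presupposed.
  zeta-increment : ∀ s κ → Null (λ K → zetaPartial (suc s) (K ℕ.+ κ) - zetaPartial (suc s) K)
  zeta-increment s zero    = null-cong (λ K → sym (cong (λ z → zetaPartial (suc s) z - zetaPartial (suc s) K) (ℕP.+-identityʳ K) ∙ +-inverseʳ (zetaPartial (suc s) K))) null-0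
  zeta-increment s (suc κ) = null-cong (λ K → alg (zetaPartial (suc s) (K ℕ.+ κ)) (zetaPartial (suc s) K) (pow (inv-suc (K ℕ.+ κ)) (suc s))
         ∙ cong (_- zetaPartial (suc s) K) (sym (zeta-step (suc s) (K ℕ.+ κ)) ∙ cong (zetaPartial (suc s)) (sym (ℕP.+-suc K κ))))
     (null-+ (zeta-increment s κ) (null-shift κ (null-pow s)))
    where
    alg : ∀ x y z → (x - y) + z ≡ (x + z) - y
    alg = solve-∀ ℚring

  -- 1/((w+1)(w+2)) = 1/(w+1) - 1/(w+2)
  telescope : ∀ (f : ℕ → ℚ) X → (∀ w → ∣ f w ∣ * ιℕ (suc w ℕ.* suc (suc w)) ≤ X) → ∀ W → ∣ Σ W f ∣ ≤ X * (1ℚ - inv-suc W)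
  telescope f X h zero    = ≤-reflexive (sym (cong (λ z → X * (1ℚ - inv z)) ι1 ∙ *-zeroʳ X))
  telescope f X h (suc W) = ≤-trans (∣p+q∣≤∣p∣+∣q∣ (Σ W f) (f W)) (≤-trans (+-mono-≤ (telescope f X h W) last) (≤-reflexive (alg X (inv-suc W) (inv-suc (suc W)))))
    where
    i j : ℚ
    i = inv-suc W
    j = inv-suc (suc W)
    n₁ : ιℕ (suc W) ≢ 0ℚ
    n₁ = pos⇒≢0 (ιℕ>0 {suc W} (ℕ.s≤s ℕ.z≤n))
    n₂ : ιℕ (suc (suc W)) ≢ 0ℚ
    n₂ = pos⇒≢0 (ιℕ>0 {suc (suc W)} (ℕ.s≤s ℕ.z≤n))
    alg : ∀ X i j → X * (1ℚ - i) + X * (i - j) ≡ X * (1ℚ - j)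
    alg = solve-∀ ℚring
    ij : i * j ≡ i - j
    ij = sym (cong₂ _-_ (sym (*-identityʳ i)) (sym (*-identityˡ j)) ∙ cong₂ (λ x y → i * x - y * j) (sym (inv-r n₂)) (sym (inv-l n₁))
          ∙ alg₂ i j (ιℕ (suc W)) (ιℕ (suc (suc W))) ∙ cong (λ z → (i * j) * (z - ιℕ (suc W))) (ιℕ-+ 1 (suc W) ∙ cong (_+ ιℕ (suc W)) ι1) ∙ alg₃ (i * j) (ιℕ (suc W)))
      where
      alg₂ : ∀ i j x y → i * (y * j) - (i * x) * j ≡ (i * j) * (y - x)
      alg₂ = solve-∀ ℚring
      alg₃ : ∀ k x → k * ((1ℚ + x) - x) ≡ k
      alg₃ = solve-∀ ℚring
    last : ∣ f W ∣ ≤ X * (i - j)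
    last = Eq.subst₂ _≤_ (*-assoc ∣ f W ∣ (ιℕ (suc W ℕ.* suc (suc W))) (i * j) ∙ cong (∣ f W ∣ *_) (cong (_* (i * j)) (ιℕ-* (suc W) (suc (suc W))) ∙ alg₄ (ιℕ (suc W)) (ιℕ (suc (suc W))) i j ∙ cong₂ _*_ (inv-r n₁) (inv-r n₂)) ∙ *-identityʳ _)
        (cong (X *_) ij) (*-monoʳ (*-nonneg (<⇒≤ (inv-suc>0 W)) (<⇒≤ (inv-suc>0 (suc W)))) (h W))
      where
      alg₄ : ∀ x y i j → (x * y) * (i * j) ≡ (x * i) * (y * j)
      alg₄ = solve-∀ ℚring

-- Calculus of polynomial and exponential bounds

module Asymptotics where

  open Mangoldt
  open Chebyshev
  open Certificates
  open import Data.Nat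
  open import Data.Nat.Properties
  open import Data.Nat.DivMod
  open import Data.Nat.Tactic.RingSolver using (solve-∀)
  open import Data.List using (List; []; _∷_)
  open import Data.Product using (∃; _,_; proj₁; proj₂)
  open import Relation.Binary.PropositionalEquality
  open ≤-Reasoning

  PolyBounded : (ℕ → ℕ) → Set
  PolyBounded f = ∃ λ c → ∃ λ J → ∀ q → f q ≤ (c * suc q) ^ J

  poly-≤ : ∀ {f g} → (∀ q → f q ≤ g q) → PolyBounded g → PolyBounded f
  poly-≤ h (c , J , k) = c , J , λ q → ≤-trans (h q) (k q)

  poly-const : ∀ C → PolyBounded (λ _ → C)
  poly-const C = C , 1 , λ q → ≤-trans (m≤m*n C (suc q)) (≤-reflexive (sym (*-identityʳ (C * suc q))))

  poly-suc : PolyBounded suc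
  poly-suc = 1 , 1 , λ q → ≤-reflexive (sym (*-identityʳ (1 * suc q) ∙ *-identityˡ (suc q)))

  poly-* : ∀ {f g} → PolyBounded f → PolyBounded g → PolyBounded (λ q → f q * g q)
  poly-* {f} {g} (c , J , h) (c′ , J′ , h′) = c + c′ , J + J′ , λ q → begin
    f q * g q                                       ≤⟨ *-mono-≤ (h q) (h′ q) ⟩
    (c * suc q) ^ J * (c′ * suc q) ^ J′             ≤⟨ *-mono-≤ (^-monoˡ-≤ J (*-monoˡ-≤ (suc q) (m≤m+n c c′))) (^-monoˡ-≤ J′ (*-monoˡ-≤ (suc q) (m≤n+m c′ c))) ⟩
    ((c + c′) * suc q) ^ J * ((c + c′) * suc q) ^ J′ ≡⟨ sym (^-distribˡ-+-* ((c + c′) * suc q) J J′) ⟩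
    ((c + c′) * suc q) ^ (J + J′) ∎

  poly-^ : ∀ {f} k → PolyBounded f → PolyBounded (λ q → f q ^ k)
  poly-^ {f} k (c , J , h) = c , J * k , λ q → ≤-trans (^-monoˡ-≤ k (h q)) (≤-reflexive (^-*-assoc (c * suc q) J k))

  poly-linear : ∀ a b → PolyBounded (λ q → a * q + b)
  poly-linear a b = a + b , 1 , λ q → ≤-trans (m≤m+n (a * q + b) (a + b * q)) (≤-reflexive (alg a b q))
    where
    alg : ∀ a b q → a * q + b + (a + b * q) ≡ (a + b) * suc q * 1
    alg = solve-∀

  suc≤2^ : ∀ n → suc n ≤ 2 ^ n
  suc≤2^ zero    = ≤-refl
  suc≤2^ (suc n) = ≤-trans (+-mono-≤ (≥1-^ {2} n (s≤s z≤n)) (suc≤2^ n)) (≤-reflexive (cong (2 ^ n +_) (sym (+-identityʳ (2 ^ n)))))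

  -- With k = 2(J+1) and y = ⌊q/k⌋, both c k and y + 1 are at most 2^y for large q, so c (q+1) ≤
  -- 2^(2y), whose J-th power stays below 2^q.
  poly<exp : ∀ {f} → PolyBounded f → ∃ λ q₀ → ∀ q → q₀ ≤ q → f q ≤ 2 ^ q
  poly<exp {f} (c , J , h) = k * (c * k) , λ q l → begin
    f q                     ≤⟨ h q ⟩
    (c * suc q) ^ J         ≤⟨ ^-monoˡ-≤ J (inner q l) ⟩
    (2 ^ (2 * (q / k))) ^ J ≡⟨ ^-*-assoc 2 (2 * (q / k)) J ⟩
    2 ^ (2 * (q / k) * J)   ≤⟨ ^-monoʳ-≤ 2 {2 * (q / k) * J} {q} (≤-trans (≤-trans (m≤m+n (2 * (q / k) * J) (2 * (q / k))) (≤-reflexive (alg (q / k) J))) (m/n*n≤m q k)) ⟩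
    2 ^ q ∎
    where
    k = 2 * suc J
    alg : ∀ y J → 2 * y * J + 2 * y ≡ y * (2 * suc J)
    alg = solve-∀
    inner : ∀ q → k * (c * k) ≤ q → c * suc q ≤ 2 ^ (2 * (q / k))
    inner q l = begin
      c * suc q               ≤⟨ *-monoʳ-≤ c q< ⟩
      c * (k * suc y)         ≡⟨ sym (*-assoc c k (suc y)) ⟩
      c * k * suc y           ≤⟨ *-mono-≤ (≤-trans (≤-trans ck (n≤1+n y)) (suc≤2^ y)) (suc≤2^ y) ⟩
      2 ^ y * 2 ^ y           ≡⟨ sym (^-distribˡ-+-* 2 y y) ∙ cong (2 ^_) (cong (y +_) (sym (+-identityʳ y))) ⟩
      2 ^ (2 * y) ∎
      where
      y = q / k
      ck : c * k ≤ y
      ck = ≤-trans (≤-reflexive (sym (m*n/n≡m (c * k) k))) (/-monoˡ-≤ k (≤-trans (≤-reflexive (*-comm (c * k) k)) l))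
      q< : suc q ≤ k * suc y
      q< = ≤-trans (s≤s (≤-reflexive (m≡m%n+[m/n]*n q k))) (≤-trans (+-monoˡ-≤ (y * k) (m%n<n q k)) (≤-reflexive (*-comm (suc y) k)))

  floor-scale : ∀ B k c → (B / suc k) * c ≤ B * (c / suc k + 1)
  floor-scale B k c = begin
    y * c                        ≤⟨ *-monoʳ-≤ y c≤ ⟩
    y * ((c / suc k + 1) * suc k) ≡⟨ alg y (c / suc k + 1) (suc k) ⟩
    (y * suc k) * (c / suc k + 1) ≤⟨ *-monoˡ-≤ (c / suc k + 1) (m/n*n≤m B (suc k)) ⟩
    B * (c / suc k + 1) ∎
    where
    y = B / suc k
    alg : ∀ y c k → y * (c * k) ≡ (y * k) * c
    alg = solve-∀
    c≤ : c ≤ (c / suc k + 1) * suc k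
    c≤ = ≤-trans (≤-reflexive (m≡m%n+[m/n]*n c (suc k))) (≤-trans (+-monoˡ-≤ ((c / suc k) * suc k) (<⇒≤ (m%n<n c (suc k)))) (≤-reflexive (alg₂ (c / suc k) (suc k))))
      where
      alg₂ : ∀ x k → k + x * k ≡ (x + 1) * k
      alg₂ = solve-∀

  ExpBounded : ℕ → (ℕ → ℕ) → Set
  ExpBounded E f = ∃ λ c → ∃ λ J → ∀ B → f B ≤ 2 ^ (B * E) * (c * suc B) ^ J

  exp-cong : ∀ {E f g} → (∀ B → f B ≤ g B) → ExpBounded E g → ExpBounded E f
  exp-cong h (c , J , k) = c , J , λ B → ≤-trans (h B) (k B)

  exp-* : ∀ {E E′ f g} → ExpBounded E f → ExpBounded E′ g → ExpBounded (E + E′) (λ B → f B * g B)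
  exp-* {E} {E′} {f} {g} (c , J , h) (c′ , J′ , h′) = proj₁ p , proj₁ (proj₂ p) , λ B → begin
    f B * g B ≤⟨ *-mono-≤ (h B) (h′ B) ⟩
    (2 ^ (B * E) * (c * suc B) ^ J) * (2 ^ (B * E′) * (c′ * suc B) ^ J′) ≡⟨ alg (2 ^ (B * E)) ((c * suc B) ^ J) (2 ^ (B * E′)) ((c′ * suc B) ^ J′) ⟩
    (2 ^ (B * E) * 2 ^ (B * E′)) * ((c * suc B) ^ J * (c′ * suc B) ^ J′) ≤⟨ *-mono-≤ (≤-reflexive (sym (^-distribˡ-+-* 2 (B * E) (B * E′)) ∙ cong (2 ^_) (sym (*-distribˡ-+ B E E′)))) (proj₂ (proj₂ p) B) ⟩
    2 ^ (B * (E + E′)) * (proj₁ p * suc B) ^ proj₁ (proj₂ p) ∎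
    where
    p : PolyBounded (λ B → (c * suc B) ^ J * (c′ * suc B) ^ J′)
    p = poly-* (c , J , λ _ → ≤-refl) (c′ , J′ , λ _ → ≤-refl)
    alg : ∀ a b x y → (a * b) * (x * y) ≡ (a * x) * (b * y)
    alg = solve-∀

  exp-poly : ∀ {f} → PolyBounded f → ExpBounded 0 f
  exp-poly (c , J , h) = c , J , λ B → ≤-trans (h B) (≤-trans (m≤n*m _ 1) (≤-reflexive (cong (λ z → 2 ^ z * (c * suc B) ^ J) (sym (*-zeroʳ B)))))

  exp-^ : ∀ {E f} k → ExpBounded E f → ExpBounded (k * E) (λ B → f B ^ k)
  exp-^ zero    h = exp-poly (poly-const 1)
  exp-^ (suc k) h = exp-* h (exp-^ k h)

  exp-/ : ∀ {δ f} g k → ExpBounded δ f → ExpBounded (g * δ / suc k + 1) (λ B → f (B / suc k) ^ g)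
  exp-/ {δ} {f} g k (c , J , h) = c , J * g , λ B → begin
    f (B / suc k) ^ g ≤⟨ ^-monoˡ-≤ g (h (B / suc k)) ⟩
    (2 ^ ((B / suc k) * δ) * (c * suc (B / suc k)) ^ J) ^ g ≡⟨ ^-distribʳ-* (2 ^ ((B / suc k) * δ)) ((c * suc (B / suc k)) ^ J) g ∙ cong₂ _*_ (^-*-assoc 2 ((B / suc k) * δ) g ∙ cong (2 ^_) (*-assoc (B / suc k) δ g ∙ cong ((B / suc k) *_) (*-comm δ g))) (^-*-assoc (c * suc (B / suc k)) J g) ⟩
    2 ^ ((B / suc k) * (g * δ)) * (c * suc (B / suc k)) ^ (J * g) ≤⟨ *-mono-≤ (^-monoʳ-≤ 2 (floor-scale B k (g * δ))) (^-monoˡ-≤ (J * g) (*-monoʳ-≤ c (s≤s (m/n≤m B (suc k))))) ⟩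
    2 ^ (B * (g * δ / suc k + 1)) * (c * suc B) ^ (J * g) ∎

  -- The summand 1 rounds each quotient up, because ⌊B/(k+1)⌋ g δ has to be bounded by an integral
  -- multiple of B.
  penalty-rate : ℕ → List Ent → ℕ
  penalty-rate δ []            = 0
  penalty-rate δ ((g , k) ∷ l) = (g * δ / suc k + 1) + penalty-rate δ l

  swap-pow : ∀ x p q → (x ^ p) ^ q ≡ (x ^ q) ^ p
  swap-pow x p q = ^-*-assoc x p q ∙ cong (x ^_) (*-comm p q) ∙ sym (^-*-assoc x q p)

  exp-dpen : ∀ {δ} K → ExpBounded δ (λ x → d x ^ K) → ∀ l → ExpBounded (penalty-rate δ l) (λ B → dpen l B ^ K)
  exp-dpen K h []            = exp-cong (λ B → ≤-reflexive (^-zeroˡ K)) (exp-poly (poly-const 1))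
  exp-dpen K h ((g , k) ∷ l) = exp-cong (λ B → ≤-reflexive (^-distribʳ-* (d (B / suc k) ^ g) (dpen l B) K ∙ cong (_* dpen l B ^ K) (swap-pow (d (B / suc k)) g K))) (exp-* (exp-/ g k h) (exp-dpen K h l))

  exp-certificate : ∀ {Y δ} (C : Certificate Y) → ExpBounded δ (λ x → d x ^ Certificate.K C) →
    ExpBounded (Certificate.E C + penalty-rate δ (Certificate.pen C)) (λ B → (⟦ (λ w → Y (fl B w)) ⟧ B ^ Certificate.s C) ^ Certificate.K C)
  exp-certificate C h = exp-cong bound (exp-* main (exp-* {0} (exp-poly (poly-^ K (poly-^ (wt pos + wt neg) (poly-* poly-suc (poly-const Mx))))) (exp-dpen K h pen)))
    where
    open Certificate C
    main : ExpBounded E (λ B → 2 ^ (B * E))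
    main = 1 , 0 , λ B → ≤-reflexive (sym (*-identityʳ (2 ^ (B * E))))

-- Growth of the denominators against decay of the series

module Rates where

  open Mangoldt
  open Chebyshev
  open Certificates
  open Asymptotics
  open import Data.Nat
  open import Data.Nat.Properties
  open import Data.Nat.DivMod
  open import Data.Nat.Tactic.RingSolver using (solve-∀)
  open import Data.Product using (∃; _,_; proj₁; proj₂)
  open import Relation.Binary.PropositionalEquality
  open ≤-Reasoning

  -- The crude rate 4 = log₂ 16 enters only through the penalties of H, so a single pass already
  -- sharpens it.
  lcm-rate : (H : Certificate (step 1)) → Certificate.s H ≡ 1 →
    ExpBounded (Certificate.E H + penalty-rate (4 * Certificate.K H) (Certificate.pen H)) (λ x → d x ^ Certificate.K H)
  lcm-rate H s≡1 = exp-cong (λ B → ≤-reflexive (cong (_^ K) (sym (cong (⟦ (λ w → step 1 (fl B w)) ⟧ B ^_) s≡1 ∙ *-identityʳ _ ∙ ⟦step⟧ 0 B ∙ cong d (n/1≡n B)))))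
      (exp-certificate H (1 , 0 , λ x → ≤-trans (^-monoˡ-≤ K (d≤16^ x)) (≤-reflexive (cong (_^ K) (^-*-assoc 2 4 x) ∙ ^-*-assoc 2 (4 * x) K ∙ cong (2 ^_) (alg x K) ∙ sym (*-identityʳ _)))))
    where
    open Certificate H
    alg : ∀ x K → 4 * x * K ≡ x * (4 * K)
    alg = solve-∀

  combined-rate : ∀ {Y Y′ δ} (C : Certificate Y) (C′ : Certificate Y′) c → Certificate.s C′ ≡ Certificate.s C → Certificate.K C′ ≡ Certificate.K C → ExpBounded δ (λ x → d x ^ Certificate.K C) →
    ExpBounded ((Certificate.E C + penalty-rate δ (Certificate.pen C)) + c * (Certificate.E C′ + penalty-rate δ (Certificate.pen C′)))
      (λ B → ⟦ (λ w → Y (fl B w) + c * Y′ (fl B w)) ⟧ B ^ (Certificate.s C * Certificate.K C))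
  combined-rate {Y} {Y′} {δ} C C′ c s≡ K≡ h = exp-cong (λ B → ≤-reflexive (
        cong (_^ (s C * K C)) (⟦⟧-+ (λ w → Y (fl B w)) (λ w → c * Y′ (fl B w)) B ∙ cong (⟦ (λ w → Y (fl B w)) ⟧ B *_) (⟦⟧-* c (λ w → Y′ (fl B w)) B))
      ∙ ^-distribʳ-* (⟦ (λ w → Y (fl B w)) ⟧ B) (⟦ (λ w → Y′ (fl B w)) ⟧ B ^ c) (s C * K C)
      ∙ cong₂ _*_ (sym (^-*-assoc (⟦ (λ w → Y (fl B w)) ⟧ B) (s C) (K C))) (swap-pow (⟦ (λ w → Y′ (fl B w)) ⟧ B) c (s C * K C) ∙ cong (_^ c) (cong₂ (λ x y → ⟦ (λ w → Y′ (fl B w)) ⟧ B ^ (x * y)) (sym s≡) (sym K≡) ∙ sym (^-*-assoc (⟦ (λ w → Y′ (fl B w)) ⟧ B) (s C′) (K C′))))))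
      (exp-* (exp-certificate C h) (exp-^ c (exp-certificate C′ (subst (λ k → ExpBounded δ (λ x → d x ^ k)) (sym K≡) h))))
    where open Certificate using (s; K)

  -- The function y is taken at 12n = 24q + 12, whence 24 E. After raising to a fixed power, the
  -- spare 1 in `hE` leaves a factor 2^q that absorbs every polynomial.
  decay : ∀ {α γ} (y : ℕ → ℕ) {E} κ′ k₂ F → ExpBounded E (λ B → y B ^ suc κ′) → α ^ suc k₂ * 2 ^ F ≤ γ ^ suc k₂ → 24 * E * suc k₂ + 1 ≤ F * suc κ′ →
    ∀ f → PolyBounded f → ∃ λ q₀ → ∀ q → q₀ ≤ q → f q * (y (12 * suc (2 * q)) * α ^ q) ≤ γ ^ q
  decay {α} {γ} y {E} κ′ k₂ F (c , J , h) hα hE f pf = proj₁ ev , λ q l → pow-cancel (k₂ + κ′ * suc k₂) (main q l)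
    where
    κ = suc κ′
    K₂ = suc k₂
    n : ℕ → ℕ
    n q = 12 * suc (2 * q)
    p : ℕ → ℕ
    p q = (c * suc (n q)) ^ J
    g : ℕ → ℕ
    g q = f q ^ (κ * K₂) * (2 ^ (12 * E * K₂) * p q ^ K₂)
    pg : PolyBounded g
    pg = poly-* (poly-^ (κ * K₂) pf) (poly-* (poly-const (2 ^ (12 * E * K₂))) (poly-^ K₂ (poly-^ J (poly-* (poly-const c) (poly-≤ (λ q → ≤-reflexive (alg q)) (poly-linear 24 13))))))
      where
      alg : ∀ q → suc (12 * suc (2 * q)) ≡ 24 * q + 13
      alg = solve-∀
    ev = poly<exp pg
    y-bound : ∀ q → (y (n q) ^ κ) ^ K₂ ≤ 2 ^ (q * (24 * E * K₂)) * (2 ^ (12 * E * K₂) * p q ^ K₂)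
    y-bound q = begin
      (y (n q) ^ κ) ^ K₂              ≤⟨ ^-monoˡ-≤ K₂ (h (n q)) ⟩
      (2 ^ (n q * E) * p q) ^ K₂      ≡⟨ ^-distribʳ-* (2 ^ (n q * E)) (p q) K₂ ∙ cong (_* p q ^ K₂) (^-*-assoc 2 (n q * E) K₂ ∙ cong (2 ^_) (alg q E K₂) ∙ ^-distribˡ-+-* 2 (q * (24 * E * K₂)) (12 * E * K₂)) ∙ *-assoc (2 ^ (q * (24 * E * K₂))) _ _ ⟩
      2 ^ (q * (24 * E * K₂)) * (2 ^ (12 * E * K₂) * p q ^ K₂) ∎
      where
      alg : ∀ q E K → 12 * suc (2 * q) * E * K ≡ q * (24 * E * K) + 12 * E * K
      alg = solve-∀
    main : ∀ q → proj₁ ev ≤ q → (f q * (y (n q) * α ^ q)) ^ (κ * K₂) ≤ (γ ^ q) ^ (κ * K₂)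
    main q l = begin
      (f q * (y (n q) * α ^ q)) ^ (κ * K₂) ≡⟨ ^-distribʳ-* (f q) (y (n q) * α ^ q) (κ * K₂) ∙ cong (f q ^ (κ * K₂) *_) (^-distribʳ-* (y (n q)) (α ^ q) (κ * K₂) ∙ cong (_* (α ^ q) ^ (κ * K₂)) (sym (^-*-assoc (y (n q)) κ K₂))) ⟩
      f q ^ (κ * K₂) * ((y (n q) ^ κ) ^ K₂ * (α ^ q) ^ (κ * K₂)) ≤⟨ *-monoʳ-≤ (f q ^ (κ * K₂)) (*-monoˡ-≤ ((α ^ q) ^ (κ * K₂)) (y-bound q)) ⟩
      f q ^ (κ * K₂) * (2 ^ (q * (24 * E * K₂)) * (2 ^ (12 * E * K₂) * p q ^ K₂) * (α ^ q) ^ (κ * K₂)) ≡⟨ alg₁ (f q ^ (κ * K₂)) (2 ^ (q * (24 * E * K₂))) (2 ^ (12 * E * K₂) * p q ^ K₂) ((α ^ q) ^ (κ * K₂)) ⟩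
      g q * 2 ^ (q * (24 * E * K₂)) * (α ^ q) ^ (κ * K₂) ≤⟨ *-monoˡ-≤ ((α ^ q) ^ (κ * K₂)) (*-monoˡ-≤ (2 ^ (q * (24 * E * K₂))) (proj₂ ev q l)) ⟩
      2 ^ q * 2 ^ (q * (24 * E * K₂)) * (α ^ q) ^ (κ * K₂) ≡⟨ cong (_* (α ^ q) ^ (κ * K₂)) (sym (^-distribˡ-+-* 2 q (q * (24 * E * K₂))) ∙ cong (2 ^_) (alg₂ q (24 * E * K₂))) ⟩
      2 ^ (q * (24 * E * K₂ + 1)) * (α ^ q) ^ (κ * K₂) ≤⟨ *-monoˡ-≤ ((α ^ q) ^ (κ * K₂)) (^-monoʳ-≤ 2 (*-monoʳ-≤ q hE)) ⟩
      2 ^ (q * (F * κ)) * (α ^ q) ^ (κ * K₂) ≡⟨ *-comm (2 ^ (q * (F * κ))) _ ∙ cong₂ _*_ (regroup α) (cong (2 ^_) (alg₃ q F κ) ∙ sym (^-*-assoc 2 F (q * κ))) ∙ sym (^-distribʳ-* (α ^ K₂) (2 ^ F) (q * κ)) ⟩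
      (α ^ K₂ * 2 ^ F) ^ (q * κ) ≤⟨ ^-monoˡ-≤ (q * κ) hα ⟩
      (γ ^ K₂) ^ (q * κ) ≡⟨ sym (regroup γ) ⟩
      (γ ^ q) ^ (κ * K₂) ∎
      where
      regroup : ∀ x → (x ^ q) ^ (κ * K₂) ≡ (x ^ K₂) ^ (q * κ)
      regroup x = ^-*-assoc x q (κ * K₂) ∙ cong (x ^_) (alg₄ q κ K₂) ∙ sym (^-*-assoc x K₂ (q * κ))
        where
        alg₄ : ∀ q κ K → q * (κ * K) ≡ K * (q * κ)
        alg₄ = solve-∀
      alg₁ : ∀ f t p a → f * (t * p * a) ≡ f * p * t * a
      alg₁ = solve-∀
      alg₂ : ∀ q e → q + q * e ≡ q * (e + 1)
      alg₂ = solve-∀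
      alg₃ : ∀ q F κ → q * (F * κ) ≡ F * (q * κ)
      alg₃ = solve-∀

  -- The product on the right is (5q+3)!/(3q+1)!, and 3125/108 = 5^5/(2^2 3^3) is the growth rate of
  -- (5q)!/((2q)!(3q)!).
  factorial-ratio : ∀ q → (suc (2 * q)) ! * 3125 ^ q ≤ rise (3 * q + 1 + 0) (2 * q + 2) * ((5 * q + 1) ^ 5 * 108 ^ q)
  factorial-ratio q = *-cancelˡ-≤ ((5 * q) ! * (3 * q) !) {{>-nonZero (*-mono-≤ (1≤n! (5 * q)) (1≤n! (3 * q)))}} (begin
    (5 * q) ! * (3 * q) ! * (n ! * 3125 ^ q)  ≡⟨ a₁ ((5 * q) !) ((3 * q) !) (suc (2 * q)) ((2 * q) !) (3125 ^ q) ⟩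
    suc (2 * q) * (5 * q) ! * ((2 * q) ! * (3 * q) ! * 3125 ^ q) ≤⟨ *-monoʳ-≤ (suc (2 * q) * (5 * q) !) fs ⟩
    suc (2 * q) * (5 * q) ! * ((5 * q) ! * suc (5 * q) ^ 5 * 108 ^ q) ≡⟨ a₂ (suc (2 * q)) ((5 * q) !) (suc (5 * q) ^ 5) (108 ^ q) ⟩
    suc (2 * q) * (5 * q) ! * ((5 * q) ! * (suc (5 * q) ^ 5 * 108 ^ q)) ≤⟨ *-monoˡ-≤ ((5 * q) ! * (suc (5 * q) ^ 5 * 108 ^ q)) g≥ ⟩
    (3 * q) ! * G * ((5 * q) ! * (suc (5 * q) ^ 5 * 108 ^ q)) ≡⟨ a₃ ((3 * q) !) G ((5 * q) !) (suc (5 * q) ^ 5 * 108 ^ q) ∙ cong (λ z → (5 * q) ! * (3 * q) ! * (G * (z ^ 5 * 108 ^ q))) (+-comm 1 (5 * q)) ⟩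
    (5 * q) ! * (3 * q) ! * (G * ((5 * q + 1) ^ 5 * 108 ^ q)) ∎)
    where
    n = suc (2 * q)
    G = rise (3 * q + 1 + 0) (2 * q + 2)
    a₁ : ∀ x y n z t → x * y * ((n * z) * t) ≡ n * x * (z * y * t)
    a₁ = solve-∀
    a₂ : ∀ n x s t → n * x * (x * s * t) ≡ n * x * (x * (s * t))
    a₂ = solve-∀
    a₃ : ∀ y G x s → y * G * (x * s) ≡ x * y * (G * s)
    a₃ = solve-∀
    fs : (2 * q) ! * (3 * q) ! * 3125 ^ q ≤ (5 * q) ! * suc (5 * q) ^ 5 * 108 ^ q
    fs = begin
      (2 * q) ! * (3 * q) ! * 3125 ^ q ≤⟨ *-monoˡ-≤ (3125 ^ q) (*-mono-≤ (fact-lower 2 q) (fact-lower 3 q)) ⟩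
      ((q !) ^ 2 * 2 ^ (2 * q)) * ((q !) ^ 3 * 3 ^ (3 * q)) * 3125 ^ q ≡⟨ cong₂ (λ x y → ((q !) ^ 2 * x) * ((q !) ^ 3 * y) * 3125 ^ q) (sym (^-*-assoc 2 2 q)) (sym (^-*-assoc 3 3 q)) ∙ alg ((q !) ^ 2) (4 ^ q) ((q !) ^ 3) (27 ^ q) (3125 ^ q) ∙ cong₂ (λ x y → x * 3125 ^ q * y) (sym (^-distribˡ-+-* (q !) 2 3)) (sym (^-distribʳ-* 4 27 q)) ⟩
      (q !) ^ 5 * 3125 ^ q * 108 ^ q ≤⟨ *-monoˡ-≤ (108 ^ q) (≤-trans (≤-reflexive (cong ((q !) ^ 5 *_) (^-*-assoc 5 5 q))) (fact-upper 5 q)) ⟩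
      (5 * q) ! * suc (5 * q) ^ 5 * 108 ^ q ∎
      where
      alg : ∀ a x b y z → (a * x) * (b * y) * z ≡ (a * b) * z * (x * y)
      alg = solve-∀
    -- (3q)! G ≥ (5q)! (2q+1): both sides times 3q+1 are compared with (5q+3)!
    g≥ : suc (2 * q) * (5 * q) ! ≤ (3 * q) ! * G
    g≥ = *-cancelˡ-≤ (suc (3 * q)) (begin
      suc (3 * q) * (suc (2 * q) * (5 * q) !) ≤⟨ *-mono-≤ (s≤s (*-monoˡ-≤ q {3} {5} (m≤m+n 3 2))) (*-monoˡ-≤ ((5 * q) !) (s≤s (≤-trans (*-monoˡ-≤ q {2} {5} (m≤m+n 2 3)) (n≤1+n _)))) ⟩
      suc (5 * q) * (suc (suc (5 * q)) * (5 * q) !) ≡⟨ alg (suc (5 * q)) (suc (suc (5 * q))) ((5 * q) !) ⟩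
      suc (suc (5 * q)) ! ≤⟨ m≤n*m (suc (suc (5 * q)) !) (suc (suc (suc (5 * q)))) ⟩
      suc (suc (suc (5 * q))) ! ≡⟨ cong _! (alg₂ q) ∙ rise-! (3 * q + 1 + 0) (2 * q + 2) ∙ cong (λ z → z ! * G) (alg₃ q) ∙ *-assoc (suc (3 * q)) ((3 * q) !) G ⟩
      suc (3 * q) * ((3 * q) ! * G) ∎)
      where
      alg : ∀ a b c → a * (b * c) ≡ b * (a * c)
      alg = solve-∀
      alg₂ : ∀ q → suc (suc (suc (5 * q))) ≡ 3 * q + 1 + 0 + (2 * q + 2)
      alg₂ = solve-∀
      alg₃ : ∀ q → 3 * q + 1 + 0 ≡ suc (3 * q)
      alg₃ = solve-∀

  -- The numerical input for one value of b = 3 + c: the growth rate of the arithmetic factor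
  -- is beaten by the decay rate of the series.
  record Numerics (c : ℕ) (y : ℕ → ℕ) : Set where
    b = 3 + c
    field
      T ϑ κ′ k₂ F E : ℕ
      T≡ : suc T ≡ 8 * b
      hd : suc ϑ ^ b * 13 ^ T ≤ 21 ^ T
      rate : ExpBounded E (λ B → y B ^ suc κ′)
      -- F/(k₂+1) is a lower bound for the number of bits by which the series decays per unit of q.
      hα : (suc ϑ ^ (8 * b) * 108 ^ T) ^ suc k₂ * 2 ^ F ≤ (ϑ ^ (8 * b) * 3125 ^ T) ^ suc k₂
      hE : 24 * E * suc k₂ + 1 ≤ F * suc κ′

    ϑ≥1 : 1 ≤ ϑ
    ϑ≥1 = pos-d ϑ hα
      where
      pos-d : ∀ ϑ → (suc ϑ ^ (8 * b) * 108 ^ T) ^ suc k₂ * 2 ^ F ≤ (ϑ ^ (8 * b) * 3125 ^ T) ^ suc k₂ → 1 ≤ ϑ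
      pos-d (suc ϑ) _ = s≤s z≤n
      pos-d zero h with ≤-trans (*-mono-≤ (≥1-^ (suc k₂) (*-mono-≤ (≥1-^ {1} (8 * b) ≤-refl) (≥1-^ {108} T (m≤m+n 1 107)))) (≥1-^ {2} F (m≤m+n 1 1))) h
      ... | ()

    smallness : ∀ Q (k : ℕ → ℕ) → PolyBounded k → ∃ λ q₀ → ∀ q → q₀ ≤ q →
      Q * ((((suc (2 * q)) !) ^ T * y (12 * suc (2 * q))) * k q * (suc ϑ ^ ((8 * q + 4) * b) * (q + 10) ^ (3 * b)) * (8 * q + 5)) ≤ ϑ ^ ((8 * q + 4) * b) * rise (3 * q + 1 + 0) (2 * q + 2) ^ T
    smallness Q k pk = proj₁ dec , λ q l → *-cancelʳ-≤ _ _ ((3125 ^ q) ^ T) {{>-nonZero (≥1-^ T (≥1-^ q (m≤m+n 1 3124)))}} (begin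
      Q * ((((suc (2 * q)) !) ^ T * Y q) * k q * (D′ q * (q + 10) ^ (3 * b)) * (8 * q + 5)) * (3125 ^ q) ^ T
        ≡⟨ alg₁ Q (((suc (2 * q)) !) ^ T) (Y q) (k q) (D′ q) ((q + 10) ^ (3 * b)) (8 * q + 5) ((3125 ^ q) ^ T) ⟩
      R q * (Y q * D′ q) * (((suc (2 * q)) !) ^ T * (3125 ^ q) ^ T)
        ≤⟨ *-monoʳ-≤ (R q * (Y q * D′ q)) (≤-trans (≤-reflexive (sym (^-distribʳ-* ((suc (2 * q)) !) (3125 ^ q) T))) (≤-trans (^-monoˡ-≤ T (factorial-ratio q)) (≤-reflexive (^-distribʳ-* (G q) ((5 * q + 1) ^ 5 * 108 ^ q) T ∙ cong (G q ^ T *_) (^-distribʳ-* ((5 * q + 1) ^ 5) (108 ^ q) T))))) ⟩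
      R q * (Y q * D′ q) * (G q ^ T * (((5 * q + 1) ^ 5) ^ T * (108 ^ q) ^ T))
        ≡⟨ cong (λ z → R q * (Y q * z) * (G q ^ T * (((5 * q + 1) ^ 5) ^ T * (108 ^ q) ^ T))) (split (suc ϑ) q) ∙ alg₂ (R q) (Y q) ((suc ϑ ^ (8 * b)) ^ q) (suc ϑ ^ (4 * b)) (G q ^ T) (((5 * q + 1) ^ 5) ^ T) ((108 ^ q) ^ T) ∙ cong (λ z → G q ^ T * (f q * (Y q * z))) (cong ((suc ϑ ^ (8 * b)) ^ q *_) (swap-pow 108 q T) ∙ sym (^-distribʳ-* (suc ϑ ^ (8 * b)) (108 ^ T) q)) ⟩
      G q ^ T * (f q * (Y q * (suc ϑ ^ (8 * b) * 108 ^ T) ^ q))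
        ≤⟨ *-monoʳ-≤ (G q ^ T) (proj₂ dec q l) ⟩
      G q ^ T * (ϑ ^ (8 * b) * 3125 ^ T) ^ q
        ≡⟨ cong (G q ^ T *_) (^-distribʳ-* (ϑ ^ (8 * b)) (3125 ^ T) q ∙ cong ((ϑ ^ (8 * b)) ^ q *_) (swap-pow 3125 T q)) ⟩
      G q ^ T * ((ϑ ^ (8 * b)) ^ q * (3125 ^ q) ^ T)
        ≤⟨ *-monoʳ-≤ (G q ^ T) (*-monoˡ-≤ ((3125 ^ q) ^ T) (≤-trans (≤-trans (≤-reflexive (sym (*-identityʳ ((ϑ ^ (8 * b)) ^ q)))) (*-monoʳ-≤ ((ϑ ^ (8 * b)) ^ q) (≥1-^ (4 * b) ϑ≥1))) (≤-reflexive (sym (split ϑ q))))) ⟩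
      G q ^ T * (ϑ ^ ((8 * q + 4) * b) * (3125 ^ q) ^ T)
        ≡⟨ alg₃ (G q ^ T) (ϑ ^ ((8 * q + 4) * b)) ((3125 ^ q) ^ T) ⟩
      ϑ ^ ((8 * q + 4) * b) * G q ^ T * (3125 ^ q) ^ T ∎)
      where
      Y G D′ R f : ℕ → ℕ
      Y q = y (12 * suc (2 * q))
      G q = rise (3 * q + 1 + 0) (2 * q + 2)
      D′ q = suc ϑ ^ ((8 * q + 4) * b)
      R q = Q * (k q * ((q + 10) ^ (3 * b) * (8 * q + 5)))
      f q = R q * (suc ϑ ^ (4 * b) * ((5 * q + 1) ^ 5) ^ T)
      pf : PolyBounded f
      pf = poly-* (poly-* (poly-const Q) (poly-* pk (poly-* (poly-^ (3 * b) (poly-≤ (λ q → +-monoˡ-≤ 10 (≤-reflexive (sym (*-identityˡ q)))) (poly-linear 1 10))) (poly-linear 8 5)))) (poly-* (poly-const (suc ϑ ^ (4 * b))) (poly-^ T (poly-^ 5 (poly-linear 5 1))))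
      dec = decay {suc ϑ ^ (8 * b) * 108 ^ T} {ϑ ^ (8 * b) * 3125 ^ T} y {E} κ′ k₂ F rate hα hE f pf
      split : ∀ x q → x ^ ((8 * q + 4) * b) ≡ (x ^ (8 * b)) ^ q * x ^ (4 * b)
      split x q = cong (x ^_) (a q b) ∙ ^-distribˡ-+-* x (8 * b * q) (4 * b) ∙ cong (_* x ^ (4 * b)) (sym (^-*-assoc x (8 * b) q))
        where
        a : ∀ q b → (8 * q + 4) * b ≡ 8 * b * q + 4 * b
        a = solve-∀
      alg₁ : ∀ Q n Y k D p e t → Q * ((n * Y) * k * (D * p) * e) * t ≡ (Q * (k * (p * e))) * (Y * D) * (n * t)
      alg₁ = solve-∀
      alg₂ : ∀ R Y x s G p t → R * (Y * (x * s)) * (G * (p * t)) ≡ G * ((R * (s * p)) * (Y * (x * t)))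
      alg₂ = solve-∀
      alg₃ : ∀ G ϑ t → G * (ϑ * t) ≡ ϑ * G * t
      alg₃ = solve-∀

-- Primes, denominators and rearrangement of sums

module Preparation where

  open import Defs using (pow)
  open Mangoldt
  open Rationals
  open PowerSeries using (_∙_)
  open PartialFractions
  open LocalExpansion using (sg; sg-even)
  open IntegerValues using (IsInt; int-*; int-ι; int-≡; hinv)
  open Coefficients using (*-monoʳ)
  open Limits
  open import Data.Nat as ℕ using (ℕ; zero; suc; _!)
  import Data.Nat.Properties as ℕP
  open import Data.Nat.DivMod using (m≡m%n+[m/n]*n; m%n<n; _/_; _%_)
  open import Data.Nat.Divisibility using (_∣_; divides; ∣m+n∣m⇒∣n; ∣1⇒≡1; m∣m*n; ∣-trans; m≤n⇒m!∣n!)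
  open import Data.Nat.Primality using (Prime; prime?)
  import Data.Nat.Tactic.RingSolver as ℕS
  open import Data.Integer as ℤ using (ℤ; -[1+_])
  open import Data.Rational hiding (_/_)
  open import Data.Rational.Properties
  open import Data.List using (replicate)
  open import Data.Product using (∃; _×_; _,_)
  open import Data.Sum using (_⊎_; inj₁; inj₂)
  open import Data.Empty using (⊥-elim)
  open import Relation.Nullary
  open import Relation.Nullary.Decidable using (toWitness)
  open import Data.Unit using (tt)
  open import Relation.Binary.PropositionalEquality using (_≡_; _≢_; refl; sym; cong; subst)
  open import Tactic.RingSolver using (solve-∀)

  ⟦⟧-extend : ∀ e k B → ⟦ e ⟧ B ℕ.≤ ⟦ e ⟧ (k ℕ.+ B)
  ⟦⟧-extend e zero    B = ℕP.≤-refl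
  ⟦⟧-extend e (suc k) B = ℕP.≤-trans (⟦⟧-extend e k B) (ℕP.m≤m*n (⟦ e ⟧ (k ℕ.+ B)) (Λ (k ℕ.+ B) ℕ.^ e (k ℕ.+ B)) {{ℕ.>-nonZero (ℕP.m^n>0 (Λ (k ℕ.+ B)) {{ℕ.>-nonZero (Λ≥1 (k ℕ.+ B))}} (e (k ℕ.+ B)))}})

  -- Euclid: every prime factor of N! + 1 exceeds N.
  large-prime : ∀ N → ∃ λ p → Prime p × N ℕ.< p
  large-prime N with primeDivisor (suc (N !)) (ℕ.s≤s (ℕP.1≤n! N))
  ... | p , pr , p∣ with N ℕ.<? p
  ...   | yes l = p , pr , l
  ...   | no ¬l = ⊥-elim (ℕP.<-irrefl (sym (∣1⇒≡1 (∣m+n∣m⇒∣n (subst (p ∣_) (ℕP.+-comm 1 (N !)) p∣) (p∣N! p (prime>1 pr) (ℕP.≮⇒≥ ¬l))))) (prime>1 pr))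
    where
    p∣N! : ∀ p → 1 ℕ.< p → p ℕ.≤ N → p ∣ N !
    p∣N! (suc p) _ l = ∣-trans (m∣m*n (p !)) (m≤n⇒m!∣n! l)

  odd-prime : ∀ N → ∃ λ q → N ℕ.≤ q × Prime (suc (2 ℕ.* q))
  odd-prime N with large-prime (2 ℕ.+ 2 ℕ.* N)
  ... | p , pr , l with p % 2 in eq | m≡m%n+[m/n]*n p 2 | m%n<n p 2
  ...   | zero | e | _ = ⊥-elim (ℕP.<-irrefl (prime∣prime two pr (divides (p / 2) e)) (ℕP.≤-trans (ℕ.s≤s (ℕP.m≤m+n 2 (2 ℕ.* N))) l))
    where
    two : Prime 2
    two = toWitness {a? = prime? 2} tt
  ...   | suc zero | e | _ = p / 2 , ℕP.*-cancelˡ-≤ 2 (ℕP.≤-trans (ℕP.m≤n+m (2 ℕ.* N) 2) (ℕP.≤-pred (ℕP.≤-trans l (ℕP.≤-reflexive (e′))))) , subst Prime e′ pr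
    where
    e′ : p ≡ suc (2 ℕ.* (p / 2))
    e′ = e ∙ cong suc (ℕP.*-comm (p / 2) 2)
  ...   | suc (suc _) | e | ℕ.s≤s (ℕ.s≤s ())

  common-denominator : ∀ k (z : ℕ → ℚ) → ∃ λ Q → 1 ℕ.≤ Q × (∀ i → i ℕ.< k → IsInt (ιℕ Q * z i))
  common-denominator zero    z = 1 , ℕP.≤-refl , λ i ()
  common-denominator (suc k) z with common-denominator k z
  ... | Q , Q≥1 , h = Q ℕ.* ↧ₙ (z k) , ℕP.*-mono-≤ Q≥1 (ℕ.s≤s ℕ.z≤n) , go
    where
    go : ∀ i → i ℕ.< suc k → IsInt (ιℕ (Q ℕ.* ↧ₙ (z k)) * z i)
    go i l with i ℕ.≟ k
    ... | yes refl = int-≡ (sym (cong (_* z k) (ιℕ-* Q (↧ₙ (z k))) ∙ *-assoc (ιℕ Q) (ιℕ (↧ₙ (z k))) (z k) ∙ cong (ιℕ Q *_) (clear-denominator (z k)))) (int-* (int-ι (ℤ.+ Q)) (int-ι (↥ (z k))))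
    ... | no ne = int-≡ (alg (ιℕ (↧ₙ (z k))) (ιℕ Q) (z i) ∙ cong (_* z i) (sym (ιℕ-* Q (↧ₙ (z k))))) (int-* (int-ι (ℤ.+ ↧ₙ (z k))) (h i (ℕP.≤∧≢⇒< (ℕP.≤-pred l) ne)))
      where
      alg : ∀ d q z → d * (q * z) ≡ (q * d) * z
      alg = solve-∀ ℚring

  integer≥1 : ∀ z → z ≢ ℤ.+ 0 → 1ℚ ≤ ∣ ι z ∣
  integer≥1 (ℤ.+ zero)  nz = ⊥-elim (nz refl)
  integer≥1 (ℤ.+ suc n) nz = ≤-trans (≤-reflexive (sym ι1)) (≤-trans (ιℕ-mono {1} {suc n} (ℕ.s≤s ℕ.z≤n)) (≤-reflexive (sym (0≤p⇒∣p∣≡p (ιℕ≥0 (suc n))))))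
  integer≥1 -[1+ n ]    nz = ≤-trans (≤-reflexive (sym ι1)) (≤-trans (ιℕ-mono {1} {suc n} (ℕ.s≤s ℕ.z≤n)) (≤-reflexive (sym (cong ∣_∣ (ι-neg (ℤ.+ suc n)) ∙ ∣-p∣≡∣p∣ (ιℕ (suc n)) ∙ 0≤p⇒∣p∣≡p (ιℕ≥0 (suc n))))))

  hinv-replicate : ∀ k j → hinv (replicate k j) ≡ pow (inv (ι j)) k
  hinv-replicate zero    j = refl
  hinv-replicate (suc k) j = cong (inv (ι j) *_) (hinv-replicate k j)

  Σ-split : ∀ m n f → Σ (m ℕ.+ n) f ≡ Σ m f + Σ n (λ w → f (m ℕ.+ w))
  Σ-split m zero    f = cong (λ z → Σ z f) (ℕP.+-identityʳ m) ∙ sym (+-identityʳ (Σ m f))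
  Σ-split m (suc n) f = cong (λ z → Σ z f) (ℕP.+-suc m n) ∙ cong (_+ f (m ℕ.+ n)) (Σ-split m n f) ∙ +-assoc (Σ m f) (Σ n (λ w → f (m ℕ.+ w))) (f (m ℕ.+ n))

  -- The finite zeta sums y κ cancel between the truncated series and the linear form, leaving only
  -- distances of partial sums from the limit.
  Σ-recentre : ∀ n (c x y : ℕ → ℚ) z → Σ n (λ κ → c κ * (x κ - y κ)) - (Σ n c * z - Σ n (λ κ → c κ * y κ)) ≡ Σ n (λ κ → c κ * (x κ - z))
  Σ-recentre zero    c x y z = alg z
    where
    alg : ∀ z → 0ℚ - (0ℚ * z - 0ℚ) ≡ 0ℚ
    alg = solve-∀ ℚring
  Σ-recentre (suc n) c x y z = alg (Σ n (λ κ → c κ * (x κ - y κ))) (Σ n c) (Σ n (λ κ → c κ * y κ)) (c n) (x n) (y n) z ∙ cong (_+ c n * (x n - z)) (Σ-recentre n c x y z)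
    where
    alg : ∀ s r t c x y z → (s + c * (x - y)) - ((r + c) * z - (t + c * y)) ≡ (s - (r * z - t)) + c * (x - z)
    alg = solve-∀ ℚring

  Σ-shift : ∀ n (c x : ℕ → ℚ) y z → Σ n c ≡ 0ℚ → Σ n (λ κ → c κ * (x κ - z)) ≡ Σ n (λ κ → c κ * (x κ - y))
  Σ-shift n c x y z e = go n ∙ cong (λ t → Σ n (λ κ → c κ * (x κ - y)) + t * (y - z)) e ∙ cong (Σ n (λ κ → c κ * (x κ - y)) +_) (*-zeroˡ (y - z)) ∙ +-identityʳ _
    where
    go : ∀ n → Σ n (λ κ → c κ * (x κ - z)) ≡ Σ n (λ κ → c κ * (x κ - y)) + Σ n c * (y - z)
    go zero    = sym (cong (0ℚ +_) (*-zeroˡ (y - z)))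
    go (suc n) = cong (_+ c n * (x n - z)) (go n) ∙ alg (Σ n (λ κ → c κ * (x κ - y))) (Σ n c) (c n) (x n) y z
      where
      alg : ∀ s r c x y z → (s + r * (y - z)) + c * (x - z) ≡ (s + c * (x - y)) + (r + c) * (y - z)
      alg = solve-∀ ℚring

  Σ-linear : ∀ n (c e r s : ℕ → ℚ) → Σ n (λ i → c i * e i) - (Σ n (λ i → c i * r i) - Σ n (λ i → c i * s i)) ≡ Σ n (λ i → c i * (e i - (r i - s i)))
  Σ-linear zero    c e r s = refl
  Σ-linear (suc n) c e r s = alg (Σ n (λ i → c i * e i)) (Σ n (λ i → c i * r i)) (Σ n (λ i → c i * s i)) (c n) (e n) (r n) (s n) ∙ cong (_+ c n * (e n - (r n - s n))) (Σ-linear n c e r s)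
    where
    alg : ∀ a b d c e r s → (a + c * e) - ((b + c * r) - (d + c * s)) ≡ (a - (b - d)) + c * (e - (r - s))
    alg = solve-∀ ℚring

  parity : ∀ i → (∃ λ j → i ≡ j ℕ.+ j) ⊎ (sg i ≡ - 1ℚ)
  parity zero    = inj₁ (0 , refl)
  parity (suc i) with parity i
  ... | inj₁ (j , e) = inj₂ (cong -_ (cong sg e ∙ sg-even j))
  ... | inj₂ e with i
  ...   | zero  = ⊥-elim (absurd e)
    where
    absurd : 1ℚ ≢ - 1ℚ
    absurd ()
  ...   | suc k with parity k
  ...     | inj₁ (j , e′) = inj₁ (suc j , (cong (λ z → suc (suc z)) e′ ∙ cong suc (sym (ℕP.+-suc j j))))
  ...     | inj₂ e′ = ⊥-elim (absurd (sym (cong -_ e′) ∙ e))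
    where
    absurd : - (- 1ℚ) ≢ - 1ℚ
    absurd ()

  cancel-≤ : ∀ {x y} c → 1 ℕ.≤ c → x * ιℕ c ≤ y * ιℕ c → x ≤ y
  cancel-≤ {x} {y} c l h = *-cancelʳ-≤-pos (ιℕ c) {{positive (ιℕ>0 l)}} h

  -- Of the three powers of s in W, one pays for the linear factor c ≤ e s and two for the
  -- telescoping weight s(s+1) ≤ 2 s², which is the 2 on the right.
  term-estimate : ∀ v {g c a k D G W F D′ Qp M nT y e s} → 0ℚ ≤ v → v * ιℕ g ≤ ιℕ (c ℕ.* a ℕ.* k) → (a ℕ.* D) ℕ.* (G ℕ.* W) ℕ.≤ (F ℕ.* D′) ℕ.* (g ℕ.* Qp) → M ℕ.* F ℕ.≤ nT ℕ.* y →
    1 ℕ.≤ g → 1 ℕ.≤ F → c ℕ.≤ e ℕ.* s → s ℕ.* (s ℕ.* s) ℕ.≤ W → 1 ℕ.≤ s →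
    v * ιℕ (M ℕ.* (D ℕ.* G)) * ιℕ (s ℕ.* suc s) ≤ ιℕ (2 ℕ.* (((nT ℕ.* y) ℕ.* k ℕ.* (D′ ℕ.* Qp)) ℕ.* e))
  term-estimate v {g} {c} {a} {k} {D} {G} {W} {F} {D′} {Qp} {M} {nT} {y} {e} {s} v≥0 hv hg hM g≥1 F≥1 hc hW s≥1 =
    cancel-≤ (g ℕ.* F ℕ.* s) (ℕP.*-mono-≤ (ℕP.*-mono-≤ g≥1 F≥1) s≥1) (begin
      v * ιℕ (M ℕ.* (D ℕ.* G)) * ιℕ (s ℕ.* suc s) * ιℕ (g ℕ.* F ℕ.* s)
        ≡⟨ *-assoc₄ v (ιℕ (M ℕ.* (D ℕ.* G))) (ιℕ (s ℕ.* suc s)) (ιℕ (g ℕ.* F ℕ.* s)) ∙ cong (v *_) (cong (_* ιℕ (g ℕ.* F ℕ.* s)) (sym (ιℕ-* (M ℕ.* (D ℕ.* G)) (s ℕ.* suc s))) ∙ sym (ιℕ-* (M ℕ.* (D ℕ.* G) ℕ.* (s ℕ.* suc s)) (g ℕ.* F ℕ.* s)) ∙ cong ιℕ (n₁ M D G s (suc s) g F) ∙ ιℕ-* g rest) ∙ sym (*-assoc v (ιℕ g) (ιℕ rest)) ⟩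
      v * ιℕ g * ιℕ rest ≤⟨ *-monoʳ (ιℕ≥0 rest) hv ⟩
      ιℕ (c ℕ.* a ℕ.* k) * ιℕ rest ≡⟨ sym (ιℕ-* (c ℕ.* a ℕ.* k) rest) ⟩
      ιℕ (c ℕ.* a ℕ.* k ℕ.* rest) ≤⟨ ιℕ-mono nat ⟩
      ιℕ (X ℕ.* (g ℕ.* F ℕ.* s)) ≡⟨ ιℕ-* X (g ℕ.* F ℕ.* s) ⟩
      ιℕ X * ιℕ (g ℕ.* F ℕ.* s) ∎)
    where
    open ≤-Reasoning
    rest X : ℕ
    rest = M ℕ.* (D ℕ.* G) ℕ.* (s ℕ.* suc s) ℕ.* (F ℕ.* s)
    X = 2 ℕ.* (((nT ℕ.* y) ℕ.* k ℕ.* (D′ ℕ.* Qp)) ℕ.* e)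
    *-assoc₄ : ∀ v a b c → v * a * b * c ≡ v * (a * b * c)
    *-assoc₄ = solve-∀ ℚring
    n₁ : ∀ M D G s t g F → M ℕ.* (D ℕ.* G) ℕ.* (s ℕ.* t) ℕ.* (g ℕ.* F ℕ.* s) ≡ g ℕ.* (M ℕ.* (D ℕ.* G) ℕ.* (s ℕ.* t) ℕ.* (F ℕ.* s))
    n₁ = ℕS.solve-∀
    n₂ : ∀ c a k M D G s t F → c ℕ.* a ℕ.* k ℕ.* (M ℕ.* (D ℕ.* G) ℕ.* (s ℕ.* t) ℕ.* (F ℕ.* s)) ≡ (c ℕ.* k) ℕ.* (M ℕ.* F) ℕ.* ((a ℕ.* D) ℕ.* (G ℕ.* (s ℕ.* (s ℕ.* t))))
    n₂ = ℕS.solve-∀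
    n₃ : ∀ a D G W → (a ℕ.* D) ℕ.* (G ℕ.* (2 ℕ.* W)) ≡ 2 ℕ.* ((a ℕ.* D) ℕ.* (G ℕ.* W))
    n₃ = ℕS.solve-∀
    n₄ : ∀ e s k nT y F D′ g Qp → (e ℕ.* s ℕ.* k) ℕ.* (nT ℕ.* y) ℕ.* (2 ℕ.* ((F ℕ.* D′) ℕ.* (g ℕ.* Qp))) ≡ 2 ℕ.* (((nT ℕ.* y) ℕ.* k ℕ.* (D′ ℕ.* Qp)) ℕ.* e) ℕ.* (g ℕ.* F ℕ.* s)
    n₄ = ℕS.solve-∀
    n₅ : ∀ s → 1 ℕ.≤ s → s ℕ.* (s ℕ.* s) ℕ.≤ W → s ℕ.* (s ℕ.* suc s) ℕ.≤ 2 ℕ.* W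
    n₅ s l h = ℕP.≤-trans (ℕP.*-monoʳ-≤ s (ℕP.*-monoʳ-≤ s (ℕP.≤-trans (ℕP.+-monoˡ-≤ s l) (ℕP.≤-reflexive (cong (s ℕ.+_) (sym (ℕP.+-identityʳ s))))))) (ℕP.≤-trans (ℕP.≤-reflexive (alg s)) (ℕP.*-monoʳ-≤ 2 h))
      where
      alg : ∀ s → s ℕ.* (s ℕ.* (2 ℕ.* s)) ≡ 2 ℕ.* (s ℕ.* (s ℕ.* s))
      alg = ℕS.solve-∀
    nat : c ℕ.* a ℕ.* k ℕ.* rest ℕ.≤ X ℕ.* (g ℕ.* F ℕ.* s)
    nat = ℕP.≤-trans (ℕP.≤-reflexive (n₂ c a k M D G s (suc s) F)) (ℕP.≤-trans
      (ℕP.*-mono-≤ (ℕP.*-mono-≤ (ℕP.*-monoˡ-≤ k hc) hM) (ℕP.≤-trans (ℕP.*-monoʳ-≤ (a ℕ.* D) (ℕP.*-monoʳ-≤ G (n₅ s s≥1 hW))) (ℕP.≤-trans (ℕP.≤-reflexive (n₃ a D G W)) (ℕP.*-monoʳ-≤ 2 hg))))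
      (ℕP.≤-reflexive (n₄ e s k nT y F D′ g Qp)))

-- The exponent as a function of one floor

module Weights where

  open Mangoldt
  open Chebyshev
  open import Data.Nat
  open import Data.Nat.Properties
  open import Data.Nat.DivMod
  open import Data.Nat.Divisibility using (divides)
  open import Data.Nat.Tactic.RingSolver using (solve-∀)
  open import Relation.Binary.PropositionalEquality

  -- In terms of X = ⌊12n/v⌋ the floors ⌊4n/v⌋, ⌊m/v⌋, ⌊n/v⌋ are ⌊X/3⌋, ⌊X/8⌋, ⌊X/12⌋.
  -- _⊔′_ rather than _⊔_ because it evaluates in constant time.
  Z : ℕ → ℕ
  Z X = X / 3 ∸ step 12 X * ((X / 3 ∸ 1) ⊔′ (X / 8 + X / 8 + X / 12))

  Yc : ℕ → ℕ → ℕ → ℕ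
  Yc t c X = t * step 12 X + c * Z X

  -- For b = 3 + c and A = 7b - 1 the exponent is affine in c: the constant part and the slope get
  -- one certificate each, and these two serve all three values of b.
  exponent : ℕ → ℕ → ℕ
  exponent c X = Yc 22 3 X + c * Yc 8 1 X

  weight : ℕ → ℕ → ℕ
  weight c B = ⟦ (λ w → exponent c (fl B w)) ⟧ B

  exponent-high : ∀ c a → suc (suc a) ≡ 7 * (3 + c) → ∀ X → 12 ≤ X → (a + (3 + c)) + (3 + c) * (X / 3 ∸ ((X / 3 ∸ 1) ⊔ (X / 8 + X / 8 + X / 12))) ≡ exponent c X
  exponent-high c a ha X l = cong₂ (λ x y → (x + (3 + c)) + (3 + c) * (X / 3 ∸ y)) (suc-injective (suc-injective (ha ∙ r c))) (⊔≡⊔′ (X / 3 ∸ 1) (X / 8 + X / 8 + X / 12) ∙ sym (*-identityˡ g)) ∙ alg c (X / 3 ∸ 1 * g)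
      ∙ cong (λ t → (22 * t + 3 * (X / 3 ∸ t * g)) + c * (8 * t + 1 * (X / 3 ∸ t * g))) (sym (step-yes 12 X l))
    where
    g = (X / 3 ∸ 1) ⊔′ (X / 8 + X / 8 + X / 12)
    r : ∀ c → 7 * (3 + c) ≡ suc (suc (19 + 7 * c))
    r = solve-∀
    alg : ∀ c z → (19 + 7 * c + (3 + c)) + (3 + c) * z ≡ (22 * 1 + 3 * z) + c * (8 * 1 + 1 * z)
    alg = solve-∀

  exponent-low : ∀ c X → X < 12 → (3 + c) * (X / 3) ≡ exponent c X
  exponent-low c X l = alg c (X / 3) ∙ cong (λ t → (22 * t + 3 * (X / 3 ∸ t * g)) + c * (8 * t + 1 * (X / 3 ∸ t * g))) (sym (step-no 12 X l))
    where
    g = (X / 3 ∸ 1) ⊔′ (X / 8 + X / 8 + X / 12)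
    alg : ∀ c z → (3 + c) * z ≡ (22 * 0 + 3 * z) + c * (8 * 0 + 1 * z)
    alg = solve-∀

  fl-quotient : ∀ k r x B w → r < suc k → B ≡ r + x * suc k → fl x w ≡ fl B w / suc k
  fl-quotient k r x B w l e = cong (λ t → fl t w) (sym (cong (_/ suc k) e ∙ +-distrib-/-∣ʳ r (divides x refl) ∙ cong₂ _+_ (m<n⇒m/n≡0 l) (m*n/n≡m x (suc k)))) ∙ fl-fl B k w

-- Data of the floor certificates

module Tables where

  open Chebyshev
  open Certificates
  open Weights
  open import Data.Nat
  open import Data.Nat.Properties
  open import Data.Nat.DivMod
  open import Data.Bool using (true; false; T)
  open import Data.Unit using (tt)
  open import Data.List using (List; []; _∷_)
  open import Data.Product using (_,_)
  open import Relation.Binary.PropositionalEquality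

  b2n≤1 : ∀ x → b2n x ≤ 1
  b2n≤1 true  = ≤-refl
  b2n≤1 false = z≤n

  ymaxH : ∀ X → step 1 X ≤ 1
  ymaxH X = b2n≤1 (1 ≤ᵇ X)

  -- Hanson's floor sum for lcm (1..n), from 1 = 1/2 + 1/3 + 1/7 + 1/43 + 1/1806.
  posH : List Ent
  posH =
        (1 , 0) ∷ []

  negH : List Ent
  negH =
        (1 , 1) ∷ (1 , 2) ∷ (1 , 6) ∷ (1 , 42) ∷ (1 , 1805) ∷ []

  penH : List Ent
  penH =
        (2 , 1805) ∷ []

  plogH nlogH : List ℕ
  plogH =
        0 ∷ []
  nlogH =
        3612 ∷ 5725 ∷ 10141 ∷ 19600 ∷ 39077 ∷ []

  opaque
    checkH : checks (step 1) posH negH penH 1 1806 1 0 ≡ true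
    checkH = refl

  certificateH : Certificate (step 1)
  certificateH = record
    { pos = posH ; neg = negH ; pen = penH ; plog = plogH ; nlog = nlogH
    -- `L` is the lcm of the moduli and `K` the resolution at which logarithms are rounded. E/K is
    -- about 1.5617 bits, below log₂ 3.
    ; s = 1 ; L′ = 1805 ; K′ = 3611 ; ymax = 1 ; len = 1806 ; chunks = 1 ; Mx = 1806 ; E = 5641
    ; hY = ymaxH ; h-check = checkH ; h-divp = refl ; h-divn = refl ; h-bal = refl ; h-tail = refl
    ; h-bp = refl ; h-bn = refl ; h-lo = refl ; h-hi = refl ; h-E = refl }

  -- From X = 12 on, `Z` is at most 1, since at least ⌊X/3⌋ - 1 is subtracted. Below 12 it may reach
  -- 3 but the summand t is absent, which the hypothesis on t and c takes care of.
  ymax : ∀ t c → 3 * c ≤ t + c → ∀ X → Yc t c X ≤ t + c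
  ymax t c h X with 12 ≤ᵇ X in eq
  ... | true  = +-mono-≤ (≤-reflexive (*-identityʳ t)) (≤-trans (*-monoʳ-≤ c (≤-trans (∸-monoʳ-≤ (X / 3) (≤-trans (≤-trans (m≤m⊔n (X / 3 ∸ 1) (X / 8 + X / 8 + X / 12)) (≤-reflexive (⊔≡⊔′ (X / 3 ∸ 1) _))) (≤-reflexive (sym (+-identityʳ _))))) (one (X / 3)))) (≤-reflexive (*-identityʳ c)))
    where
    one : ∀ x → x ∸ (x ∸ 1) ≤ 1
    one zero    = z≤n
    one (suc x) = ≤-reflexive (m+n∸n≡m 1 x)
  ... | false = ≤-trans (+-mono-≤ (≤-reflexive (*-zeroʳ t)) (≤-trans (*-monoʳ-≤ c (≤-pred (m<n*o⇒m/o<n {X} {4} {3} (≰⇒> λ l → subst T (trans (sym (≤ᵇ-complete l)) eq) tt)))) (≤-reflexive (*-comm c 3)))) h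
    where
    ≤ᵇ-complete : ∀ {x y} → x ≤ y → (x ≤ᵇ y) ≡ true
    ≤ᵇ-complete {x} {y} l with x ≤ᵇ y | ≤⇒≤ᵇ l
    ... | true | _ = refl

  ymaxA : ∀ X → Yc 22 3 X ≤ 25
  ymaxA = ymax 22 3 (m≤m+n 9 16)

  ymaxB : ∀ X → Yc 8 1 X ≤ 9
  ymaxB = ymax 8 1 (m≤m+n 3 6)

  -- The coefficients in the two following certificates were found by linear programming:
  -- they minimise the resulting growth rate subject to the floor inequality.
  posA : List Ent
  posA =
        (90000 , 2) ∷ (1 , 7) ∷ (390000 , 11) ∷ (90000 , 41) ∷ (90000 , 47) ∷ (1 , 63) ∷ (480000 , 71) ∷ (90000 , 74) ∷ (90000 , 79) ∷ (2267 , 87) ∷ (164696 ,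
        104) ∷ (90000 , 107) ∷ (90000 , 111) ∷ (570000 , 119) ∷ (1 , 127) ∷ (90000 , 137) ∷ (2267 , 143) ∷ (87733 , 146) ∷ (90000 , 158) ∷ (1493 , 164) ∷
        (457684 , 167) ∷ (99503 , 175) ∷ (368805 , 179) ∷ (43463 , 185) ∷ (1493 , 191) ∷ (178507 , 194) ∷ (75158 , 199) ∷ (90000 , 206) ∷ (40336 , 215) ∷
        (58417 , 221) ∷ (168230 , 233) ∷ (115515 , 242) ∷ (15847 , 245) ∷ (165170 , 248) ∷ (7718 , 251) ∷ (90000 , 254) ∷ (335577 , 263) ∷ (205265 , 269) ∷
        (90000 , 271) ∷ (180000 , 272) ∷ (46537 , 278) ∷ (180564 , 281) ∷ (64568 , 287) ∷ (44489 , 295) ∷ (116431 , 296) ∷ (64236 , 302) ∷ (90000 , 303) ∷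
        (52812 , 305) ∷ (187429 , 311) ∷ (15304 , 314) ∷ (165158 , 319) ∷ (115513 , 323) ∷ (109020 , 329) ∷ (1802 , 335) ∷ (129557 , 347) ∷ (351424 , 371) ∷
        (74666 , 395) ∷ (164599 , 407) ∷ (232635 , 419) ∷ (91887 , 431) ∷ (289180 , 455) ∷ (55549 , 479) ∷ []

  negA : List Ent
  negA =
        (90000 , 14) ∷ (90000 , 15) ∷ (90000 , 20) ∷ (570000 , 23) ∷ (480000 , 35) ∷ (90000 , 38) ∷ (90000 , 39) ∷ (90000 , 53) ∷ (90000 , 55) ∷ (390000 , 59)
        ∷ (90000 , 68) ∷ (480000 , 83) ∷ (44489 , 86) ∷ (47778 , 89) ∷ (90000 , 92) ∷ (90000 , 101) ∷ (74696 , 103) ∷ (90000 , 110) ∷ (90000 , 125) ∷ (412513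
        , 131) ∷ (67487 , 134) ∷ (90000 , 135) ∷ (90000 , 140) ∷ (90000 , 149) ∷ (90000 , 151) ∷ (88507 , 155) ∷ (165158 , 159) ∷ (115514 , 161) ∷ (1606 ,
        173) ∷ (145671 , 176) ∷ (89975 , 182) ∷ (43463 , 183) ∷ (90000 , 197) ∷ (75174 , 200) ∷ (390000 , 203) ∷ (15304 , 207) ∷ (25032 , 209) ∷ (90028 , 212)
        ∷ (90009 , 218) ∷ (58417 , 223) ∷ (25403 , 227) ∷ (83472 , 231) ∷ (179962 , 236) ∷ (156128 , 239) ∷ (175319 , 247) ∷ (137471 , 257) ∷ (45511 , 260) ∷
        (425414 , 275) ∷ (11116 , 279) ∷ (90558 , 284) ∷ (66833 , 290) ∷ (157147 , 293) ∷ (257422 , 299) ∷ (155427 , 308) ∷ (180000 , 317) ∷ (90034 , 326) ∷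
        (90000 , 327) ∷ (591490 , 359) ∷ (252087 , 383) ∷ (342215 , 443) ∷ (80028 , 467) ∷ (382585 , 491) ∷ []

  penA : List Ent
  penA =
        (158998 , 179) ∷ (175685 , 482) ∷ (13190 , 659) ∷ (23409 , 683) ∷ (143434 , 1199) ∷ (105989 , 1475) ∷ (54 , 1553) ∷ (291131 , 3299) ∷ (72 , 3639) ∷
        (107379 , 9439) ∷ (176049 , 9917) ∷ (339595 , 10853) ∷ (93297 , 22655) ∷ (7060225 , 59999) ∷ []

  plogA nlogA : List ℕ
  plogA =
        5724 ∷ 10836 ∷ 12948 ∷ 19477 ∷ 20172 ∷ 21672 ∷ 22285 ∷ 22498 ∷ 22834 ∷ 23331 ∷ 24251 ∷ 24398 ∷ 24588 ∷ 24947 ∷ 25284 ∷ 25675 ∷ 25897 ∷ 26005 ∷ 26414 ∷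
        26607 ∷ 26701 ∷ 26943 ∷ 27060 ∷ 27231 ∷ 27396 ∷ 27477 ∷ 27609 ∷ 27788 ∷ 28010 ∷ 28153 ∷ 28427 ∷ 28624 ∷ 28688 ∷ 28751 ∷ 28813 ∷ 28875 ∷ 29056 ∷ 29173
        ∷ 29211 ∷ 29231 ∷ 29344 ∷ 29400 ∷ 29509 ∷ 29652 ∷ 29670 ∷ 29774 ∷ 29791 ∷ 29825 ∷ 29926 ∷ 29976 ∷ 30058 ∷ 30123 ∷ 30219 ∷ 30313 ∷ 30495 ∷ 30843 ∷
        31169 ∷ 31324 ∷ 31475 ∷ 31622 ∷ 31904 ∷ 32171 ∷ []
  nlogA =
        14112 ∷ 14448 ∷ 15866 ∷ 16561 ∷ 18674 ∷ 19091 ∷ 19223 ∷ 20787 ∷ 20977 ∷ 21336 ∷ 22064 ∷ 23090 ∷ 23272 ∷ 23449 ∷ 23620 ∷ 24101 ∷ 24202 ∷ 24542 ∷ 25202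
        ∷ 25445 ∷ 25562 ∷ 25600 ∷ 25789 ∷ 26111 ∷ 26180 ∷ 26315 ∷ 26447 ∷ 26512 ∷ 26884 ∷ 26973 ∷ 27147 ∷ 27176 ∷ 27558 ∷ 27636 ∷ 27713 ∷ 27814 ∷ 27864 ∷
        27938 ∷ 28083 ∷ 28201 ∷ 28293 ∷ 28384 ∷ 28495 ∷ 28560 ∷ 28731 ∷ 28937 ∷ 28997 ∷ 29288 ∷ 29363 ∷ 29456 ∷ 29564 ∷ 29618 ∷ 29723 ∷ 29877 ∷ 30027 ∷ 30172
        ∷ 30188 ∷ 30673 ∷ 31009 ∷ 31766 ∷ 32040 ∷ 32301 ∷ []

  opaque
    checkA : checks (Yc 22 3) posA negA penA 30000 600 100 0 ≡ true
    checkA = refl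

  certificateA : Certificate (Yc 22 3)
  certificateA = record
    { pos = posA ; neg = negA ; pen = penA ; plog = plogA ; nlog = nlogA
    -- Evaluation covers X < 600 · 100 = 60000; the last penalty in the list starts exactly there
    -- and completes what the tail needs.
    ; s = 30000 ; L′ = 5329740399310259332162808653792710636084374399 ; K′ = 3611 ; ymax = 25 ; len = 600 ; chunks = 100 ; Mx = 492 ; E = 487395630
    ; hY = ymaxA ; h-check = checkA ; h-divp = refl ; h-divn = refl ; h-bal = refl ; h-tail = refl
    ; h-bp = refl ; h-bn = refl ; h-lo = refl ; h-hi = refl ; h-E = refl }

  posB : List Ent
  posB =
        (1 , 1) ∷ (30000 , 2) ∷ (1 , 3) ∷ (149988 , 11) ∷ (1 , 31) ∷ (30000 , 41) ∷ (30000 , 47) ∷ (1 , 63) ∷ (180000 , 71) ∷ (30000 , 74) ∷ (30000 , 79) ∷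
        (4379 , 87) ∷ (50553 , 104) ∷ (30000 , 107) ∷ (30000 , 111) ∷ (210000 , 119) ∷ (1 , 127) ∷ (30000 , 137) ∷ (2423 , 143) ∷ (25621 , 146) ∷ (30000 ,
        158) ∷ (9447 , 164) ∷ (162930 , 167) ∷ (33334 , 175) ∷ (139645 , 179) ∷ (11342 , 185) ∷ (60000 , 194) ∷ (34832 , 199) ∷ (30000 , 206) ∷ (20459 , 215)
        ∷ (12475 , 221) ∷ (50331 , 233) ∷ (45987 , 242) ∷ (64823 , 248) ∷ (15548 , 251) ∷ (25393 , 254) ∷ (115564 , 263) ∷ (94711 , 269) ∷ (30000 , 271) ∷
        (60000 , 272) ∷ (18658 , 278) ∷ (65911 , 281) ∷ (18261 , 287) ∷ (7773 , 295) ∷ (43536 , 296) ∷ (11110 , 302) ∷ (30000 , 303) ∷ (14895 , 305) ∷ (66972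
        , 311) ∷ (9447 , 314) ∷ (64832 , 319) ∷ (45988 , 323) ∷ (23004 , 329) ∷ (14619 , 335) ∷ (41885 , 347) ∷ (130254 , 371) ∷ (24889 , 395) ∷ (76877 , 407)
        ∷ (101108 , 419) ∷ (11951 , 431) ∷ (103397 , 455) ∷ (35840 , 479) ∷ []

  negB : List Ent
  negB =
        (30000 , 14) ∷ (30000 , 15) ∷ (30000 , 20) ∷ (210000 , 23) ∷ (180000 , 35) ∷ (30000 , 38) ∷ (30000 , 39) ∷ (30000 , 53) ∷ (30000 , 55) ∷ (150000 , 59)
        ∷ (30000 , 68) ∷ (180000 , 83) ∷ (4832 , 86) ∷ (29547 , 89) ∷ (30000 , 92) ∷ (30000 , 101) ∷ (20553 , 103) ∷ (30000 , 110) ∷ (30000 , 125) ∷ (144836 ,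
        131) ∷ (35164 , 134) ∷ (30000 , 135) ∷ (28044 , 140) ∷ (30000 , 149) ∷ (30000 , 151) ∷ (31558 , 155) ∷ (64832 , 159) ∷ (45987 , 161) ∷ (13265 , 173) ∷
        (49619 , 176) ∷ (30012 , 182) ∷ (11342 , 183) ∷ (30000 , 197) ∷ (34840 , 200) ∷ (150000 , 203) ∷ (9447 , 207) ∷ (9056 , 209) ∷ (31950 , 212) ∷ (30003
        , 218) ∷ (12475 , 223) ∷ (11042 , 227) ∷ (23790 , 231) ∷ (59961 , 236) ∷ (50783 , 239) ∷ (12814 , 245) ∷ (70415 , 247) ∷ (38356 , 257) ∷ (25168 , 260)
        ∷ (155520 , 275) ∷ (13148 , 279) ∷ (37860 , 284) ∷ (20661 , 290) ∷ (36227 , 293) ∷ (99213 , 299) ∷ (42333 , 308) ∷ (60000 , 317) ∷ (29975 , 326) ∷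
        (30000 , 327) ∷ (222123 , 359) ∷ (94509 , 383) ∷ (120461 , 443) ∷ (27335 , 467) ∷ (134905 , 491) ∷ []

  penB : List Ent
  penB =
        (34 , 11) ∷ (69932 , 179) ∷ (49772 , 482) ∷ (5481 , 659) ∷ (7616 , 674) ∷ (11107 , 683) ∷ (59943 , 1199) ∷ (34773 , 1475) ∷ (100084 , 3299) ∷ (35361 ,
        9439) ∷ (77355 , 9917) ∷ (89292 , 10853) ∷ (8203 , 17762) ∷ (48277 , 22655) ∷ (2543767 , 59999) ∷ []

  plogB nlogB : List ℕ
  plogB =
        3612 ∷ 5724 ∷ 7224 ∷ 12948 ∷ 18060 ∷ 19477 ∷ 20172 ∷ 21672 ∷ 22285 ∷ 22498 ∷ 22834 ∷ 23331 ∷ 24251 ∷ 24398 ∷ 24588 ∷ 24947 ∷ 25284 ∷ 25675 ∷ 25897 ∷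
        26005 ∷ 26414 ∷ 26607 ∷ 26701 ∷ 26943 ∷ 27060 ∷ 27231 ∷ 27477 ∷ 27609 ∷ 27788 ∷ 28010 ∷ 28153 ∷ 28427 ∷ 28624 ∷ 28751 ∷ 28813 ∷ 28875 ∷ 29056 ∷ 29173
        ∷ 29211 ∷ 29231 ∷ 29344 ∷ 29400 ∷ 29509 ∷ 29652 ∷ 29670 ∷ 29774 ∷ 29791 ∷ 29825 ∷ 29926 ∷ 29976 ∷ 30058 ∷ 30123 ∷ 30219 ∷ 30313 ∷ 30495 ∷ 30843 ∷
        31169 ∷ 31324 ∷ 31475 ∷ 31622 ∷ 31904 ∷ 32171 ∷ []
  nlogB =
        14112 ∷ 14448 ∷ 15866 ∷ 16561 ∷ 18674 ∷ 19091 ∷ 19223 ∷ 20787 ∷ 20977 ∷ 21336 ∷ 22064 ∷ 23090 ∷ 23272 ∷ 23449 ∷ 23620 ∷ 24101 ∷ 24202 ∷ 24542 ∷ 25202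
        ∷ 25445 ∷ 25562 ∷ 25600 ∷ 25789 ∷ 26111 ∷ 26180 ∷ 26315 ∷ 26447 ∷ 26512 ∷ 26884 ∷ 26973 ∷ 27147 ∷ 27176 ∷ 27558 ∷ 27636 ∷ 27713 ∷ 27814 ∷ 27864 ∷
        27938 ∷ 28083 ∷ 28201 ∷ 28293 ∷ 28384 ∷ 28495 ∷ 28560 ∷ 28689 ∷ 28731 ∷ 28937 ∷ 28997 ∷ 29288 ∷ 29363 ∷ 29456 ∷ 29564 ∷ 29618 ∷ 29723 ∷ 29877 ∷ 30027
        ∷ 30172 ∷ 30188 ∷ 30673 ∷ 31009 ∷ 31766 ∷ 32040 ∷ 32301 ∷ []

  opaque
    checkB : checks (Yc 8 1) posB negB penB 30000 600 100 0 ≡ true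
    checkB = refl

  certificateB : Certificate (Yc 8 1)
  certificateB = record
    { pos = posB ; neg = negB ; pen = penB ; plog = plogB ; nlog = nlogB
    ; s = 30000 ; L′ = 5329740399310259332162808653792710636084374399 ; K′ = 3611 ; ymax = 9 ; len = 600 ; chunks = 100 ; Mx = 492 ; E = 170899336
    ; hY = ymaxB ; h-check = checkB ; h-divp = refl ; h-divn = refl ; h-bal = refl ; h-tail = refl
    ; h-bp = refl ; h-bn = refl ; h-lo = refl ; h-hi = refl ; h-E = refl }

-- The linear form and the contradiction

module LinearForm where

  open import Defs
  open Mangoldt
  open Rationals
  open PowerSeries using (_∙_)
  open PartialFractions using (Σ; Σ-cong; Σ-zero; Σ-*; Σ-swap; dpow-bc)
  open LocalExpansion using (sg)
  open RationalFunction using (module RF)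
  open IntegerValues using (IsInt; int-+; int-*; int-neg; int-ι; int-≡; int-0; int-Σ; module Integrality)
  open Arithmetic using (module Denominators)
  open Nonvanishing using (Nb; module NonVanishing)
  open Certificates using (rise; rise-≥; ≥1-^)
  open Estimates using (module Growth)
  open Coefficients
  open Limits
  open Asymptotics
  open Rates
  open Preparation
  open Weights
  open import Data.Nat as ℕ using (ℕ; zero; suc; _∸_; _!; _⊔_)
  import Data.Nat.Properties as ℕP
  open import Data.Nat.DivMod using (m*n/n≡m; /-monoˡ-≤; m<n*o⇒m/o<n; _/_)
  open import Data.Nat.Divisibility using (_∣_; ∣⇒≤)
  open import Data.Nat.Primality using (Prime)
  import Data.Nat.Tactic.RingSolver as ℕS
  open import Data.Integer as ℤ using (ℤ)
  import Data.Integer.Properties as ℤP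
  open import Data.Rational hiding (_/_; _⊔_)
  open import Data.Rational.Properties
  open import Data.List using ([]; replicate)
  import Data.List.Properties as LP
  open import Data.List.Relation.Unary.All using ([])
  open import Data.List.Relation.Unary.All.Properties as AllP using ()
  open import Data.Product using (_,_; proj₁; proj₂)
  open import Data.Sum using (_⊎_; inj₁; inj₂)
  open import Data.Empty using (⊥; ⊥-elim)
  open import Relation.Nullary
  open import Relation.Binary.PropositionalEquality as Eq using (_≡_; _≢_; refl; sym; cong; cong₂; subst)
  open import Tactic.RingSolver using (solve-∀)

  module Contradiction (c a h : ℕ) (ha : suc (suc a) ≡ 7 ℕ.* (3 ℕ.+ c)) (A-even : suc a ≡ h ℕ.+ h) (num : Numerics c (weight c)) (Nb≢0 : Nb (2 ℕ.+ c) a ≢ ℤ.+ 0)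
      (lim : ∀ i → i ℕ.< suc a → ZetaRational (i ℕ.+ (3 ℕ.+ c)) ⊎ (i ≡ 0 ⊎ sg i ≡ - 1ℚ)) where
    open Numerics num hiding (b; E; F)

    b β A : ℕ
    b = 3 ℕ.+ c
    β = 2 ℕ.+ c
    A = suc a

    T≡A+b : T ≡ A ℕ.+ b
    T≡A+b = ℕP.suc-injective (T≡ ∙ sym (cong (ℕ._+ b) ha ∙ ℕP.+-comm (7 ℕ.* b) b))

    -- The default 0 stands at those i where no limit is given; there the coefficient sum is zero,
    -- by the residue theorem or by symmetry.
    z : ℕ → ℚ
    z i with i ℕ.<? A
    ... | no _  = 0ℚ
    ... | yes l with lim i l
    ...   | inj₁ (r , _) = r
    ...   | inj₂ _ = 0ℚ

    z-spec : ∀ i → i ℕ.< A → ConvergesTo (zetaPartial (i ℕ.+ b)) (z i) ⊎ (i ≡ 0 ⊎ sg i ≡ - 1ℚ)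
    z-spec i l with i ℕ.<? A
    ... | no ¬l = ⊥-elim (¬l l)
    ... | yes l′ with lim i l′
    ...   | inj₁ (r , cv) = inj₁ cv
    ...   | inj₂ e = inj₂ e

    den-data = common-denominator A z
    Q = proj₁ den-data
    Q≥1 = proj₁ (proj₂ den-data)

    ℓ-poly : ℕ → ℕ
    ℓ-poly q = suc (b ℕ.* ((3 ℕ.* q ℕ.+ 1) ℕ.+ (3 ℕ.* q ℕ.+ 1)) ℕ.+ A ℕ.* suc (suc (2 ℕ.* q)))

    -- In 4 Q one factor 2 comes from the telescoped sum of the terms, the other brings the multiple
    -- of F below one half.
    small-data = smallness (4 ℕ.* Q) (λ q → ℓ-poly q ℕ.^ β) (poly-^ β (poly-≤ (λ q → ℕP.≤-reflexive (alg b A q)) (poly-linear (6 ℕ.* b ℕ.+ 2 ℕ.* A) (2 ℕ.* b ℕ.+ 2 ℕ.* A ℕ.+ 1))))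
      where
      alg : ∀ b A q → suc (b ℕ.* ((3 ℕ.* q ℕ.+ 1) ℕ.+ (3 ℕ.* q ℕ.+ 1)) ℕ.+ A ℕ.* suc (suc (2 ℕ.* q))) ≡ (6 ℕ.* b ℕ.+ 2 ℕ.* A) ℕ.* q ℕ.+ (2 ℕ.* b ℕ.+ 2 ℕ.* A ℕ.+ 1)
      alg = ℕS.solve-∀

    module At-prime (q : ℕ) (pr : Prime (suc (2 ℕ.* q))) (q≥50 : 50 ℕ.≤ q) (Q<q : Q ℕ.< q) (N<q : ℤ.∣ Nb β a ∣ ℕ.< q) (q₀≤q : proj₁ small-data ℕ.≤ q) where
      P m : ℕ
      P = suc (2 ℕ.* q)
      m = 3 ℕ.* q ℕ.+ 1

      enough : 2 ℕ.+ b ℕ.* (m ℕ.+ m) ℕ.≤ P ℕ.+ a ℕ.* suc P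
      enough = ℕP.+-cancelʳ-≤ (2 ℕ.* suc P) _ _ (ℕP.≤-trans (ℕP.m≤m+n _ (22 ℕ.* q ℕ.+ 8 ℕ.* c ℕ.* q ℕ.+ 31 ℕ.+ 12 ℕ.* c)) (ℕP.≤-reflexive (
          e₁ c q ∙ cong (λ t → P ℕ.+ t ℕ.* suc P) (sym ha) ∙ e₂ a q)))
        where
        e₁ : ∀ c q → (2 ℕ.+ (3 ℕ.+ c) ℕ.* ((3 ℕ.* q ℕ.+ 1) ℕ.+ (3 ℕ.* q ℕ.+ 1))) ℕ.+ 2 ℕ.* suc (suc (2 ℕ.* q)) ℕ.+ (22 ℕ.* q ℕ.+ 8 ℕ.* c ℕ.* q ℕ.+ 31 ℕ.+ 12 ℕ.* c) ≡ suc (2 ℕ.* q) ℕ.+ 7 ℕ.* (3 ℕ.+ c) ℕ.* suc (suc (2 ℕ.* q))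
        e₁ = ℕS.solve-∀
        e₂ : ∀ a q → suc (2 ℕ.* q) ℕ.+ suc (suc a) ℕ.* suc (suc (2 ℕ.* q)) ≡ suc (2 ℕ.* q) ℕ.+ a ℕ.* suc (suc (2 ℕ.* q)) ℕ.+ 2 ℕ.* suc (suc (2 ℕ.* q))
        e₂ = ℕS.solve-∀

      hm : suc (m ℕ.+ m) ≡ P ℕ.+ P ℕ.+ P
      hm = e q
        where
        e : ∀ q → suc ((3 ℕ.* q ℕ.+ 1) ℕ.+ (3 ℕ.* q ℕ.+ 1)) ≡ suc (2 ℕ.* q) ℕ.+ suc (2 ℕ.* q) ℕ.+ suc (2 ℕ.* q)
        e = ℕS.solve-∀

      m≡ : m ≡ q ℕ.+ suc (2 ℕ.* q)
      m≡ = e q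
        where
        e : ∀ q → 3 ℕ.* q ℕ.+ 1 ≡ q ℕ.+ suc (2 ℕ.* q)
        e = ℕS.solve-∀

      open NonVanishing (2 ℕ.* q) m β a h pr enough hm ha A-even q m≡ (ℕP.m≤m+n q (q ℕ.+ 0)) using (C; ρ; Zp; Lform; nonvanishing)
      open RF P m b a enough using (c_; V; regular; res≡0; module Symmetric)
      open Symmetric h A-even using (ρ≡0)
      open Denominators P m b a enough hm ha (ℕ.s≤s ℕ.z≤n) using (M; Q4; Y; Y-below; Y-above; M-Y; int-c; eM)
      open Integrality P Q4 using (Small)
      open Values P m b a enough using (ℓ; V-vanish; module At-point)
      open Growth b T (8 ℕ.* q ℕ.+ 4) c q ϑ refl T≡ refl q≥50 hd using (g; good)

      F : ℕ → ℚ
      F K = Σ K (λ k → V (suc k) β)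

      E : ℕ → ℕ → ℚ
      E i K = Σ (suc P) (λ κ → c_ κ i * (Zp i (K ℕ.+ κ) - Zp i κ))

      -- The coefficient of ε^β in (κ+ν+ε)^(-i-1) is C i (κ+ν)^(-i-b), so summation over ν produces
      -- a window of the partial zeta sums that starts at κ.
      F-expand : ∀ K → F K ≡ Σ A (λ i → ι (C i) * E i K)
      F-expand K = Σ-cong K (λ k _ → regular (suc k) β (ℕ.s≤s ℕ.z≤n) ∙ Σ-swap (suc P) A _ ∙ Σ-cong A (λ i _ → Σ-cong (suc P) (λ κ _ → cong (c_ κ i *_) (dpow-bc (ιℕ (κ ℕ.+ suc k)) (suc i) β) ∙ alg (c_ κ i) (ι (C i)) _ ∙ cong (λ t → ι (C i) * (c_ κ i * pow (inv (ιℕ (κ ℕ.+ suc k))) t)) (sym (ℕP.+-suc i β))) ∙ Σ-* (suc P) (ι (C i)) _))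
        ∙ Σ-swap K A _ ∙ Σ-cong A (λ i _ → Σ-* K (ι (C i)) _ ∙ cong (ι (C i) *_) (Σ-swap K (suc P) _ ∙ Σ-cong (suc P) (λ κ _ → Σ-* K (c_ κ i) _ ∙ cong (c_ κ i *_) (zeta-window (i ℕ.+ b) κ K))))
        where
        alg : ∀ x y z → x * (y * z) ≡ y * (x * z)
        alg = solve-∀ ℚring

      -- For each i, either z i is a given limit, or the coefficients sum to zero and only
      -- increments of partial zeta sums occur, which tend to 0 by themselves.
      F-null : Null (λ K → F K - Lform z)
      F-null = null-cong (λ K → sym (cong (_- Lform z) (F-expand K) ∙ Σ-linear A (λ i → ι (C i)) (λ i → E i K) (λ i → ρ i * z i) (λ i → Σ (suc P) (λ κ → c_ κ i * Zp i κ))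
           ∙ Σ-cong A (λ i _ → cong (ι (C i) *_) (Σ-recentre (suc P) (λ κ → c_ κ i) (λ κ → Zp i (K ℕ.+ κ)) (Zp i) (z i)))))
        (null-Σ A (λ i l → null-* (ι (C i)) (inner i l (z-spec i l))))
        where
        vanishing : ∀ i → ρ i ≡ 0ℚ → Null (λ K → Σ (suc P) (λ κ → c_ κ i * (Zp i (K ℕ.+ κ) - z i)))
        vanishing i ρ0 = null-cong (λ K → sym (Σ-shift (suc P) (λ κ → c_ κ i) (λ κ → Zp i (K ℕ.+ κ)) (Zp i K) (z i) ρ0))
          (null-Σ (suc P) (λ κ _ → null-* (c_ κ i) (subst (λ s → Null (λ K → zetaPartial s (K ℕ.+ κ) - zetaPartial s K)) (sym (ℕP.+-suc i β)) (zeta-increment (i ℕ.+ β) κ))))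
        inner : ∀ i → i ℕ.< A → ConvergesTo (zetaPartial (i ℕ.+ b)) (z i) ⊎ (i ≡ 0 ⊎ sg i ≡ - 1ℚ) → Null (λ K → Σ (suc P) (λ κ → c_ κ i * (Zp i (K ℕ.+ κ) - z i)))
        inner i l (inj₁ cv) = null-Σ (suc P) (λ κ _ → null-* (c_ κ i) (null-shift κ {λ n → zetaPartial (i ℕ.+ b) n - z i} cv))
        inner i l (inj₂ (inj₁ refl)) = vanishing 0 (res≡0 (λ ()))
        inner i l (inj₂ (inj₂ e)) = vanishing i (ρ≡0 i l e)

      Q4≡N : Q4 ≡ 8 ℕ.* q ℕ.+ 4
      Q4≡N = e q
        where
        e : ∀ q → suc (suc (2 ℕ.* q) ℕ.+ ((3 ℕ.* q ℕ.+ 1) ℕ.+ (3 ℕ.* q ℕ.+ 1))) ≡ 8 ℕ.* q ℕ.+ 4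
        e = ℕS.solve-∀

      B : ℕ
      B = 12 ℕ.* P

      fQ : ∀ w → fl Q4 w ≡ fl B w / 3
      fQ w = fl-quotient 2 0 Q4 B w (ℕ.s≤s ℕ.z≤n) (e q)
        where
        e : ∀ q → 12 ℕ.* suc (2 ℕ.* q) ≡ 0 ℕ.+ suc (suc (2 ℕ.* q) ℕ.+ ((3 ℕ.* q ℕ.+ 1) ℕ.+ (3 ℕ.* q ℕ.+ 1))) ℕ.* 3
        e = ℕS.solve-∀
      fm : ∀ w → fl m w ≡ fl B w / 8
      fm w = fl-quotient 7 4 m B w (ℕP.m≤m+n 5 3) (e q)
        where
        e : ∀ q → 12 ℕ.* suc (2 ℕ.* q) ≡ 4 ℕ.+ (3 ℕ.* q ℕ.+ 1) ℕ.* 8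
        e = ℕS.solve-∀
      fP : ∀ w → fl P w ≡ fl B w / 12
      fP w = fl-quotient 11 0 P B w (ℕ.s≤s ℕ.z≤n) (ℕP.*-comm 12 P)

      Y≡ : ∀ w → Y w ≡ exponent c (fl B w)
      Y≡ w = go (w ℕ.<? P)
        where
        go : Dec (w ℕ.< P) → Y w ≡ exponent c (fl B w)
        go (yes l) = Y-below w l ∙ cong₂ (λ x y → (a ℕ.+ b) ℕ.+ b ℕ.* (x ∸ ((x ∸ 1) ⊔ y))) (fQ w) (cong₂ (λ x y → x ℕ.+ x ℕ.+ y) (fm w) (fP w))
            ∙ exponent-high c a ha (fl B w) (ℕP.≤-trans (ℕP.≤-reflexive (sym (m*n/n≡m 12 (suc w)))) (/-monoˡ-≤ (suc w) (ℕP.*-monoʳ-≤ 12 l)))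
        go (no ¬l) = Y-above w ¬l ∙ cong (b ℕ.*_) (fQ w) ∙ exponent-low c (fl B w) (m<n*o⇒m/o<n {B} {12} {suc w} (ℕP.*-monoʳ-< 12 (ℕ.s≤s (ℕP.≮⇒≥ ¬l))))

      -- Positions beyond 4n contribute factors of at least 1. The range is enlarged to 12n because
      -- all the floors in question are functions of ⌊12n/v⌋.
      Y≤ : ⟦ Y ⟧ Q4 ℕ.≤ weight c B
      Y≤ = ℕP.≤-trans (ℕP.≤-reflexive (⟦⟧-cong Q4 (λ w _ → Y≡ w))) (ℕP.≤-trans (⟦⟧-extend (λ w → exponent c (fl B w)) (B ∸ Q4) Q4) (ℕP.≤-reflexive (cong ⟦ (λ w → exponent c (fl B w)) ⟧ (ℕP.m∸n+n≡m Q4≤B))))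
        where
        Q4≤B : Q4 ℕ.≤ B
        Q4≤B = ℕP.≤-trans (ℕP.m≤m+n Q4 (16 ℕ.* q ℕ.+ 8)) (ℕP.≤-reflexive (e q))
          where
          e : ∀ q → suc (suc (2 ℕ.* q) ℕ.+ ((3 ℕ.* q ℕ.+ 1) ℕ.+ (3 ℕ.* q ℕ.+ 1))) ℕ.+ (16 ℕ.* q ℕ.+ 8) ≡ 12 ℕ.* suc (2 ℕ.* q)
          e = ℕS.solve-∀

      N DD G X₀ : ℕ
      N = 8 ℕ.* q ℕ.+ 4
      DD = ϑ ℕ.^ (N ℕ.* b)
      G = g 0 ℕ.^ T
      X₀ = (((P !) ℕ.^ T ℕ.* weight c B) ℕ.* ℓ ℕ.^ β ℕ.* (suc ϑ ℕ.^ (N ℕ.* b) ℕ.* (q ℕ.+ 10) ℕ.^ (3 ℕ.* b))) ℕ.* (8 ℕ.* q ℕ.+ 5)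

      M-bound : M ℕ.* (N !) ℕ.^ b ℕ.≤ (P !) ℕ.^ T ℕ.* weight c B
      M-bound = Eq.subst₂ (λ x y → M ℕ.* (x !) ℕ.^ b ℕ.≤ (P !) ℕ.^ y ℕ.* weight c B) Q4≡N (sym T≡A+b) (ℕP.≤-trans (ℕP.≤-reflexive M-Y) (ℕP.*-monoʳ-≤ ((P !) ℕ.^ (A ℕ.+ b)) Y≤))

      g≥1 : ∀ w → 1 ℕ.≤ g w ℕ.^ T
      g≥1 w = ≥1-^ {g w} T (ℕP.≤-trans (≥1-^ {suc (3 ℕ.* q ℕ.+ 1 ℕ.+ w)} (2 ℕ.* q ℕ.+ 2) (ℕ.s≤s ℕ.z≤n)) (rise-≥ (3 ℕ.* q ℕ.+ 1 ℕ.+ w) (2 ℕ.* q ℕ.+ 2)))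

      value : ∀ w → ∣ V (suc (m ℕ.+ w)) β ∣ * ιℕ (g w ℕ.^ T) ≤ ιℕ ((suc (m ℕ.+ w) ℕ.+ suc (m ℕ.+ w) ℕ.+ P) ℕ.* rise w N ℕ.^ b ℕ.* ℓ ℕ.^ β)
      value w = Eq.subst₂ (λ x y → ∣ V (suc (m ℕ.+ w)) β ∣ * ιℕ x ≤ ιℕ ((suc (m ℕ.+ w) ℕ.+ suc (m ℕ.+ w) ℕ.+ P) ℕ.* rise w y ℕ.^ b ℕ.* ℓ ℕ.^ β))
         (cong₂ (λ x y → rise (m ℕ.+ w) x ℕ.^ y) (ℕP.+-comm 2 (2 ℕ.* q)) (sym T≡A+b)) Q4≡N (At-point.V-bound w β)

      term : ∀ w → ∣ V (suc (m ℕ.+ w)) β ∣ * ιℕ (M ℕ.* (DD ℕ.* G)) * ιℕ (suc w ℕ.* suc (suc w)) ≤ ιℕ (2 ℕ.* X₀)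
      term w = term-estimate ∣ V (suc (m ℕ.+ w)) β ∣ {g = g w ℕ.^ T} {c = suc (m ℕ.+ w) ℕ.+ suc (m ℕ.+ w) ℕ.+ P} {a = rise w N ℕ.^ b} {k = ℓ ℕ.^ β} {D = DD} {G = G} {W = suc w ℕ.^ (3 ℕ.* b)} {F = (N !) ℕ.^ b} {D′ = suc ϑ ℕ.^ (N ℕ.* b)} {Qp = (q ℕ.+ 10) ℕ.^ (3 ℕ.* b)} {M = M}
          {nT = (P !) ℕ.^ T} {y = weight c B} {e = 8 ℕ.* q ℕ.+ 5} {s = suc w} (0≤∣p∣ _) (value w) (good w) M-bound (g≥1 w) (≥1-^ b (ℕP.1≤n! N))
          (ℕP.≤-trans (ℕP.m≤m+n _ (8 ℕ.* q ℕ.* w ℕ.+ 3 ℕ.* w)) (ℕP.≤-reflexive (e q w)))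
          (ℕP.≤-trans (ℕP.≤-reflexive (cong (λ t → suc w ℕ.* (suc w ℕ.* t)) (sym (ℕP.*-identityʳ (suc w))))) (ℕP.^-monoʳ-≤ (suc w) {3} {3 ℕ.* b} (ℕP.m≤m*n 3 b))) (ℕ.s≤s ℕ.z≤n)
        where
        e : ∀ q w → (suc ((3 ℕ.* q ℕ.+ 1) ℕ.+ w) ℕ.+ suc ((3 ℕ.* q ℕ.+ 1) ℕ.+ w) ℕ.+ suc (2 ℕ.* q)) ℕ.+ (8 ℕ.* q ℕ.* w ℕ.+ 3 ℕ.* w) ≡ (8 ℕ.* q ℕ.+ 5) ℕ.* suc w
        e = ℕS.solve-∀

      F-bound : ∀ W → ιℕ (M ℕ.* (DD ℕ.* G)) * ∣ F (m ℕ.+ W) ∣ ≤ ιℕ (2 ℕ.* X₀)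
      F-bound W = ≤-trans (≤-reflexive (sym (abs-* Cst (F (m ℕ.+ W)) Cst≥0) ∙ cong ∣_∣ (cong (Cst *_) (Σ-split m W _ ∙ cong (_+ Σ W f) (Σ-zero m (λ k l → V-vanish (suc k) (ℕ.s≤s ℕ.z≤n) l β ℕP.≤-refl)) ∙ +-identityˡ (Σ W f)) ∙ sym (Σ-* W Cst f))))
          (≤-trans (telescope (λ w → Cst * f w) X (λ w → ≤-trans (≤-reflexive (cong (_* ιℕ (suc w ℕ.* suc (suc w))) (abs-* Cst (f w) Cst≥0 ∙ *-comm Cst ∣ f w ∣))) (term w)) W)
          (≤-trans (*-monoˡ (ιℕ≥0 (2 ℕ.* X₀)) (≤-trans (+-monoʳ-≤ 1ℚ (neg-antimono-≤ (<⇒≤ (inv-suc>0 W)))) (≤-reflexive (+-identityʳ 1ℚ)))) (≤-reflexive (*-identityʳ X))))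
        where
        Cst = ιℕ (M ℕ.* (DD ℕ.* G))
        Cst≥0 = ιℕ≥0 (M ℕ.* (DD ℕ.* G))
        X = ιℕ (2 ℕ.* X₀)
        f : ℕ → ℚ
        f w = V (suc (m ℕ.+ w)) β

      t : ℚ
      t = ιℕ (Q ℕ.* M)

      -- Q clears the values z i, and M clears the coefficients even when multiplied by a power
      -- j^(-i-b) from a partial zeta sum, which is the list of extra inverses in `int-c`.
      integral : IsInt (t * Lform z)
      integral = int-≡ (alg t _ _) (int-+ (int-≡ (Σ-* A t _) (int-Σ A (λ i l → int-≡ (e₁ i) (int-* (int-ι (C i)) (int-* (Mρ i l) (proj₂ (proj₂ den-data) i l))))))
                                       (int-neg (int-≡ (Σ-* A t _) (int-Σ A (λ i l → int-≡ (e₂ i) (int-* (int-ι (C i)) (int-* (int-ι (ℤ.+ Q)) (int-≡ (Σ-* (suc P) (ιℕ M) _) (int-Σ (suc P) (λ κ l′ → McZ i κ l (ℕP.≤-pred l′) κ (ℕP.≤-pred l′)))))))))))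
        where
        alg : ∀ t x y → t * x + (- (t * y)) ≡ t * (x - y)
        alg = solve-∀ ℚring
        e₁ : ∀ i → ι (C i) * ((ιℕ M * ρ i) * (ιℕ Q * z i)) ≡ t * (ι (C i) * (ρ i * z i))
        e₁ i = alg′ (ι (C i)) (ιℕ M) (ρ i) (ιℕ Q) (z i) ∙ cong (_* (ι (C i) * (ρ i * z i))) (sym (ιℕ-* Q M))
          where
          alg′ : ∀ c m r q z → c * ((m * r) * (q * z)) ≡ (q * m) * (c * (r * z))
          alg′ = solve-∀ ℚring
        e₂ : ∀ i → ι (C i) * (ιℕ Q * (ιℕ M * Σ (suc P) (λ κ → c_ κ i * Zp i κ))) ≡ t * (ι (C i) * Σ (suc P) (λ κ → c_ κ i * Zp i κ))
        e₂ i = alg′ (ι (C i)) (ιℕ M) (ιℕ Q) (Σ (suc P) (λ κ → c_ κ i * Zp i κ)) ∙ cong (_* (ι (C i) * Σ (suc P) (λ κ → c_ κ i * Zp i κ))) (sym (ιℕ-* Q M))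
          where
          alg′ : ∀ c m q s → c * (q * (m * s)) ≡ (q * m) * (c * s)
          alg′ = solve-∀ ℚring
        Mρ : ∀ i → i ℕ.< A → IsInt (ιℕ M * ρ i)
        Mρ i l = int-≡ (Σ-* (suc P) (ιℕ M) _) (int-Σ (suc P) (λ κ l′ → int-≡ (cong (ιℕ M *_) (*-identityʳ (c_ κ i))) (int-c κ i (ℕP.≤-pred l′) l [] [] ℕ.z≤n)))
        McZ : ∀ i κ → i ℕ.< A → κ ℕ.≤ P → ∀ j → j ℕ.≤ P → IsInt (ιℕ M * (c_ κ i * Zp i j))
        McZ i κ l l′ zero    _  = int-≡ (sym (cong (ιℕ M *_) (*-zeroʳ (c_ κ i)) ∙ *-zeroʳ (ιℕ M))) int-0
        McZ i κ l l′ (suc j) jP = int-≡ (alg′ (ιℕ M) (c_ κ i) (Zp i j) (pow (inv-suc j) (i ℕ.+ b)) ∙ cong (λ x → ιℕ M * (c_ κ i * x)) (sym (zeta-step (i ℕ.+ b) j)))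
          (int-+ (McZ i κ l l′ j (ℕP.≤-trans (ℕP.n≤1+n j) jP)) (int-≡ (cong (λ x → ιℕ M * (c_ κ i * x)) (hinv-replicate (i ℕ.+ b) (ℤ.+ suc j)))
            (int-c κ i l′ l (replicate (i ℕ.+ b) (ℤ.+ suc j)) (AllP.replicate⁺ (i ℕ.+ b) ((λ ()) , jP)) (ℕP.≤-reflexive (LP.length-replicate (i ℕ.+ b))))))
          where
          alg′ : ∀ m c x y → m * (c * x) + m * (c * y) ≡ m * (c * (x + y))
          alg′ = solve-∀ ℚring

      M≥1 : 1 ℕ.≤ M
      M≥1 = ⟦⟧≥1 eM Q4

      t>0 : 0ℚ < t
      t>0 = ιℕ>0 (ℕP.*-mono-≤ Q≥1 M≥1)

      q<P : q ℕ.< P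
      q<P = ℕ.s≤s (ℕP.m≤m+n q (q ℕ.+ 0))

      not-dividing : ∀ x → 1 ℕ.≤ x → x ℕ.< q → ¬ P ∣ x
      not-dividing (suc x) _ l d = ℕP.<⇒≱ (ℕP.<-trans l q<P) (∣⇒≤ d)

      L≢0 : Lform z ≢ 0ℚ
      L≢0 = nonvanishing z Q (proj₂ (proj₂ den-data)) (not-dividing Q Q≥1 Q<q) (not-dividing ℤ.∣ Nb β a ∣ (ℕP.n≢0⇒n>0 (λ e → Nb≢0 (ℤP.∣i∣≡0⇒i≡0 e))) N<q)

      tL≥1 : 1ℚ ≤ t * ∣ Lform z ∣
      tL≥1 = go integral
        where
        go : IsInt (t * Lform z) → 1ℚ ≤ t * ∣ Lform z ∣
        go (i , e) = ≤-trans (integer≥1 i (λ i≡0 → mul≢0 (pos⇒≢0 t>0) L≢0 (e ∙ cong ι i≡0 ∙ ι0))) (≤-reflexive (cong ∣_∣ (sym e) ∙ abs-* t (Lform z) (<⇒≤ t>0)))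

      tF≤½ : ∀ W → ιℕ 2 * (t * ∣ F (m ℕ.+ W) ∣) ≤ 1ℚ
      tF≤½ W = cancel-≤ (DD ℕ.* G) DG≥1 (≤-trans (≤-reflexive (cong (λ x → ιℕ 2 * (x * v) * ιℕ (DD ℕ.* G)) (ιℕ-* Q M) ∙ alg (ιℕ 2) (ιℕ Q) (ιℕ M) v (ιℕ (DD ℕ.* G)) ∙ cong₂ (λ x y → x * (y * v)) (sym (ιℕ-* 2 Q)) (sym (ιℕ-* M (DD ℕ.* G)))))
          (≤-trans (*-monoˡ (ιℕ≥0 (2 ℕ.* Q)) (F-bound W)) (≤-trans (≤-reflexive (sym (ιℕ-* (2 ℕ.* Q) (2 ℕ.* X₀)))) (≤-trans (ιℕ-mono (ℕP.≤-trans (ℕP.≤-reflexive (alg₂ Q X₀)) (proj₂ small-data q q₀≤q))) (≤-reflexive (sym (*-identityˡ (ιℕ (DD ℕ.* G)))))))))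
        where
        v = ∣ F (m ℕ.+ W) ∣
        alg : ∀ two q m v d → two * ((q * m) * v) * d ≡ (two * q) * ((m * d) * v)
        alg = solve-∀ ℚring
        alg₂ : ∀ Q X → (2 ℕ.* Q) ℕ.* (2 ℕ.* X) ≡ 4 ℕ.* Q ℕ.* X
        alg₂ = ℕS.solve-∀
        DG≥1 : 1 ℕ.≤ DD ℕ.* G
        DG≥1 = ℕP.*-mono-≤ (≥1-^ {ϑ} (N ℕ.* b) ϑ≥1) (g≥1 0)

      -- With t |Lform| ≥ 1 and t |F| ≤ 1/2 the distance is at least 1/(2t).
      too-close : ∀ K → ∣ F (m ℕ.+ K) - Lform z ∣ < inv (ιℕ 2 * t) → ⊥
      too-close K close = <-irrefl refl (<-≤-trans (+-mono-<-≤ small (tF≤½ K)) (≤-trans (≤-reflexive (sym (ιℕ-+ 1 1 ∙ cong₂ _+_ ι1 ι1) ∙ sym (*-identityʳ (ιℕ 2)))) (≤-trans (*-monoˡ (ιℕ≥0 2) tL≥1) (≤-trans (*-monoˡ (ιℕ≥0 2) (*-monoˡ (<⇒≤ t>0) triangle)) (≤-reflexive (alg (ιℕ 2) t x y))))))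
        where
        x y : ℚ
        x = ∣ F (m ℕ.+ K) - Lform z ∣
        y = ∣ F (m ℕ.+ K) ∣
        alg : ∀ two t x y → two * (t * (y + x)) ≡ (two * t) * x + two * (t * y)
        alg = solve-∀ ℚring
        2t>0 : 0ℚ < ιℕ 2 * t
        2t>0 = *-pos (ιℕ>0 {2} (ℕ.s≤s ℕ.z≤n)) t>0
        small : (ιℕ 2 * t) * x < 1ℚ
        small = subst ((ιℕ 2 * t) * x <_) (inv-r (pos⇒≢0 2t>0)) (*-monoʳ-<-pos (ιℕ 2 * t) {{positive 2t>0}} close)
        triangle : ∣ Lform z ∣ ≤ y + x
        triangle = ≤-trans (≤-reflexive (cong ∣_∣ (alg′ (F (m ℕ.+ K)) (Lform z)))) (≤-trans (∣p+q∣≤∣p∣+∣q∣ (F (m ℕ.+ K)) (- (F (m ℕ.+ K) - Lform z))) (≤-reflexive (cong (y +_) (∣-p∣≡∣p∣ (F (m ℕ.+ K) - Lform z)))))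
          where
          alg′ : ∀ f l → l ≡ f + - (f - l)
          alg′ = solve-∀ ℚring

      contradictory : ⊥
      contradictory = too-close (proj₁ null) (proj₂ null (m ℕ.+ proj₁ null) (ℕP.m≤n+m (proj₁ null) m))
        where
        null = F-null (inv (ιℕ 2 * t)) (inv-pos (*-pos (ιℕ>0 {2} (ℕ.s≤s ℕ.z≤n)) t>0))

    contradiction′ : ⊥
    contradiction′ = go (proj₁ (odd-prime bound)) (proj₁ (proj₂ (odd-prime bound))) (proj₂ (proj₂ (odd-prime bound)))
      where
      n′ bound : ℕ
      n′ = suc ℤ.∣ Nb β a ∣
      -- 50 is what `core` asks of q; Q and the residue must be smaller than the prime in order to
      -- be prime to it.
      bound = 50 ℕ.+ suc Q ℕ.+ n′ ℕ.+ proj₁ small-data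
      go : ∀ q → bound ℕ.≤ q → Prime (suc (2 ℕ.* q)) → ⊥
      go q l pr = At-prime.contradictory q pr (ℕP.≤-trans (ℕP.m≤m+n 50 (suc Q)) l₂) (ℕP.≤-trans (ℕP.m≤n+m (suc Q) 50) l₂) (ℕP.≤-trans (ℕP.m≤n+m n′ (50 ℕ.+ suc Q)) l₁) (ℕP.≤-trans (ℕP.m≤n+m (proj₁ small-data) (50 ℕ.+ suc Q ℕ.+ n′)) l)
        where
        l₁ : 50 ℕ.+ suc Q ℕ.+ n′ ℕ.≤ q
        l₁ = ℕP.≤-trans (ℕP.m≤m+n (50 ℕ.+ suc Q ℕ.+ n′) (proj₁ small-data)) l
        l₂ : 50 ℕ.+ suc Q ℕ.≤ q
        l₂ = ℕP.≤-trans (ℕP.m≤m+n (50 ℕ.+ suc Q) n′) l₁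

  -- An even i with 0 < i < A lies between 2 and A - 2 because A is even; this gives the range of
  -- odd arguments i + b from b + 2 to A + b - 2.
  irrational : ∀ e c a h lo hi → 3 ℕ.+ c ≡ suc (2 ℕ.* e) → suc (suc a) ≡ 7 ℕ.* (3 ℕ.+ c) → suc a ≡ h ℕ.+ h → lo ≡ 2 ℕ.+ (3 ℕ.+ c) → hi ℕ.+ 2 ≡ suc a ℕ.+ (3 ℕ.+ c) →
    Numerics c (weight c) → Nb (2 ℕ.+ c) a ≢ ℤ.+ 0 → ContainsIrrational lo hi
  irrational e c a h lo hi b≡ ha A-even lo≡ hi≡ num nb rational = Contradiction.contradiction′ c a h ha A-even num nb lim
    where
    lim : ∀ i → i ℕ.< suc a → ZetaRational (i ℕ.+ (3 ℕ.+ c)) ⊎ (i ≡ 0 ⊎ sg i ≡ - 1ℚ)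
    lim i l with parity i
    ... | inj₂ s = inj₂ (inj₂ s)
    ... | inj₁ (zero , i≡) = inj₂ (inj₁ i≡)
    ... | inj₁ (suc j , i≡) = inj₁ (subst ZetaRational (sym k≡) (rational (suc j ℕ.+ e) (subst (lo ℕ.≤_) k≡ (ℕP.≤-trans (ℕP.≤-reflexive lo≡) (ℕP.+-monoˡ-≤ (3 ℕ.+ c) 2≤i))) (subst (ℕ._≤ hi) k≡ (ℕP.+-cancelʳ-≤ 2 _ _ (ℕP.≤-trans (ℕP.≤-reflexive (r i c)) (ℕP.≤-trans (ℕP.+-monoˡ-≤ (3 ℕ.+ c) i≤) (ℕP.≤-reflexive (sym hi≡))))))))
      where
      k≡ : i ℕ.+ (3 ℕ.+ c) ≡ 2 ℕ.* (suc j ℕ.+ e) ℕ.+ 1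
      k≡ = cong₂ ℕ._+_ i≡ b≡ ∙ r′ (suc j) e
        where
        r′ : ∀ j e → (j ℕ.+ j) ℕ.+ suc (2 ℕ.* e) ≡ 2 ℕ.* (j ℕ.+ e) ℕ.+ 1
        r′ = ℕS.solve-∀
      2≤i : 2 ℕ.≤ i
      2≤i = subst (2 ℕ.≤_) (sym i≡) (ℕ.s≤s (ℕP.≤-trans (ℕ.s≤s ℕ.z≤n) (ℕP.≤-reflexive (sym (ℕP.+-suc j j)))))
      r : ∀ i c → i ℕ.+ (3 ℕ.+ c) ℕ.+ 2 ≡ suc (suc i) ℕ.+ (3 ℕ.+ c)
      r = ℕS.solve-∀
      -- i and A are both even
      i≤ : suc (suc i) ℕ.≤ suc a
      i≤ = ℕP.≤-trans (ℕP.≤-reflexive (cong (λ x → suc (suc x)) i≡ ∙ r₂ (suc j))) (ℕP.≤-trans (ℕP.+-mono-≤ j<h j<h) (ℕP.≤-reflexive (sym A-even)))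
        where
        r₂ : ∀ j → suc (suc (j ℕ.+ j)) ≡ suc j ℕ.+ suc j
        r₂ = ℕS.solve-∀
        j<h : suc j ℕ.< h
        j<h = ℕP.≰⇒> (λ l′ → ℕP.<⇒≱ (Eq.subst₂ ℕ._<_ i≡ A-even l) (ℕP.+-mono-≤ l′ l′))

-- Assembly of the three cases

open Chebyshev using (≤ᵇ-true; d; step)
open Certificates
open Asymptotics
open Rates
open Weights
open Tables
open LinearForm
open import Data.Nat
open import Data.Nat.Properties
open import Data.Bool using (true)
open import Data.Product using (_,_)
open import Relation.Binary.PropositionalEquality

lcm-exponent : Certificate (step 1) → ℕ
lcm-exponent H = Certificate.E H + penalty-rate (4 * Certificate.K H) (Certificate.pen H)

total-rate : Certificate (step 1) → Certificate (Yc 22 3) → Certificate (Yc 8 1) → ℕ → ℕ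
total-rate H C C′ c = (E C + penalty-rate (lcm-exponent H) (pen C)) + c * (E C′ + penalty-rate (lcm-exponent H) (pen C′))
  where open Certificate

numerics : ∀ H C C′ → Certificate.s H ≡ 1 → Certificate.K H ≡ Certificate.K C → Certificate.s C′ ≡ Certificate.s C → Certificate.K C′ ≡ Certificate.K C → ∀ κ′ → Certificate.s C * Certificate.K C ≡ suc κ′ →
  ∀ c T ϑ k₂ F → suc T ≡ 8 * (3 + c) → (suc ϑ ^ (3 + c) * 13 ^ T ≤ᵇ 21 ^ T) ≡ true →
  ((suc ϑ ^ (8 * (3 + c)) * 108 ^ T) ^ suc k₂ * 2 ^ F ≤ᵇ (ϑ ^ (8 * (3 + c)) * 3125 ^ T) ^ suc k₂) ≡ true →
  (24 * total-rate H C C′ c * suc k₂ + 1 ≤ᵇ F * suc κ′) ≡ true → Numerics c (weight c)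
numerics H C C′ sH KH s≡ K≡ κ′ κ≡ c T ϑ k₂ F T≡ h₁ h₂ h₃ = record
  { T = T ; ϑ = ϑ ; κ′ = κ′ ; k₂ = k₂ ; F = F ; E = total-rate H C C′ c ; T≡ = T≡
  ; hd = ≤ᵇ-true h₁
  ; rate = subst (λ κ → ExpBounded (total-rate H C C′ c) (λ B → weight c B ^ κ)) κ≡ (combined-rate C C′ c s≡ K≡ (subst (λ k → ExpBounded (lcm-exponent H) (λ x → d x ^ k)) KH (lcm-rate H sH)))
  ; hα = ≤ᵇ-true h₂
  ; hE = ≤ᵇ-true h₃
  }

theorem1 : ContainsIrrational 5 21 × ContainsIrrational 7 37 × ContainsIrrational 9 53
theorem1 =
    -- In each case ϑ (here 38) is the largest integer with (ϑ+1)^b 13^T ≤ 21^T, F (here 22151) is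
    -- the integer part of 200 times the decay in bits per unit of q, and 108359999 + 1 = 30000 ·
    -- 3612. The final `λ ()` evaluates the residue `Nb` to a nonzero integer.
    irrational 1 0 19 10 5 21 refl refl refl refl refl (numerics certificateH certificateA certificateB refl refl refl refl 108359999 refl 0 23 38 199 22151 refl refl refl refl) (λ ())
  , irrational 2 2 33 17 7 37 refl refl refl refl refl (numerics certificateH certificateA certificateB refl refl refl refl 108359999 refl 2 39 41 199 37588 refl refl refl refl) (λ ())
  , irrational 3 4 47 24 9 53 refl refl refl refl refl (numerics certificateH certificateA certificateB refl refl refl refl 108359999 refl 4 55 42 199 53022 refl refl refl refl) (λ ())
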